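{- Let $P\subseteq M_{\mathbb R}$ be a pseudo-symmetric simplicial reflexive polytope. Then $P$ splits, uniquely up to isomorphism, into a 1-irreducible reflexive cs-crosspolytope $P'$ (possibly absent), $r\ge 0$ copies of $[-1,1]$, del Pezzo polytopes, and pseudo-del Pezzo polytopes.
   Context: $M\cong\mathbb Z^d$ is a lattice, $N$ its dual, $M_{\mathbb R}=M\otimes\mathbb R$. A Fano polytope is a $d$-dimensional lattice polytope with $0$ in its interior and primitive vertices; it is reflexive if its dual $P^*=\{x\in N_{\mathbb R}:\langle x,y\rangle\ge-1\ \forall y\in P\}$ has vertices in $N$; simplicial if every facet is a simplex; pseudo-symmetric if there is a facet $F$ with $-F$ also a facet. Isomorphism means via a lattice automorphism. For a lattice basis $e_1,\dots,e_k$ with $k$ even, the del Pezzo polytope is $V_k=\mathrm{conv}(\pm e_1,\dots,\pm e_k,\pm(e_1+\dots+e_k))$ and the pseudo-del Pezzo polytope is $\tilde V_k=\mathrm{conv}(\pm e_1,\dots,\pm e_k,-e_1-\dots-e_k)$. A cs-crosspolytope is the convex hull of a simplex not containing $0$ and its negative. $P$ splits into Fano polytopes $P_1\subseteq(M_1)_{\mathbb R}$, $P_2\subseteq(M_2)_{\mathbb R}$ (with $\dim P_1+\dim P_2=d$) if $P\cong\mathrm{conv}(P_1\oplus\{0\},\{0\}\oplus P_2)$ for $M\cong M_1\oplus M_2$; splitting into several factors is defined iteratively. $P$ is 1-irreducible if it does not split into $[-1,1]$ and some other factor.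
   Formalization: For uniqueness to hold, the simplex defining a cs-crosspolytope must have exactly as many vertices as the dimension (otherwise the hexagon V_2 qualifies), and [-1,1] itself is not counted as 1-irreducible (otherwise it could serve as P' or as a copy of [-1,1]). -}

module Defs where

open import Data.Nat as ℕ using (ℕ; zero; suc; _≟_)
open import Data.Integer as ℤ using (ℤ; +_)
open import Data.Integer.Divisibility as ℤD using ()
open import Data.Rational as ℚ using (ℚ; 0ℚ; 1ℚ; ½)
open import Data.Fin using (Fin; zero; suc; _≟_)
open import Data.Vec as Vec using (Vec; []; _∷_)
open import Data.List as List using (List; []; _∷_; length; lookup)
open import Data.List.Relation.Binary.Permutation.Propositional using (_↭_)
open import Data.Maybe using (Maybe; just; nothing)
open import Data.Product using (Σ; ∃; _×_; _,_)
open import Data.Sum using (_⊎_)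
open import Data.Empty using (⊥)
open import Data.Bool using (if_then_else_)
open import Relation.Nullary using (¬_; does)
open import Relation.Binary.PropositionalEquality using (_≡_; subst)

-- Points.  M ≅ ℤⁿ; lattice points are integer vectors, and we work in
-- M_ℚ = ℚⁿ (all polytopes here are rational).

Pt : ℕ → Set
Pt n = Vec ℤ n

QPt : ℕ → Set
QPt n = Vec ℚ n

toℚ : ∀ {n} → Pt n → QPt n
toℚ = Vec.map (λ z → z ℚ./ 1)

zeroQ : ∀ {n} → QPt n
zeroQ = Vec.replicate _ 0ℚ

negQ : ∀ {n} → QPt n → QPt n
negQ = Vec.map (λ q → ℚ.- q)

scaleQ : ∀ {n} → ℚ → QPt n → QPt n
scaleQ t = Vec.map (t ℚ.*_)

addQ : ∀ {n} → QPt n → QPt n → QPt n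
addQ = Vec.zipWith ℚ._+_

midpoint : ∀ {n} → QPt n → QPt n → QPt n
midpoint a b = scaleQ ½ (addQ a b)

dot : ∀ {n} → QPt n → QPt n → ℚ
dot x y = Vec.foldr _ ℚ._+_ 0ℚ (Vec.zipWith ℚ._*_ x y)

sumF : ∀ {k} → (Fin k → ℚ) → ℚ
sumF {zero}  c = 0ℚ
sumF {suc k} c = c zero ℚ.+ sumF (λ i → c (suc i))

lincomb : ∀ {n} (w : List (QPt n)) → (Fin (length w) → ℚ) → QPt n
lincomb {n} w c = Vec.tabulate (λ j → sumF (λ i → c i ℚ.* Vec.lookup (lookup w i) j))

QSet : ℕ → Set₁
QSet n = QPt n → Set

InConv : ∀ {n} → List (QPt n) → QSet n
InConv w x = Σ (Fin (length w) → ℚ) λ c →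
  ((i : Fin (length w)) → 0ℚ ℚ.≤ c i) × (sumF c ≡ 1ℚ) × (lincomb w c ≡ x)

⟦_⟧ : ∀ {n} → List (Pt n) → QSet n
⟦ V ⟧ = InConv (List.map toℚ V)

Extreme : ∀ {n} → QSet n → QPt n → Set
Extreme P v = P v × (∀ a b → P a → P b → v ≡ midpoint a b → a ≡ v)

ZeroInterior : ∀ {n} → QSet n → Set
ZeroInterior P = ∀ y → ∃ λ ε → (0ℚ ℚ.< ε) × P (scaleQ ε y)

IsLattice : ∀ {n} → QPt n → Set
IsLattice {n} x = ∃ λ (v : Pt n) → toℚ v ≡ x

Primitive : ∀ {n} → Pt n → Set
Primitive v = ∀ k → 2 ℕ.≤ k → ¬ (∀ i → (+ k) ℤD.∣ Vec.lookup v i)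

Fano : ∀ {n} → List (Pt n) → Set
Fano V = ZeroInterior ⟦ V ⟧ ×
  (∀ x → Extreme ⟦ V ⟧ x → ∃ λ v → (toℚ v ≡ x) × Primitive v)

Dual : ∀ {n} → QSet n → QSet n
Dual P x = ∀ y → P y → ℚ.- 1ℚ ℚ.≤ dot x y

Reflexive : ∀ {n} → List (Pt n) → Set
Reflexive V = Fano V × (∀ x → Extreme (Dual ⟦ V ⟧) x → IsLattice x)

AffIndep : ∀ {n} → List (QPt n) → Set
AffIndep w = ∀ (c : Fin (length w) → ℚ) → sumF c ≡ 0ℚ → lincomb w c ≡ zeroQ →
  ∀ i → c i ≡ 0ℚ

_⇔_ : Set → Set → Set
A ⇔ B = (A → B) × (B → A)

SameSet : ∀ {n} → QSet n → QSet n → Set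
SameSet A B = ∀ x → A x ⇔ B x

Face : ∀ {n} → QSet n → QSet n → Set
Face P F = ∃ λ u → ∃ λ c → (∀ x → P x → c ℚ.≤ dot u x) ×
  SameSet F (λ x → P x × (dot u x ≡ c))

ContainsAffIndep : ∀ {n} → QSet n → ℕ → Set
ContainsAffIndep {n} F m = ∃ λ (w : List (QPt n)) →
  (length w ≡ suc m) × AffIndep w × (∀ i → F (lookup w i))

HasDim : ∀ {n} → QSet n → ℕ → Set
HasDim F m = ContainsAffIndep F m × ¬ ContainsAffIndep F (suc m)

Facet : ∀ {n} → QSet n → QSet n → Set
Facet {n} P F = Face P F × HasDim F (n ℕ.∸ 1)

Simplex : ∀ {n} → QSet n → Set
Simplex {n} F = ∃ λ (w : List (QPt n)) → AffIndep w × SameSet F (InConv w)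

Simplicial : ∀ {n} → List (Pt n) → Set₁
Simplicial V = ∀ F → Facet ⟦ V ⟧ F → Simplex F

PseudoSymmetric : ∀ {n} → List (Pt n) → Set₁
PseudoSymmetric V = ∃ λ F → Facet ⟦ V ⟧ F × Facet ⟦ V ⟧ (λ x → F (negQ x))

Mat : ℕ → Set
Mat n = Vec (Vec ℤ n) n

dotℤ : ∀ {n} → Vec ℤ n → Vec ℤ n → ℤ
dotℤ x y = Vec.foldr _ ℤ._+_ (+ 0) (Vec.zipWith ℤ._*_ x y)

matMul : ∀ {n} → Mat n → Mat n → Mat n
matMul A B = Vec.map (λ row → Vec.map (dotℤ row) (Vec.transpose B)) A

idMat : ∀ {n} → Mat n
idMat {n} = Vec.tabulate (λ i → Vec.tabulate (λ j →
  if does (i Data.Fin.≟ j) then + 1 else + 0))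

applyQ : ∀ {n} → Mat n → QPt n → QPt n
applyQ A x = Vec.map (λ row → dot (toℚ row) x) A

Iso : ∀ {n} → List (Pt n) → List (Pt n) → Set
Iso {n} V W = ∃ λ (A : Mat n) → ∃ λ (B : Mat n) →
  (matMul A B ≡ idMat) × (matMul B A ≡ idMat) ×
  (∀ x → ⟦ V ⟧ x ⇔ ⟦ W ⟧ (applyQ A x))

Poly : Set
Poly = Σ ℕ (λ n → List (Pt n))

IsoP : Poly → Poly → Set
IsoP (m , V) (n , W) = Σ (m ≡ n) λ e → Iso (subst (λ k → List (Pt k)) e V) W

_⊕_ : Poly → Poly → Poly
(m , V) ⊕ (n , W) = (m ℕ.+ n ,
  List.map (λ v → v Vec.++ Vec.replicate n (+ 0)) V List.++
  List.map (λ w → Vec.replicate m (+ 0) Vec.++ w) W)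

-- the 0-dimensional polytope {0}, unit for ⊕ on polytopes containing 0
pt0 : Poly
pt0 = (0 , [] ∷ [])

⨁ : List Poly → Poly
⨁ = List.foldr _⊕_ pt0

unitVec : ∀ {k} → Fin k → Pt k
unitVec i = Vec.tabulate (λ j → if does (i Data.Fin.≟ j) then + 1 else + 0)

negℤ : ∀ {k} → Pt k → Pt k
negℤ = Vec.map (λ z → ℤ.- z)

allOnes : ∀ {k} → Pt k
allOnes = Vec.replicate _ (+ 1)

segment : Poly
segment = (1 , ((+ 1) ∷ []) ∷ (ℤ.- (+ 1) ∷ []) ∷ [])

crossVerts : (k : ℕ) → List (Pt k)
crossVerts k = List.map unitVec (List.allFin k) List.++
               List.map (λ i → negℤ (unitVec i)) (List.allFin k)

delPezzo : ℕ → Poly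
delPezzo k = (k , allOnes ∷ negℤ allOnes ∷ crossVerts k)

pseudoDelPezzo : ℕ → Poly
pseudoDelPezzo k = (k , negℤ allOnes ∷ crossVerts k)

EvenPos : ℕ → Set
EvenPos k = ∃ λ j → k ≡ suc j ℕ.+ suc j

CsCross : Poly → Set
CsCross (n , V) = ∃ λ (w : List (QPt n)) → (length w ≡ n) × AffIndep w ×
  ¬ InConv w zeroQ × SameSet ⟦ V ⟧ (InConv (w List.++ List.map negQ w))

-- 1-irreducible: does not split into [-1,1] and another factor
-- (the other factor is Fano, or 0-dimensional when P = [-1,1])
OneIrreducible : Poly → Set
OneIrreducible P = ¬ (∃ λ (Q : Poly) →
  (Fano (Data.Product.proj₂ Q) ⊎ Data.Product.proj₁ Q ≡ 0) × IsoP P (segment ⊕ Q))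

CoreOK : Maybe Poly → Set
CoreOK nothing = Data.Unit.⊤ where import Data.Unit
CoreOK (just Q) = Reflexive (Data.Product.proj₂ Q) × CsCross Q × OneIrreducible Q

record Decomposition : Set where
  field
    core      : Maybe Poly
    coreOK    : CoreOK core
    r         : ℕ
    dP        : List ℕ
    dPEven    : ∀ i → EvenPos (lookup dP i)
    pdP       : List ℕ
    pdPEven   : ∀ i → EvenPos (lookup pdP i)

corePoly : Maybe Poly → Poly
corePoly nothing  = pt0
corePoly (just Q) = Q

splitPoly : Decomposition → Poly
splitPoly D = corePoly core ⊕ (⨁ (List.replicate r segment) ⊕
  (⨁ (List.map delPezzo dP) ⊕ ⨁ (List.map pseudoDelPezzo pdP)))
  where open Decomposition D

SameCore : Maybe Poly → Maybe Poly → Set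
SameCore nothing  nothing  = Data.Unit.⊤ where import Data.Unit
SameCore (just P) (just Q) = IsoP P Q
SameCore _        _        = ⊥

SameDecomposition : Decomposition → Decomposition → Set
SameDecomposition D₁ D₂ =
  SameCore (core D₁) (core D₂) × (r D₁ ≡ r D₂) ×
  (dP D₁ ↭ dP D₂) × (pdP D₁ ↭ pdP D₂)
  where open Decomposition

{-# OPTIONS --safe #-}

-- Existence.  Let F = conv(e_1,…,e_d) and -F be facets of P and let g be the functional with g = 1 on F, so that |g| ≤ 1 on P.  The
-- functional of the facet adjacent to F across e_i is g - t e_i* with t > 0; by reflexivity t is an integer, and since the value
-- t - 1 at the vertex -e_i is at most 1, either t = 2 and the new vertex is -e_i, or t = 1 and the new vertex lies on {g = 0} and has
-- i-th coordinate -1.  Hence the vertices x on {g = 0} have coordinates 0 and ±1, as many 1 as -1, and exchanging two of them for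
-- vertices of F shows that two of them have disjoint supports or are opposite.  Each pair {x, -x} of candidates thus spans a pseudo-del
-- Pezzo or a del Pezzo factor, according as one or both are vertices.  Among the remaining e_i those with integral e_i* give segments.
-- The others span the core: integrality of g and of all 2 e_i* makes it reflexive.
--
-- Uniqueness.  Two vertices lie in the same block exactly when no linear map that fixes or kills each vertex separates them, so the
-- partition of the vertices into blocks is intrinsic.  The number of vertices of a block is 2, 2k + 2 or 2k + 1 and tells its kind, and
-- a pair ±v is a segment exactly when some integral functional is 1 at v and 0 at all vertices other than ±v.
module Submission where

open import Defs
open import Data.Nat as ℕ using (ℕ; zero; suc)
import Data.Nat.Properties as ℕP
open import Data.Integer as ℤ using (ℤ; -[1+_])
import Data.Integer.Properties as ℤP
open import Data.Rational as ℚ using (ℚ; mkℚ; 0ℚ; 1ℚ; ½; _+_; _*_; _-_; -_; _≤_; _<_; *≤*; *<*)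
import Data.Rational.Properties as ℚP
open import Data.Fin as Fin using (Fin; zero; suc)
import Data.Fin.Properties as FinP
open import Data.Vec as Vec using (Vec; []; _∷_)
import Data.Vec.Properties as VecP
open import Data.List as List using (List; []; _∷_)
import Data.List.Properties as ListP
open import Data.List.Membership.Propositional using (_∈_)
open import Data.List.Membership.Propositional.Properties using (∈-map⁺; ∈-map⁻; ∈-++⁺ˡ; ∈-++⁺ʳ; ∈-++⁻; ∈-lookup; ∈-allFin; ∈-filter⁺; ∈-filter⁻)
open import Data.List.Relation.Unary.Any as Any using (here; there)
import Data.List.Relation.Unary.Any.Properties as AnyP
open import Data.Product using (Σ; ∃; _×_; _,_; proj₁; proj₂)
open import Data.Sum using (_⊎_; inj₁; inj₂; [_,_]′)
open import Data.Empty using (⊥; ⊥-elim)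
open import Data.Unit using (⊤; tt)
open import Data.Bool using (Bool; true; false; if_then_else_)
open import Data.Maybe using (Maybe; just; nothing)
open import Function using (_∘_; id; case_of_)
open import Relation.Nullary using (¬_; Dec; yes; no; does)
open import Relation.Nullary.Decidable using (dec⇒maybe; ¬?)
open import Relation.Binary.PropositionalEquality
open import Relation.Binary.Definitions using (tri<; tri≈; tri>)
open import Tactic.RingSolver using (solve-∀)
open import Tactic.RingSolver.Core.AlmostCommutativeRing using (AlmostCommutativeRing; fromCommutativeRing)
open import Level using (0ℓ)
open import Data.Nat.Coprimality as Coprimality using (Coprime)
open import Data.Integer.DivMod using (a≡a%n+[a/n]*n; n%d<d)
import Data.Integer.Divisibility.Signed
open Data.Integer.Divisibility.Signed using (∣⇒∣ᵤ; ∣ᵤ⇒∣) renaming (divides to dividesℤ)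
open import Data.List.Relation.Unary.Unique.Propositional using (Unique)
import Data.List.Relation.Unary.Unique.Propositional.Properties as UniqueP
import Data.List.Relation.Unary.AllPairs as AllPairs
import Data.List.Relation.Unary.All as All
open import Relation.Unary using (Decidable)
import Data.Vec.Relation.Unary.All as VAll
import Data.Vec.Relation.Unary.All.Properties as VAllP
open import Data.Nat.ListAction using (sum)
import Data.Bool
import Data.Nat.Divisibility
open import Function.Bundles using (_↔_; Inverse; mk↔ₛ′)
open import Function.Properties.Inverse using (↔-refl; ↔-sym; ↔-trans)
open import Data.Sum.Function.Propositional using (_⊎-↔_)
open import Data.Product.Function.NonDependent.Propositional using (_×-↔_)
import Data.Sum.Properties as SumP
open import Data.List.Relation.Binary.BagAndSetEquality using (∼bag⇒↭)
open import Data.List.Relation.Binary.Permutation.Propositional using (_↭_)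

-- Three obstacles shape the proof. A polytope is given by a list that may contain points other than
-- vertices, and extremality is not decidable by definition. Therefore vertices are always obtained
-- from facets: by simpliciality a facet is the hull of a basis of vertices, and a pivot as in the
-- simplex method leads to the neighbouring facet; the existence of vertices on {g = 0} with given
-- support then becomes a case distinction on the number t. Linear algebra is done with biorthogonal
-- families instead of determinants: a dual family gives independence, coordinates and exposing
-- functionals, and lattice bases if both families are integral. Finally, the e_i need not form a
-- lattice basis: those with integral e_i* split off, and the lattice of the core is the common
-- kernel of these e_i*, for which a basis is found by the Euclidean algorithm. In the uniqueness
-- proof each pair ±w of the core counts as a block of its own, just like a segment, and only
-- integrality tells the two apart.

private
  variable
    n m k l : ℕ

-- Integers among the rationals, finite sums and vectors

ℚring : AlmostCommutativeRing 0ℓ 0ℓ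
ℚring = fromCommutativeRing ℚP.+-*-commutativeRing (λ x → dec⇒maybe (0ℚ ℚP.≟ x))


infixl 9 _‼_

_‼_ : {A : Set} → Vec A n → Fin n → A
_‼_ = Vec.lookup

0≤-diff : ∀ {p q} → p ≤ q → 0ℚ ≤ q - p
0≤-diff {p} {q} h = subst (_≤ q - p) (ℚP.+-inverseʳ p) (ℚP.+-monoˡ-≤ (- p) h)

0<-diff : ∀ {p q} → p < q → 0ℚ < q - p
0<-diff {p} {q} h = subst (_< q - p) (ℚP.+-inverseʳ p) (ℚP.+-monoˡ-< (- p) h)

sub-add : ∀ p q → (q - p) + p ≡ q
sub-add = solve-∀ ℚring

≤-diff : ∀ {p q} → 0ℚ ≤ q - p → p ≤ q
≤-diff {p} {q} h = subst₂ _≤_ (ℚP.+-identityˡ p) (sub-add p q) (ℚP.+-monoˡ-≤ p h)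

<-diff : ∀ {p q} → 0ℚ < q - p → p < q
<-diff {p} {q} h = subst₂ _<_ (ℚP.+-identityˡ p) (sub-add p q) (ℚP.+-monoˡ-< p h)

≤-by : ∀ {p q} r → 0ℚ ≤ r → q - p ≡ r → p ≤ q
≤-by r h eq = ≤-diff (subst (0ℚ ≤_) (sym eq) h)

<-by : ∀ {p q} r → 0ℚ < r → q - p ≡ r → p < q
<-by r h eq = <-diff (subst (0ℚ <_) (sym eq) h)

+-nonneg : ∀ {p q} → 0ℚ ≤ p → 0ℚ ≤ q → 0ℚ ≤ p + q
+-nonneg = ℚP.+-mono-≤

*-nonneg : ∀ {p q} → 0ℚ ≤ p → 0ℚ ≤ q → 0ℚ ≤ p * q
*-nonneg {p} {q} hp hq = subst (_≤ p * q) (ℚP.*-zeroʳ p) (ℚP.*-monoˡ-≤-nonNeg p {{ℚ.nonNegative hp}} hq)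

*-pos : ∀ {p q} → 0ℚ < p → 0ℚ < q → 0ℚ < p * q
*-pos {p} {q} hp hq = subst (_< p * q) (ℚP.*-zeroʳ p) (ℚP.*-monoʳ-<-pos p {{ℚ.positive hp}} hq)

neg-pos : ∀ {p} → p < 0ℚ → 0ℚ < - p
neg-pos h = ℚP.neg-antimono-< h

pos-neg : ∀ {p} → 0ℚ < p → - p < 0ℚ
pos-neg h = ℚP.neg-antimono-< h

0≢1 : 0ℚ ≢ 1ℚ
0≢1 ()

0<1 : 0ℚ < 1ℚ
0<1 = *<* (ℤ.+<+ (ℕ.s≤s ℕ.z≤n))

0≤1 : 0ℚ ≤ 1ℚ
0≤1 = ℚP.<⇒≤ 0<1

-1<0 : - 1ℚ < 0ℚ
-1<0 = *<* ℤ.-<+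

opaque
  inverse : ∀ p → p ≢ 0ℚ → ∃ λ q → q * p ≡ 1ℚ
  inverse p h = (ℚ.1/_ p {{ℚ.≢-nonZero h}}) , ℚP.*-inverseˡ p {{ℚ.≢-nonZero h}}

opaque
  inverse-pos : ∀ p → 0ℚ < p → ∃ λ q → q * p ≡ 1ℚ × 0ℚ < q
  inverse-pos p h = q , ℚP.*-inverseˡ p {{pos⇒nz}} , ℚP.positive⁻¹ q {{ℚP.1/pos⇒pos p {{ℚ.positive h}}}}
    where
    pos⇒nz : ℚ.NonZero p
    pos⇒nz = ℚP.pos⇒nonZero p {{ℚ.positive h}}
    q : ℚ
    q = ℚ.1/_ p {{pos⇒nz}}

*-cancel-0 : ∀ p q → p * q ≡ 0ℚ → q ≢ 0ℚ → p ≡ 0ℚ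
*-cancel-0 p q h q≢0 with inverse q q≢0
... | r , rq = begin
  p            ≡⟨ sym (ℚP.*-identityʳ p) ⟩
  p * 1ℚ       ≡⟨ cong (p *_) (sym rq) ⟩
  p * (r * q)  ≡⟨ shuffle p r q ⟩
  (p * q) * r  ≡⟨ cong (_* r) h ⟩
  0ℚ * r       ≡⟨ ℚP.*-zeroˡ r ⟩
  0ℚ           ∎
  where
  open ≡-Reasoning
  shuffle : ∀ p r q → p * (r * q) ≡ (p * q) * r
  shuffle = solve-∀ ℚring

*-zero-split : ∀ p q → p * q ≡ 0ℚ → p ≡ 0ℚ ⊎ q ≡ 0ℚ
*-zero-split p q h with q ℚP.≟ 0ℚ
... | yes q0 = inj₂ q0
... | no q≢0 = inj₁ (*-cancel-0 p q h q≢0)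

neg-neg : ∀ p → - - p ≡ p
neg-neg = solve-∀ ℚring

diff-0 : ∀ {p q} → p - q ≡ 0ℚ → p ≡ q
diff-0 {p} {q} h = trans (sym (sub-add q p)) (trans (cong (_+ q) h) (ℚP.+-identityˡ q))

fromℤ : ℤ → ℚ
fromℤ z = z ℚ./ 1

IsInt : ℚ → Set
IsInt q = ∃ λ z → fromℤ z ≡ q

fromℤ-mk : ∀ z .(c : Coprime ℤ.∣ z ∣ 1) → fromℤ z ≡ mkℚ z 0 c
fromℤ-mk z c = ℚP.↥p/↧p≡p (mkℚ z 0 c)

any-coprime-1 : ∀ k → Coprime k 1
any-coprime-1 k = Coprimality.sym (Coprimality.1-coprimeTo k)

-- `z / 1` divides by a gcd and does not reduce for a variable `z`. The constructor form does, so
-- arithmetic of integers inside ℚ is proved for `mk` and transferred.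
mk : ℤ → ℚ
mk z = mkℚ z 0 (any-coprime-1 ℤ.∣ z ∣)

fromℤ≡mk : ∀ z → fromℤ z ≡ mk z
fromℤ≡mk z = fromℤ-mk z _

fromℤ-+ : ∀ a b → fromℤ (a ℤ.+ b) ≡ fromℤ a + fromℤ b
fromℤ-+ a b = sym (trans (cong₂ _+_ (fromℤ≡mk a) (fromℤ≡mk b))
  (cong fromℤ (cong₂ ℤ._+_ (ℤP.*-identityʳ a) (ℤP.*-identityʳ b))))

fromℤ-* : ∀ a b → fromℤ (a ℤ.* b) ≡ fromℤ a * fromℤ b
fromℤ-* a b = sym (cong₂ _*_ (fromℤ≡mk a) (fromℤ≡mk b))

fromℤ-neg : ∀ a → fromℤ (ℤ.- a) ≡ - fromℤ a
fromℤ-neg a = trans (fromℤ≡mk (ℤ.- a)) (trans (lem a) (cong -_ (sym (fromℤ≡mk a))))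
  where
  lem : ∀ a → mk (ℤ.- a) ≡ - mk a
  lem (ℤ.+ zero)    = refl
  lem (ℤ.+ (suc n)) = refl
  lem -[1+ n ]    = refl

fromℤ-injective : ∀ {a b} → fromℤ a ≡ fromℤ b → a ≡ b
fromℤ-injective {a} {b} h = cong ℚ.↥_ (trans (sym (fromℤ≡mk a)) (trans h (fromℤ≡mk b)))

fromℤ-cancel-≤ : ∀ {a b} → fromℤ a ≤ fromℤ b → a ℤ.≤ b
fromℤ-cancel-≤ {a} {b} h with subst₂ _≤_ (fromℤ≡mk a) (fromℤ≡mk b) h
... | *≤* p = subst₂ ℤ._≤_ (ℤP.*-identityʳ a) (ℤP.*-identityʳ b) p

fromℤ-cancel-< : ∀ {a b} → fromℤ a < fromℤ b → a ℤ.< b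
fromℤ-cancel-< {a} {b} h with subst₂ _<_ (fromℤ≡mk a) (fromℤ≡mk b) h
... | *<* p = subst₂ ℤ._<_ (ℤP.*-identityʳ a) (ℤP.*-identityʳ b) p

-- A rational is stored in lowest terms, so it is an integer exactly when the stored denominator is
-- 1, that is, `denominator-1` is 0.
isInt? : ∀ q → Dec (IsInt q)
isInt? (mkℚ z zero c)    = yes (z , fromℤ-mk z c)
isInt? (mkℚ z (suc d) c) = no λ { (a , eq) → case cong ℚ.ℚ.denominator-1 (trans (sym (fromℤ≡mk a)) eq) of λ () }

Int-+ : ∀ {p q} → IsInt p → IsInt q → IsInt (p + q)
Int-+ (a , refl) (b , refl) = a ℤ.+ b , fromℤ-+ a b

Int-* : ∀ {p q} → IsInt p → IsInt q → IsInt (p * q)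
Int-* (a , refl) (b , refl) = a ℤ.* b , fromℤ-* a b

Int-neg : ∀ {p} → IsInt p → IsInt (- p)
Int-neg (a , refl) = ℤ.- a , fromℤ-neg a

Int-sub : ∀ {p q} → IsInt p → IsInt q → IsInt (p - q)
Int-sub a b = Int-+ a (Int-neg b)

Int-0 : IsInt 0ℚ
Int-0 = ℤ.+ 0 , refl

Int-1 : IsInt 1ℚ
Int-1 = ℤ.+ 1 , refl

2ℚ : ℚ
2ℚ = 1ℚ + 1ℚ

Int-cast : ∀ {p q} → p ≡ q → IsInt p → IsInt q
Int-cast = subst IsInt

Int-1-or-2 : ∀ {t} → IsInt t → 0ℚ < t → t ≤ 2ℚ → t ≡ 1ℚ ⊎ t ≡ 2ℚ
Int-1-or-2 (z , refl) lo hi with fromℤ-cancel-< {ℤ.+ 0} {z} lo | fromℤ-cancel-≤ {z} {ℤ.+ 2} hi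
Int-1-or-2 (ℤ.+ 1 , refl) lo hi | _ | _ = inj₁ refl
Int-1-or-2 (ℤ.+ 2 , refl) lo hi | _ | _ = inj₂ refl
Int-1-or-2 (ℤ.+ 0 , refl) lo hi | ℤ.+<+ () | _
Int-1-or-2 (ℤ.+ suc (suc (suc _)) , refl) lo hi | _ | ℤ.+≤+ (ℕ.s≤s (ℕ.s≤s ()))

Int-unit : ∀ {t} → IsInt t → 0ℚ < t → t ≤ 1ℚ → t ≡ 1ℚ
Int-unit (z , refl) lo hi with fromℤ-cancel-< {ℤ.+ 0} {z} lo | fromℤ-cancel-≤ {z} {ℤ.+ 1} hi
Int-unit (ℤ.+ 1 , refl) lo hi | _ | _ = refl
Int-unit (ℤ.+ 0 , refl) lo hi | ℤ.+<+ () | _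
Int-unit (ℤ.+ suc (suc _) , refl) lo hi | _ | ℤ.+≤+ (ℕ.s≤s ())

Int-±1 : ∀ {t} → IsInt t → - 1ℚ ≤ t → t ≤ 1ℚ → t ≡ - 1ℚ ⊎ t ≡ 0ℚ ⊎ t ≡ 1ℚ
Int-±1 {t} it lo hi with ℚP.<-cmp 0ℚ t
... | tri< 0<t _ _ = inj₂ (inj₂ (Int-unit it 0<t hi))
... | tri≈ _ eq _  = inj₂ (inj₁ (sym eq))
... | tri> _ _ t<0 = inj₁ (trans (sym (neg-neg t)) (cong -_ (Int-unit (Int-neg it) (neg-pos t<0) (ℚP.neg-antimono-≤ lo))))

δ : Fin n → Fin n → ℚ
δ i j = if does (i Fin.≟ j) then 1ℚ else 0ℚ

δ-refl : (i : Fin n) → δ i i ≡ 1ℚ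
δ-refl i with i Fin.≟ i
... | yes _ = refl
... | no h  = ⊥-elim (h refl)

δ-≢ : {i j : Fin n} → i ≢ j → δ i j ≡ 0ℚ
δ-≢ {i = i} {j} h with i Fin.≟ j
... | yes e = ⊥-elim (h e)
... | no _  = refl

δ-sym : (i j : Fin n) → δ i j ≡ δ j i
δ-sym i j with i Fin.≟ j
... | yes refl = sym (δ-refl i)
... | no h     = sym (δ-≢ (h ∘ sym))

δ-suc : (i j : Fin n) → δ (Fin.suc i) (suc j) ≡ δ i j
δ-suc i j with i Fin.≟ j
... | yes _ = refl
... | no _  = refl

Int-δ : (i j : Fin n) → IsInt (δ i j)
Int-δ i j with i Fin.≟ j
... | yes _ = Int-1
... | no _  = Int-0

sumF-cong : {f g : Fin k → ℚ} → (∀ i → f i ≡ g i) → sumF f ≡ sumF g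
sumF-cong {k = zero}  h = refl
sumF-cong {k = suc k} h = cong₂ _+_ (h zero) (sumF-cong (h ∘ suc))

sumF-0 : sumF {k} (λ _ → 0ℚ) ≡ 0ℚ
sumF-0 {zero}  = refl
sumF-0 {suc k} = trans (ℚP.+-identityˡ _) (sumF-0 {k})

sumF-zero : {f : Fin k → ℚ} → (∀ i → f i ≡ 0ℚ) → sumF f ≡ 0ℚ
sumF-zero {k} h = trans (sumF-cong h) (sumF-0 {k})

+-interchange : ∀ a b c d → (a + b) + (c + d) ≡ (a + c) + (b + d)
+-interchange = solve-∀ ℚring

sumF-+ : (f g : Fin k → ℚ) → sumF (λ i → f i + g i) ≡ sumF f + sumF g
sumF-+ {zero}  f g = refl
sumF-+ {suc k} f g = trans (cong ((f zero + g zero) +_) (sumF-+ (f ∘ suc) (g ∘ suc)))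
  (+-interchange (f zero) (g zero) (sumF (f ∘ suc)) (sumF (g ∘ suc)))

sumF-* : (c : ℚ) (f : Fin k → ℚ) → sumF (λ i → c * f i) ≡ c * sumF f
sumF-* {zero}  c f = sym (ℚP.*-zeroʳ c)
sumF-* {suc k} c f = trans (cong (c * f zero +_) (sumF-* c (f ∘ suc))) (sym (ℚP.*-distribˡ-+ c (f zero) (sumF (f ∘ suc))))

sumF-*ʳ : (c : ℚ) (f : Fin k → ℚ) → sumF (λ i → f i * c) ≡ sumF f * c
sumF-*ʳ c f = trans (sumF-cong (λ i → ℚP.*-comm (f i) c)) (trans (sumF-* c f) (ℚP.*-comm c _))

neg-as-* : ∀ p → - p ≡ (- 1ℚ) * p
neg-as-* = solve-∀ ℚring

sumF-neg : (f : Fin k → ℚ) → sumF (λ i → - f i) ≡ - sumF f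
sumF-neg f = trans (sumF-cong (λ i → neg-as-* (f i))) (trans (sumF-* (- 1ℚ) f) (sym (neg-as-* _)))

sumF-sub : (f g : Fin k → ℚ) → sumF (λ i → f i - g i) ≡ sumF f - sumF g
sumF-sub f g = trans (sumF-+ f (λ i → - g i)) (cong (sumF f +_) (sumF-neg g))

sumF-swap : (f : Fin k → Fin l → ℚ) →
  sumF (λ i → sumF (λ j → f i j)) ≡ sumF (λ j → sumF (λ i → f i j))
sumF-swap {zero} {l} f = sym (sumF-0 {l})
sumF-swap {suc k} f = trans (cong (sumF (f zero) +_) (sumF-swap (f ∘ suc)))
  (sym (sumF-+ (f zero) (λ j → sumF (λ i → f (suc i) j))))

sumF-single : (i : Fin k) (f : Fin k → ℚ) → (∀ j → j ≢ i → f j ≡ 0ℚ) → sumF f ≡ f i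
sumF-single zero f h = trans (cong (f zero +_) (sumF-zero (λ j → h (suc j) λ ()))) (ℚP.+-identityʳ (f zero))
sumF-single (suc i) f h = trans (cong₂ _+_ (h zero λ ())
  (sumF-single i (f ∘ suc) (λ j j≢i → h (suc j) (j≢i ∘ FinP.suc-injective)))) (ℚP.+-identityˡ _)

sumF-δ : (i : Fin k) (f : Fin k → ℚ) → sumF (λ j → δ i j * f j) ≡ f i
sumF-δ i f = trans (sumF-single i _ (λ j h → trans (cong (_* f j) (δ-≢ (h ∘ sym))) (ℚP.*-zeroˡ (f j))))
  (trans (cong (_* f i) (δ-refl i)) (ℚP.*-identityˡ (f i)))

sumF-δʳ : (i : Fin k) (f : Fin k → ℚ) → sumF (λ j → f j * δ j i) ≡ f i
sumF-δʳ i f = trans (sumF-cong (λ j → trans (ℚP.*-comm (f j) _) (cong (_* f j) (δ-sym j i)))) (sumF-δ i f)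

sumF-nonneg : (f : Fin k → ℚ) → (∀ i → 0ℚ ≤ f i) → 0ℚ ≤ sumF f
sumF-nonneg {zero}  f h = ℚP.≤-refl
sumF-nonneg {suc k} f h = +-nonneg (h zero) (sumF-nonneg (f ∘ suc) (h ∘ suc))

+-nonneg-0ˡ : ∀ {p q} → 0ℚ ≤ p → 0ℚ ≤ q → p + q ≡ 0ℚ → p ≡ 0ℚ
+-nonneg-0ˡ {p} {q} hp hq eq = ℚP.≤-antisym
  (≤-by q hq (trans (cong (_- p) (sym eq)) (lem p q))) hp
  where
  lem : ∀ p q → (p + q) - p ≡ q
  lem = solve-∀ ℚring

sumF-nonneg-0 : (f : Fin k → ℚ) → (∀ i → 0ℚ ≤ f i) → sumF f ≡ 0ℚ → ∀ i → f i ≡ 0ℚ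
sumF-nonneg-0 {suc k} f h eq zero    = +-nonneg-0ˡ (h zero) (sumF-nonneg _ (h ∘ suc)) eq
sumF-nonneg-0 {suc k} f h eq (suc i) = sumF-nonneg-0 (f ∘ suc) (h ∘ suc)
  (+-nonneg-0ˡ (sumF-nonneg _ (h ∘ suc)) (h zero) (trans (ℚP.+-comm (sumF (f ∘ suc)) (f zero)) eq)) i

sumF-neg-term : (f : Fin k → ℚ) → sumF f < 0ℚ → ∃ λ i → f i < 0ℚ
sumF-neg-term {zero} f h = ⊥-elim (ℚP.<-irrefl refl h)
sumF-neg-term {suc k} f h with f zero ℚP.<? 0ℚ
... | yes p = zero , p
... | no ¬p with sumF-neg-term (f ∘ suc) (ℚP.≤-<-trans
        (subst (_≤ sumF f) (ℚP.+-identityˡ _) (ℚP.+-monoˡ-≤ _ (ℚP.≮⇒≥ ¬p))) h)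
...   | i , q = suc i , q

sumF-≤ : {f g : Fin k → ℚ} → (∀ i → f i ≤ g i) → sumF f ≤ sumF g
sumF-≤ {k = zero}  h = ℚP.≤-refl
sumF-≤ {k = suc k} h = ℚP.+-mono-≤ (h zero) (sumF-≤ (h ∘ suc))

Int-sumF : (f : Fin k → ℚ) → (∀ i → IsInt (f i)) → IsInt (sumF f)
Int-sumF {zero}  f h = Int-0
Int-sumF {suc k} f h = Int-+ (h zero) (Int-sumF (f ∘ suc) (h ∘ suc))

vext : {A : Set} {x y : Vec A n} → (∀ i → x ‼ i ≡ y ‼ i) → x ≡ y
vext {x = []}    {[]}    h = refl
vext {x = _ ∷ _} {_ ∷ _} h = cong₂ _∷_ (h zero) (vext (h ∘ suc))

‼-tab : {A : Set} (f : Fin n → A) (i : Fin n) → Vec.tabulate f ‼ i ≡ f i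
‼-tab = VecP.lookup∘tabulate

‼-add : (x y : QPt n) (i : Fin n) → addQ x y ‼ i ≡ x ‼ i + y ‼ i
‼-add x y i = VecP.lookup-zipWith _+_ i x y

‼-scale : (t : ℚ) (x : QPt n) (i : Fin n) → scaleQ t x ‼ i ≡ t * x ‼ i
‼-scale t x i = VecP.lookup-map i (t *_) x

‼-neg : (x : QPt n) (i : Fin n) → negQ x ‼ i ≡ - x ‼ i
‼-neg x i = VecP.lookup-map i -_ x

‼-zero : (i : Fin n) → zeroQ ‼ i ≡ 0ℚ
‼-zero i = VecP.lookup-replicate i 0ℚ

‼-toℚ : (v : Pt n) (i : Fin n) → toℚ v ‼ i ≡ fromℤ (v ‼ i)
‼-toℚ v i = VecP.lookup-map i fromℤ v

dot-sum : (x y : QPt n) → dot x y ≡ sumF (λ i → x ‼ i * y ‼ i)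
dot-sum []      []      = refl
dot-sum (a ∷ x) (b ∷ y) = cong (a * b +_) (dot-sum x y)

dot-comm : (x y : QPt n) → dot x y ≡ dot y x
dot-comm []      []      = refl
dot-comm (a ∷ x) (b ∷ y) = cong₂ _+_ (ℚP.*-comm a b) (dot-comm x y)

dot-add : (f x y : QPt n) → dot f (addQ x y) ≡ dot f x + dot f y
dot-add []      []      []      = refl
dot-add (a ∷ f) (b ∷ x) (c ∷ y) = trans (cong₂ _+_ (ℚP.*-distribˡ-+ a b c) (dot-add f x y))
  (+-interchange (a * b) (a * c) (dot f x) (dot f y))

dot-scale : (t : ℚ) (f x : QPt n) → dot f (scaleQ t x) ≡ t * dot f x
dot-scale t []      []      = sym (ℚP.*-zeroʳ t)
dot-scale t (a ∷ f) (b ∷ x) = trans (cong (a * (t * b) +_) (dot-scale t f x)) (lem t a b (dot f x))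
  where
  lem : ∀ t a b d → a * (t * b) + t * d ≡ t * (a * b + d)
  lem = solve-∀ ℚring

neg-scale : (x : QPt n) → negQ x ≡ scaleQ (- 1ℚ) x
neg-scale x = VecP.map-cong neg-as-* x

dot-neg : (f x : QPt n) → dot f (negQ x) ≡ - dot f x
dot-neg f x = trans (cong (dot f) (neg-scale x)) (trans (dot-scale (- 1ℚ) f x) (sym (neg-as-* _)))

dot-negˡ : (f x : QPt n) → dot (negQ f) x ≡ - dot f x
dot-negˡ f x = trans (dot-comm (negQ f) x) (trans (dot-neg x f) (cong -_ (dot-comm x f)))

dot-zero : (f : QPt n) → dot f zeroQ ≡ 0ℚ
dot-zero []      = refl
dot-zero (a ∷ f) = trans (cong₂ _+_ (ℚP.*-zeroʳ a) (dot-zero f)) refl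

dot-zeroˡ : (x : QPt n) → dot zeroQ x ≡ 0ℚ
dot-zeroˡ x = trans (dot-comm zeroQ x) (dot-zero x)

dot-addˡ : (f g x : QPt n) → dot (addQ f g) x ≡ dot f x + dot g x
dot-addˡ f g x = trans (dot-comm (addQ f g) x) (trans (dot-add x f g) (cong₂ _+_ (dot-comm x f) (dot-comm x g)))

dot-scaleˡ : (t : ℚ) (f x : QPt n) → dot (scaleQ t f) x ≡ t * dot f x
dot-scaleˡ t f x = trans (dot-comm _ x) (trans (dot-scale t x f) (cong (t *_) (dot-comm x f)))

dot-mid : (f x y : QPt n) → dot f (midpoint x y) ≡ ½ * (dot f x + dot f y)
dot-mid f x y = trans (dot-scale ½ f (addQ x y)) (cong (½ *_) (dot-add f x y))

subQ : QPt n → QPt n → QPt n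
subQ x y = addQ x (negQ y)

‼-sub : (x y : QPt n) (i : Fin n) → subQ x y ‼ i ≡ x ‼ i - y ‼ i
‼-sub x y i = trans (‼-add x (negQ y) i) (cong (x ‼ i +_) (‼-neg y i))

dot-sub : (f x y : QPt n) → dot f (subQ x y) ≡ dot f x - dot f y
dot-sub f x y = trans (dot-add f x (negQ y)) (cong (dot f x +_) (dot-neg f y))

dot-subˡ : (f g x : QPt n) → dot (subQ f g) x ≡ dot f x - dot g x
dot-subˡ f g x = trans (dot-addˡ f (negQ g) x) (cong (dot f x +_) (dot-negˡ g x))

unitQ : Fin n → QPt n
unitQ i = Vec.tabulate (δ i)

dot-unit : (i : Fin n) (x : QPt n) → dot (unitQ i) x ≡ x ‼ i
dot-unit i x = trans (dot-sum (unitQ i) x)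
  (trans (sumF-cong (λ j → cong (_* x ‼ j) (‼-tab (δ i) j))) (sumF-δ i (x ‼_)))

dot-unitʳ : (x : QPt n) (i : Fin n) → dot x (unitQ i) ≡ x ‼ i
dot-unitʳ x i = trans (dot-comm x (unitQ i)) (dot-unit i x)

negQ-negQ : (x : QPt n) → negQ (negQ x) ≡ x
negQ-negQ x = vext λ i → trans (‼-neg (negQ x) i) (trans (cong -_ (‼-neg x i)) (neg-neg _))

opaque
  -- `lincomb` for arbitrary finite families; with positions in a list, exchanging or reindexing
  -- vectors would be awkward.
  comb : (Fin k → ℚ) → (Fin k → QPt n) → QPt n
  comb c e = Vec.tabulate (λ j → sumF (λ i → c i * e i ‼ j))

  lincomb-comb : (w : List (QPt n)) (c : Fin (List.length w) → ℚ) → lincomb w c ≡ comb c (List.lookup w)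
  lincomb-comb w c = refl

  ‼-comb : (c : Fin k → ℚ) (e : Fin k → QPt n) (j : Fin n) → comb c e ‼ j ≡ sumF (λ i → c i * e i ‼ j)
  ‼-comb c e j = ‼-tab _ j

dot-comb : (f : QPt n) (c : Fin k → ℚ) (e : Fin k → QPt n) →
  dot f (comb c e) ≡ sumF (λ i → c i * dot f (e i))
dot-comb f c e = begin
  dot f (comb c e)                                             ≡⟨ dot-sum f _ ⟩
  sumF (λ j → f ‼ j * comb c e ‼ j)                            ≡⟨ sumF-cong (λ j → cong (f ‼ j *_) (‼-comb c e j)) ⟩
  sumF (λ j → f ‼ j * sumF (λ i → c i * e i ‼ j))              ≡⟨ sumF-cong (λ j → sym (sumF-* (f ‼ j) (λ i → c i * e i ‼ j))) ⟩
  sumF (λ j → sumF (λ i → f ‼ j * (c i * e i ‼ j)))            ≡⟨ sumF-swap (λ j i → f ‼ j * (c i * e i ‼ j)) ⟩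
  sumF (λ i → sumF (λ j → f ‼ j * (c i * e i ‼ j)))            ≡⟨ sumF-cong (λ i → trans (sumF-cong (λ j → lem (f ‼ j) (c i) (e i ‼ j))) (sumF-* (c i) (λ j → f ‼ j * e i ‼ j))) ⟩
  sumF (λ i → c i * sumF (λ j → f ‼ j * e i ‼ j))              ≡⟨ sumF-cong (λ i → cong (c i *_) (sym (dot-sum f (e i)))) ⟩
  sumF (λ i → c i * dot f (e i))                               ∎
  where
  open ≡-Reasoning
  lem : ∀ a b c → a * (b * c) ≡ b * (a * c)
  lem = solve-∀ ℚring

dot-combˡ : (c : Fin k → ℚ) (e : Fin k → QPt n) (f : QPt n) →
  dot (comb c e) f ≡ sumF (λ i → c i * dot (e i) f)
dot-combˡ c e f = trans (dot-comm _ f) (trans (dot-comb f c e) (sumF-cong (λ i → cong (c i *_) (dot-comm f (e i)))))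

comb-cong : {c c' : Fin k → ℚ} {e e' : Fin k → QPt n} →
  (∀ i → c i ≡ c' i) → (∀ i → e i ≡ e' i) → comb c e ≡ comb c' e'
comb-cong {c = c} {c'} {e} {e'} hc he = vext λ j → trans (‼-comb c e j)
  (trans (sumF-cong (λ i → cong₂ _*_ (hc i) (cong (_‼ j) (he i)))) (sym (‼-comb c' e' j)))

comb-unit : (x : QPt n) → comb (x ‼_) unitQ ≡ x
comb-unit x = vext λ j → trans (‼-comb (x ‼_) unitQ j)
  (trans (sumF-cong (λ i → cong (x ‼ i *_) (‼-tab (δ i) j))) (sumF-δʳ j (x ‼_)))

lattice-int : {x : QPt n} → IsLattice x → ∀ i → IsInt (x ‼ i)
lattice-int (v , refl) i = v ‼ i , sym (‼-toℚ v i)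

int-lattice : {x : QPt n} → (∀ i → IsInt (x ‼ i)) → IsLattice x
int-lattice {x = x} h = Vec.tabulate (proj₁ ∘ h) , vext λ i →
  trans (‼-toℚ (Vec.tabulate (proj₁ ∘ h)) i) (trans (cong fromℤ (‼-tab (proj₁ ∘ h) i)) (proj₂ (h i)))

isLattice? : (x : QPt n) → Dec (IsLattice x)
isLattice? x with FinP.all? (λ i → isInt? (x ‼ i))
... | yes h = yes (int-lattice h)
... | no ¬h = no (¬h ∘ lattice-int)

lattice-dot : {x y : QPt n} → IsLattice x → IsLattice y → IsInt (dot x y)
lattice-dot {x = x} {y} hx hy = Int-cast (sym (dot-sum x y))
  (Int-sumF _ (λ i → Int-* (lattice-int hx i) (lattice-int hy i)))

lattice-unit : (i : Fin n) → IsLattice (unitQ i)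
lattice-unit i = int-lattice λ j → Int-cast (sym (‼-tab (δ i) j)) (Int-δ i j)

lattice-comb : (c : Fin k → ℚ) (e : Fin k → QPt n) → (∀ i → IsInt (c i)) → (∀ i → IsLattice (e i)) →
  IsLattice (comb c e)
lattice-comb c e hc he = int-lattice λ j → Int-cast (sym (‼-comb c e j))
  (Int-sumF _ (λ i → Int-* (hc i) (lattice-int (he i) j)))

lattice-neg : {x : QPt n} → IsLattice x → IsLattice (negQ x)
lattice-neg {x = x} h = int-lattice λ j → Int-cast (sym (‼-neg x j)) (Int-neg (lattice-int h j))

lattice-add : {x y : QPt n} → IsLattice x → IsLattice y → IsLattice (addQ x y)
lattice-add {x = x} {y} h h' = int-lattice λ j → Int-cast (sym (‼-add x y j)) (Int-+ (lattice-int h j) (lattice-int h' j))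

lattice-sub : {x y : QPt n} → IsLattice x → IsLattice y → IsLattice (subQ x y)
lattice-sub h h' = lattice-add h (lattice-neg h')

lattice-scale : {t : ℚ} {x : QPt n} → IsInt t → IsLattice x → IsLattice (scaleQ t x)
lattice-scale {t = t} {x} h h' = int-lattice λ j → Int-cast (sym (‼-scale t x j)) (Int-* h (lattice-int h' j))

lattice-zero : IsLattice (zeroQ {n})
lattice-zero = int-lattice λ j → Int-cast (sym (‼-zero j)) Int-0

-- Linear algebra

Indep : (Fin k → QPt n) → Set
Indep e = ∀ c → comb c e ≡ zeroQ → ∀ i → c i ≡ 0ℚ

-- A biorthogonal system is an independent family together with a left inverse of its coordinate
-- map. Carrying the inverse along replaces determinants and elimination.
record Dualᶠ {k n : ℕ} (f e : Fin k → QPt n) : Set where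
  constructor dualᶠ
  field
    biorth : ∀ i j → dot (f i) (e j) ≡ δ i j

open Dualᶠ public

InSpan : (Fin k → QPt n) → QPt n → Set
InSpan e x = ∃ λ c → comb c e ≡ x

Complete : (f e : Fin k → QPt n) → Set
Complete f e = ∀ x → comb (λ i → dot (f i) x) e ≡ x

infixr 5 _∷ᶠ_

_∷ᶠ_ : {A : Set} → A → (Fin k → A) → Fin (suc k) → A
(a ∷ᶠ f) zero    = a
(a ∷ᶠ f) (suc i) = f i

dual-coeff : {f e : Fin k → QPt n} → Dualᶠ f e → ∀ c i → dot (f i) (comb c e) ≡ c i
dual-coeff {f = f} {e} d c i = trans (dot-comb (f i) c e)
  (trans (sumF-cong (λ j → cong (c j *_) (trans (biorth d i j) (δ-sym i j)))) (sumF-δʳ i c))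

dual-indep : {f e : Fin k → QPt n} → Dualᶠ f e → Indep e
dual-indep {f = f} {e} d c h i = trans (sym (dual-coeff d c i)) (trans (cong (dot (f i)) h) (dot-zero (f i)))

span-fixed : {f e : Fin k → QPt n} → Dualᶠ f e → ∀ {x} → InSpan e x → comb (λ i → dot (f i) x) e ≡ x
span-fixed d (c , refl) = comb-cong (dual-coeff d c) (λ _ → refl)

comb-∷ : (a : ℚ) (c : Fin k → ℚ) (v : QPt n) (e : Fin k → QPt n) →
  comb (a ∷ᶠ c) (v ∷ᶠ e) ≡ addQ (scaleQ a v) (comb c e)
comb-∷ a c v e = vext λ j → trans (‼-comb (a ∷ᶠ c) (v ∷ᶠ e) j)
  (sym (trans (‼-add (scaleQ a v) (comb c e) j) (cong₂ _+_ (‼-scale a v j) (‼-comb c e j))))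

scale-0 : (x : QPt n) → scaleQ 0ℚ x ≡ zeroQ
scale-0 x = vext λ j → trans (‼-scale 0ℚ x j) (trans (ℚP.*-zeroˡ (x ‼ j)) (sym (‼-zero j)))

scale-1 : (x : QPt n) → scaleQ 1ℚ x ≡ x
scale-1 x = vext λ j → trans (‼-scale 1ℚ x j) (ℚP.*-identityˡ (x ‼ j))

add-zeroˡ : (x : QPt n) → addQ zeroQ x ≡ x
add-zeroˡ x = vext λ j → trans (‼-add zeroQ x j) (trans (cong (_+ x ‼ j) (‼-zero j)) (ℚP.+-identityˡ (x ‼ j)))

add-zeroʳ : (x : QPt n) → addQ x zeroQ ≡ x
add-zeroʳ x = vext λ j → trans (‼-add x zeroQ j) (trans (cong (x ‼ j +_) (‼-zero j)) (ℚP.+-identityʳ (x ‼ j)))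

comb-0 : (e : Fin k → QPt n) → comb (λ _ → 0ℚ) e ≡ zeroQ
comb-0 e = vext λ j → trans (‼-comb (λ _ → 0ℚ) e j)
  (trans (sumF-zero (λ i → ℚP.*-zeroˡ (e i ‼ j))) (sym (‼-zero j)))

span-there : {e : Fin k → QPt n} {x : QPt n} (v : QPt n) → InSpan e x → InSpan (v ∷ᶠ e) x
span-there {e = e} v (c , refl) = 0ℚ ∷ᶠ c ,
  trans (comb-∷ 0ℚ c v e) (trans (cong (λ z → addQ z (comb c e)) (scale-0 v)) (add-zeroˡ _))

span-here : {e : Fin k → QPt n} (v : QPt n) → InSpan (v ∷ᶠ e) v
span-here {e = e} v = 1ℚ ∷ᶠ (λ _ → 0ℚ) ,
  trans (comb-∷ 1ℚ (λ _ → 0ℚ) v e) (trans (cong₂ addQ (scale-1 v) (comb-0 e)) (add-zeroʳ v))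

sub-zero : {x y : QPt n} → subQ x y ≡ zeroQ → x ≡ y
sub-zero {x = x} {y} h = vext λ j → diff-0 (trans (sym (‼-sub x y j)) (trans (cong (_‼ j) h) (‼-zero j)))

nonzero-coord : (x : QPt n) → x ≡ zeroQ ⊎ ∃ λ j → x ‼ j ≢ 0ℚ
nonzero-coord x with FinP.all? (λ j → x ‼ j ℚP.≟ 0ℚ)
... | yes h = inj₁ (vext λ j → trans (h j) (sym (‼-zero j)))
... | no ¬h = inj₂ (FinP.¬∀⟶∃¬ _ _ (λ j → x ‼ j ℚP.≟ 0ℚ) ¬h)

-- One step of Gram–Schmidt with a biorthogonal system in place of an inner product.
opaque
  extend-dual : {f e : Fin k → QPt n} → Dualᶠ f e → (v : QPt n) →
    InSpan e v ⊎ ∃ λ f' → Dualᶠ f' (v ∷ᶠ e)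
  extend-dual {k} {n} {f} {e} d v with nonzero-coord (subQ v (comb (λ i → dot (f i) v) e))
  ... | inj₁ r≡0 = inj₁ ((λ i → dot (f i) v) , sym (sub-zero r≡0))
  ... | inj₂ (j , rj≢0) = inj₂ (g ∷ᶠ f' , dual)
    where
    open ≡-Reasoning
    p r : QPt n
    p = comb (λ i → dot (f i) v) e
    r = subQ v p
    q : ℚ
    q = proj₁ (inverse (r ‼ j) rj≢0)
    h : QPt n
    h = scaleQ q (unitQ j)
    hr : dot h r ≡ 1ℚ
    hr = trans (dot-scaleˡ q (unitQ j) r) (trans (cong (q *_) (dot-unit j r)) (proj₂ (inverse (r ‼ j) rj≢0)))
    g : QPt n
    g = subQ h (comb (λ i → dot h (e i)) f)
    f' : Fin k → QPt n
    f' i = subQ (f i) (scaleQ (dot (f i) v) g)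
    gx : ∀ x → dot g x ≡ dot h x - sumF (λ i → dot h (e i) * dot (f i) x)
    gx x = trans (dot-subˡ h (comb (λ i → dot h (e i)) f) x) (cong (λ s → dot h x - s) (dot-combˡ (λ i → dot h (e i)) f x))
    ge : ∀ l → dot g (e l) ≡ 0ℚ
    ge l = trans (gx (e l)) (trans (cong (λ s → dot h (e l) - s)
      (trans (sumF-cong (λ i → cong (dot h (e i) *_) (biorth d i l))) (sumF-δʳ l (λ i → dot h (e i)))))
      (ℚP.+-inverseʳ (dot h (e l))))
    gv : dot g v ≡ 1ℚ
    gv = begin
      dot g v                                                  ≡⟨ gx v ⟩
      dot h v - sumF (λ i → dot h (e i) * dot (f i) v)         ≡⟨ cong (λ s → dot h v - s) (sumF-cong (λ i → ℚP.*-comm (dot h (e i)) (dot (f i) v))) ⟩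
      dot h v - sumF (λ i → dot (f i) v * dot h (e i))         ≡⟨ cong (λ s → dot h v - s) (sym (dot-comb h (λ i → dot (f i) v) e)) ⟩
      dot h v - dot h p                                        ≡⟨ sym (dot-sub h v p) ⟩
      dot h r                                                  ≡⟨ hr ⟩
      1ℚ                                                       ∎
    f'x : ∀ i x → dot (f' i) x ≡ dot (f i) x - dot (f i) v * dot g x
    f'x i x = trans (dot-subˡ (f i) (scaleQ (dot (f i) v) g) x) (cong (λ s → dot (f i) x - s) (dot-scaleˡ (dot (f i) v) g x))
    lem₁ : ∀ a → a - a * 1ℚ ≡ 0ℚ
    lem₁ = solve-∀ ℚring
    lem₂ : ∀ a b → a - b * 0ℚ ≡ a
    lem₂ = solve-∀ ℚring
    dual : Dualᶠ (g ∷ᶠ f') (v ∷ᶠ e)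
    biorth dual zero    zero    = gv
    biorth dual zero    (suc l) = ge l
    biorth dual (suc i) zero    = trans (f'x i v) (trans (cong (λ s → dot (f i) v - dot (f i) v * s) gv) (lem₁ (dot (f i) v)))
    biorth dual (suc i) (suc l) = trans (f'x i (e l)) (trans (cong (λ s → dot (f i) (e l) - dot (f i) v * s) (ge l))
      (trans (lem₂ (dot (f i) (e l)) (dot (f i) v)) (trans (biorth d i l) (sym (δ-suc i l)))))

opaque
  -- Vectors are added one at a time. If `extend-dual` reports that the new one lies in the span of
  -- the others, the relation with coefficient -1 at it contradicts independence.
  indep-dual : (e : Fin k → QPt n) → Indep e → ∃ λ f → Dualᶠ f e
  indep-dual {zero} e h = (λ ()) , dualᶠ (λ ())
  indep-dual {suc k} e h with indep-dual (e ∘ suc) tail-indep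
    where
    tail-indep : Indep (e ∘ suc)
    tail-indep c eq i = h (0ℚ ∷ᶠ c) (trans (comb-cong (λ _ → refl) split)
      (trans (comb-∷ 0ℚ c (e zero) (e ∘ suc)) (trans (cong₂ addQ (scale-0 (e zero)) eq) (add-zeroˡ zeroQ)))) (suc i)
      where
      split : ∀ i → e i ≡ (e zero ∷ᶠ (e ∘ suc)) i
      split zero    = refl
      split (suc i) = refl
  ... | f , d with extend-dual d (e zero)
  ...   | inj₂ (f' , d') = f' , dualᶠ λ { i zero → biorth d' i zero ; i (suc j) → biorth d' i (suc j) }
  ...   | inj₁ (c , eq) = ⊥-elim (0≢1 (sym (trans (neg-cancel (h (- 1ℚ ∷ᶠ c) dependent zero)) refl)))
    where
    neg-cancel : - 1ℚ ≡ 0ℚ → 1ℚ ≡ 0ℚ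
    neg-cancel ()
    split : ∀ i → e i ≡ (e zero ∷ᶠ (e ∘ suc)) i
    split zero    = refl
    split (suc i) = refl
    cancel : ∀ a → (- 1ℚ) * a + a ≡ 0ℚ
    cancel = solve-∀ ℚring
    dependent : comb (- 1ℚ ∷ᶠ c) e ≡ zeroQ
    dependent = trans (comb-cong (λ _ → refl) split) (trans (comb-∷ (- 1ℚ) c (e zero) (e ∘ suc))
      (vext λ j → trans (‼-add (scaleQ (- 1ℚ) (e zero)) (comb c (e ∘ suc)) j)
        (trans (cong₂ _+_ (‼-scale (- 1ℚ) (e zero) j) (cong (_‼ j) eq))
          (trans (cancel (e zero ‼ j)) (sym (‼-zero j))))))

-- The size is a field because it is decided only along the way which `v j` enlarge the span.
record Extension {k n m : ℕ} (e : Fin k → QPt n) (v : Fin m → QPt n) : Set where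
  field
    size   : ℕ
    f' e'  : Fin size → QPt n
    dual   : Dualᶠ f' e'
    larger : k ℕ.≤ size
    old    : ∀ {x} → InSpan e x → InSpan e' x
    new    : ∀ j → InSpan e' (v j)

opaque
  extend : {f e : Fin k → QPt n} → Dualᶠ f e → (v : Fin m → QPt n) → Extension e v
  extend {m = zero} {f = f} {e} d v = record
    { f' = f ; e' = e ; dual = d ; larger = ℕP.≤-refl ; old = id ; new = λ () }
  extend {m = suc m} d v with extend d (v ∘ suc)
  ... | E with extend-dual (Extension.dual E) (v zero)
  ...   | inj₁ s = record { f' = f' ; e' = e' ; dual = dual ; larger = larger ; old = old
                          ; new = λ { zero → s ; (suc j) → new j } }
    where open Extension E
  ...   | inj₂ (g , d') = record
    { f' = g ; e' = v zero ∷ᶠ e' ; dual = d' ; larger = ℕP.≤-trans larger (ℕP.n≤1+n _)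
    ; old = λ s → span-there (v zero) (old s)
    ; new = λ { zero → span-here (v zero) ; (suc j) → span-there (v zero) (new j) } }
    where open Extension E

sumF-1 : sumF {k} (λ _ → 1ℚ) ≡ fromℤ (ℤ.+ k)
sumF-1 {zero}  = refl
sumF-1 {suc k} = trans (cong (1ℚ +_) (sumF-1 {k})) (sym (fromℤ-+ (ℤ.+ 1) (ℤ.+ k)))

-- The projection onto a span has trace its dimension.
spanning-dual-size : {f e : Fin k → QPt n} → Dualᶠ f e → (∀ j → InSpan e (unitQ j)) → k ≡ n
spanning-dual-size {k} {n} {f} {e} d s = ℤP.+-injective (fromℤ-injective (begin
  fromℤ (ℤ.+ k)                                     ≡⟨ sym (sumF-1 {k}) ⟩
  sumF {k} (λ _ → 1ℚ)                               ≡⟨ sumF-cong (λ i → sym (trans (biorth d i i) (δ-refl i))) ⟩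
  sumF (λ i → dot (f i) (e i))                      ≡⟨ sumF-cong (λ i → dot-sum (f i) (e i)) ⟩
  sumF (λ i → sumF (λ j → f i ‼ j * e i ‼ j))       ≡⟨ sumF-swap (λ i j → f i ‼ j * e i ‼ j) ⟩
  sumF (λ j → sumF (λ i → f i ‼ j * e i ‼ j))       ≡⟨ sumF-cong diag ⟩
  sumF {n} (λ _ → 1ℚ)                               ≡⟨ sumF-1 {n} ⟩
  fromℤ (ℤ.+ n)                                     ∎))
  where
  open ≡-Reasoning
  diag : ∀ j → sumF (λ i → f i ‼ j * e i ‼ j) ≡ 1ℚ
  diag j = begin
    sumF (λ i → f i ‼ j * e i ‼ j)                   ≡⟨ sumF-cong (λ i → cong (_* e i ‼ j) (sym (dot-unitʳ (f i) j))) ⟩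
    sumF (λ i → dot (f i) (unitQ j) * e i ‼ j)       ≡⟨ sym (‼-comb (λ i → dot (f i) (unitQ j)) e j) ⟩
    comb (λ i → dot (f i) (unitQ j)) e ‼ j           ≡⟨ cong (_‼ j) (span-fixed d (s j)) ⟩
    unitQ j ‼ j                                      ≡⟨ trans (‼-tab (δ j) j) (δ-refl j) ⟩
    1ℚ                                               ∎

-- Extending by all unit vectors gives a spanning system, whose size is n by the trace.
dual-≤ : {f e : Fin k → QPt n} → Dualᶠ f e → k ℕ.≤ n
dual-≤ {n = n} d = subst (_ ℕ.≤_) (spanning-dual-size dual new) larger
  where open Extension (extend d (unitQ {n}))

indep-≤ : {e : Fin k → QPt n} → Indep e → k ℕ.≤ n
indep-≤ {e = e} h = dual-≤ (proj₂ (indep-dual e h))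

-- A vector outside the span would extend the system to n + 1 members, against `dual-≤`.
dual-complete : {f e : Fin n → QPt n} → Dualᶠ f e → Complete f e
dual-complete d x with extend-dual d x
... | inj₁ s        = span-fixed d s
... | inj₂ (_ , d') = ⊥-elim (ℕP.<-irrefl refl (dual-≤ d'))

opaque
  -- The coefficients of the unit vectors form a one-sided inverse of the square matrix of `e`.
  -- `dual-complete`, applied to the transposed matrices, makes it two-sided.
  spanning-dual : {e : Fin n → QPt n} → (∀ j → InSpan e (unitQ j)) → ∃ λ f → Dualᶠ f e
  spanning-dual {n} {e} s = f , dualᶠ λ i j → begin
    dot (f i) (e j)                                                 ≡⟨ dot-sum (f i) (e j) ⟩
    sumF (λ a → f i ‼ a * e j ‼ a)                                  ≡⟨ sumF-cong (λ a → cong₂ _*_ (trans (‼-tab (λ a → c a i) a) (sym (trans (dot-unitʳ (ft a) i) (‼-tab (c a) i)))) (sym (‼-tab (λ i → e i ‼ a) j))) ⟩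
    sumF (λ a → dot (ft a) (unitQ i) * et a ‼ j)                    ≡⟨ sym (‼-comb (λ a → dot (ft a) (unitQ i)) et j) ⟩
    comb (λ a → dot (ft a) (unitQ i)) et ‼ j                        ≡⟨ cong (_‼ j) (dual-complete transposed (unitQ i)) ⟩
    unitQ i ‼ j                                                     ≡⟨ ‼-tab (δ i) j ⟩
    δ i j                                                           ∎
    where
    open ≡-Reasoning
    c : Fin n → Fin n → ℚ
    c a = proj₁ (s a)
    f ft et : Fin n → QPt n
    f i  = Vec.tabulate (λ a → c a i)
    ft a = Vec.tabulate (c a)
    et b = Vec.tabulate (λ i → e i ‼ b)
    transposed : Dualᶠ ft et
    biorth transposed a b = begin
      dot (ft a) (et b)                  ≡⟨ dot-sum (ft a) (et b) ⟩
      sumF (λ i → ft a ‼ i * et b ‼ i)   ≡⟨ sumF-cong (λ i → cong₂ _*_ (‼-tab (c a) i) (‼-tab (λ i → e i ‼ b) i)) ⟩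
      sumF (λ i → c a i * e i ‼ b)       ≡⟨ sym (‼-comb (c a) e b) ⟩
      comb (c a) e ‼ b                   ≡⟨ cong (_‼ b) (proj₂ (s a)) ⟩
      unitQ a ‼ b                        ≡⟨ ‼-tab (δ a) b ⟩
      δ a b                              ∎

dot-ext-dual : {f e : Fin n → QPt n} → Dualᶠ f e → {x y : QPt n} → (∀ i → dot (f i) x ≡ dot (f i) y) → x ≡ y
dot-ext-dual d {x} {y} h = trans (sym (dual-complete d x)) (trans (comb-cong h (λ _ → refl)) (dual-complete d y))

-- Convex hulls and extreme points

record Conv {k n : ℕ} (w : Fin k → QPt n) (x : QPt n) : Set where
  constructor conv
  field
    coeff  : Fin k → ℚ
    nonneg : ∀ i → 0ℚ ≤ coeff i
    total  : sumF coeff ≡ 1ℚ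
    point  : comb coeff w ≡ x

toConv : (W : List (QPt n)) {x : QPt n} → InConv W x → Conv (List.lookup W) x
toConv W (c , h , s , e) = conv c h s (trans (sym (lincomb-comb W c)) e)

fromConv : (W : List (QPt n)) {x : QPt n} → Conv (List.lookup W) x → InConv W x
fromConv W (conv c h s e) = c , h , s , trans (lincomb-comb W c) e

0≤δ : (i j : Fin k) → 0ℚ ≤ δ i j
0≤δ i j with i Fin.≟ j
... | yes _ = 0≤1
... | no _  = ℚP.≤-refl

sumF-δ1 : (i : Fin k) → sumF (δ i) ≡ 1ℚ
sumF-δ1 i = trans (sumF-cong (λ j → sym (ℚP.*-identityʳ (δ i j)))) (sumF-δ i (λ _ → 1ℚ))

comb-δ : (i : Fin k) (w : Fin k → QPt n) → comb (δ i) w ≡ w i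
comb-δ i w = vext λ j → trans (‼-comb (δ i) w j) (sumF-δ i (λ l → w l ‼ j))

conv-gen : (w : Fin k → QPt n) (i : Fin k) → Conv w (w i)
conv-gen w i = conv (δ i) (0≤δ i) (sumF-δ1 i) (comb-δ i w)

comb-comb : (c : Fin k → ℚ) (a : Fin k → Fin l → ℚ) (w : Fin l → QPt n) →
  comb c (λ i → comb (a i) w) ≡ comb (λ j → sumF (λ i → c i * a i j)) w
comb-comb c a w = vext λ t → begin
  comb c (λ i → comb (a i) w) ‼ t                            ≡⟨ ‼-comb c _ t ⟩
  sumF (λ i → c i * comb (a i) w ‼ t)                        ≡⟨ sumF-cong (λ i → cong (c i *_) (‼-comb (a i) w t)) ⟩
  sumF (λ i → c i * sumF (λ j → a i j * w j ‼ t))            ≡⟨ sumF-cong (λ i → sym (sumF-* (c i) (λ j → a i j * w j ‼ t))) ⟩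
  sumF (λ i → sumF (λ j → c i * (a i j * w j ‼ t)))          ≡⟨ sumF-swap (λ i j → c i * (a i j * w j ‼ t)) ⟩
  sumF (λ j → sumF (λ i → c i * (a i j * w j ‼ t)))          ≡⟨ sumF-cong (λ j → trans (sumF-cong (λ i → sym (ℚP.*-assoc (c i) (a i j) (w j ‼ t)))) (sumF-*ʳ (w j ‼ t) (λ i → c i * a i j))) ⟩
  sumF (λ j → sumF (λ i → c i * a i j) * w j ‼ t)            ≡⟨ sym (‼-comb _ w t) ⟩
  comb (λ j → sumF (λ i → c i * a i j)) w ‼ t                ∎
  where open ≡-Reasoning

conv-trans : {w : Fin l → QPt n} {e : Fin k → QPt n} → (∀ i → Conv w (e i)) → ∀ {x} → Conv e x → Conv w x
conv-trans {w = w} {e} h (conv c c≥0 c1 refl) = conv (λ j → sumF (λ i → c i * a i j))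
  (λ j → sumF-nonneg _ (λ i → *-nonneg (c≥0 i) (Conv.nonneg (h i) j)))
  (begin
    sumF (λ j → sumF (λ i → c i * a i j))    ≡⟨ sumF-swap (λ j i → c i * a i j) ⟩
    sumF (λ i → sumF (λ j → c i * a i j))    ≡⟨ sumF-cong (λ i → trans (sumF-* (c i) (a i)) (trans (cong (c i *_) (Conv.total (h i))) (ℚP.*-identityʳ (c i)))) ⟩
    sumF c                                   ≡⟨ c1 ⟩
    1ℚ                                       ∎)
  (trans (sym (comb-comb c a w)) (comb-cong (λ _ → refl) (λ i → Conv.point (h i))))
  where
  open ≡-Reasoning
  a : _
  a i = Conv.coeff (h i)

conv-dot : {w : Fin k → QPt n} {x : QPt n} (f : QPt n) (h : Conv w x) →
  dot f x ≡ sumF (λ i → Conv.coeff h i * dot f (w i))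
conv-dot {w = w} f (conv c _ _ refl) = dot-comb f c w

weighted-const : (c : Fin k → ℚ) → sumF c ≡ 1ℚ → ∀ b → sumF (λ i → c i * b) ≡ b
weighted-const c h b = trans (sumF-*ʳ b c) (trans (cong (_* b) h) (ℚP.*-identityˡ b))

*-monoˡ-≤ : ∀ {r p q} → 0ℚ ≤ r → p ≤ q → r * p ≤ r * q
*-monoˡ-≤ {r} hr = ℚP.*-monoˡ-≤-nonNeg r {{ℚ.nonNegative hr}}

conv-≤ : {w : Fin k → QPt n} {x : QPt n} (f : QPt n) (b : ℚ) → (∀ i → dot f (w i) ≤ b) → Conv w x → dot f x ≤ b
conv-≤ f b h h' = subst₂ _≤_ (sym (conv-dot f h')) (weighted-const (Conv.coeff h') (Conv.total h') b)
  (sumF-≤ (λ i → *-monoˡ-≤ (Conv.nonneg h' i) (h i)))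

conv-≥ : {w : Fin k → QPt n} {x : QPt n} (f : QPt n) (b : ℚ) → (∀ i → b ≤ dot f (w i)) → Conv w x → b ≤ dot f x
conv-≥ f b h h' = subst₂ _≤_ (weighted-const (Conv.coeff h') (Conv.total h') b) (sym (conv-dot f h'))
  (sumF-≤ (λ i → *-monoˡ-≤ (Conv.nonneg h' i) (h i)))

conv-neg-gen : {w : Fin k → QPt n} {x : QPt n} (f : QPt n) → Conv w x → dot f x < 0ℚ → ∃ λ i → dot f (w i) < 0ℚ
conv-neg-gen {w = w} f h lt with sumF-neg-term _ (subst (_< 0ℚ) (conv-dot f h) lt)
... | i , p with dot f (w i) ℚP.<? 0ℚ
...   | yes q = i , q
...   | no ¬q = ⊥-elim (ℚP.<-irrefl refl (ℚP.<-≤-trans p (*-nonneg (Conv.nonneg h i) (ℚP.≮⇒≥ ¬q))))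

-- The terms c_i (b - f(w_i)) are nonnegative and add up to 0, so every generator with a value less
-- than b has weight 0 and only copies of `p` remain.
conv-exposed : {w : Fin k → QPt n} {x : QPt n} (f : QPt n) (b : ℚ) (p : QPt n) → dot f p ≡ b →
  (∀ i → dot f (w i) < b ⊎ w i ≡ p) → Conv w x → dot f x ≡ b → x ≡ p
conv-exposed {w = w} {x} f b p fp h (conv c c≥0 c1 refl) fx = vext λ t → begin
  comb c w ‼ t                    ≡⟨ ‼-comb c w t ⟩
  sumF (λ i → c i * w i ‼ t)      ≡⟨ sumF-cong (λ i → same i t) ⟩
  sumF (λ i → c i * p ‼ t)        ≡⟨ weighted-const c c1 (p ‼ t) ⟩
  p ‼ t                           ∎
  where
  open ≡-Reasoning
  distrib : ∀ c b d → c * (b - d) ≡ c * b - c * d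
  distrib = solve-∀ ℚring
  bound : ∀ i → dot f (w i) ≤ b
  bound i with h i
  ... | inj₁ lt = ℚP.<⇒≤ lt
  ... | inj₂ e  = ℚP.≤-reflexive (trans (cong (dot f) e) fp)
  slack-sum : sumF (λ i → c i * (b - dot f (w i))) ≡ 0ℚ
  slack-sum = begin
    sumF (λ i → c i * (b - dot f (w i)))                          ≡⟨ sumF-cong (λ i → distrib (c i) b (dot f (w i))) ⟩
    sumF (λ i → c i * b - c i * dot f (w i))                      ≡⟨ sumF-sub (λ i → c i * b) (λ i → c i * dot f (w i)) ⟩
    sumF (λ i → c i * b) - sumF (λ i → c i * dot f (w i))         ≡⟨ cong₂ _-_ (weighted-const c c1 b) (trans (sym (dot-comb f c w)) fx) ⟩
    b - b                                                         ≡⟨ ℚP.+-inverseʳ b ⟩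
    0ℚ                                                            ∎
  slack-0 : ∀ i → c i * (b - dot f (w i)) ≡ 0ℚ
  slack-0 = sumF-nonneg-0 _ (λ i → *-nonneg (c≥0 i) (0≤-diff (bound i))) slack-sum
  same : ∀ i t → c i * w i ‼ t ≡ c i * p ‼ t
  same i t with h i
  ... | inj₂ e  = cong (λ z → c i * z ‼ t) e
  ... | inj₁ lt = trans (vanish (w i ‼ t)) (sym (vanish (p ‼ t)))
    where
    vanish : ∀ z → c i * z ≡ 0ℚ
    vanish z = trans (cong (_* z) (*-cancel-0 (c i) _ (slack-0 i)
      (λ e → ℚP.<-irrefl (sym e) (0<-diff lt)))) (ℚP.*-zeroˡ z)

Convex : QSet n → Set
Convex {n} P = ∀ {k} (w : Fin k → QPt n) {x} → (∀ i → P (w i)) → Conv w x → P x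

mid-+ : ∀ a b x → x ≡ ½ * (a + b) → x + x ≡ a + b
mid-+ a b x refl = lem a b
  where
  lem : ∀ a b → ½ * (a + b) + ½ * (a + b) ≡ a + b
  lem = solve-∀ ℚring

mid-max : ∀ {a b} c → a ≤ c → b ≤ c → c ≡ ½ * (a + b) → a ≡ c
mid-max {a} {b} c a≤c b≤c h = ℚP.≤-antisym a≤c (≤-by (c - b) (0≤-diff b≤c)
  (trans (lem₁ a b c) (trans (cong (λ s → (s - c) - b) (sym (mid-+ a b c h))) (lem₂ c b))))
  where
  lem₁ : ∀ a b c → a - c ≡ ((a + b) - c) - b
  lem₁ = solve-∀ ℚring
  lem₂ : ∀ c b → ((c + c) - c) - b ≡ c - b
  lem₂ = solve-∀ ℚring

mid-min : ∀ {a b} c → c ≤ a → c ≤ b → c ≡ ½ * (a + b) → a ≡ c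
mid-min {a} {b} c c≤a c≤b h = trans (sym (neg-neg a)) (trans (cong -_ (mid-max (- c) (ℚP.neg-antimono-≤ c≤a) (ℚP.neg-antimono-≤ c≤b)
  (trans (cong -_ h) (lem a b)))) (neg-neg c))
  where
  lem : ∀ a b → - (½ * (a + b)) ≡ ½ * (- a + - b)
  lem = solve-∀ ℚring

exposed-extreme : {P : QSet n} (f : QPt n) (b : ℚ) {p : QPt n} → P p → dot f p ≡ b →
  (∀ x → P x → dot f x ≤ b) → (∀ x → P x → dot f x ≡ b → x ≡ p) → Extreme P p
exposed-extreme f b {p} Pp fp sup uniq = Pp , λ x y Px Py e →
  uniq x Px (mid-max b (sup x Px) (sup y Py) (trans (sym fp) (trans (cong (dot f) e) (dot-mid f x y))))

term-≤-sum : (f : Fin k → ℚ) → (∀ i → 0ℚ ≤ f i) → ∀ i → f i ≤ sumF f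
term-≤-sum f h zero    = ≤-by (sumF (f ∘ suc)) (sumF-nonneg _ (h ∘ suc)) (lem (f zero) (sumF (f ∘ suc)))
  where
  lem : ∀ a b → (a + b) - a ≡ b
  lem = solve-∀ ℚring
term-≤-sum f h (suc i) = ℚP.≤-trans (term-≤-sum (f ∘ suc) (h ∘ suc) i)
  (≤-by (f zero) (h zero) (lem (f zero) (sumF (f ∘ suc))))
  where
  lem : ∀ a b → (a + b) - b ≡ a
  lem = solve-∀ ℚring

comb-perturb : (c : Fin k → ℚ) (s t : ℚ) (i : Fin k) (w : Fin k → QPt n) (l : Fin n) →
  comb (λ j → c j * s + t * δ i j) w ‼ l ≡ s * comb c w ‼ l + t * w i ‼ l
comb-perturb c s t i w l = begin
  comb (λ j → c j * s + t * δ i j) w ‼ l                                    ≡⟨ ‼-comb _ w l ⟩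
  sumF (λ j → (c j * s + t * δ i j) * w j ‼ l)                              ≡⟨ sumF-cong (λ j → lem (c j) s t (δ i j) (w j ‼ l)) ⟩
  sumF (λ j → s * (c j * w j ‼ l) + t * (δ i j * w j ‼ l))                  ≡⟨ sumF-+ (λ j → s * (c j * w j ‼ l)) (λ j → t * (δ i j * w j ‼ l)) ⟩
  sumF (λ j → s * (c j * w j ‼ l)) + sumF (λ j → t * (δ i j * w j ‼ l))     ≡⟨ cong₂ _+_ (trans (sumF-* s (λ j → c j * w j ‼ l)) (cong (s *_) (sym (‼-comb c w l))))
                                                                                (trans (sumF-* t (λ j → δ i j * w j ‼ l)) (cong (t *_) (sumF-δ i (λ j → w j ‼ l)))) ⟩
  s * comb c w ‼ l + t * w i ‼ l                                            ∎
  where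
  open ≡-Reasoning
  lem : ∀ c s t d x → (c * s + t * d) * x ≡ s * (c * x) + t * (d * x)
  lem = solve-∀ ℚring

sum-perturb : (c : Fin k → ℚ) (s t : ℚ) (i : Fin k) → sumF c ≡ 1ℚ → s + t ≡ 1ℚ → sumF (λ j → c j * s + t * δ i j) ≡ 1ℚ
sum-perturb c s t i h st = trans (sumF-+ (λ j → c j * s) (λ j → t * δ i j)) (trans (cong₂ _+_ (weighted-const c h s)
  (trans (sumF-* t (δ i)) (trans (cong (t *_) (sumF-δ1 i)) (ℚP.*-identityʳ t)))) st)

-- Some weight c_i is nonzero. The points x ± c_i (w_i - x) both lie in P and have midpoint x, so
-- they coincide with x and w_i = x. Moving by the factor c_i keeps all weights nonnegative and
-- avoids a division by 1 - c_i.
extreme-gen : {P : QSet n} {w : Fin k → QPt n} {x : QPt n} → Convex P → (∀ i → P (w i)) →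
  Extreme P x → Conv w x → ∃ λ i → w i ≡ x
extreme-gen {n} {k} {P} {w} convex Pw (_ , ext) (conv c c≥0 c1 refl) = pick (FinP.any? (λ i → ¬? (c i ℚP.≟ 0ℚ)))
  where
  x = comb c w
  pick : Dec (∃ λ i → c i ≢ 0ℚ) → ∃ λ i → w i ≡ x
  pick (no ¬p) = ⊥-elim (0≢1 (trans (sym (sumF-zero (λ i → zero-at i (c i ℚP.≟ 0ℚ)))) c1))
    where
    zero-at : ∀ i → Dec (c i ≡ 0ℚ) → c i ≡ 0ℚ
    zero-at i (yes e) = e
    zero-at i (no h)  = ⊥-elim (¬p (i , h))
  pick (yes (i , ci≢0)) = i , vext λ l → diff-0 (*-cancel-0 (w i ‼ l - x ‼ l) (c i)
      (trans (lem (w i ‼ l) (x ‼ l) (c i)) (trans (cong (_- x ‼ l) (trans (sym (comb-perturb c (1ℚ - c i) (c i) i w l)) (cong (_‼ l) a≡x)))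
        (ℚP.+-inverseʳ (x ‼ l)))) ci≢0)
    where
    ci≤1 : c i ≤ 1ℚ
    ci≤1 = subst (c i ≤_) c1 (term-≤-sum c c≥0 i)
    lem : ∀ w x c → (w - x) * c ≡ ((1ℚ - c) * x + c * w) - x
    lem = solve-∀ ℚring
    st₁ : ∀ c → (1ℚ - c) + c ≡ 1ℚ
    st₁ = solve-∀ ℚring
    st₂ : ∀ c → (1ℚ + c) + (- c) ≡ 1ℚ
    st₂ = solve-∀ ℚring
    ca cb : Fin k → ℚ
    ca j = c j * (1ℚ - c i) + c i * δ i j
    cb j = c j * (1ℚ + c i) + (- c i) * δ i j
    -- At `i` the weight is c_i (1 + c_i) - c_i, the square of c_i; elsewhere nothing is subtracted.
    cb≥0 : ∀ j → 0ℚ ≤ cb j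
    cb≥0 j with i Fin.≟ j
    ... | yes refl = subst (0ℚ ≤_) (sq (c i)) (*-nonneg (c≥0 i) (c≥0 i))
      where
      sq : ∀ c → c * c ≡ c * (1ℚ + c) + (- c) * 1ℚ
      sq = solve-∀ ℚring
    ... | no _     = subst (0ℚ ≤_) (off (c j) (c i)) (*-nonneg (c≥0 j) (+-nonneg 0≤1 (c≥0 i)))
      where
      off : ∀ a c → a * (1ℚ + c) ≡ a * (1ℚ + c) + (- c) * 0ℚ
      off = solve-∀ ℚring
    a b : QPt n
    a = comb ca w
    b = comb cb w
    Pa : P a
    Pa = convex w Pw (conv ca (λ j → +-nonneg (*-nonneg (c≥0 j) (0≤-diff ci≤1)) (*-nonneg (c≥0 i) (0≤δ i j)))
      (sum-perturb c (1ℚ - c i) (c i) i c1 (st₁ (c i))) refl)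
    Pb : P b
    Pb = convex w Pw (conv cb cb≥0 (sum-perturb c (1ℚ + c i) (- c i) i c1 (st₂ (c i))) refl)
    mid : ∀ x w c → x ≡ ½ * (((1ℚ - c) * x + c * w) + ((1ℚ + c) * x + (- c) * w))
    mid = solve-∀ ℚring
    a≡x : a ≡ x
    a≡x = ext a b Pa Pb (vext λ l → trans (mid (x ‼ l) (w i ‼ l) (c i))
      (sym (trans (‼-scale ½ (addQ a b) l) (cong (½ *_) (trans (‼-add a b l)
        (cong₂ _+_ (comb-perturb c (1ℚ - c i) (c i) i w l) (comb-perturb c (1ℚ + c i) (- c i) i w l)))))))

lookup-in : {A : Set} {x : A} {xs : List A} → x ∈ xs → ∃ λ i → List.lookup xs i ≡ x
lookup-in p = Any.index p , sym (AnyP.lookup-index p)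

inconv-∈ : {W : List (QPt n)} {x : QPt n} → x ∈ W → InConv W x
inconv-∈ {W = W} p with lookup-in p
... | i , refl = fromConv W (conv-gen (List.lookup W) i)

inconv-convex : (W : List (QPt n)) → Convex (InConv W)
inconv-convex W e h c = fromConv W (conv-trans (λ i → toConv W (h i)) c)

inconv-sub : (W : List (QPt n)) {P : QSet n} → Convex P → (∀ {x} → x ∈ W → P x) → ∀ {x} → InConv W x → P x
inconv-sub W convex h c = convex (List.lookup W) (λ i → h (∈-lookup i)) (toConv W c)

inconv-extreme : (W : List (QPt n)) {x : QPt n} → Extreme (InConv W) x → x ∈ W
inconv-extreme W e with extreme-gen {w = List.lookup W} (inconv-convex W) (λ i → inconv-∈ (∈-lookup {xs = W} i)) e (toConv W (proj₁ e))
... | i , refl = ∈-lookup i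

⟦⟧-∈ : {V : List (Pt n)} {v : Pt n} → v ∈ V → ⟦ V ⟧ (toℚ v)
⟦⟧-∈ p = inconv-∈ (∈-map⁺ toℚ p)

⟦⟧-convex : (V : List (Pt n)) → Convex ⟦ V ⟧
⟦⟧-convex V = inconv-convex (List.map toℚ V)

⟦⟧-sub : (V : List (Pt n)) {P : QSet n} → Convex P → (∀ {v} → v ∈ V → P (toℚ v)) → ∀ {x} → ⟦ V ⟧ x → P x
⟦⟧-sub V {P} convex h = inconv-sub (List.map toℚ V) {P} convex λ {x} p → case ∈-map⁻ toℚ p of λ { (v , v∈ , refl) → h v∈ }

⟦⟧-extreme : (V : List (Pt n)) {x : QPt n} → Extreme ⟦ V ⟧ x → ∃ λ v → v ∈ V × x ≡ toℚ v
⟦⟧-extreme V e = ∈-map⁻ toℚ (inconv-extreme (List.map toℚ V) e)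

⟦⟧-≤ : (V : List (Pt n)) (f : QPt n) (b : ℚ) → (∀ {v} → v ∈ V → dot f (toℚ v) ≤ b) → ∀ {x} → ⟦ V ⟧ x → dot f x ≤ b
⟦⟧-≤ V f b h = ⟦⟧-sub V {P = λ x → dot f x ≤ b} (λ w → conv-≤ f b) h

-- Facets and their neighbours

agree-on-basis : {f w : Fin n → QPt n} → Dualᶠ f w → {a b : QPt n} → (∀ i → dot a (w i) ≡ dot b (w i)) → a ≡ b
agree-on-basis {n} {f} {w} d {a} {b} h = vext λ j → trans (sym (dot-unitʳ a j)) (trans (go j) (dot-unitʳ b j))
  where
  expand : ∀ u j → dot u (unitQ j) ≡ sumF (λ i → dot (f i) (unitQ j) * dot u (w i))
  expand u j = trans (cong (dot u) (sym (dual-complete d (unitQ j)))) (dot-comb u (λ i → dot (f i) (unitQ j)) w)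
  go : ∀ j → dot a (unitQ j) ≡ dot b (unitQ j)
  go j = trans (expand a j) (trans (sumF-cong (λ i → cong (dot (f i) (unitQ j) *_) (h i))) (sym (expand b j)))

dual-injective : {f w : Fin k → QPt n} → Dualᶠ f w → ∀ {i j} → w i ≡ w j → i ≡ j
dual-injective {f = f} {w} d {i} {j} eq with i Fin.≟ j
... | yes e = e
... | no h  = ⊥-elim (0≢1 (trans (sym (δ-≢ h)) (trans (sym (biorth d i j)) (trans (cong (dot (f i)) (sym eq))
  (trans (biorth d i i) (δ-refl i))))))

lookup-tab : {A : Set} (w : Fin k → A) (i : Fin (List.length (List.tabulate w))) →
  List.lookup (List.tabulate w) i ≡ w (Fin.cast (ListP.length-tabulate w) i)
lookup-tab {suc k} w zero    = refl
lookup-tab {suc k} w (suc i) = lookup-tab (w ∘ suc) i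

indep-cong : {w w' : Fin k → QPt n} → (∀ i → w' i ≡ w i) → Indep w → Indep w'
indep-cong h ind c e = ind c (trans (comb-cong (λ _ → refl) (sym ∘ h)) e)

indep-reindex : (e : l ≡ k) (w : Fin k → QPt n) → Indep w → Indep (λ i → w (Fin.cast e i))
indep-reindex refl w = indep-cong (λ i → cong w (FinP.cast-is-id refl i))

indep-tabulate : (w : Fin k → QPt n) → Indep w → Indep (List.lookup (List.tabulate w))
indep-tabulate w h = indep-cong (lookup-tab w) (indep-reindex (ListP.length-tabulate w) w h)

indep⇒aff : (W : List (QPt n)) → Indep (List.lookup W) → AffIndep W
indep⇒aff W h c _ e = h c (trans (sym (lincomb-comb W c)) e)

aff⇒indep : (W : List (QPt n)) → AffIndep W → (f : QPt n) → (∀ i → dot f (List.lookup W i) ≡ 1ℚ) → Indep (List.lookup W)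
aff⇒indep W aff f h c e = aff c total (trans (lincomb-comb W c) e)
  where
  total : sumF c ≡ 0ℚ
  total = trans (sumF-cong (λ i → trans (sym (ℚP.*-identityʳ (c i))) (cong (c i *_) (sym (h i)))))
    (trans (sym (dot-comb f c (List.lookup W))) (trans (cong (dot f) e) (dot-zero f)))

replace : {A : Set} → Fin k → A → (Fin k → A) → Fin k → A
replace i v w j = if does (j Fin.≟ i) then v else w j

replace-at : {A : Set} (i : Fin k) (v : A) (w : Fin k → A) → replace i v w i ≡ v
replace-at i v w with i Fin.≟ i
... | yes _ = refl
... | no h  = ⊥-elim (h refl)

replace-≢ : {A : Set} {i j : Fin k} (v : A) (w : Fin k → A) → j ≢ i → replace i v w j ≡ w j
replace-≢ {i = i} {j} v w h with j Fin.≟ i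
... | yes e = ⊥-elim (h e)
... | no _  = refl

replace-all : {A : Set} {R : A → Set} (i : Fin k) {v : A} {w : Fin k → A} → R v → (∀ j → j ≢ i → R (w j)) → ∀ j → R (replace i v w j)
replace-all i Rv Rw j with j Fin.≟ i
... | yes _ = Rv
... | no h  = Rw j h

-- The dual family after the exchange of the i-th vector for `v`, where `q` stands for the inverse
-- of f_i(v): one pivot of Gauss-Jordan elimination.
replaceDual : (i : Fin k) (q : ℚ) (v : QPt n) (f : Fin k → QPt n) → Fin k → QPt n
replaceDual i q v f j = if does (j Fin.≟ i) then scaleQ q (f i) else subQ (f j) (scaleQ (dot (f j) v * q) (f i))

replaceDual-≢ : {i j : Fin k} (q : ℚ) (v : QPt n) (f : Fin k → QPt n) → j ≢ i →
  ∀ x → dot (replaceDual i q v f j) x ≡ dot (f j) x - (dot (f j) v * q) * dot (f i) x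
replaceDual-≢ {i = i} {j} q v f h x with j Fin.≟ i
... | yes e = ⊥-elim (h e)
... | no _  = trans (dot-subˡ (f j) (scaleQ (dot (f j) v * q) (f i)) x)
  (cong (λ s → dot (f j) x - s) (dot-scaleˡ (dot (f j) v * q) (f i) x))

replace-dual : {f w : Fin k → QPt n} → Dualᶠ f w → (i : Fin k) (v : QPt n) (q : ℚ) → q * dot (f i) v ≡ 1ℚ →
  Dualᶠ (replaceDual i q v f) (replace i v w)
biorth (replace-dual {k} {n} {f} {w} d i v q hq) a b with a Fin.≟ i | b Fin.≟ i
... | yes refl | yes refl = trans (dot-scaleˡ q (f a) v) (trans hq (sym (δ-refl a)))
... | yes refl | no b≢i   = trans (dot-scaleˡ q (f a) (w b)) (trans (cong (q *_) (trans (biorth d a b) (δ-≢ (b≢i ∘ sym))))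
  (trans (ℚP.*-zeroʳ q) (sym (δ-≢ (b≢i ∘ sym)))))
... | no a≢i   | yes refl = trans (dot-subˡ (f a) (scaleQ (dot (f a) v * q) (f i)) v)
  (trans (cong (λ s → dot (f a) v - s) (trans (dot-scaleˡ (dot (f a) v * q) (f i) v) (trans (ℚP.*-assoc (dot (f a) v) q (dot (f i) v)) (cong (dot (f a) v *_) hq))))
    (trans (lem (dot (f a) v)) (sym (δ-≢ a≢i))))
  where
  lem : ∀ x → x - x * 1ℚ ≡ 0ℚ
  lem = solve-∀ ℚring
... | no a≢i   | no b≢i   = trans (dot-subˡ (f a) (scaleQ (dot (f a) v * q) (f i)) (w b))
  (trans (cong₂ _-_ (biorth d a b) (trans (dot-scaleˡ (dot (f a) v * q) (f i) (w b)) (cong (dot (f a) v * q *_) (trans (biorth d i b) (δ-≢ (b≢i ∘ sym))))))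
    (lem (δ a b) (dot (f a) v * q)))
  where
  lem : ∀ x y → x - y * 0ℚ ≡ x
  lem = solve-∀ ℚring

-- The ratio test of the simplex method: `t` is the least quotient A/C over the members with C > 0.
-- The inequality is multiplied out so that it can also be stated at members with C ≤ 0, where it
-- follows from A ≥ 0.
record MinRatio {X : Set} (L : List X) (A C : X → ℚ) : Set where
  field
    t       : ℚ
    t≥0     : 0ℚ ≤ t
    below   : ∀ {x} → x ∈ L → t * C x ≤ A x
    x       : X
    x∈L     : x ∈ L
    pos     : 0ℚ < C x
    attains : t * C x ≡ A x

opaque
  minRatio : {X : Set} (L : List X) (A C : X → ℚ) → (∀ {x} → x ∈ L → 0ℚ ≤ A x) →
    (∀ {x} → x ∈ L → ¬ (0ℚ < C x)) ⊎ MinRatio L A C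
  minRatio [] A C hA = inj₁ λ ()
  minRatio (y ∷ L) A C hA with minRatio L A C (hA ∘ there) | 0ℚ ℚP.<? C y
  ... | inj₁ none | no ¬p = inj₁ λ { (here refl) → ¬p ; (there q) → none q }
  ... | inj₂ M | no ¬p = inj₂ record
    { t = t ; t≥0 = t≥0 ; x∈L = there x∈L ; pos = pos ; attains = attains
    ; below = λ { (here refl) → ℚP.≤-trans (subst (t * C y ≤_) (ℚP.*-zeroʳ t) (*-monoˡ-≤ t≥0 (ℚP.≮⇒≥ ¬p))) (hA (here refl))
                ; (there q) → below q } }
    where open MinRatio M
  ... | r | yes p with inverse-pos (C y) p
  ...   | q , qC , q>0 = inj₂ (join r)
    where
    s : ℚ
    s = q * A y
    s≥0 : 0ℚ ≤ s
    s≥0 = *-nonneg (ℚP.<⇒≤ q>0) (hA (here refl))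
    sC : s * C y ≡ A y
    sC = trans (lem q (A y) (C y)) (trans (cong (_* A y) qC) (ℚP.*-identityˡ (A y)))
      where
      lem : ∀ q a c → q * a * c ≡ q * c * a
      lem = solve-∀ ℚring
    join : (∀ {x} → x ∈ L → ¬ (0ℚ < C x)) ⊎ MinRatio L A C → MinRatio (y ∷ L) A C
    join (inj₁ none) = record { t = s ; t≥0 = s≥0 ; x∈L = here refl ; pos = p ; attains = sC
      ; below = λ { (here refl) → ℚP.≤-reflexive sC
                  ; {x} (there z) → ℚP.≤-trans (subst (s * C x ≤_) (ℚP.*-zeroʳ s) (*-monoˡ-≤ s≥0 (ℚP.≮⇒≥ (none z)))) (hA (there z)) } }
    join (inj₂ M) with ℚP.≤-total s (MinRatio.t M)
    ... | inj₁ s≤t = record { t = s ; t≥0 = s≥0 ; x∈L = here refl ; pos = p ; attains = sC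
      ; below = λ { (here refl) → ℚP.≤-reflexive sC ; {x} (there z) → smaller x z } }
      where
      smaller : ∀ x → x ∈ L → s * C x ≤ A x
      smaller x z with 0ℚ ℚP.<? C x
      ... | yes c>0 = ℚP.≤-trans (ℚP.*-monoʳ-≤-nonNeg (C x) {{ℚ.nonNegative (ℚP.<⇒≤ c>0)}} s≤t) (MinRatio.below M z)
      ... | no ¬c   = ℚP.≤-trans (subst (s * C x ≤_) (ℚP.*-zeroʳ s) (*-monoˡ-≤ s≥0 (ℚP.≮⇒≥ ¬c))) (hA (there z))
    ... | inj₂ t≤s = record { t = t ; t≥0 = t≥0 ; x∈L = there x∈L ; pos = pos ; attains = attains
      ; below = λ { (here refl) → ℚP.≤-trans (ℚP.*-monoʳ-≤-nonNeg (C y) {{ℚ.nonNegative (ℚP.<⇒≤ p)}} t≤s) (ℚP.≤-reflexive sC)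
                  ; (there z) → below z } }
      where open MinRatio M

neg-generator : (W : List (QPt n)) {x : QPt n} (f : QPt n) → Conv (List.lookup W) x → dot f x < 0ℚ → ∃ λ v → v ∈ W × dot f v < 0ℚ
neg-generator W f c lt with conv-neg-gen f c lt
... | i , p = List.lookup W i , ∈-lookup i , p

_≟ᵛ_ : (x y : QPt n) → Dec (x ≡ y)
_≟ᵛ_ = VecP.≡-dec ℚP._≟_

δ≤1 : (i j : Fin k) → δ i j ≤ 1ℚ
δ≤1 i j with i Fin.≟ j
... | yes _ = ℚP.≤-refl
... | no _  = 0≤1

dual-conv-extreme : {f w : Fin k → QPt n} → Dualᶠ f w → ∀ i → Extreme (Conv w) (w i)
dual-conv-extreme {k} {n} {f} {w} dl i = exposed-extreme (f i) 1ℚ (conv-gen w i) fi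
  (λ x → conv-≤ (f i) 1ℚ (λ j → subst (_≤ 1ℚ) (sym (biorth dl i j)) (δ≤1 i j)))
  (λ x → conv-exposed (f i) 1ℚ (w i) fi (λ j → off j (i Fin.≟ j)))
  where
  fi : dot (f i) (w i) ≡ 1ℚ
  fi = trans (biorth dl i i) (δ-refl i)
  off : ∀ j → Dec (i ≡ j) → dot (f i) (w j) < 1ℚ ⊎ w j ≡ w i
  off j (yes refl) = inj₂ refl
  off j (no h)     = inj₁ (subst (_< 1ℚ) (sym (trans (biorth dl i j) (δ-≢ h))) 0<1)

module Facets {d : ℕ} (V : List (Pt (suc d))) (reflexive : Reflexive V) (simplicial : Simplicial V) where

  P : QSet (suc d)
  P = ⟦ V ⟧

  Family : Set
  Family = Fin (suc d) → QPt (suc d)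

  -- Facets are normalised as h = 1 with h ≤ 1 on P. Since the dual polytope is defined by values at
  -- least -1, the facet corresponds to its point `negQ h`.
  Below : QPt (suc d) → Set
  Below h = ∀ x → P x → dot h x ≤ 1ℚ

  opaque
    extreme-lattice : ∀ {x} → Extreme P x → IsLattice x
    extreme-lattice ex with proj₂ (proj₁ reflexive) _ ex
    ... | v , e , _ = v , e

  opaque
    -- `negQ h` attains the bound -1 on a basis. If it is the midpoint of two points of the dual
    -- polytope, these attain the bound there too and agree with it. So it is a vertex of the dual
    -- polytope and reflexivity applies.
    tight-lattice : ∀ {h} {w w* : Family} → Below h → Dualᶠ w* w → (∀ i → P (w i)) → (∀ i → dot h (w i) ≡ 1ℚ) → IsLattice h
    tight-lattice {h} {w} below dl Pw tight = subst IsLattice (negQ-negQ h) (lattice-neg (proj₂ reflexive (negQ h) (inDual , ext)))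
      where
      inDual : Dual P (negQ h)
      inDual y Py = subst (- 1ℚ ≤_) (sym (dot-negˡ h y)) (ℚP.neg-antimono-≤ (below y Py))
      neg-tight : ∀ i → dot (negQ h) (w i) ≡ - 1ℚ
      neg-tight i = trans (dot-negˡ h (w i)) (cong -_ (tight i))
      ext : ∀ a b → Dual P a → Dual P b → negQ h ≡ midpoint a b → a ≡ negQ h
      ext a b Da Db e = agree-on-basis dl λ i → trans (mid-min (- 1ℚ) (Da (w i) (Pw i)) (Db (w i) (Pw i))
        (trans (sym (neg-tight i)) (trans (cong (λ z → dot z (w i)) e)
          (trans (dot-scaleˡ ½ (addQ a b) (w i)) (cong (½ *_) (dot-addˡ a b (w i))))))) (sym (neg-tight i))

  opaque
    -- The `w i` supply d + 1 affinely independent points. Affinely independent points of the level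
    -- h = 1 are linearly independent, so there is no room for d + 2 of them.
    facet : ∀ {h} {w w* : Family} → Below h → Dualᶠ w* w → (∀ i → P (w i)) → (∀ i → dot h (w i) ≡ 1ℚ) →
      Facet P (λ x → P x × dot (negQ h) x ≡ - 1ℚ)
    facet {h} {w} below dl Pw tight =
      (negQ h , - 1ℚ , (λ y Py → subst (- 1ℚ ≤_) (sym (dot-negˡ h y)) (ℚP.neg-antimono-≤ (below y Py))) , λ x → id , id) ,
      (List.tabulate w , ListP.length-tabulate w , indep⇒aff _ (indep-tabulate w (dual-indep dl)) , on) ,
      λ { (W , len , aff , F) → ℕP.<-irrefl refl (subst (ℕ._≤ suc d) len (indep-≤ (aff⇒indep W aff h (λ i → level (proj₂ (F i)))))) }
      where
      level : ∀ {x} → dot (negQ h) x ≡ - 1ℚ → dot h x ≡ 1ℚ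
      level {x} e = trans (sym (neg-neg (dot h x))) (cong -_ (trans (sym (dot-negˡ h x)) e))
      on : ∀ i → P (List.lookup (List.tabulate w) i) × dot (negQ h) (List.lookup (List.tabulate w) i) ≡ - 1ℚ
      on i = subst (λ x → P x × dot (negQ h) x ≡ - 1ℚ) (sym (lookup-tab w i))
        (Pw _ , trans (dot-negˡ h _) (cong -_ (tight _)))

  -- The simplex provided by `Simplicial` comes as a list of unknown length and order; `Frame`
  -- replaces it by a family indexed by `Fin (suc d)`.
  record FacetVertices (h : QPt (suc d)) : Set where
    field
      W       : List (QPt (suc d))
      indep   : Indep (List.lookup W)
      extreme : ∀ {x} → x ∈ W → Extreme P x × dot h x ≡ 1ℚ
      hull    : ∀ {x} → P x → dot h x ≡ 1ℚ → Conv (List.lookup W) x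

  opaque
    -- If a vertex of the face is a midpoint of points of P, both have h = 1 because h ≤ 1 on P. So
    -- they lie in the simplex, where a member of the dual family exposes the vertex.
    simplex-vertices : ∀ {h F} → Below h → Simplex F → (∀ {x} → F x → P x × dot h x ≡ 1ℚ) →
      (∀ {x} → P x → dot h x ≡ 1ℚ → F x) → FacetVertices h
    simplex-vertices {h} {F} below (W , aff , same) sound complete = record
      { W = W ; indep = ind ; extreme = λ p → ext p , proj₂ (sound (inF p)) ; hull = λ Px hx → toConv W (proj₁ (same _) (complete Px hx)) }
      where
      inF : ∀ {x} → x ∈ W → F x
      inF p = proj₂ (same _) (inconv-∈ p)
      ind : Indep (List.lookup W)
      ind = aff⇒indep W aff h (λ i → proj₂ (sound (inF (∈-lookup i))))
      ext-at : ∀ i → Extreme P (List.lookup W i)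
      ext-at i = proj₁ (sound (inF (∈-lookup i))) , λ a b Pa Pb e →
        let hm  = trans (sym (proj₂ (sound (inF (∈-lookup i))))) (trans (cong (dot h) e) (dot-mid h a b))
            ca  = toConv W (proj₁ (same a) (complete Pa (mid-max 1ℚ (below a Pa) (below b Pb) hm)))
            hm' = trans hm (cong (½ *_) (ℚP.+-comm (dot h a) (dot h b)))
            cb  = toConv W (proj₁ (same b) (complete Pb (mid-max 1ℚ (below b Pb) (below a Pa) hm')))
        in proj₂ (dual-conv-extreme (proj₂ (indep-dual (List.lookup W) ind)) i) a b ca cb e
      ext : ∀ {x} → x ∈ W → Extreme P x
      ext p with lookup-in p
      ... | i , refl = ext-at i

  opaque
    facet-vertices : ∀ {h} {w w* : Family} → Below h → Dualᶠ w* w → (∀ i → P (w i)) → (∀ i → dot h (w i) ≡ 1ℚ) → FacetVertices h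
    facet-vertices {h} below dl Pw tight = simplex-vertices {h} below (simplicial _ (facet {h} below dl Pw tight))
      (λ { {x} (Px , e) → Px , trans (sym (neg-neg (dot h x))) (cong -_ (trans (sym (dot-negˡ h x)) e)) })
      (λ {x} Px e → Px , trans (dot-negˡ h x) (cong -_ e))

  -- A facet with its vertices in a fixed order; the order lets a neighbouring facet keep the
  -- positions of the vertices that both share.
  record Frame : Set where
    field
      w w*    : Family
      h       : QPt (suc d)
      dl      : Dualᶠ w* w
      below   : Below h
      tight   : ∀ i → dot h (w i) ≡ 1ℚ
      extreme : ∀ i → Extreme P (w i)

    lattice : IsLattice h
    lattice = tight-lattice {h} below dl (proj₁ ∘ extreme) tight

    -- All extreme points on the facet occur among the independent generators `W`. One more besides
    -- the d + 1 vertices `w` would make d + 2 independent vectors in dimension d + 1.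
    vertex : ∀ {x} → Extreme P x → dot h x ≡ 1ℚ → ∃ λ j → x ≡ w j
    vertex {x} ex hx with FinP.any? (λ j → x ≟ᵛ w j)
    ... | yes p = p
    ... | no ¬p = ⊥-elim (ℕP.<-irrefl refl (ℕP.≤-trans (FinP.injective⇒≤ {f = index} index-inj) (indep-≤ (FacetVertices.indep FV))))
      where
      FV = facet-vertices {h} below dl (proj₁ ∘ extreme) tight
      open FacetVertices FV using (W; hull)
      find : ∀ {y} → Extreme P y → dot h y ≡ 1ℚ → ∃ λ i → List.lookup W i ≡ y
      find ey hy = extreme-gen (⟦⟧-convex V) (λ i → proj₁ (proj₁ (FacetVertices.extreme FV (∈-lookup i)))) ey (hull (proj₁ ey) hy)
      all : ∀ i → ∃ λ j → List.lookup W j ≡ (x ∷ᶠ w) i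
      all zero    = find ex hx
      all (suc i) = find (extreme i) (tight i)
      index : Fin (suc (suc d)) → Fin (List.length W)
      index = proj₁ ∘ all
      same : ∀ i j → index i ≡ index j → (x ∷ᶠ w) i ≡ (x ∷ᶠ w) j
      same i j e = trans (sym (proj₂ (all i))) (trans (cong (List.lookup W) e) (proj₂ (all j)))
      index-inj : ∀ {i j} → index i ≡ index j → i ≡ j
      index-inj {zero}  {zero}  e = refl
      index-inj {zero}  {suc j} e = ⊥-elim (¬p (j , same zero (suc j) e))
      index-inj {suc i} {zero}  e = ⊥-elim (¬p (i , sym (same (suc i) zero e)))
      index-inj {suc i} {suc j} e = cong suc (dual-injective dl (same (suc i) (suc j) e))

    hull : ∀ {x} → P x → dot h x ≡ 1ℚ → Conv w x
    hull Px hx = conv-trans gens (FacetVertices.hull FV Px hx)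
      where
      FV = facet-vertices {h} below dl (proj₁ ∘ extreme) tight
      gens : ∀ i → Conv w (List.lookup (FacetVertices.W FV) i)
      gens i = let (e , hx) = FacetVertices.extreme FV (∈-lookup i) ; (j , eq) = vertex e hx in
        subst (Conv w) (sym eq) (conv-gen w j)

    coord-nonneg : ∀ i {x} → P x → dot h x ≡ 1ℚ → 0ℚ ≤ dot (w* i) x
    coord-nonneg i Px hx = conv-≥ (w* i) 0ℚ (λ j → subst (0ℚ ≤_) (sym (biorth dl i j)) (0≤δ i j)) (hull Px hx)

  record Neighbour (Fr : Frame) (i : Fin (suc d)) : Set where
    open Frame Fr
    field
      next  : Frame
      t     : ℚ
      t>0   : 0ℚ < t
      apex     : QPt (suc d)
      apex<0   : dot (w* i) apex < 0ℚ
      q     : ℚ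
      qm    : q * dot (w* i) apex ≡ 1ℚ
      h-eq  : ∀ x → dot (Frame.h next) x ≡ dot h x - t * dot (w* i) x
      w-at  : Frame.w next i ≡ apex
      w-≢   : ∀ {j} → j ≢ i → Frame.w next j ≡ w j
      w*-≢  : ∀ {j} → j ≢ i → ∀ x → dot (Frame.w* next j) x ≡ dot (w* j) x - (dot (w* j) apex * q) * dot (w* i) x

  opaque
    -- The functional h is tilted to h - t w_i*, which does not change it at the other vertices of
    -- the facet, until it is about to exceed 1 at some listed point; the ratio test finds this t.
    neighbour : ∀ Fr i → Neighbour Fr i
    neighbour Fr i = result
      where
      open Frame Fr
      A C : Pt (suc d) → ℚ
      A v = 1ℚ - dot h (toℚ v)
      C v = - dot (w* i) (toℚ v)
      -- P contains a positive multiple of -w_i, where w_i* is negative. Hence w_i* is negative at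
      -- some generator and the ratio test is not void.
      some-neg : ∃ λ v → v ∈ V × dot (w* i) (toℚ v) < 0ℚ
      some-neg =
        let (ε , ε>0 , Pε) = proj₁ (proj₁ reflexive) (negQ (w i))
            value = trans (dot-scale ε (w* i) (negQ (w i))) (trans (cong (ε *_) (trans (dot-neg (w* i) (w i))
              (cong -_ (trans (biorth dl i i) (δ-refl i))))) (lem ε))
            (y , y∈ , neg) = neg-generator (List.map toℚ V) (w* i) (toConv (List.map toℚ V) Pε) (subst (_< 0ℚ) (sym value) (pos-neg ε>0))
            (v , v∈ , e) = ∈-map⁻ toℚ y∈
        in v , v∈ , subst (λ y → dot (w* i) y < 0ℚ) e neg
        where
        lem : ∀ ε → ε * (- 1ℚ) ≡ - ε
        lem = solve-∀ ℚring
      M : MinRatio V A C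
      M = [ (λ none → ⊥-elim (none (proj₁ (proj₂ some-neg)) (neg-pos (proj₂ (proj₂ some-neg))))) , id ]′
        (minRatio V A C (λ v∈ → 0≤-diff (below _ (⟦⟧-∈ v∈))))
      open MinRatio M renaming (x to v₀; x∈L to v₀∈; pos to Cv₀; below to t-below)
      v : QPt (suc d)
      v = toℚ v₀
      v<0 : dot (w* i) v < 0ℚ
      v<0 = subst (_< 0ℚ) (neg-neg _) (pos-neg Cv₀)
      h' : QPt (suc d)
      h' = subQ h (scaleQ t (w* i))
      h'x : ∀ x → dot h' x ≡ dot h x - t * dot (w* i) x
      h'x x = trans (dot-subˡ h (scaleQ t (w* i)) x) (cong (λ s → dot h x - s) (dot-scaleˡ t (w* i) x))
      below' : Below h'
      below' x = ⟦⟧-≤ V h' 1ℚ (λ {u} u∈ → ≤-by (A u - t * C u) (0≤-diff (t-below u∈))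
        (trans (cong (λ s → 1ℚ - s) (h'x (toℚ u))) (lem (dot h (toℚ u)) t (dot (w* i) (toℚ u)))))
        where
        lem : ∀ a t b → 1ℚ - (a - t * b) ≡ (1ℚ - a) - t * (- b)
        lem = solve-∀ ℚring
      -- For t = 0 the point `v₀` would lie on the old facet, where w_i* is nonnegative.
      t>0 : 0ℚ < t
      t>0 = ℚP.≰⇒> λ t≤0 → ℚP.<-irrefl refl (ℚP.<-≤-trans v<0 (coord-nonneg i (⟦⟧-∈ v₀∈)
        (sym (diff-0 (trans (sym attains) (trans (cong (_* C v₀) (ℚP.≤-antisym t≤0 t≥0)) (ℚP.*-zeroˡ (C v₀))))))))
      tight-v : dot h' v ≡ 1ℚ
      tight-v = trans (h'x v) (trans (lem₁ (dot h v) t (dot (w* i) v)) (trans (cong (dot h v +_) attains) (lem₂ (dot h v))))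
        where
        lem₁ : ∀ a t b → a - t * b ≡ a + t * (- b)
        lem₁ = solve-∀ ℚring
        lem₂ : ∀ a → a + (1ℚ - a) ≡ 1ℚ
        lem₂ = solve-∀ ℚring
      tight-≢ : ∀ j → j ≢ i → dot h' (w j) ≡ 1ℚ
      tight-≢ j j≢i = trans (h'x (w j)) (trans (cong₂ (λ a b → a - t * b) (tight j) (trans (biorth dl i j) (δ-≢ (j≢i ∘ sym)))) (lem t))
        where
        lem : ∀ t → 1ℚ - t * 0ℚ ≡ 1ℚ
        lem = solve-∀ ℚring
      invert : ∀ y → dot (w* i) y < 0ℚ → ∃ λ q → q * dot (w* i) y ≡ 1ℚ
      invert y lt = inverse _ (ℚP.<⇒≢ lt)
      FV : FacetVertices h'
      FV = facet-vertices {h'} {w = replace i v w} below' (replace-dual dl i v (proj₁ (invert v v<0)) (proj₂ (invert v v<0)))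
        (replace-all {R = P} i (⟦⟧-∈ v₀∈) (λ j _ → proj₁ (extreme j))) (replace-all {R = λ x → dot h' x ≡ 1ℚ} i tight-v tight-≢)
      -- `v₀` is a member of the list and possibly no vertex. It lies on the new facet, so w_i* is
      -- negative at some vertex of that facet, and this vertex becomes the apex.
      pick : ∃ λ apex → apex ∈ FacetVertices.W FV × dot (w* i) apex < 0ℚ
      pick = neg-generator (FacetVertices.W FV) (w* i) (FacetVertices.hull FV (⟦⟧-∈ v₀∈) tight-v) v<0
      apex : QPt (suc d)
      apex = proj₁ pick
      apex-vertex : Extreme P apex × dot h' apex ≡ 1ℚ
      apex-vertex = FacetVertices.extreme FV (proj₁ (proj₂ pick))
      q : ℚ
      q = proj₁ (invert apex (proj₂ (proj₂ pick)))
      result : Neighbour Fr i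
      result = record
        { next = record { w = replace i apex w ; w* = replaceDual i q apex w* ; h = h'
                        ; dl = replace-dual dl i apex q (proj₂ (invert apex (proj₂ (proj₂ pick)))) ; below = below'
                        ; tight = replace-all {R = λ x → dot h' x ≡ 1ℚ} i (proj₂ apex-vertex) tight-≢
                        ; extreme = replace-all {R = Extreme P} i (proj₁ apex-vertex) (λ j _ → extreme j) }
        ; t = t ; t>0 = t>0 ; apex = apex ; apex<0 = proj₂ (proj₂ pick) ; q = q ; qm = proj₂ (invert apex (proj₂ (proj₂ pick)))
        ; h-eq = h'x ; w-at = replace-at i apex w ; w-≢ = replace-≢ apex w ; w*-≢ = replaceDual-≢ q apex w* }

  -- At x the functional of the neighbouring facet has the value -t w_i*(x), a positive integer at
  -- most 1. So x lies on that facet, and all its vertices except the apex have h = 1.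
  level-0-neighbour : ∀ {Fr i} (N : Neighbour Fr i) {x} → Extreme P x → dot (Frame.h Fr) x ≡ 0ℚ → dot (Frame.w* Fr i) x < 0ℚ →
    x ≡ Neighbour.apex N × Neighbour.t N * dot (Frame.w* Fr i) x ≡ - 1ℚ
  level-0-neighbour {Fr} {i} N {x} ex hx neg = is-apex , (begin
      t * dot (w* i) x                  ≡⟨ lem (t * dot (w* i) x) ⟩
      - (0ℚ - t * dot (w* i) x)         ≡⟨ cong (λ s → - (s - t * dot (w* i) x)) (sym hx) ⟩
      - (dot h x - t * dot (w* i) x)    ≡⟨ cong -_ (trans (sym (h-eq x)) on) ⟩
      - 1ℚ                              ∎)
    where
    open ≡-Reasoning
    open Frame Fr
    open Neighbour N
    lem : ∀ a → a ≡ - (0ℚ - a)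
    lem = solve-∀ ℚring
    value : dot (Frame.h next) x ≡ t * (- dot (w* i) x)
    value = trans (h-eq x) (trans (cong (λ s → s - t * dot (w* i) x) hx) (lem' t (dot (w* i) x)))
      where
      lem' : ∀ t a → 0ℚ - t * a ≡ t * (- a)
      lem' = solve-∀ ℚring
    on : dot (Frame.h next) x ≡ 1ℚ
    on = Int-unit (lattice-dot (Frame.lattice next) (extreme-lattice ex))
      (subst (0ℚ <_) (sym value) (*-pos t>0 (neg-pos neg))) (Frame.below next x (proj₁ ex))
    is-apex : x ≡ apex
    is-apex = locate (Frame.vertex next ex on)
      where
      which : ∀ j → Dec (j ≡ i) → x ≡ Frame.w next j → x ≡ apex
      which j (yes refl) e = trans e w-at
      which j (no j≢i)   e = ⊥-elim (0≢1 (trans (sym hx) (trans (cong (dot h) (trans e (w-≢ j≢i))) (tight j))))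
      locate : (∃ λ j → x ≡ Frame.w next j) → x ≡ apex
      locate (j , e) = which j (j Fin.≟ i) e

-- A pair of opposite facets

functional-ext : {a b : QPt n} → (∀ x → dot a x ≡ dot b x) → a ≡ b
functional-ext {a = a} {b} h = vext λ i → trans (sym (dot-unitʳ a i)) (trans (h (unitQ i)) (dot-unitʳ b i))

span-≤ : {w : Fin k → QPt n} {e : Fin l → QPt n} → Indep w → (∀ i → InSpan e (w i)) → k ℕ.≤ l
span-≤ {k} {n} {l} {w} {e} ind s = indep-≤ {e = λ i → Vec.tabulate (a i)} λ c h → ind c (begin
  comb c w                                        ≡⟨ comb-cong (λ _ → refl) (λ i → sym (proj₂ (s i))) ⟩
  comb c (λ i → comb (a i) e)                     ≡⟨ comb-comb c a e ⟩
  comb (λ j → sumF (λ i → c i * a i j)) e         ≡⟨ comb-cong (λ j → trans (sumF-cong (λ i → cong (c i *_) (sym (‼-tab (a i) j))))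
                                                       (trans (sym (‼-comb c (λ i → Vec.tabulate (a i)) j)) (trans (cong (_‼ j) h) (‼-zero j)))) (λ _ → refl) ⟩
  comb (λ _ → 0ℚ) e                               ≡⟨ comb-0 e ⟩
  zeroQ                                           ∎)
  where
  open ≡-Reasoning
  a : Fin k → Fin l → ℚ
  a i = proj₁ (s i)

conv-span : {w : Fin k → QPt n} {x : QPt n} → Conv w x → InSpan w x
conv-span c = Conv.coeff c , Conv.point c

aff-zero∷ : (W : List (QPt n)) → Indep (List.lookup W) → AffIndep (zeroQ ∷ W)
aff-zero∷ {n} W ind c c0 h = all
  where
  split : ∀ i → List.lookup (zeroQ ∷ W) i ≡ (zeroQ ∷ᶠ List.lookup W) i
  split zero    = refl
  split (suc i) = refl
  coeffs : ∀ i → c i ≡ (c zero ∷ᶠ (c ∘ suc)) i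
  coeffs zero    = refl
  coeffs (suc i) = refl
  scale-zero : ∀ t → scaleQ t (zeroQ {n}) ≡ zeroQ
  scale-zero t = vext λ j → trans (‼-scale t zeroQ j) (trans (cong (t *_) (‼-zero j)) (trans (ℚP.*-zeroʳ t) (sym (‼-zero j))))
  tail : ∀ i → c (suc i) ≡ 0ℚ
  tail = ind (c ∘ suc) (begin
    comb (c ∘ suc) (List.lookup W)                                    ≡⟨ sym (add-zeroˡ _) ⟩
    addQ zeroQ (comb (c ∘ suc) (List.lookup W))                       ≡⟨ cong (λ z → addQ z (comb (c ∘ suc) (List.lookup W))) (sym (scale-zero (c zero))) ⟩
    addQ (scaleQ (c zero) zeroQ) (comb (c ∘ suc) (List.lookup W))     ≡⟨ sym (comb-∷ (c zero) (c ∘ suc) zeroQ (List.lookup W)) ⟩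
    comb (c zero ∷ᶠ (c ∘ suc)) (zeroQ ∷ᶠ List.lookup W)               ≡⟨ comb-cong (sym ∘ coeffs) (sym ∘ split) ⟩
    comb c (List.lookup (zeroQ ∷ W))                                  ≡⟨ trans (sym (lincomb-comb (zeroQ ∷ W) c)) h ⟩
    zeroQ                                                             ∎)
    where open ≡-Reasoning
  all : ∀ i → c i ≡ 0ℚ
  all zero    = trans (trans (sym (ℚP.+-identityʳ (c zero))) (cong (c zero +_) (sym (sumF-zero tail)))) c0
  all (suc i) = tail i

scaled-units : (ε : Fin n → ℚ) → (∀ i → 0ℚ < ε i) → Indep (λ i → scaleQ (ε i) (unitQ i))
scaled-units ε ε>0 c h i = *-cancel-0 (c i) (ε i) (begin
  c i * ε i                                            ≡⟨ sym (sumF-δʳ i (λ j → c j * ε j)) ⟩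
  sumF (λ j → c j * ε j * δ j i)                       ≡⟨ sumF-cong (λ j → trans (ℚP.*-assoc (c j) (ε j) (δ j i))
                                                            (cong (c j *_) (sym (trans (‼-scale (ε j) (unitQ j) i) (cong (ε j *_) (‼-tab (δ j) i)))))) ⟩
  sumF (λ j → c j * scaleQ (ε j) (unitQ j) ‼ i)        ≡⟨ sym (‼-comb c (λ j → scaleQ (ε j) (unitQ j)) i) ⟩
  comb c (λ j → scaleQ (ε j) (unitQ j)) ‼ i            ≡⟨ trans (cong (_‼ i) h) (‼-zero i) ⟩
  0ℚ                                                   ∎) (λ e → ℚP.<-irrefl (sym e) (ε>0 i))
  where open ≡-Reasoning

mid-neg : (a b : QPt n) → negQ (midpoint a b) ≡ midpoint (negQ a) (negQ b)
mid-neg a b = vext λ i → begin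
  negQ (midpoint a b) ‼ i                  ≡⟨ trans (‼-neg (midpoint a b) i) (cong -_ (trans (‼-scale ½ (addQ a b) i) (cong (½ *_) (‼-add a b i)))) ⟩
  - (½ * (a ‼ i + b ‼ i))                  ≡⟨ lem (a ‼ i) (b ‼ i) ⟩
  ½ * (- a ‼ i + - b ‼ i)                  ≡⟨ sym (trans (‼-scale ½ (addQ (negQ a) (negQ b)) i) (cong (½ *_) (trans (‼-add (negQ a) (negQ b) i) (cong₂ _+_ (‼-neg a i) (‼-neg b i))))) ⟩
  midpoint (negQ a) (negQ b) ‼ i           ∎
  where
  open ≡-Reasoning
  lem : ∀ a b → - (½ * (a + b)) ≡ ½ * (- a + - b)
  lem = solve-∀ ℚring

convex-0 : {Q : QSet n} → Convex Q → ∀ {x} → Q x → Q (negQ x) → Q zeroQ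
convex-0 {n} {Q} convex {x} Qx Q-x = convex pair (λ { zero → Qx ; (suc zero) → Q-x })
  (conv {2} (λ _ → ½) (λ _ → *≤* (ℤ.+≤+ ℕ.z≤n)) refl (vext λ j → trans (‼-comb (λ _ → ½) pair j)
    (trans (cong (λ z → ½ * x ‼ j + (½ * z + 0ℚ)) (‼-neg x j)) (trans (lem (x ‼ j)) (sym (‼-zero j))))))
  where
  pair : Fin 2 → QPt n
  pair = x ∷ᶠ negQ x ∷ᶠ λ ()
  lem : ∀ a → ½ * a + (½ * (- a) + 0ℚ) ≡ 0ℚ
  lem = solve-∀ ℚring

module Symmetric {d : ℕ} (V : List (Pt (suc d))) (reflexive : Reflexive V) (simplicial : Simplicial V) where

  open Facets V reflexive simplicial

  zero∈P : P zeroQ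
  zero∈P = let (ε , _ , Pε) = proj₁ (proj₁ reflexive) zeroQ in
    subst P (vext λ j → trans (‼-scale ε zeroQ j) (trans (cong (ε *_) (‼-zero j)) (trans (ℚP.*-zeroʳ ε) (sym (‼-zero j))))) Pε

  full-dimensional : ContainsAffIndep P (suc d)
  full-dimensional = zeroQ ∷ List.tabulate w , cong suc (ListP.length-tabulate w) ,
    aff-zero∷ (List.tabulate w) (indep-tabulate w (scaled-units ε ε>0)) , on
    where
    ε : Fin (suc d) → ℚ
    ε i = proj₁ (proj₁ (proj₁ reflexive) (unitQ i))
    ε>0 : ∀ i → 0ℚ < ε i
    ε>0 i = proj₁ (proj₂ (proj₁ (proj₁ reflexive) (unitQ i)))
    w : Fin (suc d) → QPt (suc d)
    w i = scaleQ (ε i) (unitQ i)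
    on : ∀ i → P (List.lookup (zeroQ ∷ List.tabulate w) i)
    on zero    = zero∈P
    on (suc i) = subst P (sym (lookup-tab w i)) (proj₂ (proj₂ (proj₁ (proj₁ reflexive) (unitQ (Fin.cast (ListP.length-tabulate w) i)))))

  nonneg-zero : ∀ u → (∀ x → P x → 0ℚ ≤ dot u x) → u ≡ zeroQ
  nonneg-zero u u≥0 = vext λ j → trans (ℚP.≤-antisym (≤0 j) (≥0 j)) (sym (‼-zero j))
    where
    lem : ∀ ε a → ε * (- a) ≡ - (ε * a)
    lem = solve-∀ ℚring
    positive-part : ∀ {ε a} → 0ℚ < ε → 0ℚ ≤ ε * a → 0ℚ ≤ a
    positive-part {ε} {a} ε>0 h = ℚP.*-cancelˡ-≤-pos ε {{ℚ.positive ε>0}} (subst (_≤ ε * a) (sym (ℚP.*-zeroʳ ε)) h)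
    ≥0 : ∀ j → 0ℚ ≤ u ‼ j
    ≥0 j = let (ε , ε>0 , Pε) = proj₁ (proj₁ reflexive) (unitQ j) in
      positive-part ε>0 (subst (0ℚ ≤_) (trans (dot-scale ε u (unitQ j)) (cong (ε *_) (dot-unitʳ u j))) (u≥0 _ Pε))
    ≤0 : ∀ j → u ‼ j ≤ 0ℚ
    ≤0 j = let (ε , ε>0 , Pε) = proj₁ (proj₁ reflexive) (negQ (unitQ j)) in
      subst (_≤ 0ℚ) (neg-neg (u ‼ j)) (ℚP.neg-antimono-≤ (positive-part ε>0 (subst (0ℚ ≤_)
        (trans (dot-scale ε u (negQ (unitQ j))) (cong (ε *_) (trans (dot-neg u (unitQ j)) (cong -_ (dot-unitʳ u j))))) (u≥0 _ Pε))))

  record Supports (F : QSet (suc d)) : Set where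
    field
      h        : QPt (suc d)
      below    : Below h
      sound    : ∀ {x} → F x → P x × dot h x ≡ 1ℚ
      complete : ∀ {x} → P x → dot h x ≡ 1ℚ → F x

  opaque
    -- A face comes with an inequality u ≥ c. Here c ≤ 0 as 0 lies in P, and c = 0 would force u = 0
    -- because 0 is interior; then the face would be all of P, whose dimension is too large.
    -- Dividing -u by -c normalises the functional.
    supports : ∀ F → Facet P F → Supports F
    supports F ((u , c , above , same) , _ , small) = record
      { h = h ; below = λ x Px → subst₂ _≤_ (sym (hx x)) qs (*-monoˡ-≤ (ℚP.<⇒≤ s>0) (ℚP.neg-antimono-≤ (above x Px)))
      ; sound = λ {x} Fx → proj₁ (proj₁ (same x) Fx) , trans (hx x) (trans (cong (λ z → s * - z) (proj₂ (proj₁ (same x) Fx))) qs)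
      ; complete = λ {x} Px e → proj₂ (same x) (Px , diff-0 (*-cancel-0 (dot u x - c) s (trans (lem (dot u x) c s)
          (trans (cong₂ (λ a b → b - a) (trans (sym (hx x)) e) qs) refl)) (λ e → ℚP.<-irrefl (sym e) s>0))) }
      where
      c≤0 : c ≤ 0ℚ
      c≤0 = subst (c ≤_) (dot-zero u) (above zeroQ zero∈P)
      c≢0 : c ≢ 0ℚ
      c≢0 refl = small (let (W , len , aff , on) = full-dimensional in W , len , aff , λ i → proj₂ (same _) (on i ,
        trans (cong (λ z → dot z (List.lookup W i)) (nonneg-zero u above)) (dot-zeroˡ (List.lookup W i))))
      -c>0 : 0ℚ < - c
      -c>0 = neg-pos (ℚP.≰⇒> (λ 0≤c → c≢0 (ℚP.≤-antisym c≤0 0≤c)))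
      s : ℚ
      s = proj₁ (inverse-pos (- c) -c>0)
      qs : s * (- c) ≡ 1ℚ
      qs = proj₁ (proj₂ (inverse-pos (- c) -c>0))
      s>0 : 0ℚ < s
      s>0 = proj₂ (proj₂ (inverse-pos (- c) -c>0))
      h : QPt (suc d)
      h = scaleQ s (negQ u)
      hx : ∀ x → dot h x ≡ s * (- dot u x)
      hx x = trans (dot-scaleˡ s (negQ u) x) (cong (s *_) (dot-negˡ u x))

      lem : ∀ a c s → (a - c) * s ≡ s * (- c) - s * (- a)
      lem = solve-∀ ℚring

  -- Both facets with matching order and signs, so that `flip` exchanges them and every statement
  -- about F has a mirror image about -F.
  record Opposite : Set where
    field
      F⁺ F⁻ : Frame
      w-neg  : ∀ i → Frame.w F⁻ i ≡ negQ (Frame.w F⁺ i)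
      w*-neg : ∀ i → Frame.w* F⁻ i ≡ negQ (Frame.w* F⁺ i)
      h-neg  : Frame.h F⁻ ≡ negQ (Frame.h F⁺)

  flip : Opposite → Opposite
  flip O = record { F⁺ = F⁻ ; F⁻ = F⁺
    ; w-neg  = λ i → trans (sym (negQ-negQ _)) (cong negQ (sym (w-neg i)))
    ; w*-neg = λ i → trans (sym (negQ-negQ _)) (cong negQ (sym (w*-neg i)))
    ; h-neg  = trans (sym (negQ-negQ _)) (cong negQ (sym h-neg)) }
    where open Opposite O

  neg-dual : {f w : Fin k → QPt n} → Dualᶠ f w → Dualᶠ (negQ ∘ f) (negQ ∘ w)
  biorth (neg-dual {f = f} {w} dl) i j = trans (dot-negˡ (f i) (negQ (w j))) (trans (cong -_ (dot-neg (f i) (w j)))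
    (trans (neg-neg _) (biorth dl i j)))

  opaque
    opposite : PseudoSymmetric V → Opposite
    opposite (F , facet⁺ , facet⁻) = record
      { F⁺ = record { w = w ; w* = w* ; h = h ; dl = dl ; below = S⁺.below ; tight = tight ; extreme = ext }
      ; F⁻ = record { w = negQ ∘ w ; w* = negQ ∘ w* ; h = negQ h ; dl = neg-dual dl ; below = subst Below h₂≡ S⁻.below
                    ; tight = λ i → trans (cong (λ z → dot z (negQ (w i))) (sym h₂≡)) (proj₂ (on⁻ i)) ; extreme = ext⁻ }
      ; w-neg = λ _ → refl ; w*-neg = λ _ → refl ; h-neg = refl }
      where
      module S⁺ = Supports (supports F facet⁺)
      module S⁻ = Supports (supports (λ x → F (negQ x)) facet⁻)
      h : QPt (suc d)
      h = S⁺.h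
      FV : FacetVertices h
      FV = simplex-vertices {h} S⁺.below (simplicial F facet⁺) S⁺.sound S⁺.complete
      W : List (QPt (suc d))
      W = FacetVertices.W FV
      -- At most d + 1 vertices by independence, and at least d + 1 because they span the d + 1
      -- affinely independent points that the dimension of the facet provides.
      len : List.length W ≡ suc d
      len with proj₁ (proj₂ facet⁺)
      ... | W₀ , len₀ , aff₀ , on₀ = ℕP.≤-antisym (indep-≤ (FacetVertices.indep FV))
        (subst (ℕ._≤ List.length W) len₀ (span-≤ (aff⇒indep W₀ aff₀ h (λ i → proj₂ (S⁺.sound (on₀ i))))
          (λ i → conv-span (FacetVertices.hull FV (proj₁ (S⁺.sound (on₀ i))) (proj₂ (S⁺.sound (on₀ i)))))))
      w : Fin (suc d) → QPt (suc d)
      w i = List.lookup W (Fin.cast (sym len) i)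
      ind : Indep w
      ind = indep-reindex (sym len) (List.lookup W) (FacetVertices.indep FV)
      w* : Fin (suc d) → QPt (suc d)
      w* = proj₁ (indep-dual w ind)
      dl : Dualᶠ w* w
      dl = proj₂ (indep-dual w ind)
      ext : ∀ i → Extreme P (w i)
      ext i = proj₁ (FacetVertices.extreme FV (∈-lookup _))
      tight : ∀ i → dot h (w i) ≡ 1ℚ
      tight i = proj₂ (FacetVertices.extreme FV (∈-lookup _))
      on⁻ : ∀ i → P (negQ (w i)) × dot S⁻.h (negQ (w i)) ≡ 1ℚ
      on⁻ i = S⁻.sound (subst F (sym (negQ-negQ (w i))) (S⁺.complete (proj₁ (ext i)) (tight i)))
      -- Both functionals are 1 at every -w_i, and the w_i form a basis.
      h₂≡ : S⁻.h ≡ negQ h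
      h₂≡ = agree-on-basis dl λ i → trans (sym (neg-neg _)) (trans (cong -_ (trans (sym (dot-neg S⁻.h (w i))) (proj₂ (on⁻ i))))
        (sym (trans (dot-negˡ h (w i)) (cong -_ (tight i)))))
      ext⁻ : ∀ i → Extreme P (negQ (w i))
      ext⁻ i = proj₁ (on⁻ i) , λ a b Pa Pb e →
        let hm  = trans (sym (proj₂ (on⁻ i))) (trans (cong (dot S⁻.h) e) (dot-mid S⁻.h a b))
            Fa  = S⁺.sound (S⁻.complete Pa (mid-max 1ℚ (S⁻.below a Pa) (S⁻.below b Pb) hm))
            hm' = trans hm (cong (½ *_) (ℚP.+-comm (dot S⁻.h a) (dot S⁻.h b)))
            Fb  = S⁺.sound (S⁻.complete Pb (mid-max 1ℚ (S⁻.below b Pb) (S⁻.below a Pa) hm'))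
        in trans (sym (negQ-negQ a)) (cong negQ (proj₂ (ext i) (negQ a) (negQ b) (proj₁ Fa) (proj₁ Fb)
             (trans (sym (negQ-negQ (w i))) (trans (cong negQ e) (mid-neg a b)))))

-- Vertices on {g = 0}, seen from one facet

module OneSide {d : ℕ} (V : List (Pt (suc d))) (reflexive : Reflexive V) (simplicial : Simplicial V)
  (O : Symmetric.Opposite V reflexive simplicial) where

  open Facets V reflexive simplicial
  open Symmetric V reflexive simplicial
  open Opposite O public
  open Frame F⁺ public renaming (w to e; w* to e*; h to g; dl to e-dual; below to g≤1; tight to g-e; extreme to e-extreme; lattice to g-lattice)

  coord : Fin (suc d) → QPt (suc d) → ℚ
  coord i x = dot (e* i) x

  e*e : ∀ i → coord i (e i) ≡ 1ℚ
  e*e i = trans (biorth e-dual i i) (δ-refl i)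

  e*e-≢ : ∀ {i j} → i ≢ j → coord i (e j) ≡ 0ℚ
  e*e-≢ {i} {j} h = trans (biorth e-dual i j) (δ-≢ h)

  g-neg-e : ∀ i → dot g (negQ (e i)) ≡ - 1ℚ
  g-neg-e i = trans (dot-neg g (e i)) (cong -_ (g-e i))

  neg-e-extreme : ∀ i → Extreme P (negQ (e i))
  neg-e-extreme i = subst (Extreme P) (w-neg i) (Frame.extreme F⁻ i)

  coord-neg-e : ∀ i → coord i (negQ (e i)) ≡ - 1ℚ
  coord-neg-e i = trans (dot-neg (e* i) (e i)) (cong -_ (e*e i))

  N : ∀ i → Neighbour F⁺ i
  N = neighbour F⁺

  module N i = Neighbour (N i)

  h' : ∀ i → QPt (suc d)
  h' i = Frame.h (N.next i)

  h'-e : ∀ i → dot (h' i) (e i) ≡ 1ℚ - N.t i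
  h'-e i = trans (N.h-eq i (e i)) (trans (cong₂ (λ a b → a - N.t i * b) (g-e i) (e*e i)) (cong (λ s → 1ℚ - s) (ℚP.*-identityʳ (N.t i))))

  h'-neg-e : ∀ i → dot (h' i) (negQ (e i)) ≡ N.t i - 1ℚ
  h'-neg-e i = trans (dot-neg (h' i) (e i)) (trans (cong -_ (h'-e i)) (lem (N.t i)))
    where
    lem : ∀ t → - (1ℚ - t) ≡ t - 1ℚ
    lem = solve-∀ ℚring

  t-int : ∀ i → IsInt (N.t i)
  t-int i = Int-cast (lem (N.t i)) (Int-sub Int-1 (Int-cast (h'-e i) (lattice-dot (Frame.lattice (N.next i)) (extreme-lattice (e-extreme i)))))
    where
    lem : ∀ t → 1ℚ - (1ℚ - t) ≡ t
    lem = solve-∀ ℚring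

  t-1-or-2 : ∀ i → N.t i ≡ 1ℚ ⊎ N.t i ≡ 2ℚ
  t-1-or-2 i = Int-1-or-2 (t-int i) (N.t>0 i) (≤-by (1ℚ - (N.t i - 1ℚ))
    (0≤-diff (subst (_≤ 1ℚ) (h'-neg-e i) (Frame.below (N.next i) _ (proj₁ (neg-e-extreme i))))) (lem (N.t i)))
    where
    lem : ∀ t → (1ℚ + 1ℚ) - t ≡ 1ℚ - (t - 1ℚ)
    lem = solve-∀ ℚring

  t-functional : ∀ i → IsLattice (scaleQ (N.t i) (e* i))
  t-functional i = subst IsLattice (functional-ext λ x → trans (dot-subˡ g (h' i) x) (trans (cong (λ s → dot g x - s) (N.h-eq i x))
      (trans (lem (dot g x) (N.t i * coord i x)) (sym (dot-scaleˡ (N.t i) (e* i) x)))))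
    (lattice-sub g-lattice (Frame.lattice (N.next i)))
    where
    lem : ∀ a b → a - (a - b) ≡ b
    lem = solve-∀ ℚring

  -- t e_i* is the difference of g and the functional of the neighbouring facet, hence integral, and
  -- t divides 2.
  2e*-lattice : ∀ i → IsLattice (scaleQ 2ℚ (e* i))
  2e*-lattice i = [ (λ t≡1 → lattice-scale (Int-+ Int-1 Int-1) (subst IsLattice (scale-1 (e* i)) (subst (λ t → IsLattice (scaleQ t (e* i))) t≡1 (t-functional i))))
                  , (λ t≡2 → subst (λ t → IsLattice (scaleQ t (e* i))) t≡2 (t-functional i)) ]′ (t-1-or-2 i)

  Level0 : QPt (suc d) → Set
  Level0 x = Extreme P x × dot g x ≡ 0ℚ

  -1≢0 : - 1ℚ ≢ 0ℚ
  -1≢0 ()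

  -1≢1 : - 1ℚ ≢ 1ℚ
  -1≢1 ()

  record NegativeCoordinate (x : QPt (suc d)) (i : Fin (suc d)) : Set where
    field
      value   : coord i x ≡ - 1ℚ
      lattice : IsLattice (e* i)
      is-apex : x ≡ N.apex i
      t≡1     : N.t i ≡ 1ℚ

  neg-e-is-e : ∀ {i j} → negQ (e i) ≡ e j → ⊥
  neg-e-is-e {i} {j} h = -1≢1 (trans (sym (g-neg-e i)) (trans (cong (dot g) h) (g-e j)))

  -- If t were 2, the vertex -e_i would also lie on the neighbouring facet; but it differs from the
  -- apex x, where g = 0, and from every e_j. With t = 1 the equation t e_i*(x) = -1 gives the
  -- value, and the integral functional t e_i* is e_i*.
  level-0-negative : ∀ {x i} → Level0 x → coord i x < 0ℚ → NegativeCoordinate x i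
  level-0-negative {x} {i} (ex , gx) neg = build (t-1-or-2 i)
    where
    on = level-0-neighbour (N i) ex gx neg
    t2-absurd : N.t i ≡ 2ℚ → (∃ λ j → negQ (e i) ≡ Frame.w (N.next i) j) → ⊥
    t2-absurd t≡2 (j , eq) = which (j Fin.≟ i)
      where
      which : Dec (j ≡ i) → ⊥
      which (yes refl) = -1≢0 (trans (sym (g-neg-e i)) (trans (cong (dot g) (trans eq (trans (N.w-at i) (sym (proj₁ on))))) gx))
      which (no j≢i)   = neg-e-is-e (trans eq (N.w-≢ i j≢i))
    build : N.t i ≡ 1ℚ ⊎ N.t i ≡ 2ℚ → NegativeCoordinate x i
    build (inj₁ t≡1) = record
      { value = trans (sym (ℚP.*-identityˡ (coord i x))) (trans (cong (_* coord i x) (sym t≡1)) (proj₂ on))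
      ; lattice = subst IsLattice (scale-1 (e* i)) (subst (λ t → IsLattice (scaleQ t (e* i))) t≡1 (t-functional i))
      ; is-apex = proj₁ on ; t≡1 = t≡1 }
    build (inj₂ t≡2) = ⊥-elim (t2-absurd t≡2 (Frame.vertex (N.next i) (neg-e-extreme i)
      (trans (h'-neg-e i) (cong (_- 1ℚ) t≡2))))

  -- Both vertices are the apex across e_i.
  unique-negative : ∀ {x y i} → Level0 x → Level0 y → coord i x < 0ℚ → coord i y < 0ℚ → x ≡ y
  unique-negative X Y nx ny = trans (NegativeCoordinate.is-apex (level-0-negative X nx)) (sym (NegativeCoordinate.is-apex (level-0-negative Y ny)))

  level-sum : ∀ x → dot g x ≡ sumF (λ i → coord i x)
  level-sum x = trans (cong (dot g) (sym (dual-complete e-dual x))) (trans (dot-comb g (λ i → coord i x) e)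
    (sumF-cong (λ i → trans (cong (coord i x *_) (g-e i)) (ℚP.*-identityʳ (coord i x)))))

  -- If x vanished at k, then exchanging e_k for y and e_i for x in F would lead through two neighbouring facets, the second containing -e_k.
  shared-negative : ∀ {x y i k} → Level0 x → Level0 y → coord i x ≡ - 1ℚ → coord i y ≡ 1ℚ → coord k y ≡ - 1ℚ → coord k x ≢ 0ℚ
  shared-negative {x} {y} {i} {k} X Y xi yi yk xk = last (Frame.vertex next₂ (neg-e-extreme k) on₂)
    where
    NC = level-0-negative Y (subst (_< 0ℚ) (sym yk) -1<0)
    y≡ : y ≡ N.apex k
    y≡ = NegativeCoordinate.is-apex NC
    t≡1 : N.t k ≡ 1ℚ
    t≡1 = NegativeCoordinate.t≡1 NC
    i≢k : i ≢ k
    i≢k refl = -1≢1 (trans (sym yk) yi)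
    next₁ : Frame
    next₁ = N.next k
    q≡-1 : N.q k ≡ - 1ℚ
    q≡-1 = trans (lem (N.q k)) (trans (cong (λ s → - (N.q k * s)) (trans (sym yk) (cong (coord k) y≡))) (cong -_ (N.qm k)))
      where
      lem : ∀ q → q ≡ - (q * (- 1ℚ))
      lem = solve-∀ ℚring
    h₁x : dot (Frame.h next₁) x ≡ 0ℚ
    h₁x = trans (N.h-eq k x) (trans (cong₂ (λ a b → a - N.t k * b) (proj₂ X) xk) (lem (N.t k)))
      where
      lem : ∀ t → 0ℚ - t * 0ℚ ≡ 0ℚ
      lem = solve-∀ ℚring
    w₁x : dot (Frame.w* next₁ i) x ≡ - 1ℚ
    w₁x = trans (N.w*-≢ k i≢k x) (trans (cong₂ (λ a b → a - (coord i (N.apex k) * N.q k) * b) xi xk) (lem (coord i (N.apex k) * N.q k)))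
      where
      lem : ∀ t → - 1ℚ - t * 0ℚ ≡ - 1ℚ
      lem = solve-∀ ℚring
    N₂ : Neighbour next₁ i
    N₂ = neighbour next₁ i
    next₂ : Frame
    next₂ = Neighbour.next N₂
    step : x ≡ Neighbour.apex N₂ × Neighbour.t N₂ * dot (Frame.w* next₁ i) x ≡ - 1ℚ
    step = level-0-neighbour N₂ (proj₁ X) h₁x (subst (_< 0ℚ) (sym w₁x) -1<0)
    t₂≡1 : Neighbour.t N₂ ≡ 1ℚ
    t₂≡1 = trans (lem (Neighbour.t N₂)) (trans (cong (λ s → - (Neighbour.t N₂ * s)) (sym w₁x)) (trans (cong -_ (proj₂ step)) refl))
      where
      lem : ∀ q → q ≡ - (q * (- 1ℚ))
      lem = solve-∀ ℚring
    on₂ : dot (Frame.h next₂) (negQ (e k)) ≡ 1ℚ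
    on₂ = trans (Neighbour.h-eq N₂ (negQ (e k))) (cong₂ (λ a b → a - b) (trans (h'-neg-e k) (cong (_- 1ℚ) t≡1))
      (cong₂ _*_ t₂≡1 (trans (N.w*-≢ k i≢k (negQ (e k))) (trans
        (cong₂ (λ a b → a - (b * N.q k) * coord k (negQ (e k))) (trans (dot-neg (e* i) (e k)) (cong -_ (e*e-≢ i≢k))) (trans (cong (coord i) (sym y≡)) yi))
        (cong₂ (λ a b → - 0ℚ - (1ℚ * a) * b) q≡-1 (coord-neg-e k))))))
    last : (∃ λ j → negQ (e k) ≡ Frame.w next₂ j) → ⊥
    last (j , eq) = which (j Fin.≟ i) (j Fin.≟ k)
      where
      which : Dec (j ≡ i) → Dec (j ≡ k) → ⊥
      which (yes refl) _ = -1≢0 (trans (sym (g-neg-e k)) (trans (cong (dot g) (trans eq (trans (Neighbour.w-at N₂) (sym (proj₁ step))))) (proj₂ X)))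
      which (no j≢i) (yes refl) = -1≢0 (trans (sym (g-neg-e k)) (trans (cong (dot g) (trans eq (trans (Neighbour.w-≢ N₂ j≢i) (trans (N.w-at k) (sym y≡))))) (proj₂ Y)))
      which (no j≢i) (no j≢k) = neg-e-is-e (trans eq (trans (Neighbour.w-≢ N₂ j≢i) (N.w-≢ k j≢k)))

  -- Serves for listed points that are not known to be vertices: v lies on the neighbouring facet
  -- across e_i by integrality, and that facet is the hull of its vertices.
  level-0-hull : {Q : QSet (suc d)} → Convex Q → (∀ {x} → Extreme P x → Q x) →
    ∀ {v i} → P v → IsLattice v → dot g v ≡ 0ℚ → coord i v < 0ℚ → Q v
  level-0-hull {Q} convex ext {v} {i} Pv lv gv neg = convex (Frame.w (N.next i)) (λ j → ext (Frame.extreme (N.next i) j)) (Frame.hull (N.next i) Pv on)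
    where
    lem : ∀ t a → 0ℚ - t * a ≡ t * (- a)
    lem = solve-∀ ℚring
    on : dot (h' i) v ≡ 1ℚ
    on = Int-unit (lattice-dot (Frame.lattice (N.next i)) lv) (subst (0ℚ <_)
      (sym (trans (N.h-eq i v) (trans (cong (λ s → s - N.t i * coord i v) gv) (lem (N.t i) (coord i v))))) (*-pos (N.t>0 i) (neg-pos neg)))
      (Frame.below (N.next i) v Pv)

-- Vertices on {g = 0}, seen from both facets

module TwoSides {d : ℕ} (V : List (Pt (suc d))) (reflexive : Reflexive V) (simplicial : Simplicial V)
  (O : Symmetric.Opposite V reflexive simplicial) where

  open Facets V reflexive simplicial
  open Symmetric V reflexive simplicial
  open OneSide V reflexive simplicial O public
  module Flip = OneSide V reflexive simplicial (flip O)

  flip-coord : ∀ i x → Flip.coord i x ≡ - coord i x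
  flip-coord i x = trans (cong (λ f → dot f x) (w*-neg i)) (dot-negˡ (e* i) x)

  flip-level : ∀ x → dot Flip.g x ≡ - dot g x
  flip-level x = trans (cong (λ f → dot f x) h-neg) (dot-negˡ g x)

  flip-Level0 : ∀ {x} → Level0 x → Flip.Level0 x
  flip-Level0 {x} (ex , gx) = ex , trans (flip-level x) (cong -_ gx)

  flip-coord-≡ : ∀ {i x c} → coord i x ≡ c → Flip.coord i x ≡ - c
  flip-coord-≡ {i} {x} eq = trans (flip-coord i x) (cong -_ eq)

  unflip-coord-≡ : ∀ {i x c} → Flip.coord i x ≡ c → coord i x ≡ - c
  unflip-coord-≡ {i} {x} eq = trans (sym (neg-neg (coord i x))) (cong -_ (trans (sym (flip-coord i x)) eq))

  unflip-lattice : ∀ {i} → IsLattice (Flip.e* i) → IsLattice (e* i)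
  unflip-lattice {i} h = subst IsLattice (trans (cong negQ (w*-neg i)) (negQ-negQ (e* i))) (lattice-neg h)

  data Coordinate (i : Fin (suc d)) (x : QPt (suc d)) : Set where
    minus : coord i x ≡ - 1ℚ → IsLattice (e* i) → Coordinate i x
    none  : coord i x ≡ 0ℚ → Coordinate i x
    plus  : coord i x ≡ 1ℚ → IsLattice (e* i) → Coordinate i x

  -- A positive i-th coordinate is a negative one seen from -F, where all coordinates change sign.
  coordinate : ∀ {x} → Level0 x → ∀ i → Coordinate i x
  coordinate {x} X i = split (ℚP.<-cmp (coord i x) 0ℚ)
    where
    split : _ → Coordinate i x
    split (tri< neg _ _) = minus (NegativeCoordinate.value NC) (NegativeCoordinate.lattice NC)
      where NC = level-0-negative X neg
    split (tri≈ _ eq _)  = none eq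
    split (tri> _ _ pos) = plus (unflip-coord-≡ (Flip.NegativeCoordinate.value NC)) (unflip-lattice (Flip.NegativeCoordinate.lattice NC))
      where NC = Flip.level-0-negative (flip-Level0 X) (subst (_< 0ℚ) (sym (flip-coord i x)) (pos-neg pos))

  support-lattice : ∀ {x} → Level0 x → ∀ {i} → coord i x ≢ 0ℚ → IsLattice (e* i)
  support-lattice X {i} h = go (coordinate X i)
    where
    go : Coordinate i _ → IsLattice (e* i)
    go (minus _ L) = L
    go (none e)    = ⊥-elim (h e)
    go (plus _ L)  = L

  level : ∀ {x} → P x → IsLattice x → dot g x ≡ - 1ℚ ⊎ dot g x ≡ 0ℚ ⊎ dot g x ≡ 1ℚ
  level {x} Px lx = Int-±1 (lattice-dot g-lattice lx)
    (subst (- 1ℚ ≤_) (neg-neg (dot g x)) (ℚP.neg-antimono-≤ (subst (_≤ 1ℚ) (flip-level x) (Flip.g≤1 x Px)))) (g≤1 x Px)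

  flip-on : ∀ {x} → dot g x ≡ - 1ℚ → dot Flip.g x ≡ 1ℚ
  flip-on {x} eq = trans (flip-level x) (cong -_ eq)

  classify : ∀ {x} → Extreme P x → (∃ λ j → x ≡ e j) ⊎ (∃ λ j → x ≡ negQ (e j)) ⊎ dot g x ≡ 0ℚ
  classify {x} ex = go (level (proj₁ ex) (extreme-lattice ex))
    where
    go : _ → (∃ λ j → x ≡ e j) ⊎ (∃ λ j → x ≡ negQ (e j)) ⊎ dot g x ≡ 0ℚ
    go (inj₁ l)        = let (j , eq) = Frame.vertex F⁻ ex (flip-on l) in inj₂ (inj₁ (j , trans eq (w-neg j)))
    go (inj₂ (inj₁ l)) = inj₂ (inj₂ l)
    go (inj₂ (inj₂ l)) = inj₁ (Frame.vertex F⁺ ex l)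

  -- Being a lattice point, each listed point lies on F, on -F or on {g = 0}. In the last case it is
  -- 0, the midpoint of e_0 and -e_0, or it lies on a neighbour of F or of -F according to the sign
  -- of a nonzero coordinate. Each facet met is the hull of its vertices, so extremality of listed
  -- points need not be decided.
  krein-milman : {Q : QSet (suc d)} → Convex Q → (∀ {x} → Extreme P x → Q x) → ∀ {x} → P x → Q x
  krein-milman {Q} convex ext = ⟦⟧-sub V convex λ {v} v∈ → at (⟦⟧-∈ v∈) (v , refl)
    where
    at : ∀ {v} → P v → IsLattice v → Q v
    at {v} Pv lv = go (level Pv lv)
      where
      zero-case : dot g v ≡ 0ℚ → (∃ λ i → coord i v ≢ 0ℚ) ⊎ v ≡ zeroQ → Q v
      zero-case l (inj₂ eq) = subst Q (sym eq) (convex-0 convex (ext (e-extreme zero)) (ext (neg-e-extreme zero)))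
      zero-case l (inj₁ (i , h)) = sign (ℚP.<-cmp (coord i v) 0ℚ)
        where
        sign : _ → Q v
        sign (tri< neg _ _) = level-0-hull {Q} convex ext Pv lv l neg
        sign (tri≈ _ eq _)  = ⊥-elim (h eq)
        sign (tri> _ _ pos) = Flip.level-0-hull {Q} convex ext Pv lv (trans (flip-level v) (cong -_ l)) (subst (_< 0ℚ) (sym (flip-coord i v)) (pos-neg pos))
      some-coord : Dec (∀ i → coord i v ≡ 0ℚ) → (∃ λ i → coord i v ≢ 0ℚ) ⊎ v ≡ zeroQ
      some-coord (yes all) = inj₂ (dot-ext-dual e-dual (λ i → trans (all i) (sym (dot-zero (e* i)))))
      some-coord (no ¬all) = inj₁ (FinP.¬∀⟶∃¬ _ _ (λ i → coord i v ℚP.≟ 0ℚ) ¬all)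
      go : _ → Q v
      go (inj₁ l)        = convex (Frame.w F⁻) (λ j → ext (Frame.extreme F⁻ j)) (Frame.hull F⁻ Pv (flip-on l))
      go (inj₂ (inj₁ l)) = zero-case l (some-coord (FinP.all? (λ i → coord i v ℚP.≟ 0ℚ)))
      go (inj₂ (inj₂ l)) = convex e (λ j → ext (e-extreme j)) (Frame.hull F⁺ Pv l)

  -- The coordinates add up to g(x) = 0.
  negative-exists : ∀ {x i} → Level0 x → coord i x ≡ 1ℚ → ∃ λ k → coord k x ≡ - 1ℚ
  negative-exists {x} {i} X xi = go (FinP.any? (λ k → coord k x ℚP.<? 0ℚ))
    where
    go : Dec (∃ λ k → coord k x < 0ℚ) → ∃ λ k → coord k x ≡ - 1ℚ
    go (yes (k , neg)) = k , NegativeCoordinate.value (level-0-negative X neg)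
    go (no ¬neg) = ⊥-elim (0≢1 (trans (sym (sumF-nonneg-0 (λ j → coord j x) (λ j → ℚP.≮⇒≥ (λ lt → ¬neg (j , lt)))
      (trans (sym (level-sum x)) (proj₂ X)) i)) xi))

  -- The k-th coordinate of x is nonzero by `shared-negative`. It is not -1, since then x and y
  -- would be the same vertex, against their i-th coordinates.
  opposite-negative : ∀ {x y i k} → Level0 x → Level0 y → coord i x ≡ - 1ℚ → coord i y ≡ 1ℚ → coord k y ≡ - 1ℚ → coord k x ≡ 1ℚ
  opposite-negative {x} {y} {i} {k} X Y xi yi yk = go (coordinate X k)
    where
    go : Coordinate k x → coord k x ≡ 1ℚ
    go (plus eq _)  = eq
    go (none eq)    = ⊥-elim (shared-negative X Y xi yi yk eq)
    go (minus eq _) = ⊥-elim (-1≢1 (trans (sym xi) (trans (cong (coord i)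
      (unique-negative X Y (subst (_< 0ℚ) (sym eq) -1<0) (subst (_< 0ℚ) (sym yk) -1<0))) yi)))

  -- With t = 1 the apex satisfies g = 1 + e_i* < 1, so it is not on F. Among the vertices -e_j of
  -- -F only -e_i has a negative i-th coordinate.
  apex-Level0 : ∀ i → N.t i ≡ 1ℚ → Level0 (N.apex i)
  apex-Level0 i t≡1 = ex , go (classify ex)
    where
    a = N.apex i
    ex : Extreme P a
    ex = subst (Extreme P) (N.w-at i) (Frame.extreme (N.next i) i)
    ga : dot g a ≡ 1ℚ + coord i a
    ga = trans (lem (dot g a) (coord i a)) (cong (_+ coord i a) (trans (cong (λ t → dot g a - t * coord i a) (sym t≡1))
      (trans (sym (N.h-eq i a)) (trans (cong (dot (h' i)) (sym (N.w-at i))) (Frame.tight (N.next i) i)))))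
      where
      lem : ∀ a b → a ≡ (a - 1ℚ * b) + b
      lem = solve-∀ ℚring
    below-1 : dot g a ≢ 1ℚ
    below-1 eq = ℚP.<-irrefl (trans (sym ga) eq) (subst (1ℚ + coord i a <_) (ℚP.+-identityʳ 1ℚ) (ℚP.+-monoʳ-< 1ℚ (N.apex<0 i)))
    go : _ → dot g a ≡ 0ℚ
    go (inj₁ (j , eq))        = ⊥-elim (below-1 (trans (cong (dot g) eq) (g-e j)))
    go (inj₂ (inj₂ l))        = l
    go (inj₂ (inj₁ (j , eq))) = which (i Fin.≟ j)
      where
      which : Dec (i ≡ j) → dot g a ≡ 0ℚ
      -- Here `ga` evaluates to 1 - 1 = 0, so the case yields the claim and does not have to be
      -- refuted.
      which (yes refl) = trans ga (trans (cong (λ z → 1ℚ + coord i z) eq) (cong (1ℚ +_) (coord-neg-e i)))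
      which (no i≢j)   = ⊥-elim (ℚP.<-irrefl (trans (cong (coord i) eq) (trans (dot-neg (e* i) (e j)) (cong -_ (e*e-≢ i≢j)))) (N.apex<0 i))

-- Supports of the vertices on {g = 0}

module Blocks {d : ℕ} (V : List (Pt (suc d))) (reflexive : Reflexive V) (simplicial : Simplicial V)
  (O : Symmetric.Opposite V reflexive simplicial) where

  open Facets V reflexive simplicial public
  open Symmetric V reflexive simplicial public
  open TwoSides V reflexive simplicial O public
  module F = TwoSides V reflexive simplicial (flip O)

  -- Since the coordinates of y add up to 0, one of them, at `j₀`, is -1, and there x is 1 by
  -- `opposite-negative`. So the signs of x and y are opposite at i and, the other way round, at
  -- `j₀`; from these two indices `opposite-negative`, for F and for -F, transfers every nonzero
  -- coordinate to the other vertex with reversed sign.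
  antipodal : ∀ {x y i} → Level0 x → Level0 y → coord i x ≡ - 1ℚ → coord i y ≡ 1ℚ → y ≡ negQ x
  antipodal {x} {y} {i} X Y xi yi = dot-ext-dual e-dual λ j → trans (mirror j (coordinate X j) (coordinate Y j)) (sym (dot-neg (e* j) x))
    where
    swapped : ∀ {a b j} → Level0 a → Level0 b → coord j a ≡ - 1ℚ → coord j b ≡ 1ℚ → ∀ {k} → coord k a ≡ 1ℚ → coord k b ≡ - 1ℚ
    swapped A B aj bj ak = unflip-coord-≡ (F.opposite-negative (flip-Level0 B) (flip-Level0 A)
      (flip-coord-≡ bj) (flip-coord-≡ aj) (flip-coord-≡ ak))
    j₀ : Fin (suc d)
    j₀ = proj₁ (negative-exists Y yi)
    yk : coord j₀ y ≡ - 1ℚ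
    yk = proj₂ (negative-exists Y yi)
    xk : coord j₀ x ≡ 1ℚ
    xk = opposite-negative X Y xi yi yk
    mirror : ∀ j → Coordinate j x → Coordinate j y → coord j y ≡ - coord j x
    mirror j (minus eq _) _ = trans (opposite-negative Y X yk xk eq) (cong -_ (sym eq))
    mirror j (plus eq _)  _ = trans (swapped X Y xi yi eq) (cong -_ (sym eq))
    mirror j (none eq) (none eq') = trans eq' (cong -_ (sym eq))
    mirror j (none eq) (minus eq' _) = ⊥-elim (0≢1 (trans (sym eq) (opposite-negative X Y xi yi eq')))
    mirror j (none eq) (plus eq' _)  = ⊥-elim (-1≢0 (trans (sym (swapped Y X yk xk eq')) eq))

  -- At a common support index the signs are equal, and the vertex with that sign is unique, or
  -- different, and the vertices are antipodal. Hence supports are equal or disjoint.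
  related : ∀ {x y i} → Level0 x → Level0 y → coord i x ≢ 0ℚ → coord i y ≢ 0ℚ → y ≡ x ⊎ y ≡ negQ x
  related {x} {y} {i} X Y xi yi = go (coordinate X i) (coordinate Y i)
    where
    <0 : ∀ {z} → coord i z ≡ - 1ℚ → coord i z < 0ℚ
    <0 eq = subst (_< 0ℚ) (sym eq) -1<0
    F<0 : ∀ {z} → coord i z ≡ 1ℚ → Flip.coord i z < 0ℚ
    F<0 eq = subst (_< 0ℚ) (sym (flip-coord-≡ eq)) -1<0
    go : Coordinate i x → Coordinate i y → y ≡ x ⊎ y ≡ negQ x
    go (none eq)    _            = ⊥-elim (xi eq)
    go _            (none eq)    = ⊥-elim (yi eq)
    go (minus a _)  (minus b _)  = inj₁ (unique-negative Y X (<0 b) (<0 a))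
    go (plus a _)   (plus b _)   = inj₁ (Flip.unique-negative (flip-Level0 Y) (flip-Level0 X) (F<0 b) (F<0 a))
    go (minus a _)  (plus b _)   = inj₂ (antipodal X Y a b)
    go (plus a _)   (minus b _)  = inj₂ (trans (sym (negQ-negQ y)) (cong negQ (sym (antipodal Y X b a))))

  neg-Level0 : ∀ {x} → Level0 x → Extreme P (negQ x) → Level0 (negQ x)
  neg-Level0 {x} (_ , gx) ex = ex , trans (dot-neg g x) (cong -_ gx)

  unflip-Level0 : ∀ {x} → Flip.Level0 x → Level0 x
  unflip-Level0 {x} (ex , l) = ex , trans (sym (neg-neg (dot g x))) (cong -_ (trans (sym (flip-level x)) l))

  2ℚ≢1 : 2ℚ ≢ 1ℚ
  2ℚ≢1 ()

  -- Decided without a search over vertices: if t = 1 at F or at -F, the apex there is a witness,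
  -- and any vertex on {g = 0} with nonzero i-th coordinate forces t = 1 on one of the two sides.
  in-block? : ∀ i → (∃ λ x → Level0 x × coord i x ≢ 0ℚ) ⊎ (∀ {x} → Level0 x → coord i x ≡ 0ℚ)
  in-block? i = go (t-1-or-2 i) (Flip.t-1-or-2 i)
    where
    go : N.t i ≡ 1ℚ ⊎ N.t i ≡ 2ℚ → Flip.N.t i ≡ 1ℚ ⊎ Flip.N.t i ≡ 2ℚ →
      (∃ λ x → Level0 x × coord i x ≢ 0ℚ) ⊎ (∀ {x} → Level0 x → coord i x ≡ 0ℚ)
    go (inj₁ t≡1) _ = inj₁ (N.apex i , apex-Level0 i t≡1 , ℚP.<⇒≢ (N.apex<0 i))
    go _ (inj₁ t≡1) = inj₁ (Flip.N.apex i , unflip-Level0 (F.apex-Level0 i t≡1) , nonzero)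
      where
      nonzero : coord i (Flip.N.apex i) ≢ 0ℚ
      nonzero eq = ℚP.<⇒≢ (Flip.N.apex<0 i) (flip-coord-≡ {x = Flip.N.apex i} eq)
    go (inj₂ t≡2) (inj₂ t'≡2) = inj₂ λ {x} X → absent X (ℚP.<-cmp (coord i x) 0ℚ)
      where
      absent : ∀ {x} → Level0 x → _ → coord i x ≡ 0ℚ
      absent X (tri< neg _ _) = ⊥-elim (2ℚ≢1 (trans (sym t≡2) (NegativeCoordinate.t≡1 (level-0-negative X neg))))
      absent X (tri≈ _ eq _)  = eq
      absent {x} X (tri> _ _ pos) = ⊥-elim (2ℚ≢1 (trans (sym t'≡2) (Flip.NegativeCoordinate.t≡1
        (Flip.level-0-negative (flip-Level0 X) (subst (_< 0ℚ) (sym (flip-coord i x)) (pos-neg pos))))))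

  -- If e_i*(x) = -1, then -x has to be the apex across -e_i seen from -F: t = 1 there produces it
  -- and t = 2 excludes it. For e_i*(x) = 1 the roles of F and -F are exchanged.
  antipode? : ∀ {x i} → Level0 x → coord i x ≢ 0ℚ → Dec (Extreme P (negQ x))
  antipode? {x} {i} X xi = go (coordinate X i)
    where
    go : Coordinate i x → Dec (Extreme P (negQ x))
    go (none eq) = ⊥-elim (xi eq)
    go (minus eq _) = at (Flip.t-1-or-2 i)
      where
      at : _ → Dec (Extreme P (negQ x))
      at (inj₁ t≡1) = yes (subst (Extreme P) (antipodal X A eq ai) (proj₁ A))
        where
        A : Level0 (Flip.N.apex i)
        A = unflip-Level0 (F.apex-Level0 i t≡1)
        ai : coord i (Flip.N.apex i) ≡ 1ℚ
        ai = unflip-coord-≡ (Flip.NegativeCoordinate.value (Flip.level-0-negative (F.apex-Level0 i t≡1) (Flip.N.apex<0 i)))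
      at (inj₂ t≡2) = no λ ex → 2ℚ≢1 (trans (sym t≡2) (Flip.NegativeCoordinate.t≡1 (Flip.level-0-negative (flip-Level0 (neg-Level0 X ex))
        (subst (_< 0ℚ) (sym (trans (flip-coord i (negQ x)) (cong -_ (trans (dot-neg (e* i) x) (cong -_ eq))))) -1<0))))
    go (plus eq _) = at (t-1-or-2 i)
      where
      at : _ → Dec (Extreme P (negQ x))
      at (inj₁ t≡1) = yes (subst (Extreme P) (trans (sym (negQ-negQ _)) (cong negQ (sym (antipodal A X ai eq)))) (proj₁ A))
        where
        A : Level0 (N.apex i)
        A = apex-Level0 i t≡1
        ai : coord i (N.apex i) ≡ - 1ℚ
        ai = NegativeCoordinate.value (level-0-negative A (N.apex<0 i))
      at (inj₂ t≡2) = no λ ex → 2ℚ≢1 (trans (sym t≡2) (NegativeCoordinate.t≡1 (level-0-negative (neg-Level0 X ex)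
        (subst (_< 0ℚ) (sym (trans (dot-neg (e* i) x) (cong -_ eq))) -1<0))))

-- Lattice bases

-- Bézout's identity for the cofactors a', b' instead of a, b. This form survives a = b = 0 and
-- makes the matrix with rows (p, q) and (-b', a') unimodular in all cases.
record Bezout (a b : ℚ) : Set where
  field
    g a' b' p q : ℚ
    Int-a'  : IsInt a'
    Int-b'  : IsInt b'
    Int-p   : IsInt p
    Int-q   : IsInt q
    a≡      : a ≡ a' * g
    b≡      : b ≡ b' * g
    bezout  : p * a' + q * b' ≡ 1ℚ

opaque
  bezout-fuel : (fuel : ℕ) (a b : ℤ) → ℤ.∣ b ∣ ℕ.≤ fuel → Bezout (fromℤ a) (fromℤ b)
  bezout-zero : (a : ℤ) → Bezout (fromℤ a) (fromℤ (ℤ.+ 0))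
  bezout-step : (fuel : ℕ) (a b : ℤ) .{{_ : ℤ.NonZero b}} → ℤ.∣ b ∣ ℕ.≤ suc fuel → Bezout (fromℤ a) (fromℤ b)

  bezout-zero a = record { g = fromℤ a ; a' = 1ℚ ; b' = 0ℚ ; p = 1ℚ ; q = 0ℚ ; Int-a' = Int-1 ; Int-b' = Int-0
    ; Int-p = Int-1 ; Int-q = Int-0 ; a≡ = sym (ℚP.*-identityˡ (fromℤ a)) ; b≡ = sym (ℚP.*-zeroˡ (fromℤ a)) ; bezout = refl }

  bezout-step fuel a b ∣b∣≤ = record
    { g = g ; a' = c * a' + b' ; b' = a' ; p = q ; q = p - q * c
    ; Int-a' = Int-+ (Int-* (a ℤ./ b , refl) Int-a') Int-b' ; Int-b' = Int-a' ; Int-p = Int-q ; Int-q = Int-sub Int-p (Int-* Int-q (a ℤ./ b , refl))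
    ; a≡ = trans (cong fromℤ (a≡a%n+[a/n]*n a b)) (trans (fromℤ-+ r ((a ℤ./ b) ℤ.* b)) (trans (cong₂ _+_ b≡ (trans (fromℤ-* (a ℤ./ b) b) (cong (c *_) a≡))) (lem₁ b' g c a')))
    ; b≡ = a≡ ; bezout = trans (lem₂ q c a' b' p) bezout }
    where
    r : ℤ
    r = ℤ.+ (a ℤ.% b)
    open Bezout (bezout-fuel fuel b r (ℕP.≤-pred (ℕP.≤-trans (n%d<d a b) ∣b∣≤)))
    c : ℚ
    c = fromℤ (a ℤ./ b)
    lem₁ : ∀ b' g c a' → b' * g + c * (a' * g) ≡ (c * a' + b') * g
    lem₁ = solve-∀ ℚring
    lem₂ : ∀ q c a' b' p → q * (c * a' + b') + (p - q * c) * a' ≡ p * a' + q * b'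
    lem₂ = solve-∀ ℚring

  bezout-fuel fuel a (ℤ.+ zero) h = bezout-zero a
  bezout-fuel (suc fuel) a (ℤ.+ suc b) h = bezout-step fuel a (ℤ.+ suc b) h
  bezout-fuel (suc fuel) a -[1+ b ] h = bezout-step fuel a -[1+ b ] h

Int-bezout : ∀ {a b} → IsInt a → IsInt b → Bezout a b
Int-bezout (a , refl) (b , refl) = bezout-fuel ℤ.∣ b ∣ a b ℕP.≤-refl

lattice-∷ : ∀ {a} {x : QPt n} → IsInt a → IsLattice x → IsLattice (a ∷ x)
lattice-∷ ha hx = int-lattice λ { zero → ha ; (suc i) → lattice-int hx i }

-- A unimodular change of basis after which only the first entry of `u` may be nonzero; `Γ` is the
-- inverse and again integral.
record Reduction {n : ℕ} (u : QPt (suc n)) : Set where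
  field
    C Γ    : Fin (suc n) → QPt (suc n)
    C-lat  : ∀ j → IsLattice (C j)
    Γ-lat  : ∀ j → IsLattice (Γ j)
    dual   : Dualᶠ Γ C
    kernel : ∀ j → dot u (C (suc j)) ≡ 0ℚ

unit-dual : Dualᶠ (unitQ {n}) unitQ
biorth unit-dual i j = trans (dot-unit i (unitQ j)) (trans (‼-tab (δ j) i) (δ-sym j i))

opaque
  reduce : (u : QPt (suc n)) → IsLattice u → Reduction u
  reduce {zero} u lu = record { C = unitQ ; Γ = unitQ ; C-lat = lattice-unit ; Γ-lat = lattice-unit ; dual = unit-dual ; kernel = λ () }
  reduce {suc n} (u₀ ∷ u) lu = record { C = C' ; Γ = Γ' ; C-lat = C'-lat ; Γ-lat = Γ'-lat ; dual = dual' ; kernel = kernel' }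
    where
    lu' : IsLattice u
    lu' = int-lattice (λ i → lattice-int lu (suc i))
    open Reduction (reduce u lu')
    open Bezout (Int-bezout (lattice-int lu zero) (lattice-dot lu' (C-lat zero)))
    C' Γ' : Fin (suc (suc n)) → QPt (suc (suc n))
    -- By induction the tail of u can be nonzero only at `C zero`. The Bézout matrix mixes this
    -- vector with the new unit vector so that u vanishes on the second of the two results.
    C' zero          = p ∷ scaleQ q (C zero)
    C' (suc zero)    = - b' ∷ scaleQ a' (C zero)
    C' (suc (suc j)) = 0ℚ ∷ C (suc j)
    Γ' zero          = a' ∷ scaleQ b' (Γ zero)
    Γ' (suc zero)    = - q ∷ scaleQ p (Γ zero)
    Γ' (suc (suc j)) = 0ℚ ∷ Γ (suc j)
    C'-lat : ∀ j → IsLattice (C' j)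
    C'-lat zero          = lattice-∷ Int-p (lattice-scale Int-q (C-lat zero))
    C'-lat (suc zero)    = lattice-∷ (Int-neg Int-b') (lattice-scale Int-a' (C-lat zero))
    C'-lat (suc (suc j)) = lattice-∷ Int-0 (C-lat (suc j))
    Γ'-lat : ∀ j → IsLattice (Γ' j)
    Γ'-lat zero          = lattice-∷ Int-a' (lattice-scale Int-b' (Γ-lat zero))
    Γ'-lat (suc zero)    = lattice-∷ (Int-neg Int-q) (lattice-scale Int-p (Γ-lat zero))
    Γ'-lat (suc (suc j)) = lattice-∷ Int-0 (Γ-lat (suc j))
    scale₂ : ∀ s t i j → dot (scaleQ s (Γ i)) (scaleQ t (C j)) ≡ s * (t * δ i j)
    scale₂ s t i j = trans (dot-scaleˡ s (Γ i) (scaleQ t (C j))) (cong (s *_) (trans (dot-scale t (Γ i) (C j)) (cong (t *_) (biorth dual i j))))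
    scaleˡ : ∀ s i j → dot (scaleQ s (Γ i)) (C j) ≡ s * δ i j
    scaleˡ s i j = trans (dot-scaleˡ s (Γ i) (C j)) (cong (s *_) (biorth dual i j))
    scaleʳ : ∀ t i j → dot (Γ i) (scaleQ t (C j)) ≡ t * δ i j
    scaleʳ t i j = trans (dot-scale t (Γ i) (C j)) (cong (t *_) (biorth dual i j))
    eq₀₀ : ∀ a b p q → a * p + b * (q * 1ℚ) ≡ p * a + q * b
    eq₀₀ = solve-∀ ℚring
    eq₀₁ : ∀ a b → a * (- b) + b * (a * 1ℚ) ≡ 0ℚ
    eq₀₁ = solve-∀ ℚring
    eq₁₀ : ∀ p q → (- q) * p + p * (q * 1ℚ) ≡ 0ℚ
    eq₁₀ = solve-∀ ℚring
    eq₁₁ : ∀ a b p q → (- q) * (- b) + p * (a * 1ℚ) ≡ p * a + q * b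
    eq₁₁ = solve-∀ ℚring
    eq-right : ∀ a b → a * 0ℚ + b * 0ℚ ≡ 0ℚ
    eq-right = solve-∀ ℚring
    eq-left : ∀ a b → 0ℚ * a + b * 0ℚ ≡ 0ℚ
    eq-left = solve-∀ ℚring
    dual' : Dualᶠ Γ' C'
    biorth dual' zero          zero          = trans (cong (a' * p +_) (scale₂ b' q zero zero)) (trans (eq₀₀ a' b' p q) bezout)
    biorth dual' zero          (suc zero)    = trans (cong (a' * (- b') +_) (scale₂ b' a' zero zero)) (eq₀₁ a' b')
    biorth dual' zero          (suc (suc j)) = trans (cong (a' * 0ℚ +_) (scaleˡ b' zero (suc j))) (eq-right a' b')
    biorth dual' (suc zero)    zero          = trans (cong ((- q) * p +_) (scale₂ p q zero zero)) (eq₁₀ p q)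
    biorth dual' (suc zero)    (suc zero)    = trans (cong ((- q) * (- b') +_) (scale₂ p a' zero zero)) (trans (eq₁₁ a' b' p q) bezout)
    biorth dual' (suc zero)    (suc (suc j)) = trans (cong ((- q) * 0ℚ +_) (scaleˡ p zero (suc j))) (eq-right (- q) p)
    biorth dual' (suc (suc i)) zero          = trans (cong (0ℚ * p +_) (scaleʳ q (suc i) zero)) (eq-left p q)
    biorth dual' (suc (suc i)) (suc zero)    = trans (cong (0ℚ * (- b') +_) (scaleʳ a' (suc i) zero)) (eq-left (- b') a')
    biorth dual' (suc (suc i)) (suc (suc j)) = trans (cong (0ℚ * 0ℚ +_) (biorth dual (suc i) (suc j))) (trans (ℚP.+-identityˡ (δ (suc i) (suc j))) (sym (δ-suc (suc i) (suc j))))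
    kernel' : ∀ j → dot (u₀ ∷ u) (C' (suc j)) ≡ 0ℚ
    kernel' zero    = trans (cong₂ _+_ (cong (_* (- b')) a≡) (trans (dot-scale a' u (C zero)) (cong (a' *_) b≡))) (lem a' b' g)
      where
      lem : ∀ a b g → a * g * (- b) + a * (b * g) ≡ 0ℚ
      lem = solve-∀ ℚring
    kernel' (suc j) = trans (cong (u₀ * 0ℚ +_) (kernel j)) (trans (ℚP.+-identityʳ (u₀ * 0ℚ)) (ℚP.*-zeroʳ u₀))

-- An integral functional u with value 1 at ε splits the lattice into ℤε and the kernel of u; `B` is
-- a basis of the kernel and `A` are its coordinates, extended by 0 at ε.
record Peel {n : ℕ} (u ε : QPt (suc n)) : Set where
  field
    B A    : Fin n → QPt (suc n)
    B-lat  : ∀ j → IsLattice (B j)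
    A-lat  : ∀ j → IsLattice (A j)
    dual   : Dualᶠ A B
    uB     : ∀ j → dot u (B j) ≡ 0ℚ
    Aε     : ∀ j → dot (A j) ε ≡ 0ℚ

opaque
  peel : {u ε : QPt (suc n)} → IsLattice u → IsLattice ε → dot u ε ≡ 1ℚ → Peel u ε
  peel {n} {u} {ε} lu lε uε = record
    { B = C ∘ suc ; A = A ; B-lat = C-lat ∘ suc
    ; A-lat = λ j → lattice-sub (Γ-lat (suc j)) (lattice-scale (lattice-dot (Γ-lat (suc j)) lε) lu)
    ; dual = dualᶠ λ i j → trans (Ax i (C (suc j))) (trans (cong₂ (λ a b → a - dot (Γ (suc i)) ε * b) (biorth dual (suc i) (suc j)) (kernel j))
        (trans (lem₁ (δ (suc i) (suc j)) (dot (Γ (suc i)) ε)) (δ-suc i j)))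
    ; uB = kernel
    ; Aε = λ j → trans (Ax j ε) (trans (cong (λ b → dot (Γ (suc j)) ε - dot (Γ (suc j)) ε * b) uε) (lem₂ (dot (Γ (suc j)) ε))) }
    where
    open Reduction (reduce u lu)
    A : Fin n → QPt (suc n)
    -- Subtracting the multiple of u makes the functional vanish at ε without changing it on the
    -- kernel of u.
    A j = subQ (Γ (suc j)) (scaleQ (dot (Γ (suc j)) ε) u)
    Ax : ∀ j x → dot (A j) x ≡ dot (Γ (suc j)) x - dot (Γ (suc j)) ε * dot u x
    Ax j x = trans (dot-subˡ (Γ (suc j)) (scaleQ (dot (Γ (suc j)) ε) u) x)
      (cong (λ s → dot (Γ (suc j)) x - s) (dot-scaleˡ (dot (Γ (suc j)) ε) u x))
    lem₁ : ∀ a b → a - b * 0ℚ ≡ a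
    lem₁ = solve-∀ ℚring
    lem₂ : ∀ a → a - a * 1ℚ ≡ 0ℚ
    lem₂ = solve-∀ ℚring

-- B is a lattice basis of the common kernel of the functionals α, and A its dual basis.
record Complement {s d : ℕ} (α b : Fin s → QPt d) : Set where
  field
    rank     : ℕ
    rank-sum : s ℕ.+ rank ≡ d
    B A      : Fin rank → QPt d
    B-lat    : ∀ j → IsLattice (B j)
    A-lat    : ∀ j → IsLattice (A j)
    dual     : Dualᶠ A B
    αB       : ∀ i j → dot (α i) (B j) ≡ 0ℚ
    Ab       : ∀ i j → dot (A j) (b i) ≡ 0ℚ
    split    : ∀ v → v ≡ addQ (comb (λ i → dot (α i) v) b) (comb (λ j → dot (A j) v) B)

comb-dual-comb : {A B : Fin k → QPt n} → Dualᶠ A B → (x y : QPt k) → dot (comb (x ‼_) A) (comb (y ‼_) B) ≡ dot x y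
comb-dual-comb {A = A} {B} dl x y = trans (dot-combˡ (x ‼_) A (comb (y ‼_) B))
  (trans (sumF-cong (λ i → cong (x ‼ i *_) (dual-coeff dl (y ‼_) i))) (sym (dot-sum x y)))

comb-zero : {c : Fin k → ℚ} {e : Fin k → QPt n} → (∀ i → c i ≡ 0ℚ) → comb c e ≡ zeroQ
comb-zero {e = e} h = trans (comb-cong h (λ _ → refl)) (comb-0 e)

comb-add : (c c' : Fin k → ℚ) (e : Fin k → QPt n) → comb (λ i → c i + c' i) e ≡ addQ (comb c e) (comb c' e)
comb-add c c' e = vext λ j → trans (‼-comb (λ i → c i + c' i) e j) (trans (sumF-cong (λ i → ℚP.*-distribʳ-+ (e i ‼ j) (c i) (c' i)))
  (trans (sumF-+ (λ i → c i * e i ‼ j) (λ i → c' i * e i ‼ j)) (sym (trans (‼-add (comb c e) (comb c' e) j) (cong₂ _+_ (‼-comb c e j) (‼-comb c' e j))))))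

comb-scale : (t : ℚ) (c : Fin k → ℚ) (e : Fin k → QPt n) → comb (λ i → t * c i) e ≡ scaleQ t (comb c e)
comb-scale t c e = vext λ j → trans (‼-comb (λ i → t * c i) e j) (trans (sumF-cong (λ i → ℚP.*-assoc t (c i) (e i ‼ j)))
  (trans (sumF-* t (λ i → c i * e i ‼ j)) (sym (trans (‼-scale t (comb c e) j) (cong (t *_) (‼-comb c e j))))))

add-assoc : (x y z : QPt n) → addQ (addQ x y) z ≡ addQ x (addQ y z)
add-assoc = VecP.zipWith-assoc ℚP.+-assoc

add-comm : (x y : QPt n) → addQ x y ≡ addQ y x
add-comm = VecP.zipWith-comm ℚP.+-comm

opaque
  -- One functional is peeled off at a time inside the common kernel of the others: b_0 lies in that
  -- kernel, and `u` and `ε` are α_0 and b_0 expressed in its lattice basis.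
  complement : ∀ {s d} {α b : Fin s → QPt d} → (∀ i → IsLattice (α i)) → (∀ i → IsLattice (b i)) → Dualᶠ α b → Complement α b
  complement {zero} {d} {α} {b} lα lb dl = record
    { rank = d ; rank-sum = refl ; B = unitQ ; A = unitQ ; B-lat = lattice-unit ; A-lat = lattice-unit ; dual = unit-dual
    ; αB = λ () ; Ab = λ ()
    ; split = λ v → sym (trans (cong₂ addQ (comb-zero {c = λ i → dot (α i) v} (λ ())) (trans (comb-cong (λ j → dot-unit j v) (λ _ → refl)) (comb-unit v))) (add-zeroˡ v)) }
  complement {suc s} {d} {α} {b} lα lb dl = extend-step (complement {s} (lα ∘ suc) (lb ∘ suc) tail-dual)
    where
    tail-dual : Dualᶠ (α ∘ suc) (b ∘ suc)
    biorth tail-dual i j = trans (biorth dl (suc i) (suc j)) (δ-suc i j)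
    extend-step : Complement (α ∘ suc) (b ∘ suc) → Complement α b
    extend-step record { rank = rank ; rank-sum = rank-sum ; B = B ; A = A ; B-lat = B-lat ; A-lat = A-lat ; dual = dual ; αB = αB ; Ab = Ab ; split = split }
      = finish rank refl
      where
      b₀-split : b zero ≡ comb (λ j → dot (A j) (b zero)) B
      b₀-split = trans (split (b zero)) (trans (cong (λ z → addQ z (comb (λ j → dot (A j) (b zero)) B))
        (comb-zero (λ i → biorth dl (suc i) zero))) (add-zeroˡ _))
      finish : ∀ r → rank ≡ r → Complement α b
      -- In a kernel of rank 0 the vector b_0 would be 0, although α_0(b_0) = 1.
      finish zero refl = ⊥-elim (0≢1 (trans (sym (trans (cong (dot (α zero)) (trans b₀-split (comb-zero {c = λ j → dot (A j) (b zero)} (λ ())))) (dot-zero (α zero)))) (biorth dl zero zero)))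
      finish (suc r) refl = record
        { rank = r ; rank-sum = trans (sym (ℕP.+-suc s r)) rank-sum
        ; B = B' ; A = A'
        ; B-lat = λ j → lattice-comb (P.B j ‼_) B (lattice-int (P.B-lat j)) B-lat
        ; A-lat = λ j → lattice-comb (P.A j ‼_) A (lattice-int (P.A-lat j)) A-lat
        ; dual = dualᶠ λ i j → trans (comb-dual-comb dual (P.A i) (P.B j)) (biorth P.dual i j)
        ; αB = αB' ; Ab = Ab' ; split = split' }
        where
        u ε : QPt (suc r)
        u = Vec.tabulate (λ j → dot (α zero) (B j))
        ε = Vec.tabulate (λ j → dot (A j) (b zero))
        u-value : ∀ y → dot u y ≡ dot (α zero) (comb (y ‼_) B)
        u-value y = trans (dot-sum u y) (trans (sumF-cong (λ j → trans (cong (_* y ‼ j) (‼-tab (λ j → dot (α zero) (B j)) j)) (ℚP.*-comm (dot (α zero) (B j)) (y ‼ j))))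
          (sym (dot-comb (α zero) (y ‼_) B)))
        ε-comb : comb (ε ‼_) B ≡ b zero
        ε-comb = trans (comb-cong (‼-tab (λ j → dot (A j) (b zero))) (λ _ → refl)) (sym b₀-split)
        uε : dot u ε ≡ 1ℚ
        uε = trans (u-value ε) (trans (cong (dot (α zero)) ε-comb) (biorth dl zero zero))
        P : Peel u ε
        P = peel (int-lattice λ j → Int-cast (sym (‼-tab (λ j → dot (α zero) (B j)) j)) (lattice-dot (lα zero) (B-lat j)))
                 (int-lattice λ j → Int-cast (sym (‼-tab (λ j → dot (A j) (b zero)) j)) (lattice-dot (A-lat j) (lb zero))) uε
        module P = Peel P
        B' A' : Fin r → QPt d
        B' j = comb (P.B j ‼_) B
        A' j = comb (P.A j ‼_) A
        αB' : ∀ i j → dot (α i) (B' j) ≡ 0ℚ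
        αB' zero    j = trans (sym (u-value (P.B j))) (P.uB j)
        αB' (suc i) j = trans (dot-comb (α (suc i)) (P.B j ‼_) B) (sumF-zero (λ l → trans (cong (P.B j ‼ l *_) (αB i l)) (ℚP.*-zeroʳ (P.B j ‼ l))))
        Ab' : ∀ i j → dot (A' j) (b i) ≡ 0ℚ
        Ab' zero    j = trans (dot-combˡ (P.A j ‼_) A (b zero)) (trans (sumF-cong (λ l → cong (P.A j ‼ l *_) (sym (‼-tab (λ j → dot (A j) (b zero)) l))))
          (trans (sym (dot-sum (P.A j) ε)) (P.Aε j)))
        Ab' (suc i) j = trans (dot-combˡ (P.A j ‼_) A (b (suc i))) (sumF-zero (λ l → trans (cong (P.A j ‼ l *_) (Ab i l)) (ℚP.*-zeroʳ (P.A j ‼ l))))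
        peel-dual : Dualᶠ (u ∷ᶠ P.A) (ε ∷ᶠ P.B)
        biorth peel-dual zero    zero    = uε
        biorth peel-dual zero    (suc j) = P.uB j
        biorth peel-dual (suc i) zero    = P.Aε i
        biorth peel-dual (suc i) (suc j) = trans (biorth P.dual i j) (sym (δ-suc i j))
        split' : ∀ v → v ≡ addQ (comb (λ i → dot (α i) v) b) (comb (λ j → dot (A' j) v) B')
        split' v = begin
          v                                                                           ≡⟨ split v ⟩
          addQ vb (comb (λ j → dot (A j) v) B)                                        ≡⟨ cong (addQ vb) rest ⟩
          addQ vb (addQ (scaleQ (dot (α zero) v) (b zero)) (comb (λ j → dot (A' j) v) B'))  ≡⟨ sym (add-assoc vb _ _) ⟩
          addQ (addQ vb (scaleQ (dot (α zero) v) (b zero))) (comb (λ j → dot (A' j) v) B')  ≡⟨ cong (λ z → addQ z (comb (λ j → dot (A' j) v) B')) (trans (add-comm vb _)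
                                                                                        (trans (sym (comb-∷ (dot (α zero) v) (λ i → dot (α (suc i)) v) (b zero) (b ∘ suc)))
                                                                                          (comb-cong (λ { zero → refl ; (suc i) → refl }) (λ { zero → refl ; (suc i) → refl })))) ⟩
          addQ (comb (λ i → dot (α i) v) b) (comb (λ j → dot (A' j) v) B')             ∎
          where
          open ≡-Reasoning
          vb : QPt d
          vb = comb (λ i → dot (α (suc i)) v) (b ∘ suc)
          y : QPt (suc r)
          y = Vec.tabulate (λ j → dot (A j) v)
          y‼ : ∀ j → y ‼ j ≡ dot (A j) v
          y‼ = ‼-tab (λ j → dot (A j) v)
          uy : dot u y ≡ dot (α zero) v
          uy = trans (u-value y) (trans (cong (dot (α zero)) (comb-cong y‼ (λ _ → refl))) (sym (trans (cong (dot (α zero)) (split v))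
            (trans (dot-add (α zero) vb (comb (λ j → dot (A j) v) B)) (trans (cong (_+ dot (α zero) (comb (λ j → dot (A j) v) B))
              (trans (dot-comb (α zero) (λ i → dot (α (suc i)) v) (b ∘ suc)) (sumF-zero (λ i → trans (cong (dot (α (suc i)) v *_) (biorth dl zero (suc i))) (ℚP.*-zeroʳ (dot (α (suc i)) v))))))
              (ℚP.+-identityˡ _))))))
          Ay : ∀ j → dot (P.A j) y ≡ dot (A' j) v
          Ay j = trans (dot-sum (P.A j) y) (trans (sumF-cong (λ l → cong (P.A j ‼ l *_) (y‼ l))) (sym (dot-combˡ (P.A j ‼_) A v)))
          y-split : ∀ l → dot (A l) v ≡ dot (α zero) v * ε ‼ l + comb (λ j → dot (A' j) v) P.B ‼ l
          y-split l = trans (sym (y‼ l)) (trans (cong (_‼ l) (sym (dual-complete peel-dual y))) (trans (cong (_‼ l) (trans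
              (comb-cong {c' = dot (α zero) v ∷ᶠ λ j → dot (A' j) v} (λ { zero → uy ; (suc j) → Ay j }) (λ _ → refl))
              (comb-∷ (dot (α zero) v) (λ j → dot (A' j) v) ε P.B)))
            (trans (‼-add (scaleQ (dot (α zero) v) ε) (comb (λ j → dot (A' j) v) P.B) l) (cong (_+ comb (λ j → dot (A' j) v) P.B ‼ l) (‼-scale (dot (α zero) v) ε l)))))
          rest : comb (λ j → dot (A j) v) B ≡ addQ (scaleQ (dot (α zero) v) (b zero)) (comb (λ j → dot (A' j) v) B')
          rest = begin
            comb (λ j → dot (A j) v) B
              ≡⟨ comb-cong y-split (λ _ → refl) ⟩
            comb (λ l → dot (α zero) v * ε ‼ l + comb (λ j → dot (A' j) v) P.B ‼ l) B
              ≡⟨ comb-add (λ l → dot (α zero) v * ε ‼ l) (comb (λ j → dot (A' j) v) P.B ‼_) B ⟩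
            addQ (comb (λ l → dot (α zero) v * ε ‼ l) B) (comb (comb (λ j → dot (A' j) v) P.B ‼_) B)
              ≡⟨ cong₂ addQ (trans (comb-scale (dot (α zero) v) (ε ‼_) B) (cong (scaleQ (dot (α zero) v)) ε-comb))
                            (trans (comb-cong (‼-comb (λ j → dot (A' j) v) P.B) (λ _ → refl)) (sym (comb-comb (λ j → dot (A' j) v) (λ j → P.B j ‼_) B))) ⟩
            addQ (scaleQ (dot (α zero) v) (b zero)) (comb (λ j → dot (A' j) v) B')
              ∎

-- Isomorphisms of polytopes

-- Lattice isomorphisms are kept as functions that commute with `comb`, so that projections,
-- embeddings and dual coordinates compose freely. Matrices occur only in the passage from and to
-- `Iso`.
record LinIso (m n : ℕ) : Set where
  field
    f      : QPt m → QPt n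
    g      : QPt n → QPt m
    f-comb : ∀ {k} (c : Fin k → ℚ) (e : Fin k → QPt m) → f (comb c e) ≡ comb c (f ∘ e)
    g-comb : ∀ {k} (c : Fin k → ℚ) (e : Fin k → QPt n) → g (comb c e) ≡ comb c (g ∘ e)
    gf     : ∀ x → g (f x) ≡ x
    fg     : ∀ y → f (g y) ≡ y
    f-lat  : ∀ {x} → IsLattice x → IsLattice (f x)
    g-lat  : ∀ {y} → IsLattice y → IsLattice (g y)

LinIso-sym : LinIso m n → LinIso n m
LinIso-sym L = record { f = g ; g = f ; f-comb = g-comb ; g-comb = f-comb ; gf = fg ; fg = gf ; f-lat = g-lat ; g-lat = f-lat }
  where open LinIso L

Linear : (QPt m → QPt n) → Set
Linear {m} f = ∀ {k} (c : Fin k → ℚ) (e : Fin k → QPt m) → f (comb c e) ≡ comb c (f ∘ e)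

linear-conv : {f : QPt m → QPt n} → Linear f → {w : Fin k → QPt m} {x : QPt m} → Conv w x → Conv (f ∘ w) (f x)
linear-conv lin (conv c h s refl) = conv c h s (sym (lin c _))

linear-convex : {f : QPt m → QPt n} → Linear f → {Q : QSet n} → Convex Q → Convex (Q ∘ f)
linear-convex {f = f} lin convex w h c = convex (f ∘ w) h (linear-conv lin c)

neg-comb : (x : QPt n) → negQ x ≡ comb {1} (λ _ → - 1ℚ) (λ _ → x)
neg-comb x = vext λ j → trans (‼-neg x j) (trans (lem (x ‼ j)) (sym (‼-comb (λ _ → - 1ℚ) (λ _ → x) j)))
  where
  lem : ∀ a → - a ≡ (- 1ℚ) * a + 0ℚ
  lem = solve-∀ ℚring

linear-neg : {f : QPt m → QPt n} → Linear f → ∀ x → f (negQ x) ≡ negQ (f x)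
linear-neg {f = f} lin x = trans (cong f (neg-comb x)) (trans (lin (λ _ → - 1ℚ) (λ _ → x)) (sym (neg-comb (f x))))

linear-zero : {f : QPt m → QPt n} → Linear f → f zeroQ ≡ zeroQ
linear-zero {f = f} lin = trans (cong f (sym (comb-0 {0} λ ()))) (trans (lin {0} (λ _ → 0ℚ) (λ ())) (comb-0 _))

scale-comb : (t : ℚ) (x : QPt n) → scaleQ t x ≡ comb {1} (λ _ → t) (λ _ → x)
scale-comb t x = vext λ j → trans (‼-scale t x j) (trans (sym (ℚP.+-identityʳ (t * x ‼ j))) (sym (‼-comb (λ _ → t) (λ _ → x) j)))

linear-scale : {f : QPt m → QPt n} → Linear f → ∀ t x → f (scaleQ t x) ≡ scaleQ t (f x)
linear-scale {f = f} lin t x = trans (cong f (scale-comb t x)) (trans (lin (λ _ → t) (λ _ → x)) (sym (scale-comb t (f x))))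

mid-comb : (x y : QPt n) → midpoint x y ≡ comb (λ _ → ½) (x ∷ᶠ λ (_ : Fin 1) → y)
mid-comb x y = vext λ j → trans (‼-scale ½ (addQ x y) j) (trans (cong (½ *_) (‼-add x y j)) (trans (lem (x ‼ j) (y ‼ j)) (sym (‼-comb (λ _ → ½) (x ∷ᶠ λ (_ : Fin 1) → y) j))))
  where
  lem : ∀ a b → ½ * (a + b) ≡ ½ * a + (½ * b + 0ℚ)
  lem = solve-∀ ℚring

linear-mid : {f : QPt m → QPt n} → Linear f → ∀ x y → f (midpoint x y) ≡ midpoint (f x) (f y)
linear-mid {f = f} lin x y = trans (cong f (mid-comb x y)) (trans (lin (λ _ → ½) (x ∷ᶠ λ _ → y)) (trans (comb-cong (λ _ → refl) (λ { zero → refl ; (suc _) → refl })) (sym (mid-comb (f x) (f y)))))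

-- The transpose of `g`. It keeps functionals integral if `g` preserves the lattice, which is how
-- integrality is carried between a polytope and its factors.
pullback : (QPt m → QPt n) → QPt n → QPt m
pullback g u = Vec.tabulate (λ j → dot u (g (unitQ j)))

dot-pullback : {g : QPt m → QPt n} → Linear g → ∀ u x → dot (pullback g u) x ≡ dot u (g x)
dot-pullback {g = g} lin u x = begin
  dot (pullback g u) x                         ≡⟨ dot-sum (pullback g u) x ⟩
  sumF (λ j → pullback g u ‼ j * x ‼ j)        ≡⟨ sumF-cong (λ j → trans (cong (_* x ‼ j) (‼-tab (λ j → dot u (g (unitQ j))) j)) (ℚP.*-comm (dot u (g (unitQ j))) (x ‼ j))) ⟩
  sumF (λ j → x ‼ j * dot u (g (unitQ j)))     ≡⟨ sym (dot-comb u (x ‼_) (g ∘ unitQ)) ⟩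
  dot u (comb (x ‼_) (g ∘ unitQ))              ≡⟨ cong (dot u) (trans (sym (lin (x ‼_) unitQ)) (cong g (comb-unit x))) ⟩
  dot u (g x)                                  ∎
  where open ≡-Reasoning

pullback-lattice : {g : QPt m → QPt n} → (∀ {x} → IsLattice x → IsLattice (g x)) → ∀ {u} → IsLattice u → IsLattice (pullback g u)
pullback-lattice {g = g} lat {u} lu = int-lattice λ j → Int-cast (sym (‼-tab (λ j → dot u (g (unitQ j))) j)) (lattice-dot lu (lat (lattice-unit j)))

record PolyIso {m n : ℕ} (P : QSet m) (Q : QSet n) : Set where
  field
    iso  : LinIso m n
    into : ∀ {x} → P x → Q (LinIso.f iso x)
    back : ∀ {y} → Q y → P (LinIso.g iso y)
  open LinIso iso public

PolyIso-sym : {P : QSet m} {Q : QSet n} → PolyIso P Q → PolyIso Q P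
PolyIso-sym I = record { iso = LinIso-sym (PolyIso.iso I) ; into = PolyIso.back I ; back = PolyIso.into I }

iso-extreme : {P : QSet m} {Q : QSet n} (I : PolyIso P Q) → ∀ {x} → Extreme P x → Extreme Q (PolyIso.f I x)
iso-extreme {P = P} {Q} I {x} (Px , ext) = into Px , λ a b Qa Qb e → trans (sym (fg a)) (cong f
  (ext (g a) (g b) (back Qa) (back Qb) (trans (sym (gf x)) (trans (cong g e) (linear-mid g-comb a b)))))
  where open PolyIso I

dotℤ-fromℤ : (x y : Pt n) → fromℤ (dotℤ x y) ≡ dot (toℚ x) (toℚ y)
dotℤ-fromℤ []      []      = refl
dotℤ-fromℤ (a ∷ x) (b ∷ y) = trans (fromℤ-+ (a ℤ.* b) (dotℤ x y)) (cong₂ _+_ (fromℤ-* a b) (dotℤ-fromℤ x y))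

‼-transpose : {A : Set} (M : Vec (Vec A n) m) (i : Fin m) (j : Fin n) → Vec.transpose M ‼ j ‼ i ≡ M ‼ i ‼ j
‼-transpose {n} {suc m} {A} (r ∷ M) i j = trans (cong (_‼ i) row) (step i)
  where
  cons : A → Vec A m → Vec A (suc m)
  cons = _∷_
  row : Vec.transpose (r ∷ M) ‼ j ≡ r ‼ j ∷ Vec.transpose M ‼ j
  row = trans (VecP.lookup-⊛ j (Vec.replicate n cons Vec.⊛ r) (Vec.transpose M))
    (cong (λ h → h (Vec.transpose M ‼ j)) (trans (VecP.lookup-⊛ j (Vec.replicate n cons) r) (cong (λ h → h (r ‼ j)) (VecP.lookup-replicate j cons))))
  step : ∀ i → (r ‼ j ∷ Vec.transpose M ‼ j) ‼ i ≡ (r ∷ M) ‼ i ‼ j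
  step zero    = refl
  step (suc i) = ‼-transpose M i j

‼-matMul : (A B : Mat n) (i j : Fin n) → matMul A B ‼ i ‼ j ≡ dotℤ (A ‼ i) (Vec.transpose B ‼ j)
‼-matMul A B i j = trans (cong (_‼ j) (VecP.lookup-map i (λ row → Vec.map (dotℤ row) (Vec.transpose B)) A))
  (VecP.lookup-map j (dotℤ (A ‼ i)) (Vec.transpose B))

‼-apply : (A : Mat n) (x : QPt n) (i : Fin n) → applyQ A x ‼ i ≡ dot (toℚ (A ‼ i)) x
‼-apply A x i = VecP.lookup-map i (λ row → dot (toℚ row) x) A

apply-linear : (A : Mat n) → Linear (applyQ A)
apply-linear A c e = vext λ i → trans (‼-apply A (comb c e) i) (trans (dot-comb (toℚ (A ‼ i)) c e)
  (trans (sumF-cong (λ j → cong (c j *_) (sym (‼-apply A (e j) i)))) (sym (‼-comb c (applyQ A ∘ e) i))))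

apply-lattice : (A : Mat n) {x : QPt n} → IsLattice x → IsLattice (applyQ A x)
apply-lattice A {x} lx = int-lattice λ i → Int-cast (sym (‼-apply A x i)) (lattice-dot (A ‼ i , refl) lx)

apply-unit : (A : Mat n) (i j : Fin n) → applyQ A (unitQ j) ‼ i ≡ fromℤ (A ‼ i ‼ j)
apply-unit A i j = trans (‼-apply A (unitQ j) i) (trans (dot-unitʳ (toℚ (A ‼ i)) j) (‼-toℚ (A ‼ i) j))

matMul-entry : (A B : Mat n) (i j : Fin n) → fromℤ (matMul A B ‼ i ‼ j) ≡ applyQ A (applyQ B (unitQ j)) ‼ i
matMul-entry A B i j = begin
  fromℤ (matMul A B ‼ i ‼ j)                            ≡⟨ cong fromℤ (‼-matMul A B i j) ⟩
  fromℤ (dotℤ (A ‼ i) (Vec.transpose B ‼ j))            ≡⟨ dotℤ-fromℤ (A ‼ i) (Vec.transpose B ‼ j) ⟩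
  dot (toℚ (A ‼ i)) (toℚ (Vec.transpose B ‼ j))         ≡⟨ cong (dot (toℚ (A ‼ i))) (vext λ l → trans (‼-toℚ (Vec.transpose B ‼ j) l)
                                                             (trans (cong fromℤ (‼-transpose B l j)) (sym (apply-unit B l j)))) ⟩
  dot (toℚ (A ‼ i)) (applyQ B (unitQ j))                ≡⟨ sym (‼-apply A (applyQ B (unitQ j)) i) ⟩
  applyQ A (applyQ B (unitQ j)) ‼ i                     ∎
  where open ≡-Reasoning

fromℤ-idMat : (i j : Fin n) → fromℤ (idMat ‼ i ‼ j) ≡ δ i j
fromℤ-idMat {n} i j = trans (cong fromℤ (trans (cong (_‼ j) (‼-tab (λ i → Vec.tabulate (λ j → if does (i Fin.≟ j) then ℤ.+ 1 else ℤ.+ 0)) i))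
    (‼-tab (λ j → if does (i Fin.≟ j) then ℤ.+ 1 else ℤ.+ 0) j))) (go (i Fin.≟ j))
  where
  go : (D : Dec (i ≡ j)) → fromℤ (if does D then ℤ.+ 1 else ℤ.+ 0) ≡ (if does D then 1ℚ else 0ℚ)
  go (yes _) = refl
  go (no _)  = refl

linear-ext : {f g : QPt m → QPt n} → Linear f → Linear g → (∀ j → f (unitQ j) ≡ g (unitQ j)) → ∀ x → f x ≡ g x
linear-ext {f = f} {g} lf lg h x = trans (cong f (sym (comb-unit x))) (trans (lf (x ‼_) unitQ)
  (trans (comb-cong (λ _ → refl) h) (trans (sym (lg (x ‼_) unitQ)) (cong g (comb-unit x)))))

∘-linear : {f : QPt m → QPt n} {g : QPt l → QPt m} → Linear f → Linear g → Linear (f ∘ g)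
∘-linear {f = f} {g} lf lg c e = trans (cong f (lg c e)) (lf c (g ∘ e))

id-linear : Linear (id {A = QPt n})
id-linear c e = refl

inverse-matrices : (A B : Mat n) → matMul A B ≡ idMat → ∀ x → applyQ A (applyQ B x) ≡ x
inverse-matrices A B h = linear-ext {f = applyQ A ∘ applyQ B} {id} (∘-linear {f = applyQ A} {applyQ B} (apply-linear A) (apply-linear B)) id-linear λ j → vext λ i →
  trans (sym (matMul-entry A B i j)) (trans (cong (λ M → fromℤ (M ‼ i ‼ j)) h) (trans (fromℤ-idMat i j) (trans (δ-sym i j) (sym (‼-tab (δ j) i)))))

fromIso : {V W : List (Pt n)} → Iso V W → PolyIso ⟦ V ⟧ ⟦ W ⟧
fromIso {V = V} {W} (A , B , AB , BA , h) = record
  { iso = record { f = applyQ A ; g = applyQ B ; f-comb = apply-linear A ; g-comb = apply-linear B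
                 ; gf = inverse-matrices B A BA ; fg = inverse-matrices A B AB ; f-lat = apply-lattice A ; g-lat = apply-lattice B }
  ; into = λ {x} → proj₁ (h x)
  ; back = λ {y} Wy → proj₂ (h (applyQ B y)) (subst ⟦ W ⟧ (sym (inverse-matrices A B AB y)) Wy) }

fromIsoP : {V : List (Pt m)} {W : List (Pt n)} → IsoP (m , V) (n , W) → PolyIso ⟦ V ⟧ ⟦ W ⟧
fromIsoP {V = V} {W} (refl , I) = fromIso {V = V} {W} I

LinIso-≤ : LinIso m n → m ℕ.≤ n
LinIso-≤ {m} {n} L = indep-≤ {e = f ∘ unitQ} λ c h i → trans (sym (dual-coeff (unit-dual) c i))
  (trans (cong (dot (unitQ i)) (trans (sym (gf (comb c unitQ))) (trans (cong g (trans (f-comb c unitQ) h)) (linear-zero {f = g} g-comb)))) (dot-zero (unitQ i)))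
  where open LinIso L

matrix : {f : QPt n → QPt n} → (∀ {x} → IsLattice x → IsLattice (f x)) → Mat n
matrix {f = f} lat = Vec.tabulate λ i → Vec.tabulate λ j → proj₁ (lattice-int (lat (lattice-unit j)) i)

apply-matrix : {f : QPt n → QPt n} → Linear f → (lat : ∀ {x} → IsLattice x → IsLattice (f x)) → ∀ x → applyQ (matrix {f = f} lat) x ≡ f x
apply-matrix {n} {f} lin lat = linear-ext {f = applyQ (matrix {f = f} lat)} {f} (apply-linear (matrix {f = f} lat)) lin λ j → vext λ i → trans (apply-unit (matrix {f = f} lat) i j)
  (trans (cong fromℤ (trans (cong (_‼ j) (‼-tab (λ i → Vec.tabulate λ j → entry i j) i)) (‼-tab (entry i) j))) (proj₂ (lattice-int (lat (lattice-unit j)) i)))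
  where
  entry : Fin n → Fin n → ℤ
  entry i j = proj₁ (lattice-int (lat (lattice-unit j)) i)

matrix-inverse : {f g : QPt n → QPt n} → Linear f → Linear g → (lf : ∀ {x} → IsLattice x → IsLattice (f x)) (lg : ∀ {x} → IsLattice x → IsLattice (g x)) →
  (∀ x → f (g x) ≡ x) → matMul (matrix {f = f} lf) (matrix {f = g} lg) ≡ idMat
matrix-inverse {f = f} {g} linf ling lf lg fg = vext λ i → vext λ j → fromℤ-injective (begin
  fromℤ (matMul Mf Mg ‼ i ‼ j)                   ≡⟨ matMul-entry Mf Mg i j ⟩
  applyQ Mf (applyQ Mg (unitQ j)) ‼ i            ≡⟨ cong (_‼ i) (trans (apply-matrix linf lf _) (trans (cong f (apply-matrix ling lg (unitQ j))) (fg (unitQ j)))) ⟩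
  unitQ j ‼ i                                    ≡⟨ trans (‼-tab (δ j) i) (δ-sym j i) ⟩
  δ i j                                          ≡⟨ sym (fromℤ-idMat i j) ⟩
  fromℤ (idMat ‼ i ‼ j)                          ∎)
  where
  open ≡-Reasoning
  Mf = matrix {f = f} lf
  Mg = matrix {f = g} lg

toIso : {V W : List (Pt n)} → PolyIso ⟦ V ⟧ ⟦ W ⟧ → Iso V W
toIso {V = V} {W} I = matrix {f = f} f-lat , matrix {f = g} g-lat , matrix-inverse f-comb g-comb f-lat g-lat fg , matrix-inverse g-comb f-comb g-lat f-lat gf ,
  λ x → (λ Vx → subst ⟦ W ⟧ (sym (apply-matrix f-comb f-lat x)) (into Vx)) ,
        (λ Wx → subst ⟦ V ⟧ (gf x) (back (subst ⟦ W ⟧ (apply-matrix f-comb f-lat x) Wx)))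
  where open PolyIso I

-- `IsoP` demands an equation of dimensions. It follows from the isomorphism, which sends unit
-- vectors to independent vectors in both directions.
toIsoP : {V : List (Pt m)} {W : List (Pt n)} → PolyIso ⟦ V ⟧ ⟦ W ⟧ → IsoP (m , V) (n , W)
toIsoP {V = V} {W} I = go (ℕP.≤-antisym (LinIso-≤ (PolyIso.iso I)) (LinIso-≤ (LinIso-sym (PolyIso.iso I)))) V W I
  where
  go : ∀ {m n} → m ≡ n → (V : List (Pt m)) (W : List (Pt n)) → PolyIso ⟦ V ⟧ ⟦ W ⟧ → IsoP (m , V) (n , W)
  go refl V W I = refl , toIso {V = V} {W} I

-- The crosspolytope factor

unique-lookup : {A : Set} {xs : List A} → Unique xs → ∀ {i j} → List.lookup xs i ≡ List.lookup xs j → i ≡ j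
unique-lookup {xs = x ∷ xs} (x∉ AllPairs.∷ u) {zero}  {zero}  e = refl
unique-lookup {xs = x ∷ xs} (x∉ AllPairs.∷ u) {zero}  {suc j} e = ⊥-elim (All.lookup x∉ (∈-lookup j) e)
unique-lookup {xs = x ∷ xs} (x∉ AllPairs.∷ u) {suc i} {zero}  e = ⊥-elim (All.lookup x∉ (∈-lookup i) (sym e))
unique-lookup {xs = x ∷ xs} (x∉ AllPairs.∷ u) {suc i} {suc j} e = cong suc (unique-lookup u e)

filter-lengths : {A : Set} {Q : A → Set} (Q? : Decidable Q) (xs : List A) →
  List.length (List.filter Q? xs) ℕ.+ List.length (List.filter (¬? ∘ Q?) xs) ≡ List.length xs
filter-lengths Q? [] = refl
filter-lengths Q? (x ∷ xs) with Q? x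
... | yes _ = cong suc (filter-lengths Q? xs)
... | no _  = trans (ℕP.+-suc _ _) (cong suc (filter-lengths Q? xs))

filter-filter : {A : Set} {Q R : A → Set} (Q? : Decidable Q) (R? : Decidable R) → (∀ x → Q x → R x) →
  (xs : List A) → List.filter Q? (List.filter R? xs) ≡ List.filter Q? xs
filter-filter Q? R? h [] = refl
filter-filter Q? R? h (x ∷ xs) with R? x
... | yes _ with Q? x
...   | yes _ = cong (x ∷_) (filter-filter Q? R? h xs)
...   | no _  = filter-filter Q? R? h xs
filter-filter Q? R? h (x ∷ xs) | no ¬r with Q? x
...   | yes q = ⊥-elim (¬r (h x q))
...   | no _  = filter-filter Q? R? h xs

toℚ-neg : (v : Pt n) → toℚ (negℤ v) ≡ negQ (toℚ v)
toℚ-neg v = vext λ i → trans (‼-toℚ (negℤ v) i) (trans (cong fromℤ (VecP.lookup-map i ℤ.-_ v))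
  (trans (fromℤ-neg (v ‼ i)) (trans (cong -_ (sym (‼-toℚ v i))) (sym (‼-neg (toℚ v) i)))))

integral : {x : QPt n} → IsLattice x → Pt n
integral = proj₁

-- As the vectors `B` are integral, a common divisor of the coordinates divides the vector itself.
primitive-coords : (B : Fin m → QPt n) → (∀ j → IsLattice (B j)) → (v : Pt m) (w : Pt n) → comb (toℚ v ‼_) B ≡ toℚ w → Primitive w → Primitive v
primitive-coords {m} {n} B lB v w eq prim c 2≤c div = prim c 2≤c λ t → ∣⇒∣ᵤ {ℤ.+ c} {w ‼ t} (dividesℤ (z t) (fromℤ-injective (begin
  fromℤ (w ‼ t)                                        ≡⟨ trans (sym (‼-toℚ w t)) (trans (cong (_‼ t) (sym eq)) (‼-comb (toℚ v ‼_) B t)) ⟩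
  sumF (λ j → toℚ v ‼ j * B j ‼ t)                     ≡⟨ sumF-cong (λ j → trans (cong (_* B j ‼ t) (trans (‼-toℚ v j) (quotient j))) (lem (fromℤ (q j)) (fromℤ (ℤ.+ c)) (B j ‼ t))) ⟩
  sumF (λ j → fromℤ (q j) * B j ‼ t * fromℤ (ℤ.+ c))   ≡⟨ sumF-*ʳ (fromℤ (ℤ.+ c)) (λ j → fromℤ (q j) * B j ‼ t) ⟩
  sumF (λ j → fromℤ (q j) * B j ‼ t) * fromℤ (ℤ.+ c)   ≡⟨ cong (_* fromℤ (ℤ.+ c)) (sym (proj₂ (int t))) ⟩
  fromℤ (z t) * fromℤ (ℤ.+ c)                          ≡⟨ sym (fromℤ-* (z t) (ℤ.+ c)) ⟩
  fromℤ (z t ℤ.* ℤ.+ c)                                ∎)))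
  where
  open ≡-Reasoning
  open Data.Integer.Divisibility.Signed._∣_ using () renaming (quotient to quot; equality to quot-eq)
  q : Fin m → ℤ
  q j = quot (∣ᵤ⇒∣ {ℤ.+ c} {v ‼ j} (div j))
  quotient : ∀ j → fromℤ (v ‼ j) ≡ fromℤ (q j) * fromℤ (ℤ.+ c)
  quotient j = trans (cong fromℤ (quot-eq (∣ᵤ⇒∣ {ℤ.+ c} {v ‼ j} (div j)))) (fromℤ-* (q j) (ℤ.+ c))
  int : ∀ t → IsInt (sumF (λ j → fromℤ (q j) * B j ‼ t))
  int t = Int-sumF _ (λ j → Int-* (q j , refl) (lattice-int (lB j) t))
  z : Fin n → ℤ
  z t = proj₁ (int t)
  lem : ∀ a c b → a * c * b ≡ a * b * c
  lem = solve-∀ ℚring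

tab-linear : (A : Fin m → QPt n) → Linear (λ x → Vec.tabulate (λ j → dot (A j) x))
tab-linear A c e = vext λ j → trans (‼-tab (λ j → dot (A j) (comb c e)) j) (trans (dot-comb (A j) c e)
  (trans (sumF-cong (λ i → cong (c i *_) (sym (‼-tab (λ j → dot (A j) (e i)) j)))) (sym (‼-comb c (λ i → Vec.tabulate (λ j → dot (A j) (e i))) j))))

tab-lattice : (A : Fin m → QPt n) → (∀ j → IsLattice (A j)) → ∀ {x} → IsLattice x → IsLattice (Vec.tabulate (λ j → dot (A j) x))
tab-lattice A lA {x} lx = int-lattice λ j → Int-cast (sym (‼-tab (λ j → dot (A j) x) j)) (lattice-dot (lA j) lx)

comb-linear : (B : Fin m → QPt n) → Linear (λ y → comb (y ‼_) B)
comb-linear B c e = trans (comb-cong (‼-comb c e) (λ _ → refl)) (sym (comb-comb c (λ i j → e i ‼ j) B))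

-- In the segment factor of a splitting the first coordinate separates the two vertices ±(1,0,…,0) from all other generators.
module SegmentFactor (n : ℕ) (W : List (Pt n)) where

  verts : List (Pt (suc n))
  verts = proj₂ (segment ⊕ (n , W))

  top bottom : Pt (suc n)
  top    = (ℤ.+ 1) ∷ Vec.replicate n (ℤ.+ 0)
  bottom = (ℤ.- (ℤ.+ 1)) ∷ Vec.replicate n (ℤ.+ 0)

  toℚ-bottom : toℚ bottom ≡ negQ (toℚ top)
  toℚ-bottom = trans (cong toℚ (vext {x = bottom} λ { zero → refl ; (suc i) → trans (VecP.lookup-replicate i (ℤ.+ 0))
    (sym (trans (VecP.lookup-map i ℤ.-_ (Vec.replicate n (ℤ.+ 0))) (cong ℤ.-_ (VecP.lookup-replicate i (ℤ.+ 0))))) })) (toℚ-neg top)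

  cases : ∀ {v} → v ∈ verts → v ≡ top ⊎ v ≡ bottom ⊎ toℚ v ‼ zero ≡ 0ℚ
  cases (here refl)         = inj₁ refl
  cases (there (here refl)) = inj₂ (inj₁ refl)
  cases (there (there p)) with ∈-map⁻ (λ w → Vec.replicate 1 (ℤ.+ 0) Vec.++ w) p
  ... | w , _ , refl = inj₂ (inj₂ refl)

  first : QPt (suc n) → ℚ
  first = dot (unitQ zero)

  first-top : first (toℚ top) ≡ 1ℚ
  first-top = dot-unit zero (toℚ top)

  first-bottom : first (toℚ bottom) ≡ - 1ℚ
  first-bottom = dot-unit zero (toℚ bottom)

  top-in : ⟦ verts ⟧ (toℚ top)
  top-in = ⟦⟧-∈ {V = verts} (here refl)

  gens : ∀ {v} → v ∈ verts → first (toℚ v) < 1ℚ ⊎ toℚ v ≡ toℚ top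
  gens {v} p with cases p
  ... | inj₁ refl        = inj₂ refl
  ... | inj₂ (inj₁ refl) = inj₁ (subst (_< 1ℚ) (sym first-bottom) (ℚP.<-trans -1<0 0<1))
  ... | inj₂ (inj₂ e)    = inj₁ (subst (_< 1ℚ) (sym (trans (dot-unit zero (toℚ v)) e)) 0<1)

  top-extreme : Extreme ⟦ verts ⟧ (toℚ top)
  top-extreme = exposed-extreme (unitQ zero) 1ℚ top-in first-top
    (λ x → ⟦⟧-≤ verts (unitQ zero) 1ℚ (λ p → [ ℚP.<⇒≤ , (λ e → ℚP.≤-reflexive (trans (cong first e) first-top)) ]′ (gens p)))
    (λ x c → conv-exposed (unitQ zero) 1ℚ (toℚ top) first-top
      (λ i → case ∈-map⁻ toℚ (∈-lookup {xs = List.map toℚ verts} i) of λ { (v , p , e) → subst (λ y → first y < 1ℚ ⊎ y ≡ toℚ top) (sym e) (gens p) })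
      (toConv (List.map toℚ verts) c))

module CoreFactor {d : ℕ} (V : List (Pt (suc d))) (reflexive : Reflexive V) (simplicial : Simplicial V)
  (O : Symmetric.Opposite V reflexive simplicial) where

  open Blocks V reflexive simplicial O

  integral? : Decidable (λ i → IsLattice (e* i))
  integral? i = isLattice? (e* i)

  opaque
    -- Twice every lattice vector is an integral combination of the e_i, because all 2 e_i* are
    -- integral. Indices with integral e_i* contribute nothing to this 2-torsion and split off; the
    -- others form the core.
    torsion-free core : List (Fin (suc d))
    torsion-free = List.filter integral? (List.allFin (suc d))
    core         = List.filter (¬? ∘ integral?) (List.allFin (suc d))

    core-∈ : ∀ {i} → ¬ IsLattice (e* i) → i ∈ core
    core-∈ h = ∈-filter⁺ (¬? ∘ integral?) (∈-allFin _) h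

    core-¬lattice : ∀ {i} → i ∈ core → ¬ IsLattice (e* i)
    core-¬lattice p = proj₂ (∈-filter⁻ (¬? ∘ integral?) {xs = List.allFin (suc d)} p)

    tf-∈ : ∀ {i} → IsLattice (e* i) → i ∈ torsion-free
    tf-∈ h = ∈-filter⁺ integral? (∈-allFin _) h

    tf-lattice : ∀ {i} → i ∈ torsion-free → IsLattice (e* i)
    tf-lattice p = proj₂ (∈-filter⁻ integral? {xs = List.allFin (suc d)} p)

    core-unique : Unique core
    core-unique = UniqueP.filter⁺ (¬? ∘ integral?) (UniqueP.allFin⁺ (suc d))

    tf-unique : Unique torsion-free
    tf-unique = UniqueP.filter⁺ integral? (UniqueP.allFin⁺ (suc d))

    tf-filter : {Q : Fin (suc d) → Set} (Q? : Decidable Q) → (∀ {i} → Q i → IsLattice (e* i)) →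
      List.filter Q? torsion-free ≡ List.filter Q? (List.allFin (suc d))
    tf-filter Q? h = filter-filter Q? integral? (λ _ q → h q) (List.allFin (suc d))

    tf+core : List.length torsion-free ℕ.+ List.length core ≡ suc d
    tf+core = trans (filter-lengths integral? (List.allFin (suc d))) (ListP.length-tabulate id)

  idx : Fin (List.length torsion-free) → Fin (suc d)
  idx = List.lookup torsion-free

  idx-dual : Dualᶠ (e* ∘ idx) (e ∘ idx)
  biorth idx-dual i j = trans (biorth e-dual (idx i) (idx j)) (go (i Fin.≟ j))
    where
    go : Dec (i ≡ j) → δ (idx i) (idx j) ≡ δ i j
    go (yes refl) = trans (δ-refl (idx i)) (sym (δ-refl i))
    go (no h)     = trans (δ-≢ (h ∘ unique-lookup tf-unique)) (sym (δ-≢ h))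

  K : Complement (e* ∘ idx) (e ∘ idx)
  K = complement (λ i → tf-lattice (∈-lookup i)) (λ i → extreme-lattice (e-extreme (idx i))) idx-dual

  open Complement K public

  length-core : List.length core ≡ rank
  length-core = ℕP.+-cancelˡ-≡ (List.length torsion-free) _ _ (trans tf+core (sym rank-sum))

  π : QPt (suc d) → QPt rank
  π x = Vec.tabulate (λ j → dot (A j) x)

  ι : QPt rank → QPt (suc d)
  ι y = comb (y ‼_) B

  π-linear : Linear π
  π-linear = tab-linear A

  ι-linear : Linear ι
  ι-linear = comb-linear B

  π-lattice : ∀ {x} → IsLattice x → IsLattice (π x)
  π-lattice = tab-lattice A A-lat

  πι : ∀ y → π (ι y) ≡ y
  πι y = vext λ j → trans (‼-tab (λ j → dot (A j) (ι y)) j) (dual-coeff dual (y ‼_) j)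

  π-tf : ∀ {i} → IsLattice (e* i) → π (e i) ≡ zeroQ
  π-tf {i} lat = vext λ j → trans (‼-tab (λ j → dot (A j) (e i)) j) (trans (trans (cong (λ i → dot (A j) (e i)) (sym (proj₂ found))) (Ab (proj₁ found) j)) (sym (‼-zero j)))
    where
    found : ∃ λ l → idx l ≡ i
    found = lookup-in (tf-∈ lat)

  coord-B : ∀ {i} → IsLattice (e* i) → ∀ j → coord i (B j) ≡ 0ℚ
  coord-B {i} lat j = trans (cong (λ i → coord i (B j)) (sym (proj₂ found))) (αB (proj₁ found) j)
    where
    found : ∃ λ l → idx l ≡ i
    found = lookup-in (tf-∈ lat)

  κ : Fin (suc d) → QPt rank
  κ i = π (e i)

  -- Each integral e_l* vanishes at e_i, so e_i already lies in the sublattice with basis `B`.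
  ι-κ : ∀ {i} → ¬ IsLattice (e* i) → ι (κ i) ≡ e i
  ι-κ {i} h = sym (trans (split (e i)) (trans (cong₂ addQ (comb-zero (λ l → e*e-≢ (λ eq → h (subst (λ i → IsLattice (e* i)) eq (tf-lattice (∈-lookup l))))))
    (comb-cong (λ j → sym (‼-tab (λ j → dot (A j) (e i)) j)) (λ _ → refl))) (add-zeroˡ (ι (κ i)))))

  κ* : Fin (suc d) → QPt rank
  κ* i = pullback ι (e* i)

  dot-κ* : ∀ i y → dot (κ* i) y ≡ coord i (ι y)
  dot-κ* i y = dot-pullback {g = ι} ι-linear (e* i) y

  κ*κ : ∀ i {l} → ¬ IsLattice (e* l) → dot (κ* i) (κ l) ≡ δ i l
  κ*κ i {l} h = trans (dot-κ* i (κ l)) (trans (cong (coord i) (ι-κ h)) (biorth e-dual i l))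

  opaque
    κℤ : Fin (suc d) → Pt rank
    κℤ i = integral (π-lattice (extreme-lattice (e-extreme i)))

    toℚ-κℤ : ∀ i → toℚ (κℤ i) ≡ κ i
    toℚ-κℤ i = proj₂ (π-lattice (extreme-lattice (e-extreme i)))

  V₀ : List (Pt rank)
  V₀ = List.map κℤ core List.++ List.map (negℤ ∘ κℤ) core

  V₀-cases : ∀ {v} → v ∈ V₀ → ∃ λ i → ¬ IsLattice (e* i) × (toℚ v ≡ κ i ⊎ toℚ v ≡ negQ (κ i))
  V₀-cases p =
    [ (λ q → let (i , i∈ , eq) = ∈-map⁻ κℤ q in i , core-¬lattice i∈ , inj₁ (trans (cong toℚ eq) (toℚ-κℤ i)))
    , (λ q → let (i , i∈ , eq) = ∈-map⁻ (negℤ ∘ κℤ) q in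
        i , core-¬lattice i∈ , inj₂ (trans (cong toℚ eq) (trans (toℚ-neg (κℤ i)) (cong negQ (toℚ-κℤ i))))) ]′
    (∈-++⁻ (List.map κℤ core) p)

  κ-in : ∀ {i} → ¬ IsLattice (e* i) → ⟦ V₀ ⟧ (κ i)
  κ-in {i} h = subst ⟦ V₀ ⟧ (toℚ-κℤ i) (⟦⟧-∈ (∈-++⁺ˡ (∈-map⁺ κℤ (core-∈ h))))

  κℤ⁻ : Fin (suc d) → Pt rank
  κℤ⁻ i = negℤ (κℤ i)

  toℚ-κℤ⁻ : ∀ i → toℚ (κℤ⁻ i) ≡ negQ (κ i)
  toℚ-κℤ⁻ i = trans (toℚ-neg (κℤ i)) (cong negQ (toℚ-κℤ i))

  κℤ⁻-∈ : ∀ {i} → ¬ IsLattice (e* i) → κℤ⁻ i ∈ V₀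
  κℤ⁻-∈ h = ∈-++⁺ʳ (List.map κℤ core) (∈-map⁺ (negℤ ∘ κℤ) (core-∈ h))

  -κ-in : ∀ {i} → ¬ IsLattice (e* i) → ⟦ V₀ ⟧ (negQ (κ i))
  -κ-in {i} h = subst ⟦ V₀ ⟧ (toℚ-κℤ⁻ i) (⟦⟧-∈ (κℤ⁻-∈ h))

  V₀-sub : {Q : QSet rank} → Convex Q → (∀ {i} → ¬ IsLattice (e* i) → Q (κ i)) → (∀ {i} → ¬ IsLattice (e* i) → Q (negQ (κ i))) → ∀ {y} → ⟦ V₀ ⟧ y → Q y
  V₀-sub {Q} convex pos neg = ⟦⟧-sub V₀ {Q} convex λ {v} p → let (i , h , c) = V₀-cases p in
    [ (λ eq → subst Q (sym eq) (pos h)) , (λ eq → subst Q (sym eq) (neg h)) ]′ c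

  V₀-extreme : ∀ {y} → Extreme ⟦ V₀ ⟧ y → ∃ λ i → ¬ IsLattice (e* i) × (y ≡ κ i ⊎ y ≡ negQ (κ i))
  V₀-extreme ex = let (v , p , eq) = ⟦⟧-extreme V₀ ex ; (i , h , c) = V₀-cases p in
    i , h , [ (λ e → inj₁ (trans eq e)) , (λ e → inj₂ (trans eq e)) ]′ c

  κ-extreme : ∀ {i} → ¬ IsLattice (e* i) → Extreme ⟦ V₀ ⟧ (κ i)
  κ-extreme {i} h = exposed-extreme (κ* i) 1ℚ (κ-in h) κi
    (λ y → ⟦⟧-≤ V₀ (κ* i) 1ℚ (λ p → [ ℚP.<⇒≤ , (λ eq → ℚP.≤-reflexive (trans (cong (dot (κ* i)) eq) κi)) ]′ (gens p)))
    (λ y c → conv-exposed (κ* i) 1ℚ (κ i) κi (λ l → let (v , p , eq) = ∈-map⁻ toℚ (∈-lookup {xs = List.map toℚ V₀} l) in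
      subst (λ y → dot (κ* i) y < 1ℚ ⊎ y ≡ κ i) (sym eq) (gens p)) (toConv (List.map toℚ V₀) c))
    where
    κi : dot (κ* i) (κ i) ≡ 1ℚ
    κi = trans (κ*κ i h) (δ-refl i)
    at : ∀ {l y} → ¬ IsLattice (e* l) → Dec (i ≡ l) → y ≡ κ l ⊎ y ≡ negQ (κ l) → dot (κ* i) y < 1ℚ ⊎ y ≡ κ i
    at hl (yes refl) (inj₁ eq) = inj₂ eq
    at hl (yes refl) (inj₂ eq) = inj₁ (subst (_< 1ℚ) (sym (trans (cong (dot (κ* i)) eq) (trans (dot-neg (κ* i) (κ i)) (cong -_ κi)))) (ℚP.<-trans -1<0 0<1))
    at {l} hl (no i≢l) (inj₁ eq) = inj₁ (subst (_< 1ℚ) (sym (trans (cong (dot (κ* i)) eq) (trans (κ*κ i hl) (δ-≢ i≢l)))) 0<1)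
    at {l} hl (no i≢l) (inj₂ eq) = inj₁ (subst (_< 1ℚ) (sym (trans (cong (dot (κ* i)) eq) (trans (dot-neg (κ* i) (κ l)) (cong -_ (trans (κ*κ i hl) (δ-≢ i≢l)))))) 0<1)
    gens : ∀ {v} → v ∈ V₀ → dot (κ* i) (toℚ v) < 1ℚ ⊎ toℚ v ≡ κ i
    gens p = let (l , hl , c) = V₀-cases p in at hl (i Fin.≟ l) c

  -- The support of x consists of indices with integral e_i*, and π kills these e_i. Hence only the
  -- ±e_i of the core survive in the image of P.
  π-level0 : ∀ {x} → Level0 x → π x ≡ zeroQ
  π-level0 {x} X = trans (cong π (sym (dual-complete e-dual x))) (trans (π-linear (λ i → coord i x) e)
    (vext λ j → trans (‼-comb (λ i → coord i x) κ j) (trans (sumF-zero (λ i → term i j (coord i x ℚP.≟ 0ℚ))) (sym (‼-zero j)))))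
    where
    term : ∀ i j → Dec (coord i x ≡ 0ℚ) → coord i x * κ i ‼ j ≡ 0ℚ
    term i j (yes eq) = trans (cong (_* κ i ‼ j) eq) (ℚP.*-zeroˡ (κ i ‼ j))
    term i j (no h)   = trans (cong (λ y → coord i x * y ‼ j) (π-tf (support-lattice X h))) (trans (cong (coord i x *_) (‼-zero j)) (ℚP.*-zeroʳ (coord i x)))

  -- An index of the core makes `V₀` nonempty, so its hull contains 0, to which all vertices outside
  -- the core are projected.
  module NonTrivial {i₀ : Fin (suc d)} (i₀-core : ¬ IsLattice (e* i₀)) where

    zero-in : ⟦ V₀ ⟧ zeroQ
    zero-in = convex-0 (⟦⟧-convex V₀) (κ-in i₀-core) (-κ-in i₀-core)

    projection : ∀ {x} → P x → ⟦ V₀ ⟧ (π x)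
    projection = krein-milman (linear-convex {f = π} π-linear {⟦ V₀ ⟧} (⟦⟧-convex V₀)) λ {x} ex → on ex (classify ex)
      where
      sign : ∀ j → Dec (IsLattice (e* j)) → ⟦ V₀ ⟧ (π (e j)) × ⟦ V₀ ⟧ (negQ (π (e j)))
      sign j (yes l) = subst ⟦ V₀ ⟧ (sym (π-tf l)) zero-in , subst ⟦ V₀ ⟧ (sym (trans (cong negQ (π-tf l)) (vext λ t → trans (‼-neg zeroQ t) (trans (cong -_ (‼-zero t)) (sym (‼-zero t)))))) zero-in
      sign j (no h)  = κ-in h , -κ-in h
      on : ∀ {x} → Extreme P x → _ → ⟦ V₀ ⟧ (π x)
      on ex (inj₁ (j , refl))        = proj₁ (sign j (integral? j))
      on ex (inj₂ (inj₁ (j , refl))) = subst ⟦ V₀ ⟧ (sym (linear-neg {f = π} π-linear (e j))) (proj₂ (sign j (integral? j)))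
      on ex (inj₂ (inj₂ l))          = subst ⟦ V₀ ⟧ (sym (π-level0 (ex , l))) zero-in

    -- The point 0 stays interior under the surjection π, and primitivity of the ±e_i passes to
    -- their coordinates with respect to the integral vectors `B`.
    V₀-fano : Fano V₀
    V₀-fano = (λ y → let (ε , ε>0 , Pε) = proj₁ (proj₁ reflexive) (ι y) in
        ε , ε>0 , subst ⟦ V₀ ⟧ (trans (linear-scale {f = π} π-linear ε (ι y)) (cong (scaleQ ε) (πι y))) (projection Pε)) ,
      λ y ex → let (v , p , eq) = ⟦⟧-extreme V₀ ex ; (i , h , c) = V₀-cases p in v , sym eq , prim v i h c
      where
      from : ∀ v x → Extreme P x → ι (toℚ v) ≡ x → Primitive v
      from v x ex eq = let (w , eqw , pw) = proj₂ (proj₁ reflexive) x ex in primitive-coords B B-lat v w (trans eq (sym eqw)) pw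
      prim : ∀ v i → ¬ IsLattice (e* i) → toℚ v ≡ κ i ⊎ toℚ v ≡ negQ (κ i) → Primitive v
      prim v i h (inj₁ eq) = from v (e i) (e-extreme i) (trans (cong ι eq) (ι-κ h))
      prim v i h (inj₂ eq) = from v (negQ (e i)) (neg-e-extreme i) (trans (cong ι eq) (trans (linear-neg {f = ι} ι-linear (κ i)) (cong negQ (ι-κ h))))

    module DualVertex {y : QPt rank} (ex : Extreme (Dual ⟦ V₀ ⟧) y) where

      s : Fin (suc d) → ℚ
      s i = dot y (κ i)

      lower : ∀ {i} → ¬ IsLattice (e* i) → - 1ℚ ≤ s i
      lower h = proj₁ ex (κ _) (κ-in h)

      upper : ∀ {i} → ¬ IsLattice (e* i) → s i ≤ 1ℚ
      upper {i} h = subst (_≤ 1ℚ) (trans (cong -_ (dot-neg y (κ i))) (neg-neg (s i))) (ℚP.neg-antimono-≤ (proj₁ ex (negQ (κ i)) (-κ-in h)))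

      -- `η` is half of 1 - s², where s is the value of y at κ_i. It is small enough for s ± η to
      -- stay in [-1, 1] and vanishes only for s = ±1. At a vertex of the dual polytope the move
      -- must be trivial, so s = ±1.
      module Perturb {i : Fin (suc d)} (h : ¬ IsLattice (e* i)) where

        η : ℚ
        η = ½ * ((1ℚ - s i) * (1ℚ + s i))

        1-s : 0ℚ ≤ 1ℚ - s i
        1-s = 0≤-diff (upper h)

        1+s : 0ℚ ≤ 1ℚ + s i
        1+s = subst (0ℚ ≤_) (lem (s i)) (0≤-diff (lower h))
          where
          lem : ∀ s → s - (- 1ℚ) ≡ 1ℚ + s
          lem = solve-∀ ℚring

        half : ∀ {p} → 0ℚ ≤ p → 0ℚ ≤ ½ * p
        half {p} = *-nonneg {½} {p} (*≤* (ℤ.+≤+ ℕ.z≤n))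

        moved : ℚ → QPt rank
        moved t = addQ y (scaleQ t (κ* i))

        moved-value : ∀ t {l} → ¬ IsLattice (e* l) → dot (moved t) (κ l) ≡ s l + t * δ i l
        moved-value t {l} hl = trans (dot-addˡ y (scaleQ t (κ* i)) (κ l)) (cong (s l +_) (trans (dot-scaleˡ t (κ* i) (κ l)) (cong (t *_) (κ*κ i hl))))

        in-dual : ∀ t → - 1ℚ ≤ s i + t → s i + t ≤ 1ℚ → Dual ⟦ V₀ ⟧ (moved t)
        in-dual t lo hi z = V₀-sub {Q = λ z → - 1ℚ ≤ dot (moved t) z} (λ w → conv-≥ (moved t) (- 1ℚ))
          (λ {l} hl → subst (- 1ℚ ≤_) (sym (moved-value t hl)) (proj₁ (bounds hl (i Fin.≟ l))))
          (λ {l} hl → subst (- 1ℚ ≤_) (sym (trans (dot-neg (moved t) (κ l)) (cong -_ (moved-value t hl)))) (ℚP.neg-antimono-≤ (proj₂ (bounds hl (i Fin.≟ l)))))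
          where
          lem₁ : ∀ a t → a + t * 1ℚ ≡ a + t
          lem₁ = solve-∀ ℚring
          lem₀ : ∀ a t → a + t * 0ℚ ≡ a
          lem₀ = solve-∀ ℚring
          bounds : ∀ {l} → ¬ IsLattice (e* l) → Dec (i ≡ l) → - 1ℚ ≤ s l + t * δ i l × s l + t * δ i l ≤ 1ℚ
          bounds hl (yes refl) = subst (λ z → - 1ℚ ≤ z × z ≤ 1ℚ) (sym (trans (cong (λ z → s i + t * z) (δ-refl i)) (lem₁ (s i) t))) (lo , hi)
          bounds {l} hl (no i≢l) = subst (λ z → - 1ℚ ≤ z × z ≤ 1ℚ) (sym (trans (cong (λ z → s l + t * z) (δ-≢ i≢l)) (lem₀ (s l) t))) (lower hl , upper hl)

        up : Dual ⟦ V₀ ⟧ (moved η)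
        up = in-dual η (≤-by (½ * ((1ℚ + s i) * (1ℚ + s i)) + ((½ * ((1ℚ - s i) * (1ℚ + s i))) + ½ * ((1ℚ - s i) * (1ℚ + s i))))
            (+-nonneg (half (*-nonneg 1+s 1+s)) (+-nonneg (half (*-nonneg 1-s 1+s)) (half (*-nonneg 1-s 1+s)))) (lem₁ (s i)))
          (≤-by (½ * ((1ℚ - s i) * (1ℚ - s i))) (half (*-nonneg 1-s 1-s)) (lem₂ (s i)))
          where
          lem₁ : ∀ s → s + ½ * ((1ℚ - s) * (1ℚ + s)) - (- 1ℚ) ≡ ½ * ((1ℚ + s) * (1ℚ + s)) + ((½ * ((1ℚ - s) * (1ℚ + s))) + ½ * ((1ℚ - s) * (1ℚ + s)))
          lem₁ = solve-∀ ℚring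
          lem₂ : ∀ s → 1ℚ - (s + ½ * ((1ℚ - s) * (1ℚ + s))) ≡ ½ * ((1ℚ - s) * (1ℚ - s))
          lem₂ = solve-∀ ℚring

        down : Dual ⟦ V₀ ⟧ (moved (- η))
        down = in-dual (- η) (≤-by (½ * ((1ℚ + s i) * (1ℚ + s i))) (half (*-nonneg 1+s 1+s)) (lem₁ (s i)))
          (≤-by (½ * ((1ℚ - s i) * (1ℚ - s i)) + ((½ * ((1ℚ - s i) * (1ℚ + s i))) + ½ * ((1ℚ - s i) * (1ℚ + s i))))
            (+-nonneg (half (*-nonneg 1-s 1-s)) (+-nonneg (half (*-nonneg 1-s 1+s)) (half (*-nonneg 1-s 1+s)))) (lem₂ (s i)))
          where
          lem₁ : ∀ s → s + - (½ * ((1ℚ - s) * (1ℚ + s))) - (- 1ℚ) ≡ ½ * ((1ℚ + s) * (1ℚ + s))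
          lem₁ = solve-∀ ℚring
          lem₂ : ∀ s → 1ℚ - (s + - (½ * ((1ℚ - s) * (1ℚ + s)))) ≡ ½ * ((1ℚ - s) * (1ℚ - s)) + ((½ * ((1ℚ - s) * (1ℚ + s))) + ½ * ((1ℚ - s) * (1ℚ + s)))
          lem₂ = solve-∀ ℚring

        fixed : moved η ≡ y
        fixed = proj₂ ex (moved η) (moved (- η)) up down (vext λ j → trans (lem (y ‼ j) η (κ* i ‼ j))
          (sym (trans (‼-scale ½ (addQ (moved η) (moved (- η))) j) (cong (½ *_) (trans (‼-add (moved η) (moved (- η)) j)
            (cong₂ _+_ (entry η j) (entry (- η) j)))))))
          where
          entry : ∀ t j → moved t ‼ j ≡ y ‼ j + t * κ* i ‼ j
          entry t j = trans (‼-add y (scaleQ t (κ* i)) j) (cong (y ‼ j +_) (‼-scale t (κ* i) j))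
          lem : ∀ y t k → y ≡ ½ * ((y + t * k) + (y + (- t) * k))
          lem = solve-∀ ℚring

        sign : s i ≡ 1ℚ ⊎ s i ≡ - 1ℚ
        sign = [ (λ eq → inj₁ (sym (diff-0 eq))) , (λ eq → inj₂ (trans (lem₃ (s i)) (cong (_- 1ℚ) eq))) ]′
          (*-zero-split (1ℚ - s i) (1ℚ + s i) (trans (lem₂ ((1ℚ - s i) * (1ℚ + s i))) (cong₂ _+_ η≡0 η≡0)))
          where
          lem₁ : ∀ a t → t ≡ (a + t * 1ℚ) - a
          lem₁ = solve-∀ ℚring
          lem₂ : ∀ a → a ≡ ½ * a + ½ * a
          lem₂ = solve-∀ ℚring
          lem₃ : ∀ a → a ≡ (1ℚ + a) - 1ℚ
          lem₃ = solve-∀ ℚring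
          η≡0 : η ≡ 0ℚ
          η≡0 = trans (lem₁ (s i) η) (trans (cong (_- s i) (trans (sym (trans (moved-value η h) (cong (λ z → s i + η * z) (δ-refl i)))) (cong (λ z → dot z (κ i)) fixed))) (ℚP.+-inverseʳ (s i)))

      -- As g is the sum of the e_i*, the j-th entry of y is the sum of all (s_i - 1) e_i*(B_j),
      -- plus g(B_j). A term is 0 if e_i* is integral, since e_i* then kills B_j; otherwise it is 0
      -- for s_i = 1 and the integer -2 e_i*(B_j) for s_i = -1.
      lattice-y : IsLattice y
      lattice-y = int-lattice λ j → Int-cast (trans (cong₂ _+_ (sumF-sub (λ i → coord i (B j) * s i) (λ i → coord i (B j))) refl)
          (trans (lem (sumF (λ i → coord i (B j) * s i)) (sumF (λ i → coord i (B j)))) (value j)))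
        (Int-+ (Int-sumF (λ i → coord i (B j) * s i - coord i (B j)) (λ i → term i j (integral? i))) (Int-cast (level-sum (B j)) (lattice-dot g-lattice (B-lat j))))
        where
        lem : ∀ a b → a - b + b ≡ a
        lem = solve-∀ ℚring
        value : ∀ j → sumF (λ i → coord i (B j) * s i) ≡ y ‼ j
        value j = trans (sym (dot-comb y (λ i → coord i (B j)) κ)) (trans (cong (dot y) (trans (sym (π-linear (λ i → coord i (B j)) e))
          (trans (cong π (trans (dual-complete e-dual (B j)) (sym (comb-δ j B)))) (trans (cong π (comb-cong (λ t → sym (‼-tab (δ j) t)) (λ _ → refl))) (πι (unitQ j)))))) (dot-unitʳ y j))
        lem₀ : ∀ s → 0ℚ * s - 0ℚ ≡ 0ℚ
        lem₀ = solve-∀ ℚring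
        lem₁ : ∀ c → 0ℚ ≡ c * 1ℚ - c
        lem₁ = solve-∀ ℚring
        lem₂ : ∀ c → - (2ℚ * c) ≡ c * (- 1ℚ) - c
        lem₂ c = trans (cong -_ (ℚP.*-distribʳ-+ c 1ℚ 1ℚ)) (lem' c)
          where
          lem' : ∀ c → - (1ℚ * c + 1ℚ * c) ≡ c * (- 1ℚ) - c
          lem' = solve-∀ ℚring
        term : ∀ i j → Dec (IsLattice (e* i)) → IsInt (coord i (B j) * s i - coord i (B j))
        term i j (yes l) = Int-cast (sym (trans (cong (λ c → c * s i - c) (coord-B l j)) (lem₀ (s i)))) Int-0
        term i j (no h)  = [ (λ eq → Int-cast (trans (lem₁ (coord i (B j))) (cong (λ z → coord i (B j) * z - coord i (B j)) (sym eq))) Int-0)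
          , (λ eq → Int-cast (trans (lem₂ (coord i (B j))) (cong (λ z → coord i (B j) * z - coord i (B j)) (sym eq)))
              (Int-neg (Int-cast (dot-scaleˡ 2ℚ (e* i) (B j)) (lattice-dot (2e*-lattice i) (B-lat j))))) ]′ (Perturb.sign h)

    V₀-reflexive : Reflexive V₀
    V₀-reflexive = V₀-fano , λ y ex → DualVertex.lattice-y ex

    V₀-cs : CsCross (rank , V₀)
    V₀-cs = List.tabulate w , trans (ListP.length-tabulate w) length-core , indep⇒aff (List.tabulate w) ind , no-zero ,
      λ x → V₀-sub {Q = InConv both} (inconv-convex both) (λ {i} h → inconv-∈ (∈-++⁺ˡ (member h)))
              (λ {i} h → inconv-∈ (∈-++⁺ʳ (List.tabulate w) (∈-map⁺ negQ (member h)))) ,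
            inconv-sub both {⟦ V₀ ⟧} (⟦⟧-convex V₀) back
      where
      w : Fin (List.length core) → QPt rank
      w j = κ (List.lookup core j)
      both : List (QPt rank)
      both = List.tabulate w List.++ List.map negQ (List.tabulate w)
      ¬lat : ∀ j → ¬ IsLattice (e* (List.lookup core j))
      ¬lat j = core-¬lattice (∈-lookup j)
      w-dual : Dualᶠ (λ j → κ* (List.lookup core j)) w
      biorth w-dual i j = trans (κ*κ (List.lookup core i) (¬lat j)) (go (i Fin.≟ j))
        where
        go : Dec (i ≡ j) → δ (List.lookup core i) (List.lookup core j) ≡ δ i j
        go (yes refl) = trans (δ-refl (List.lookup core i)) (sym (δ-refl i))
        go (no h)     = trans (δ-≢ (h ∘ unique-lookup core-unique)) (sym (δ-≢ h))
      ind : Indep (List.lookup (List.tabulate w))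
      ind = indep-tabulate w (dual-indep w-dual)
      no-zero : ¬ InConv (List.tabulate w) zeroQ
      no-zero c = let cv = toConv (List.tabulate w) c in
        0≢1 (trans (sym (sumF-zero (ind (Conv.coeff cv) (Conv.point cv)))) (Conv.total cv))
      member : ∀ {i} → ¬ IsLattice (e* i) → κ i ∈ List.tabulate w
      member h = let (j , eq) = lookup-in (core-∈ h) in subst (λ i → κ i ∈ List.tabulate w) eq (AnyP.tabulate⁺ j refl)
      in-w : ∀ {x} → x ∈ List.tabulate w → ∃ λ i → ¬ IsLattice (e* i) × x ≡ κ i
      in-w p = let (j , eq) = AnyP.tabulate⁻ p in List.lookup core j , ¬lat j , eq
      back : ∀ {x} → x ∈ both → ⟦ V₀ ⟧ x
      back p = [ (λ q → let (i , h , eq) = in-w q in subst ⟦ V₀ ⟧ (sym eq) (κ-in h))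
               , (λ q → let (z , z∈ , eq) = ∈-map⁻ negQ q ; (i , h , eq') = in-w z∈ in subst ⟦ V₀ ⟧ (sym (trans eq (cong negQ eq'))) (-κ-in h)) ]′
               (∈-++⁻ (List.tabulate w) p)

    -- The first coordinate of a segment factor is integral, is 1 at some ±κ_i and vanishes at all
    -- other pairs, as the segment has only two vertices. Its pullback along π is ±e_i*, which would
    -- then be integral.
    V₀-irreducible : OneIrreducible (rank , V₀)
    V₀-irreducible ((n , W) , _ , I') = absurd (V₀-extreme (iso-extreme (PolyIso-sym I) top-extreme))
      where
      open SegmentFactor n W
      I : PolyIso ⟦ V₀ ⟧ ⟦ verts ⟧
      I = fromIsoP {V = V₀} {verts} I'
      module I = PolyIso I
      φ : QPt rank
      φ = pullback I.f (unitQ zero)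
      φ-value : ∀ x → dot φ x ≡ first (I.f x)
      φ-value x = dot-pullback {g = I.f} I.f-comb (unitQ zero) x
      φ-lattice : IsLattice φ
      φ-lattice = pullback-lattice {g = I.f} I.f-lat (lattice-unit zero)
      ψ : QPt (suc d)
      ψ = pullback π φ
      ψ-lattice : IsLattice ψ
      ψ-lattice = pullback-lattice {g = π} π-lattice φ-lattice
      ψ-value : ∀ x → dot ψ x ≡ dot φ (π x)
      ψ-value x = dot-pullback {g = π} π-linear φ x
      distinct : ∀ {i l} → ¬ IsLattice (e* i) → ¬ IsLattice (e* l) → i ≢ l → ∀ {z} → z ≡ κ i ⊎ z ≡ negQ (κ i) → ¬ (z ≡ κ l ⊎ z ≡ negQ (κ l))
      distinct {i} {l} hi hl i≢l {z} ci cl = [ (λ a → 0≢1 (trans (sym at-l) a)) , (λ a → -1≢0 (trans (sym a) at-l)) ]′ at-i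
        where
        at-i : dot (κ* i) z ≡ 1ℚ ⊎ dot (κ* i) z ≡ - 1ℚ
        at-i = [ (λ eq → inj₁ (trans (cong (dot (κ* i)) eq) (trans (κ*κ i hi) (δ-refl i))))
               , (λ eq → inj₂ (trans (cong (dot (κ* i)) eq) (trans (dot-neg (κ* i) (κ i)) (cong -_ (trans (κ*κ i hi) (δ-refl i)))))) ]′ ci
        at-l : dot (κ* i) z ≡ 0ℚ
        at-l = [ (λ eq → trans (cong (dot (κ* i)) eq) (trans (κ*κ i hl) (δ-≢ i≢l)))
               , (λ eq → trans (cong (dot (κ* i)) eq) (trans (dot-neg (κ* i) (κ l)) (cong -_ (trans (κ*κ i hl) (δ-≢ i≢l))))) ]′ cl
      absurd : (∃ λ i → ¬ IsLattice (e* i) × (I.g (toℚ top) ≡ κ i ⊎ I.g (toℚ top) ≡ negQ (κ i))) → ⊥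
      absurd (i , h , c) = h (finish c)
        where
        off : ∀ {l} → ¬ IsLattice (e* l) → l ≢ i → dot φ (κ l) ≡ 0ℚ
        off {l} hl l≢i = let (v , v∈ , eq) = ⟦⟧-extreme verts (iso-extreme I (κ-extreme hl)) in trans (φ-value (κ l)) (go v eq (cases v∈))
          where
          go : ∀ v → I.f (κ l) ≡ toℚ v → v ≡ top ⊎ v ≡ bottom ⊎ toℚ v ‼ zero ≡ 0ℚ → first (I.f (κ l)) ≡ 0ℚ
          go v eq (inj₁ refl) = ⊥-elim (distinct h hl (l≢i ∘ sym) c (inj₁ (trans (cong I.g (sym eq)) (I.gf (κ l)))))
          go v eq (inj₂ (inj₁ refl)) = ⊥-elim (distinct h hl (l≢i ∘ sym) c (inj₂ (trans (cong I.g (trans (sym (negQ-negQ (toℚ top))) (trans (cong negQ (trans (sym toℚ-bottom) (sym eq))) (sym (linear-neg {f = I.f} I.f-comb (κ l)))))) (I.gf (negQ (κ l))))))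
          go v eq (inj₂ (inj₂ z)) = trans (cong first eq) (trans (dot-unit zero (toℚ v)) z)
        φ-top : dot φ (I.g (toℚ top)) ≡ 1ℚ
        φ-top = trans (φ-value (I.g (toℚ top))) (trans (cong first (I.fg (toℚ top))) first-top)
        on-basis : ∀ σ → dot φ (κ i) ≡ σ → ∀ l → Dec (IsLattice (e* l)) → Dec (l ≡ i) → dot ψ (e l) ≡ σ * coord i (e l)
        on-basis σ eq l (yes lat) (yes refl) = ⊥-elim (h lat)
        on-basis σ eq l (yes lat) (no l≢i) = trans (ψ-value (e l)) (trans (cong (dot φ) (π-tf lat)) (trans (dot-zero φ) (sym (trans (cong (σ *_) (e*e-≢ (l≢i ∘ sym))) (ℚP.*-zeroʳ σ)))))
        on-basis σ eq l (no hl) (yes refl) = trans (ψ-value (e l)) (trans eq (sym (trans (cong (σ *_) (e*e l)) (ℚP.*-identityʳ σ))))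
        on-basis σ eq l (no hl) (no l≢i) = trans (ψ-value (e l)) (trans (off hl l≢i) (sym (trans (cong (σ *_) (e*e-≢ (l≢i ∘ sym))) (ℚP.*-zeroʳ σ))))
        ψ≡ : ∀ σ → dot φ (κ i) ≡ σ → ψ ≡ scaleQ σ (e* i)
        ψ≡ σ eq = agree-on-basis e-dual λ l → trans (on-basis σ eq l (integral? l) (l Fin.≟ i)) (sym (dot-scaleˡ σ (e* i) (e l)))
        finish : I.g (toℚ top) ≡ κ i ⊎ I.g (toℚ top) ≡ negQ (κ i) → IsLattice (e* i)
        finish (inj₁ eq) = subst IsLattice (trans (ψ≡ 1ℚ (trans (cong (dot φ) (sym eq)) φ-top)) (scale-1 (e* i))) ψ-lattice
        finish (inj₂ eq) = subst IsLattice (trans (cong negQ (trans (ψ≡ (- 1ℚ) (trans (sym (neg-neg _)) (cong -_ (trans (sym (dot-neg φ (κ i))) (trans (cong (dot φ) (sym eq)) φ-top)))))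
          (sym (neg-scale (e* i))))) (negQ-negQ (e* i))) (lattice-neg ψ-lattice)

-- Polytopes in coordinates

-- Recursion on vectors, so that concatenated coordinates in `⊕` belong to concatenated systems `b`.
ev : Pt k → Vec (QPt n) k → QPt n
ev []       []       = zeroQ
ev (z ∷ zs) (b ∷ bs) = addQ (scaleQ (fromℤ z) b) (ev zs bs)

ev-comb : (z : Pt k) (b : Vec (QPt n) k) → ev z b ≡ comb (toℚ z ‼_) (b ‼_)
ev-comb []       []       = sym (comb-zero {c = toℚ [] ‼_} λ ())
ev-comb (z ∷ zs) (b ∷ bs) = trans (cong (addQ (scaleQ (fromℤ z) b)) (ev-comb zs bs))
  (trans (sym (comb-∷ (fromℤ z) (toℚ zs ‼_) b (bs ‼_))) (comb-cong (λ { zero → refl ; (suc i) → refl }) (λ { zero → refl ; (suc i) → refl })))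

ev-++ : (z : Pt k) (z' : Pt l) (b : Vec (QPt n) k) (b' : Vec (QPt n) l) → ev (z Vec.++ z') (b Vec.++ b') ≡ addQ (ev z b) (ev z' b')
ev-++ []       z' []       b' = sym (add-zeroˡ (ev z' b'))
ev-++ (z ∷ zs) z' (b ∷ bs) b' = trans (cong (addQ (scaleQ (fromℤ z) b)) (ev-++ zs z' bs b')) (sym (add-assoc _ (ev zs bs) (ev z' b')))

ev-0 : (b : Vec (QPt n) k) → ev (Vec.replicate k (ℤ.+ 0)) b ≡ zeroQ
ev-0 []       = refl
ev-0 (b ∷ bs) = trans (cong₂ addQ (scale-0 b) (ev-0 bs)) (add-zeroˡ zeroQ)

ev-++ˡ : (z : Pt k) (b : Vec (QPt n) k) (b' : Vec (QPt n) l) → ev (z Vec.++ Vec.replicate l (ℤ.+ 0)) (b Vec.++ b') ≡ ev z b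
ev-++ˡ z b b' = trans (ev-++ z _ b b') (trans (cong (addQ (ev z b)) (ev-0 b')) (add-zeroʳ (ev z b)))

ev-++ʳ : (z : Pt l) (b : Vec (QPt n) k) (b' : Vec (QPt n) l) → ev (Vec.replicate k (ℤ.+ 0) Vec.++ z) (b Vec.++ b') ≡ ev z b'
ev-++ʳ {k = k} z b b' = trans (ev-++ (Vec.replicate k (ℤ.+ 0)) z b b') (trans (cong (λ y → addQ y (ev z b')) (ev-0 b)) (add-zeroˡ (ev z b')))

ev-neg : (z : Pt k) (b : Vec (QPt n) k) → ev (negℤ z) b ≡ negQ (ev z b)
ev-neg z b = trans (ev-comb (negℤ z) b) (trans (comb-cong (λ i → trans (cong (_‼ i) (toℚ-neg z)) (‼-neg (toℚ z) i)) (λ _ → refl))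
  (trans (vext λ j → trans (‼-comb (λ i → - toℚ z ‼ i) (b ‼_) j) (trans (sumF-cong (λ i → lem (toℚ z ‼ i) (b ‼ i ‼ j)))
    (trans (sumF-neg (λ i → toℚ z ‼ i * b ‼ i ‼ j)) (sym (trans (‼-neg (comb (toℚ z ‼_) (b ‼_)) j) (cong -_ (‼-comb (toℚ z ‼_) (b ‼_) j))))))) (cong negQ (sym (ev-comb z b)))))
  where
  lem : ∀ a b → (- a) * b ≡ - (a * b)
  lem = solve-∀ ℚring

toℚ-unitVec : (i : Fin n) → toℚ (unitVec i) ≡ unitQ i
toℚ-unitVec i = vext λ j → trans (‼-toℚ (unitVec i) j) (trans (cong fromℤ (‼-tab (λ j → if does (i Fin.≟ j) then ℤ.+ 1 else ℤ.+ 0) j))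
  (trans (go (i Fin.≟ j)) (sym (‼-tab (δ i) j))))
  where
  go : ∀ {A : Set} (D : Dec A) → fromℤ (if does D then ℤ.+ 1 else ℤ.+ 0) ≡ (if does D then 1ℚ else 0ℚ)
  go (yes _) = refl
  go (no _)  = refl

ev-unit : (i : Fin k) (b : Vec (QPt n) k) → ev (unitVec i) b ≡ b ‼ i
ev-unit i b = trans (ev-comb (unitVec i) b) (trans (comb-cong (λ j → trans (cong (_‼ j) (toℚ-unitVec i)) (‼-tab (δ i) j)) (λ _ → refl)) (comb-δ i (b ‼_)))

sumL : List (QPt n) → QPt n
sumL = List.foldr addQ zeroQ

ev-ones : (L : List (QPt n)) → ev allOnes (Vec.fromList L) ≡ sumL L
ev-ones []      = refl
ev-ones (x ∷ L) = cong₂ addQ (scale-1 x) (ev-ones L)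

sumL-filter : {A : Set} {Q : A → Set} (Q? : Decidable Q) (φ : A → QPt n) → (∀ x → ¬ Q x → φ x ≡ zeroQ) → (xs : List A) →
  sumL (List.map φ (List.filter Q? xs)) ≡ sumL (List.map φ xs)
sumL-filter Q? φ h [] = refl
sumL-filter Q? φ h (x ∷ xs) with Q? x
... | yes _ = cong (addQ (φ x)) (sumL-filter Q? φ h xs)
... | no ¬q = trans (sumL-filter Q? φ h xs) (sym (trans (cong (λ y → addQ y (sumL (List.map φ xs))) (h x ¬q)) (add-zeroˡ (sumL (List.map φ xs)))))

sumL-tabulate : (φ : Fin k → QPt n) → sumL (List.tabulate φ) ≡ comb (λ _ → 1ℚ) φ
sumL-tabulate {zero}  φ = sym (comb-zero {c = λ _ → 1ℚ} {φ} λ ())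
sumL-tabulate {suc k} φ = trans (cong₂ addQ (sym (scale-1 (φ zero))) (sumL-tabulate (φ ∘ suc)))
  (trans (sym (comb-∷ 1ℚ (λ _ → 1ℚ) (φ zero) (φ ∘ suc))) (comb-cong (λ { zero → refl ; (suc i) → refl }) (λ { zero → refl ; (suc i) → refl })))

record IntSpan {k n : ℕ} (b : Vec (QPt n) k) (v : QPt n) : Set where
  constructor intSpan
  field
    coeffs : Pt k
    value  : ev coeffs b ≡ v

span-comb : (b : Vec (QPt n) k) (c : Fin m → ℚ) (e : Fin m → QPt n) → (∀ i → IsInt (c i)) → (∀ i → IntSpan b (e i)) → IntSpan b (comb c e)
span-comb {k = k} b c e hc he = intSpan (proj₁ lat) (trans (ev-comb (proj₁ lat) b) (trans (comb-cong (λ j → trans (cong (_‼ j) (proj₂ lat)) (‼-comb c _ j)) (λ _ → refl))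
  (trans (sym (comb-comb c (λ i → toℚ (z i) ‼_) (b ‼_))) (comb-cong (λ _ → refl) (λ i → trans (sym (ev-comb (z i) b)) (IntSpan.value (he i)))))))
  where
  z : Fin _ → Pt k
  z i = IntSpan.coeffs (he i)
  lat : IsLattice (comb c (λ i → toℚ (z i)))
  lat = lattice-comb c (λ i → toℚ (z i)) hc (λ i → z i , refl)

span-add : (b : Vec (QPt n) k) {x y : QPt n} → IntSpan b x → IntSpan b y → IntSpan b (addQ x y)
span-add b {x} {y} hx hy = subst (IntSpan b) (trans (comb-∷ 1ℚ (λ _ → 1ℚ) x (λ (_ : Fin 1) → y)) (cong₂ addQ (scale-1 x) (trans (sym (scale-comb 1ℚ y)) (scale-1 y))))
  (span-comb b (1ℚ ∷ᶠ λ _ → 1ℚ) (x ∷ᶠ λ _ → y) (λ { zero → Int-1 ; (suc _) → Int-1 }) (λ { zero → hx ; (suc _) → hy }))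

span-++ˡ : (b : Vec (QPt n) k) (b' : Vec (QPt n) l) {v : QPt n} → IntSpan b v → IntSpan (b Vec.++ b') v
span-++ˡ b b' (intSpan z eq) = intSpan (z Vec.++ Vec.replicate _ (ℤ.+ 0)) (trans (ev-++ˡ z b b') eq)

span-++ʳ : (b : Vec (QPt n) k) (b' : Vec (QPt n) l) {v : QPt n} → IntSpan b' v → IntSpan (b Vec.++ b') v
span-++ʳ b b' (intSpan z eq) = intSpan (Vec.replicate _ (ℤ.+ 0) Vec.++ z) (trans (ev-++ʳ z b b') eq)

span-basis : (b : Vec (QPt n) k) (i : Fin k) → IntSpan b (b ‼ i)
span-basis b i = intSpan (unitVec i) (ev-unit i b)

-- A polytope Q with a system b of vectors is meant as the copy of Q in coordinates b.
Vx : (Q : Poly) → Vec (QPt n) (proj₁ Q) → QPt n → Set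
Vx (_ , W) b p = ∃ λ w → w ∈ W × ev w b ≡ p

Inside : QSet n → (Q : Poly) → Vec (QPt n) (proj₁ Q) → Set
Inside P (_ , W) b = ∀ {w} → w ∈ W → P (ev w b)

⊕-∈ : ∀ {m n} {V : List (Pt m)} {W : List (Pt n)} {x : Pt (m ℕ.+ n)} → x ∈ proj₂ ((m , V) ⊕ (n , W)) →
  (∃ λ v → v ∈ V × x ≡ v Vec.++ Vec.replicate n (ℤ.+ 0)) ⊎ (∃ λ w → w ∈ W × x ≡ Vec.replicate m (ℤ.+ 0) Vec.++ w)
⊕-∈ {m} {n} {V} {W} p = [ (λ q → inj₁ (∈-map⁻ (λ v → v Vec.++ Vec.replicate n (ℤ.+ 0)) q)) , (λ q → inj₂ (∈-map⁻ (λ w → Vec.replicate m (ℤ.+ 0) Vec.++ w) q)) ]′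
  (∈-++⁻ (List.map (λ v → v Vec.++ Vec.replicate n (ℤ.+ 0)) V) p)

⊕-∈ˡ : ∀ {m n} {V : List (Pt m)} {W : List (Pt n)} {v} → v ∈ V → v Vec.++ Vec.replicate n (ℤ.+ 0) ∈ proj₂ ((m , V) ⊕ (n , W))
⊕-∈ˡ p = ∈-++⁺ˡ (∈-map⁺ _ p)

⊕-∈ʳ : ∀ {m n} {V : List (Pt m)} {W : List (Pt n)} {w} → w ∈ W → Vec.replicate m (ℤ.+ 0) Vec.++ w ∈ proj₂ ((m , V) ⊕ (n , W))
⊕-∈ʳ {V = V} p = ∈-++⁺ʳ (List.map _ V) (∈-map⁺ _ p)

inside-⊕ : {P : QSet n} (A B : Poly) (a : Vec (QPt n) (proj₁ A)) (b : Vec (QPt n) (proj₁ B)) → Inside P A a → Inside P B b → Inside P (A ⊕ B) (a Vec.++ b)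
inside-⊕ {P = P} (_ , V) (_ , W) a b ha hb p =
  [ (λ { (v , v∈ , refl) → subst P (sym (ev-++ˡ v a b)) (ha v∈) }) , (λ { (w , w∈ , refl) → subst P (sym (ev-++ʳ w a b)) (hb w∈) }) ]′ (⊕-∈ {V = V} {W} p)

vx-⊕ˡ : (A B : Poly) (a : Vec (QPt n) (proj₁ A)) (b : Vec (QPt n) (proj₁ B)) {p : QPt n} → Vx A a p → Vx (A ⊕ B) (a Vec.++ b) p
vx-⊕ˡ (_ , V) (_ , W) a b (v , v∈ , eq) = _ , ⊕-∈ˡ {V = V} {W} v∈ , trans (ev-++ˡ v a b) eq

vx-⊕ʳ : (A B : Poly) (a : Vec (QPt n) (proj₁ A)) (b : Vec (QPt n) (proj₁ B)) {p : QPt n} → Vx B b p → Vx (A ⊕ B) (a Vec.++ b) p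
vx-⊕ʳ (_ , V) (_ , W) a b (w , w∈ , eq) = _ , ⊕-∈ʳ {V = V} {W} w∈ , trans (ev-++ʳ w a b) eq

module Family {n : ℕ} {X : Set} (F : X → Poly) (b : (x : X) → Vec (QPt n) (proj₁ (F x))) where

  -- Relates the indices to the list of factors in the shape it has in `splitPoly`, a `replicate` or
  -- an iterated `map`; this avoids transport along equations between lists.
  data Zip : List X → List Poly → Set where
    []  : Zip [] []
    _∷_ : (x : X) {xs : List X} {Qs : List Poly} → Zip xs Qs → Zip (x ∷ xs) (F x ∷ Qs)

  basis : {xs : List X} {Qs : List Poly} → Zip xs Qs → Vec (QPt n) (proj₁ (⨁ Qs))
  basis []      = []
  basis (x ∷ z) = b x Vec.++ basis z

  inside : {P : QSet n} → P zeroQ → {xs : List X} {Qs : List Poly} (z : Zip xs Qs) → (∀ {x} → x ∈ xs → Inside P (F x) (b x)) → Inside P (⨁ Qs) (basis z)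
  inside P0 [] h (here refl) = P0
  inside {P} P0 {Qs = Q ∷ Qs} (x ∷ z) h = inside-⊕ {P = P} (F x) (⨁ Qs) (b x) (basis z) (h (here refl)) (inside {P} P0 z (h ∘ there))

  vx : {xs : List X} {Qs : List Poly} (z : Zip xs Qs) {x : X} {p : QPt n} → x ∈ xs → Vx (F x) (b x) p → Vx (⨁ Qs) (basis z) p
  vx {Qs = Q ∷ Qs} (x ∷ z) (here refl) v = vx-⊕ˡ (F x) (⨁ Qs) (b x) (basis z) v
  vx {Qs = Q ∷ Qs} (x ∷ z) (there p) v   = vx-⊕ʳ (F x) (⨁ Qs) (b x) (basis z) (vx z p v)

  span : {xs : List X} {Qs : List Poly} (z : Zip xs Qs) {x : X} {v : QPt n} → x ∈ xs → IntSpan (b x) v → IntSpan (basis z) v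
  span (x ∷ z) (here refl) s = span-++ˡ (b x) (basis z) s
  span (x ∷ z) (there p) s   = span-++ʳ (b x) (basis z) (span z p s)

  lattice : {xs : List X} {Qs : List Poly} (z : Zip xs Qs) → (∀ x → VAll.All IsLattice (b x)) → VAll.All IsLattice (basis z)
  lattice []      h = VAll.[]
  lattice (x ∷ z) h = VAllP.++⁺ (h x) (lattice z h)

  dim : {xs : List X} {Qs : List Poly} → Zip xs Qs → proj₁ (⨁ Qs) ≡ sum (List.map (proj₁ ∘ F) xs)
  dim []      = refl
  dim (x ∷ z) = cong (proj₁ (F x) ℕ.+_) (dim z)

-- n lattice vectors that generate the unit vectors integrally form a lattice basis. In its
-- coordinates both inclusions are checked on generators: by `inside` on those of Q, and by `hull`
-- and `vx` on the vertices of the given polytope.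
basis-iso : {V : List (Pt n)} (Q : Poly) (b : Vec (QPt n) (proj₁ Q)) → proj₁ Q ≡ n → VAll.All IsLattice b → (∀ j → IntSpan b (unitQ j)) →
  Inside ⟦ V ⟧ Q b → (∀ {Q : QSet n} → Convex Q → (∀ {x} → Extreme ⟦ V ⟧ x → Q x) → ∀ {x} → ⟦ V ⟧ x → Q x) →
  (∀ {p} → Extreme ⟦ V ⟧ p → Vx Q b p) → PolyIso ⟦ V ⟧ ⟦ proj₂ Q ⟧
basis-iso {n} {V} (n , W) b refl lat span inside hull vx = record
  { iso = record { f = f ; g = g ; f-comb = tab-linear f* ; g-comb = comb-linear (b ‼_)
    ; gf = λ x → trans (comb-cong (‼-tab (λ j → dot (f* j) x)) (λ _ → refl)) (dual-complete f-dual x)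
    ; fg = fg
    ; f-lat = tab-lattice f* f*-lat
    ; g-lat = λ {y} ly → lattice-comb (y ‼_) (b ‼_) (lattice-int ly) (λ j → VAllP.lookup⁺ lat j) }
  ; into = hull (linear-convex {f = f} (tab-linear f*) {⟦ W ⟧} (⟦⟧-convex W)) λ {x} ex → let (w , w∈ , eq) = vx ex in
      subst ⟦ W ⟧ (sym (trans (cong f (trans (sym eq) (ev-comb w b))) (fg (toℚ w)))) (⟦⟧-∈ w∈)
  ; back = ⟦⟧-sub W {λ y → ⟦ V ⟧ (g y)} (linear-convex {f = g} (comb-linear (b ‼_)) {⟦ V ⟧} (⟦⟧-convex V)) λ {w} w∈ → subst ⟦ V ⟧ (ev-comb w b) (inside w∈) }
  where
  dual : ∃ λ f* → Dualᶠ f* (b ‼_)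
  dual = spanning-dual λ j → (toℚ (IntSpan.coeffs (span j)) ‼_) , trans (sym (ev-comb (IntSpan.coeffs (span j)) b)) (IntSpan.value (span j))
  f* : Fin n → QPt n
  f* = proj₁ dual
  f-dual : Dualᶠ f* (b ‼_)
  f-dual = proj₂ dual
  f g : QPt n → QPt n
  f x = Vec.tabulate (λ j → dot (f* j) x)
  g y = comb (y ‼_) (b ‼_)
  fg : ∀ y → f (g y) ≡ y
  fg y = vext λ j → trans (‼-tab (λ j → dot (f* j) (g y)) j) (dual-coeff f-dual (y ‼_) j)
  f*-lat : ∀ j → IsLattice (f* j)
  f*-lat j = int-lattice λ a → Int-cast (trans (sym (dual-coeff f-dual (toℚ (IntSpan.coeffs (span a)) ‼_) j))
      (trans (cong (dot (f* j)) (trans (sym (ev-comb (IntSpan.coeffs (span a)) b)) (IntSpan.value (span a)))) (dot-unitʳ (f* j) a)))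
    (lattice-int (IntSpan.coeffs (span a) , refl) j)

Trit : ℚ → Set
Trit q = q ≡ - 1ℚ ⊎ q ≡ 0ℚ ⊎ q ≡ 1ℚ

nonzero? : {A : Set} (c : A → ℚ) → Decidable (λ i → c i ≢ 0ℚ)
nonzero? c i = ¬? (c i ℚP.≟ 0ℚ)

sumLℚ : {A : Set} → (A → ℚ) → List A → ℚ
sumLℚ c []       = 0ℚ
sumLℚ c (x ∷ xs) = c x + sumLℚ c xs

sumLℚ-allFin : (c : Fin k → ℚ) → ∀ {l} (ι : Fin l → Fin k) → sumLℚ c (List.tabulate ι) ≡ sumF (c ∘ ι)
sumLℚ-allFin c {zero}  ι = refl
sumLℚ-allFin c {suc l} ι = cong (c (ι zero) +_) (sumLℚ-allFin c (ι ∘ suc))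

record SignCount {A : Set} (c : A → ℚ) (xs : List A) : Set where
  field
    p q   : ℕ
    count : List.length (List.filter (nonzero? c) xs) ≡ p ℕ.+ q
    total : sumLℚ c xs ≡ fromℤ (ℤ.+ p) - fromℤ (ℤ.+ q)

signCount : {A : Set} (c : A → ℚ) → (∀ x → Trit (c x)) → (xs : List A) → SignCount c xs
signCount c t [] = record { p = 0 ; q = 0 ; count = refl ; total = refl }
signCount c t (x ∷ xs) = go (t x) (c x ℚP.≟ 0ℚ) refl
  where
  open SignCount (signCount c t xs)
  length-yes : c x ≢ 0ℚ → List.length (List.filter (nonzero? c) (x ∷ xs)) ≡ suc (p ℕ.+ q)
  length-yes h = trans (cong List.length (ListP.filter-accept (nonzero? c) h)) (cong suc count)
  lem₁ : ∀ p q → 1ℚ + (p - q) ≡ (1ℚ + p) - q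
  lem₁ = solve-∀ ℚring
  lem₂ : ∀ p q → - 1ℚ + (p - q) ≡ p - (1ℚ + q)
  lem₂ = solve-∀ ℚring
  go : Trit (c x) → Dec (c x ≡ 0ℚ) → ∀ {z} → z ≡ c x → SignCount c (x ∷ xs)
  go (inj₁ eq) _ _ = record { p = p ; q = suc q ; count = trans (length-yes (λ e → case trans (sym eq) e of λ ())) (sym (ℕP.+-suc p q))
    ; total = trans (cong₂ _+_ eq total) (trans (lem₂ (fromℤ (ℤ.+ p)) (fromℤ (ℤ.+ q))) (cong (λ z → fromℤ (ℤ.+ p) - z) (sym (fromℤ-+ (ℤ.+ 1) (ℤ.+ q))))) }
  go (inj₂ (inj₁ eq)) _ _ = record { p = p ; q = q ; count = trans (cong List.length (ListP.filter-reject (nonzero? c) (λ h → h eq))) count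
    ; total = trans (cong₂ _+_ eq total) (ℚP.+-identityˡ _) }
  go (inj₂ (inj₂ eq)) _ _ = record { p = suc p ; q = q ; count = length-yes (λ e → case trans (sym eq) e of λ ())
    ; total = trans (cong₂ _+_ eq total) (trans (lem₁ (fromℤ (ℤ.+ p)) (fromℤ (ℤ.+ q))) (cong (_- fromℤ (ℤ.+ q)) (sym (fromℤ-+ (ℤ.+ 1) (ℤ.+ p))))) }

-- Entries ±1 with sum 0 come in equal numbers, and a nonzero entry makes this number positive. This
-- is why the del Pezzo factors have even dimension.
sign-balanced : {A : Set} (c : A → ℚ) → (∀ x → Trit (c x)) → (xs : List A) → sumLℚ c xs ≡ 0ℚ → ∀ {x} → x ∈ xs → c x ≢ 0ℚ →
  EvenPos (List.length (List.filter (nonzero? c) xs))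
sign-balanced c t xs s x∈ cx = go p refl
  where
  open SignCount (signCount c t xs)
  p≡q : p ≡ q
  p≡q = ℤP.+-injective (fromℤ-injective (diff-0 (trans (sym total) s)))
  go : ∀ p' → p ≡ p' → EvenPos (List.length (List.filter (nonzero? c) xs))
  go (suc j) eq = j , trans count (cong₂ ℕ._+_ eq (trans (sym p≡q) eq))
  go zero eq    = ⊥-elim (ℕP.<-irrefl refl (subst (0 ℕ.<_) (trans count (cong₂ ℕ._+_ eq (trans (sym p≡q) eq))) (positive (∈-filter⁺ (nonzero? c) x∈ cx))))
    where
    positive : ∀ {A : Set} {x : A} {ys : List A} → x ∈ ys → 0 ℕ.< List.length ys
    positive (here _)  = ℕ.s≤s ℕ.z≤n
    positive (there _) = ℕ.s≤s ℕ.z≤n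

-- Existence of the splitting

module Existence {d : ℕ} (V : List (Pt (suc d))) (reflexive : Reflexive V) (simplicial : Simplicial V)
  (O : Symmetric.Opposite V reflexive simplicial) where

  open Blocks V reflexive simplicial O
  module C = CoreFactor V reflexive simplicial O

  record Block : Set where
    field
      x      : QPt (suc d)
      level0 : Level0 x
      i      : Fin (suc d)
      here≢0 : coord i x ≢ 0ℚ

  coords : QPt (suc d) → Fin (suc d) → ℚ
  coords x i = coord i x

  trit : ∀ {x} → Level0 x → ∀ i → Trit (coord i x)
  trit {x} X i = go (coordinate X i)
    where
    go : Coordinate i x → Trit (coord i x)
    go (minus eq _) = inj₁ eq
    go (none eq)    = inj₂ (inj₁ eq)
    go (plus eq _)  = inj₂ (inj₂ eq)

  opaque
    support : QPt (suc d) → List (Fin (suc d))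
    support x = List.filter (nonzero? (coords x)) (List.allFin (suc d))

    support-∈ : ∀ {x i} → coord i x ≢ 0ℚ → i ∈ support x
    support-∈ {x} h = ∈-filter⁺ (nonzero? (coords x)) (∈-allFin _) h

    ∈-support : ∀ {x i} → i ∈ support x → coord i x ≢ 0ℚ
    ∈-support {x} p = proj₂ (∈-filter⁻ (nonzero? (coords x)) {xs = List.allFin (suc d)} p)

    support-tf : ∀ {x} → Level0 x → List.filter (nonzero? (coords x)) C.torsion-free ≡ support x
    support-tf {x} X = C.tf-filter (nonzero? (coords x)) (support-lattice X)

    support-even : (β : Block) → EvenPos (List.length (support (Block.x β)))
    support-even β = sign-balanced (coords x) (trit level0) (List.allFin (suc d))
      (trans (sumLℚ-allFin (coords x) id) (trans (sym (level-sum x)) (proj₂ level0))) (∈-allFin i) here≢0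
      where open Block β

    support-sum : ∀ x → sumL (List.map (λ i → scaleQ (- coord i x) (e i)) (support x)) ≡ negQ x
    support-sum x = trans (sumL-filter (nonzero? (coords x)) φ (λ i h → vanish i (coord i x ℚP.≟ 0ℚ) h) (List.allFin (suc d)))
      (trans (cong sumL (ListP.map-tabulate id φ)) (trans (sumL-tabulate φ) (dot-ext-dual e-dual value)))
      where
      φ : Fin (suc d) → QPt (suc d)
      φ i = scaleQ (- coord i x) (e i)
      vanish : ∀ i → Dec (coord i x ≡ 0ℚ) → ¬ (coord i x ≢ 0ℚ) → φ i ≡ zeroQ
      vanish i (yes eq) _ = trans (cong (λ t → scaleQ (- t) (e i)) eq) (scale-0 (e i))
      vanish i (no ne) h  = ⊥-elim (h ne)
      lem : ∀ a δ → 1ℚ * ((- a) * δ) ≡ (- a) * δ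
      lem = solve-∀ ℚring
      value : ∀ j → coord j (comb (λ _ → 1ℚ) φ) ≡ coord j (negQ x)
      value j = trans (dot-comb (e* j) (λ _ → 1ℚ) φ) (trans (sumF-cong (λ i → trans (cong (1ℚ *_) (trans (dot-scale (- coord i x) (e* j) (e i))
          (cong (- coord i x *_) (trans (biorth e-dual j i) (δ-sym j i))))) (lem (coord i x) (δ i j))))
        (trans (sumF-δʳ j (λ i → - coord i x)) (sym (dot-neg (e* j) x))))

  -- The block of x has the lattice basis -x_i e_i for i in the support of x, and then x = -Σ_i (-x_i e_i).
  bList : QPt (suc d) → List (QPt (suc d))
  bList x = List.map (λ i → scaleQ (- coord i x) (e i)) (support x)

  size : Block → ℕ
  size β = List.length (bList (Block.x β))

  size-even : (β : Block) → EvenPos (size β)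
  size-even β = subst EvenPos (sym (ListP.length-map _ (support (Block.x β)))) (support-even β)

  bVec : (β : Block) → Vec (QPt (suc d)) (size β)
  bVec β = Vec.fromList (bList (Block.x β))

  Sign : QPt (suc d) → QPt (suc d) → Set
  Sign p q = p ≡ q ⊎ p ≡ negQ q

  sign-neg : ∀ {p q} → Sign p q → Sign (negQ p) q
  sign-neg {p} {q} = [ (λ eq → inj₂ (cong negQ eq)) , (λ eq → inj₁ (trans (cong negQ eq) (negQ-negQ q))) ]′

  signed-basis : ∀ {x} → Level0 x → ∀ i → coord i x ≢ 0ℚ → Sign (scaleQ (- coord i x) (e i)) (e i)
  signed-basis {x} X i h = go (coordinate X i)
    where
    go : Coordinate i x → Sign (scaleQ (- coord i x) (e i)) (e i)
    go (none eq)    = ⊥-elim (h eq)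
    go (minus eq _) = inj₁ (trans (cong (λ t → scaleQ (- t) (e i)) eq) (scale-1 (e i)))
    go (plus eq _)  = inj₂ (trans (cong (λ t → scaleQ (- t) (e i)) eq) (sym (neg-scale (e i))))

  bList-∈ : ∀ {x y} → Level0 x → y ∈ bList x → ∃ λ i → coord i x ≢ 0ℚ × Sign y (e i)
  bList-∈ {x} {y} X p = let (i , i∈ , eq) = ∈-map⁻ (λ i → scaleQ (- coord i x) (e i)) p in
    i , ∈-support i∈ , subst (λ z → Sign z (e i)) (sym eq) (signed-basis X i (∈-support i∈))

  fromList-∈ : {A : Set} (L : List A) (j : Fin (List.length L)) → Vec.fromList L ‼ j ∈ L
  fromList-∈ (x ∷ L) zero    = here refl
  fromList-∈ (x ∷ L) (suc j) = there (fromList-∈ L j)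

  ∈-fromList : {A : Set} {L : List A} {x : A} → x ∈ L → ∃ λ j → Vec.fromList L ‼ j ≡ x
  ∈-fromList (here refl) = zero , refl
  ∈-fromList (there p)   = let (j , eq) = ∈-fromList p in suc j , eq

  sign-extreme : ∀ {y i} → Sign y (e i) → Extreme P y
  sign-extreme {i = i} = [ (λ eq → subst (Extreme P) (sym eq) (e-extreme i)) , (λ eq → subst (Extreme P) (sym eq) (neg-e-extreme i)) ]′

  b-entry : (β : Block) (j : Fin (size β)) → ∃ λ i → coord i (Block.x β) ≢ 0ℚ × Sign (bVec β ‼ j) (e i)
  b-entry β j = bList-∈ (Block.level0 β) (fromList-∈ (bList (Block.x β)) j)

  b-find : (β : Block) {i : Fin (suc d)} → coord i (Block.x β) ≢ 0ℚ → ∃ λ j → Sign (e i) (bVec β ‼ j)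
  b-find β {i} h = let (j , eq) = ∈-fromList (∈-map⁺ (λ i → scaleQ (- coord i (Block.x β)) (e i)) (support-∈ h)) in
    j , [ (λ s → inj₁ (trans (sym s) (sym eq))) , (λ s → inj₂ (trans (sym (negQ-negQ (e i))) (cong negQ (trans (sym s) (sym eq))))) ]′ (signed-basis (Block.level0 β) i h)

  ones : (β : Block) → ev allOnes (bVec β) ≡ negQ (Block.x β)
  ones β = trans (ev-ones (bList (Block.x β))) (support-sum (Block.x β))

  -ones : (β : Block) → ev (negℤ allOnes) (bVec β) ≡ Block.x β
  -ones β = trans (ev-neg allOnes (bVec β)) (trans (cong negQ (ones β)) (negQ-negQ (Block.x β)))

  cross-inside : (β : Block) → Inside P (size β , crossVerts (size β)) (bVec β)
  cross-inside β {w} p = [ (λ q → plus-case (∈-map⁻ unitVec q)) , (λ q → minus-case (∈-map⁻ (λ i → negℤ (unitVec i)) q)) ]′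
    (∈-++⁻ (List.map unitVec (List.allFin (size β))) p)
    where
    plus-case : (∃ λ j → j ∈ List.allFin (size β) × w ≡ unitVec j) → P (ev w (bVec β))
    plus-case (j , _ , refl) = subst P (sym (ev-unit j (bVec β))) (proj₁ (sign-extreme (proj₂ (proj₂ (b-entry β j)))))
    minus-case : (∃ λ j → j ∈ List.allFin (size β) × w ≡ negℤ (unitVec j)) → P (ev w (bVec β))
    minus-case (j , _ , refl) = subst P (sym (trans (ev-neg (unitVec j) (bVec β)) (cong negQ (ev-unit j (bVec β)))))
      (proj₁ (sign-extreme (sign-neg (proj₂ (proj₂ (b-entry β j))))))

  cross-vx : (β : Block) {i : Fin (suc d)} → coord i (Block.x β) ≢ 0ℚ → ∀ {y} → Sign y (e i) → ∃ λ w → w ∈ crossVerts (size β) × ev w (bVec β) ≡ y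
  cross-vx β {i} h {y} s = go (combine s (proj₂ (b-find β h)))
    where
    j : Fin (size β)
    j = proj₁ (b-find β h)
    combine : ∀ {p q r} → Sign p q → Sign q r → Sign p r
    combine (inj₁ refl) s = s
    combine (inj₂ refl) s = sign-neg s
    go : Sign y (bVec β ‼ j) → _
    go (inj₁ eq) = unitVec j , ∈-++⁺ˡ (∈-map⁺ unitVec (∈-allFin j)) , trans (ev-unit j (bVec β)) (sym eq)
    go (inj₂ eq) = negℤ (unitVec j) , ∈-++⁺ʳ (List.map unitVec (List.allFin (size β))) (∈-map⁺ (λ i → negℤ (unitVec i)) (∈-allFin j)) ,
      trans (ev-neg (unitVec j) (bVec β)) (trans (cong negQ (ev-unit j (bVec β))) (sym eq))

  dp-inside : (β : Block) → Extreme P (negQ (Block.x β)) → Inside P (delPezzo (size β)) (bVec β)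
  dp-inside β ex (here refl)         = subst P (sym (ones β)) (proj₁ ex)
  dp-inside β ex (there (here refl)) = subst P (sym (-ones β)) (proj₁ (proj₁ (Block.level0 β)))
  dp-inside β ex (there (there p))   = cross-inside β p

  pdp-inside : (β : Block) → Inside P (pseudoDelPezzo (size β)) (bVec β)
  pdp-inside β (here refl) = subst P (sym (-ones β)) (proj₁ (proj₁ (Block.level0 β)))
  pdp-inside β (there p)   = cross-inside β p

  -- Disjointness of the pieces is recorded only through the count `total`: vectors that span
  -- integrally and are as many as the dimension form a basis.
  record Cover (rest : List (Fin (suc d))) : Set where
    field
      segs     : List (Fin (suc d))
      dxs pxs  : List Block
      total    : List.length segs ℕ.+ (sum (List.map size dxs) ℕ.+ sum (List.map size pxs)) ≡ List.length rest
      free     : ∀ {i} → i ∈ segs → ∀ {x} → Level0 x → coord i x ≡ 0ℚ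
      double   : ∀ {β} → β ∈ dxs → Extreme P (negQ (Block.x β))
      simple   : ∀ {β} → β ∈ pxs → ¬ Extreme P (negQ (Block.x β))
      covered  : ∀ {i} → i ∈ rest → i ∈ segs ⊎ (∃ λ β → β ∈ dxs × coord i (Block.x β) ≢ 0ℚ) ⊎ (∃ λ β → β ∈ pxs × coord i (Block.x β) ≢ 0ℚ)

  -- Says by counting that rest contains the whole support of x as soon as it meets it.
  Saturated : List (Fin (suc d)) → Set
  Saturated rest = ∀ {x i} → Level0 x → i ∈ rest → coord i x ≢ 0ℚ → List.length (List.filter (nonzero? (coords x)) rest) ≡ List.length (support x)

  -- By `related` a common support index would make y equal to x or -x, hence nonzero at i.
  disjoint : ∀ {x y i} → Level0 x → Level0 y → coord i x ≢ 0ℚ → coord i y ≡ 0ℚ → ∀ j → coord j x ≢ 0ℚ → coord j y ≡ 0ℚ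
  disjoint {x} {y} {i} X Y xi yi j xj = go (coord j y ℚP.≟ 0ℚ)
    where
    go : Dec (coord j y ≡ 0ℚ) → coord j y ≡ 0ℚ
    go (yes eq) = eq
    go (no h)   = ⊥-elim ([ (λ eq → xi (trans (cong (coord i) (sym eq)) yi))
      , (λ eq → xi (trans (sym (neg-neg (coord i x))) (cong -_ (trans (sym (dot-neg (e* i) x)) (trans (cong (coord i) (sym eq)) yi))))) ]′ (related X Y xj h))

  cover-nil : Cover []
  cover-nil = record { segs = [] ; dxs = [] ; pxs = [] ; total = refl ; free = λ () ; double = λ () ; simple = λ () ; covered = λ () }

  cover-free : ∀ {i rest} → (∀ {x} → Level0 x → coord i x ≡ 0ℚ) → Cover rest → Cover (i ∷ rest)
  cover-free {i} fr c = record { segs = i ∷ segs ; dxs = dxs ; pxs = pxs ; total = cong suc total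
    ; free = λ { (here refl) → fr ; (there p) → free p } ; double = double ; simple = simple
    ; covered = λ { (here refl) → inj₁ (here refl) ; (there p) → [ inj₁ ∘ there , inj₂ ]′ (covered p) } }
    where open Cover c

  move : ∀ a b s t → a ℕ.+ (s ℕ.+ t) ≡ b → ∀ k → a ℕ.+ ((k ℕ.+ s) ℕ.+ t) ≡ k ℕ.+ b
  move a b s t eq k = trans (cong (a ℕ.+_) (ℕP.+-assoc k s t)) (trans (x∙yz≈y∙xz a k (s ℕ.+ t)) (cong (k ℕ.+_) eq))
    where open import Algebra.Properties.CommutativeSemigroup ℕP.+-commutativeSemigroup using (x∙yz≈y∙xz)

  move' : ∀ a b s t → a ℕ.+ (s ℕ.+ t) ≡ b → ∀ k → a ℕ.+ (s ℕ.+ (k ℕ.+ t)) ≡ k ℕ.+ b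
  move' a b s t eq k = trans (cong (a ℕ.+_) (x∙yz≈y∙xz s k t)) (trans (x∙yz≈y∙xz a k (s ℕ.+ t)) (cong (k ℕ.+_) eq))
    where open import Algebra.Properties.CommutativeSemigroup ℕP.+-commutativeSemigroup using (x∙yz≈y∙xz)

  cover-block : ∀ {rest} (β : Block) → let R? = nonzero? (coords (Block.x β)) in
    List.length (List.filter R? rest) ≡ List.length (support (Block.x β)) → Dec (Extreme P (negQ (Block.x β))) →
    Cover (List.filter (¬? ∘ R?) rest) → Cover rest
  cover-block {rest} β len dec c = go dec
    where
    open Cover c
    R? = nonzero? (coords (Block.x β))
    rest' = List.filter (¬? ∘ R?) rest
    lengths : size β ℕ.+ List.length rest' ≡ List.length rest
    lengths = trans (cong (ℕ._+ List.length rest') (trans (ListP.length-map _ (support (Block.x β))) (sym len))) (filter-lengths R? rest)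
    out : ∀ {i} → i ∈ rest → Dec (coord i (Block.x β) ≡ 0ℚ) → coord i (Block.x β) ≢ 0ℚ ⊎ i ∈ rest'
    out p (yes eq) = inj₂ (∈-filter⁺ (¬? ∘ R?) p (λ h → h eq))
    out p (no h)   = inj₁ h
    go : Dec (Extreme P (negQ (Block.x β))) → Cover rest
    go (yes ex) = record { segs = segs ; dxs = β ∷ dxs ; pxs = pxs ; free = free
      ; total = trans (move (List.length segs) (List.length rest') (sum (List.map size dxs)) (sum (List.map size pxs)) total (size β)) lengths
      ; double = λ { (here refl) → ex ; (there p) → double p } ; simple = simple
      ; covered = λ {i} p → [ (λ h → inj₂ (inj₁ (β , here refl , h))) , (λ q → [ inj₁ , [ (λ { (γ , γ∈ , h) → inj₂ (inj₁ (γ , there γ∈ , h)) }) , inj₂ ∘ inj₂ ]′ ]′ (covered q)) ]′ (out p (coord i (Block.x β) ℚP.≟ 0ℚ)) }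
    go (no ¬ex) = record { segs = segs ; dxs = dxs ; pxs = β ∷ pxs ; free = free
      ; total = trans (move' (List.length segs) (List.length rest') (sum (List.map size dxs)) (sum (List.map size pxs)) total (size β)) lengths
      ; double = double ; simple = λ { (here refl) → ¬ex ; (there p) → simple p }
      ; covered = λ {i} p → [ (λ h → inj₂ (inj₂ (β , here refl , h))) , (λ q → [ inj₁ , [ inj₂ ∘ inj₁ , (λ { (γ , γ∈ , h) → inj₂ (inj₂ (γ , there γ∈ , h)) }) ]′ ]′ (covered q)) ]′ (out p (coord i (Block.x β) ℚP.≟ 0ℚ)) }

  -- Each step removes a free index or the whole support of a vertex. Supports are equal or
  -- disjoint, so no other support is cut.
  cover : (fuel : ℕ) (rest : List (Fin (suc d))) → List.length rest ℕ.≤ fuel → Saturated rest → Cover rest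
  cover fuel [] _ _ = cover-nil
  cover (suc fuel) (i ∷ rest) (ℕ.s≤s len) sat = go (in-block? i)
    where
    go : (∃ λ x → Level0 x × coord i x ≢ 0ℚ) ⊎ (∀ {x} → Level0 x → coord i x ≡ 0ℚ) → Cover (i ∷ rest)
    go (inj₂ fr) = cover-free fr (cover fuel rest len λ {x} X p h →
      trans (cong List.length (sym (ListP.filter-reject (nonzero? (coords x)) {x = i} {xs = rest} (λ ne → ne (fr X))))) (sat X (there p) h))
    go (inj₁ (x , X , xi)) = cover-block β (sat X (here refl) xi) (antipode? X xi) (cover fuel _ short sat')
      where
      β : Block
      β = record { x = x ; level0 = X ; i = i ; here≢0 = xi }
      R? = nonzero? (coords x)
      short : List.length (List.filter (¬? ∘ R?) (i ∷ rest)) ℕ.≤ fuel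
      short = subst (λ L → List.length L ℕ.≤ fuel) (sym (ListP.filter-reject (¬? ∘ R?) {x = i} {xs = rest} (λ h → h xi)))
        (ℕP.≤-trans (ListP.length-filter (¬? ∘ R?) rest) len)
      sat' : Saturated (List.filter (¬? ∘ R?) (i ∷ rest))
      -- The support of y misses that of x, so removing the latter does not change the count for y.
      sat' {y} {j} Y p yj = let (p' , xj) = ∈-filter⁻ (¬? ∘ R?) {xs = i ∷ rest} p in
        trans (cong List.length (filter-filter (nonzero? (coords y)) (¬? ∘ R?) (λ l yl ne → ne (disjoint Y X yj (dec-eq xj) l yl)) (i ∷ rest))) (sat Y p' yj)
        where
        dec-eq : ∀ {q : ℚ} → ¬ (q ≢ 0ℚ) → q ≡ 0ℚ
        dec-eq {q} h = [ id , (λ ne → ⊥-elim (h ne)) ]′ (split (q ℚP.≟ 0ℚ))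
          where
          split : Dec (q ≡ 0ℚ) → q ≡ 0ℚ ⊎ q ≢ 0ℚ
          split (yes e) = inj₁ e
          split (no n)  = inj₂ n

  opaque
    full-cover : Cover C.torsion-free
    full-cover = cover (List.length C.torsion-free) C.torsion-free ℕP.≤-refl λ X _ _ → cong List.length (support-tf X)

  open Cover full-cover

  module S = Family {X = Fin (suc d)} (λ _ → segment) (λ i → e i ∷ [])
  module D = Family (λ β → delPezzo (size β)) bVec
  module Q = Family (λ β → pseudoDelPezzo (size β)) bVec

  seg-zip : (L : List (Fin (suc d))) → S.Zip L (List.replicate (List.length L) segment)
  seg-zip []      = S.[]
  seg-zip (i ∷ L) = i S.∷ seg-zip L

  dp-zip : (L : List Block) → D.Zip L (List.map delPezzo (List.map size L))
  dp-zip []      = D.[]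
  dp-zip (β ∷ L) = β D.∷ dp-zip L

  pdp-zip : (L : List Block) → Q.Zip L (List.map pseudoDelPezzo (List.map size L))
  pdp-zip []      = Q.[]
  pdp-zip (β ∷ L) = β Q.∷ pdp-zip L

  segP dpP pdpP : Poly
  segP = ⨁ (List.replicate (List.length segs) segment)
  dpP  = ⨁ (List.map delPezzo (List.map size dxs))
  pdpP = ⨁ (List.map pseudoDelPezzo (List.map size pxs))

  segB : Vec (QPt (suc d)) (proj₁ segP)
  segB = S.basis (seg-zip segs)
  dpB : Vec (QPt (suc d)) (proj₁ dpP)
  dpB = D.basis (dp-zip dxs)
  pdpB : Vec (QPt (suc d)) (proj₁ pdpP)
  pdpB = Q.basis (pdp-zip pxs)

  restP : Poly
  restP = segP ⊕ (dpP ⊕ pdpP)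

  restB : Vec (QPt (suc d)) (proj₁ restP)
  restB = segB Vec.++ (dpB Vec.++ pdpB)

  seg-inside : (i : Fin (suc d)) → Inside P segment (e i ∷ [])
  seg-inside i (here refl)         = subst P (sym (trans (add-zeroʳ _) (scale-1 (e i)))) (proj₁ (e-extreme i))
  seg-inside i (there (here refl)) = subst P (sym (trans (add-zeroʳ _) (sym (neg-scale (e i))))) (proj₁ (neg-e-extreme i))

  seg-vx : (i : Fin (suc d)) → ∀ {y} → Sign y (e i) → Vx segment (e i ∷ []) y
  seg-vx i (inj₁ eq) = _ , here refl , trans (add-zeroʳ _) (trans (scale-1 (e i)) (sym eq))
  seg-vx i (inj₂ eq) = _ , there (here refl) , trans (add-zeroʳ _) (trans (sym (neg-scale (e i))) (sym eq))

  bVec-lattice : (β : Block) → VAll.All IsLattice (bVec β)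
  bVec-lattice β = VAllP.lookup⁻ λ j → let (i , _ , s) = b-entry β j in extreme-lattice (sign-extreme s)

  rest-lattice : VAll.All IsLattice restB
  rest-lattice = VAllP.++⁺ (S.lattice (seg-zip segs) (λ i → extreme-lattice (e-extreme i) VAll.∷ VAll.[]))
    (VAllP.++⁺ (D.lattice (dp-zip dxs) bVec-lattice) (Q.lattice (pdp-zip pxs) bVec-lattice))

  rest-inside : Inside P restP restB
  rest-inside = inside-⊕ {P = P} segP (dpP ⊕ pdpP) segB (dpB Vec.++ pdpB) (S.inside {P} zero∈P (seg-zip segs) (λ {i} _ → seg-inside i))
    (inside-⊕ {P = P} dpP pdpP dpB pdpB (D.inside {P} zero∈P (dp-zip dxs) (λ {β} p → dp-inside β (double p))) (Q.inside {P} zero∈P (pdp-zip pxs) (λ {β} _ → pdp-inside β)))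

  in-seg : ∀ {y} → Vx segP segB y → Vx restP restB y
  in-seg = vx-⊕ˡ segP (dpP ⊕ pdpP) segB (dpB Vec.++ pdpB)

  in-dp : ∀ {y} → Vx dpP dpB y → Vx restP restB y
  in-dp v = vx-⊕ʳ segP (dpP ⊕ pdpP) segB (dpB Vec.++ pdpB) (vx-⊕ˡ dpP pdpP dpB pdpB v)

  in-pdp : ∀ {y} → Vx pdpP pdpB y → Vx restP restB y
  in-pdp v = vx-⊕ʳ segP (dpP ⊕ pdpP) segB (dpB Vec.++ pdpB) (vx-⊕ʳ dpP pdpP dpB pdpB v)

  rest-vx-e : ∀ {i} → IsLattice (e* i) → ∀ {y} → Sign y (e i) → Vx restP restB y
  rest-vx-e {i} lat {y} s = go (covered (C.tf-∈ lat))
    where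
    go : _ → Vx restP restB y
    go (inj₁ p) = in-seg (S.vx (seg-zip segs) p (seg-vx i s))
    go (inj₂ (inj₁ (β , p , h))) = let (w , w∈ , eq) = cross-vx β h s in in-dp (D.vx (dp-zip dxs) p (w , there (there w∈) , eq))
    go (inj₂ (inj₂ (β , p , h))) = let (w , w∈ , eq) = cross-vx β h s in in-pdp (Q.vx (pdp-zip pxs) p (w , there w∈ , eq))

  rest-span : ∀ {i} → IsLattice (e* i) → IntSpan restB (e i)
  rest-span lat = let (w , _ , eq) = rest-vx-e lat (inj₁ refl) in intSpan w eq

  rest-vx-0 : ∀ {x i} → Level0 x → coord i x ≢ 0ℚ → Vx restP restB x
  rest-vx-0 {x} {i} X h = go (covered (C.tf-∈ (support-lattice X h)))
    where
    go : _ → Vx restP restB x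
    go (inj₁ p) = ⊥-elim (h (free p X))
    go (inj₂ (inj₁ (β , p , hβ))) = [ (λ eq → in-dp (D.vx (dp-zip dxs) p (_ , there (here refl) , trans (-ones β) (sym eq))))
      , (λ eq → in-dp (D.vx (dp-zip dxs) p (_ , here refl , trans (ones β) (sym eq)))) ]′ (related (Block.level0 β) X hβ h)
    go (inj₂ (inj₂ (β , p , hβ))) = [ (λ eq → in-pdp (Q.vx (pdp-zip pxs) p (_ , here refl , trans (-ones β) (sym eq))))
      , (λ eq → ⊥-elim (simple p (subst (Extreme P) eq (proj₁ X)))) ]′ (related (Block.level0 β) X hβ h)

  sum-ones : (L : List (Fin (suc d))) → sum (List.map (λ _ → 1) L) ≡ List.length L
  sum-ones []      = refl
  sum-ones (x ∷ L) = cong suc (sum-ones L)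

  rest-dim : proj₁ restP ≡ List.length C.torsion-free
  rest-dim = trans (cong₂ ℕ._+_ (trans (S.dim (seg-zip segs)) (sum-ones segs)) (cong₂ ℕ._+_ (D.dim (dp-zip dxs)) (Q.dim (pdp-zip pxs)))) total

  -- Otherwise x would be 0, which is no vertex, being the midpoint of e_0 and -e_0.
  nonzero-coordinate : ∀ {x} → Level0 x → ∃ λ i → coord i x ≢ 0ℚ
  nonzero-coordinate {x} X = go (FinP.all? (λ i → coord i x ℚP.≟ 0ℚ))
    where
    zero-absurd : x ≡ zeroQ → ⊥
    zero-absurd refl = 0≢1 (trans (sym (trans (cong (dot g) (proj₂ (proj₁ X) (e zero) (negQ (e zero)) (proj₁ (e-extreme zero)) (proj₁ (neg-e-extreme zero)) mid)) (dot-zero g))) (g-e zero))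
      where
      lem : ∀ a → 0ℚ ≡ ½ * (a + - a)
      lem = solve-∀ ℚring
      mid : zeroQ ≡ midpoint (e zero) (negQ (e zero))
      mid = vext λ j → trans (‼-zero j) (trans (lem (e zero ‼ j)) (sym (trans (‼-scale ½ (addQ (e zero) (negQ (e zero))) j)
        (cong (½ *_) (trans (‼-add (e zero) (negQ (e zero)) j) (cong (e zero ‼ j +_) (‼-neg (e zero) j)))))))
    go : Dec (∀ i → coord i x ≡ 0ℚ) → ∃ λ i → coord i x ≢ 0ℚ
    go (yes all) = ⊥-elim (zero-absurd (dot-ext-dual e-dual (λ i → trans (all i) (sym (dot-zero (e* i))))))
    go (no ¬all) = FinP.¬∀⟶∃¬ _ _ (λ i → coord i x ℚP.≟ 0ℚ) ¬all

  -- The e_i with integral e_i* and the basis of their complement form a lattice basis, so integral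
  -- spanning has to be checked only on these vectors.
  lattice-split : ∀ {k} (b : Vec (QPt (suc d)) k) → (∀ {i} → IsLattice (e* i) → IntSpan b (e i)) → (∀ j → IntSpan b (C.B j)) →
    ∀ {v} → IsLattice v → IntSpan b v
  lattice-split b he hB {v} lv = subst (IntSpan b) (sym (C.split v)) (span-add b
    (span-comb b _ _ (λ i → lattice-dot (C.tf-lattice (∈-lookup i)) lv) (λ i → he (C.tf-lattice (∈-lookup i))))
    (span-comb b _ _ (λ j → lattice-dot (C.A-lat j) lv) hB))

  even-sizes : (L : List Block) → ∀ i → EvenPos (List.lookup (List.map size L) i)
  even-sizes (β ∷ L) zero    = size-even β
  even-sizes (β ∷ L) (suc i) = even-sizes L i

  sign-of : ∀ {y} → (∃ λ j → y ≡ e j) ⊎ (∃ λ j → y ≡ negQ (e j)) ⊎ dot g y ≡ 0ℚ → (∃ λ j → Sign y (e j)) ⊎ dot g y ≡ 0ℚ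
  sign-of (inj₁ (j , eq))        = inj₁ (j , inj₁ eq)
  sign-of (inj₂ (inj₁ (j , eq))) = inj₁ (j , inj₂ eq)
  sign-of (inj₂ (inj₂ l))        = inj₂ l

  module WithCore {i₀ : Fin (suc d)} (h₀ : ¬ IsLattice (e* i₀)) where

    open C.NonTrivial h₀

    D⁺ : Decomposition
    D⁺ = record { core = just (C.rank , C.V₀) ; coreOK = V₀-reflexive , V₀-cs , V₀-irreducible ; r = List.length segs
      ; dP = List.map size dxs ; dPEven = even-sizes dxs ; pdP = List.map size pxs ; pdPEven = even-sizes pxs }

    coreP : Poly
    coreP = C.rank , C.V₀

    coreB : Vec (QPt (suc d)) C.rank
    coreB = Vec.tabulate C.B

    core-ev : ∀ z → ev z coreB ≡ C.ι (toℚ z)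
    core-ev z = trans (ev-comb z coreB) (comb-cong (λ _ → refl) (‼-tab C.B))

    signed-κ : ∀ {i y} → ¬ IsLattice (e* i) → y ≡ C.κ i ⊎ y ≡ negQ (C.κ i) → Sign (C.ι y) (e i)
    signed-κ {i} h = [ (λ eq → inj₁ (trans (cong C.ι eq) (C.ι-κ h))) , (λ eq → inj₂ (trans (cong C.ι eq) (trans (linear-neg {f = C.ι} C.ι-linear (C.κ i)) (cong negQ (C.ι-κ h))))) ]′

    core-inside : Inside P coreP coreB
    core-inside {w} w∈ = let (i , h , c) = C.V₀-cases w∈ in subst P (sym (core-ev w)) (proj₁ (sign-extreme (signed-κ h c)))

    core-vx : ∀ {i y} → ¬ IsLattice (e* i) → Sign y (e i) → Vx coreP coreB y
    core-vx {i} h (inj₁ eq) = let (v , v∈ , eqv) = ⟦⟧-extreme C.V₀ (C.κ-extreme h) in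
      v , v∈ , trans (core-ev v) (trans (cong C.ι (sym eqv)) (trans (C.ι-κ h) (sym eq)))
    core-vx {i} h (inj₂ eq) = C.κℤ⁻ i , C.κℤ⁻-∈ h , trans (core-ev (C.κℤ⁻ i)) (trans (cong C.ι (C.toℚ-κℤ⁻ i))
      (trans (linear-neg {f = C.ι} C.ι-linear (C.κ i)) (trans (cong negQ (C.ι-κ h)) (sym eq))))

    B : Vec (QPt (suc d)) (proj₁ (coreP ⊕ restP))
    B = coreB Vec.++ restB

    all-vx : ∀ {y} → Extreme P y → Vx (coreP ⊕ restP) B y
    all-vx {y} ex = go (sign-of (classify ex))
      where
      at : ∀ j → Sign y (e j) → Dec (IsLattice (e* j)) → Vx (coreP ⊕ restP) B y
      at j s (yes lat) = vx-⊕ʳ coreP restP coreB restB (rest-vx-e lat s)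
      at j s (no h)    = vx-⊕ˡ coreP restP coreB restB (core-vx h s)
      go : _ → Vx (coreP ⊕ restP) B y
      go (inj₁ (j , s)) = at j s (C.integral? j)
      go (inj₂ l)       = let (i , h) = nonzero-coordinate (ex , l) in vx-⊕ʳ coreP restP coreB restB (rest-vx-0 (ex , l) h)

    result : ∃ λ D → IsoP (suc d , V) (splitPoly D)
    result = D⁺ , toIsoP {V = V} {proj₂ (coreP ⊕ restP)} (basis-iso {V = V} (coreP ⊕ restP) B
      (trans (cong₂ ℕ._+_ (sym C.length-core) rest-dim) (trans (ℕP.+-comm (List.length C.core) _) C.tf+core))
      (VAllP.++⁺ (VAllP.tabulate⁺ C.B-lat) rest-lattice)
      (λ j → lattice-split B (λ lat → span-++ʳ coreB restB (rest-span lat))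
        (λ j → span-++ˡ coreB restB (subst (IntSpan coreB) (‼-tab C.B j) (span-basis coreB j))) (lattice-unit j))
      (inside-⊕ {P = P} coreP restP coreB restB core-inside rest-inside)
      krein-milman all-vx)

  module WithoutCore (all : ∀ i → IsLattice (e* i)) where

    D⁰ : Decomposition
    D⁰ = record { core = nothing ; coreOK = tt ; r = List.length segs
      ; dP = List.map size dxs ; dPEven = even-sizes dxs ; pdP = List.map size pxs ; pdPEven = even-sizes pxs }

    rank-0 : C.rank ≡ 0
    rank-0 = trans (sym C.length-core) (empty C.core (λ p → C.core-¬lattice p (all _)))
      where
      empty : (L : List (Fin (suc d))) → (∀ {i} → i ∈ L → ⊥) → List.length L ≡ 0
      empty []      h = refl
      empty (i ∷ L) h = ⊥-elim (h (here refl))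

    no-index : Fin C.rank → ⊥
    no-index j = case subst Fin rank-0 j of λ ()

    all-vx : ∀ {y} → Extreme P y → Vx (pt0 ⊕ restP) ([] Vec.++ restB) y
    all-vx {y} ex = vx-⊕ʳ pt0 restP [] restB (go (sign-of (classify ex)))
      where
      go : _ → Vx restP restB y
      go (inj₁ (j , s)) = rest-vx-e (all j) s
      go (inj₂ l)       = let (i , h) = nonzero-coordinate (ex , l) in rest-vx-0 (ex , l) h

    result : ∃ λ D → IsoP (suc d , V) (splitPoly D)
    result = D⁰ , toIsoP {V = V} {proj₂ (pt0 ⊕ restP)} (basis-iso {V = V} (pt0 ⊕ restP) restB
      (trans rest-dim (trans (sym (ℕP.+-identityʳ _)) (trans (cong (List.length C.torsion-free ℕ.+_) (sym rank-0)) C.rank-sum)))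
      rest-lattice
      (λ j → lattice-split restB rest-span (λ j → ⊥-elim (no-index j)) (lattice-unit j))
      (inside-⊕ {P = P} pt0 restP [] restB (λ { (here refl) → zero∈P }) rest-inside)
      krein-milman all-vx)

  existence : ∃ λ D → IsoP (suc d , V) (splitPoly D)
  existence = go (FinP.all? C.integral?)
    where
    go : Dec (∀ i → IsLattice (e* i)) → ∃ λ D → IsoP (suc d , V) (splitPoly D)
    go (yes all) = WithoutCore.result all
    go (no ¬all) = let (i , h) = FinP.¬∀⟶∃¬ _ _ C.integral? ¬all in WithCore.result h

-- Vertices of the factors of a splitting

-- `single` serves for the segments and also for the vertex pairs of the core: for counting and for
-- linear maps a crosspolytope behaves like a family of segments.
data Kind : Set where
  single : Kind
  dp pdp : (k : ℕ) → EvenPos k → Kind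

polyOf : Kind → Poly
polyOf single    = segment
polyOf (dp k _)  = delPezzo k
polyOf (pdp k _) = pseudoDelPezzo k

dim : Kind → ℕ
dim = proj₁ ∘ polyOf

-- Vertices of the factor of a given kind: ±β_i and, where present, ±Σ β (no index), with true for the positive sign.
Raw : ℕ → Set
Raw k = Maybe (Fin k) × Bool

Extra : Kind → Set
Extra single    = ⊥
Extra (dp _ _)  = Bool
Extra (pdp _ _) = ⊤

Elt : Kind → Set
Elt κ = (Fin (dim κ) × Bool) ⊎ Extra κ

raw : ∀ κ → Elt κ → Raw (dim κ)
raw κ (inj₁ (i , s))       = just i , s
raw (dp _ _) (inj₂ s)      = nothing , s
raw (pdp _ _) (inj₂ _)     = nothing , false

raw-injective : ∀ κ {e e'} → raw κ e ≡ raw κ e' → e ≡ e'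
raw-injective κ         {inj₁ _} {inj₁ _} refl = refl
raw-injective (dp _ _)  {inj₁ _} {inj₂ _} ()
raw-injective (dp _ _)  {inj₂ _} {inj₁ _} ()
raw-injective (dp _ _)  {inj₂ _} {inj₂ _} refl = refl
raw-injective (pdp _ _) {inj₁ _} {inj₂ _} ()
raw-injective (pdp _ _) {inj₂ _} {inj₁ _} ()
raw-injective (pdp _ _) {inj₂ tt} {inj₂ tt} refl = refl

σ : Bool → ℚ
σ true  = 1ℚ
σ false = - 1ℚ

weight : Maybe (Fin k) → Fin k → ℚ
weight (just i) = δ i
weight nothing  = λ _ → 1ℚ

rpt : (Fin k → QPt n) → Raw k → QPt n
rpt β (i , s) = comb (λ j → σ s * weight i j) β

pt : ∀ κ → (Fin (dim κ) → QPt n) → Elt κ → QPt n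
pt κ β e = rpt β (raw κ e)

linear-rpt : {f : QPt m → QPt n} → Linear f → (β : Fin k → QPt m) (r : Raw k) → f (rpt β r) ≡ rpt (f ∘ β) r
linear-rpt lin β (i , s) = lin (λ j → σ s * weight i j) β

rpt-cong : {β β' : Fin k → QPt n} → (∀ i → β i ≡ β' i) → (r : Raw k) → rpt β r ≡ rpt β' r
rpt-cong h r = comb-cong (λ _ → refl) h

rpt-just : (β : Fin k → QPt n) (i : Fin k) → rpt β (just i , true) ≡ β i
rpt-just β i = trans (comb-cong (λ j → ℚP.*-identityˡ (δ i j)) (λ _ → refl)) (comb-δ i β)

rpt-neg : (β : Fin k → QPt n) (i : Maybe (Fin k)) → rpt β (i , false) ≡ negQ (rpt β (i , true))
rpt-neg β i = trans (comb-scale (- 1ℚ) (weight i) β) (trans (sym (neg-scale (comb (weight i) β)))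
  (cong negQ (comb-cong (λ j → sym (ℚP.*-identityˡ (weight i j))) (λ _ → refl))))

coord-rpt : {f β : Fin k → QPt n} → Dualᶠ f β → (r : Raw k) (j : Fin k) → dot (f j) (rpt β r) ≡ σ (proj₂ r) * weight (proj₁ r) j
coord-rpt d (i , s) j = dual-coeff d (λ j → σ s * weight i j) j

-- With c = 1/k, the functional (1+c) β*_i - c Σ β* (respectively c Σ β*) attains its maximum over all ±β_j, ±Σ β only at β_i (respectively Σ β).
module Exposure {k : ℕ} (c : ℚ) (c>0 : 0ℚ < c) (kc : fromℤ (ℤ.+ k) * c ≡ 1ℚ) where

  coeff : Maybe (Fin k) → Fin k → ℚ
  coeff (just i) j = (1ℚ + c) * δ i j - c
  coeff nothing  j = c

  pairing : Raw k → Raw k → ℚ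
  pairing (i , s) (j , s') = σ s * σ s' * sumF (λ l → coeff i l * weight j l)

  sum-c : sumF {k} (λ _ → c) ≡ 1ℚ
  sum-c = trans (sumF-cong {k} (λ _ → sym (ℚP.*-identityˡ c))) (trans (sumF-*ʳ {k} c (λ _ → 1ℚ)) (trans (cong (_* c) (sumF-1 {k})) kc))

  coeff-sum : ∀ i → sumF (λ l → coeff (just i) l * 1ℚ) ≡ c
  coeff-sum i = trans (sumF-cong (λ l → ℚP.*-identityʳ (coeff (just i) l))) (trans (sumF-sub (λ l → (1ℚ + c) * δ i l) (λ _ → c))
    (trans (cong₂ _-_ (trans (sumF-* (1ℚ + c) (δ i)) (cong ((1ℚ + c) *_) (sumF-δ1 i))) sum-c) (lem c)))
    where
    lem : ∀ c → (1ℚ + c) * 1ℚ - 1ℚ ≡ c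
    lem = solve-∀ ℚring

  value : Maybe (Fin k) → Maybe (Fin k) → ℚ
  value (just i) (just j) = (1ℚ + c) * δ i j - c
  value nothing  nothing  = 1ℚ
  value _        _        = c

  pairing-value : ∀ i j → sumF (λ l → coeff i l * weight j l) ≡ value i j
  pairing-value (just i) (just j) = trans (sumF-cong (λ l → cong (coeff (just i) l *_) (δ-sym j l))) (sumF-δʳ j (coeff (just i)))
  pairing-value (just i) nothing  = coeff-sum i
  pairing-value nothing  (just j) = trans (sumF-cong (λ l → cong (c *_) (δ-sym j l))) (sumF-δʳ j (λ _ → c))
  pairing-value nothing  nothing  = trans (sumF-cong {k} (λ _ → ℚP.*-identityʳ c)) sum-c

  self : ∀ i → value i i ≡ 1ℚ
  self (just i) = trans (cong (λ d → (1ℚ + c) * d - c) (δ-refl i)) (lem c)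
    where
    lem : ∀ c → (1ℚ + c) * 1ℚ - c ≡ 1ℚ
    lem = solve-∀ ℚring
  self nothing  = refl

  σσ : ∀ s → σ s * σ s ≡ 1ℚ
  σσ true  = refl
  σσ false = refl

  pairing-self : ∀ r → pairing r r ≡ 1ℚ
  pairing-self (i , s) = trans (cong₂ _*_ (σσ s) (trans (pairing-value i i) (self i))) refl

  signed-< : ∀ s s' {v} → v < 1ℚ → - v < 1ℚ → σ s * σ s' * v < 1ℚ
  signed-< true  true  {v} h h' = subst (_< 1ℚ) (sym (ℚP.*-identityˡ v)) h
  signed-< false false {v} h h' = subst (_< 1ℚ) (sym (ℚP.*-identityˡ v)) h
  signed-< true  false {v} h h' = subst (_< 1ℚ) (neg-as-* v) h'
  signed-< false true  {v} h h' = subst (_< 1ℚ) (neg-as-* v) h'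

  opposite-sign : ∀ s s' {v} → s ≢ s' → v ≡ 1ℚ → σ s * σ s' * v < 1ℚ
  opposite-sign true  true  h _ = ⊥-elim (h refl)
  opposite-sign false false h _ = ⊥-elim (h refl)
  opposite-sign true  false h refl = ℚP.<-trans -1<0 0<1
  opposite-sign false true  h refl = ℚP.<-trans -1<0 0<1

  -c<1 : - c < 1ℚ
  -c<1 = ℚP.<-trans (pos-neg c>0) 0<1

  separated : (r r' : Raw k) → (k ≡ 1 → ∃ λ i → proj₁ r ≡ just i) → (k ≡ 1 → ∃ λ i → proj₁ r' ≡ just i) → (k ≢ 1 → c < 1ℚ) → r' ≡ r ⊎ pairing r r' < 1ℚ
  separated (i , s) (j , s') a a' c<1 = go i j a a' (k ℕ.≟ 1) (s Data.Bool.≟ s')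
    where
    wrap : ∀ i j → (value i j < 1ℚ × - value i j < 1ℚ) → pairing (i , s) (j , s') < 1ℚ
    wrap i j (h , h') = subst (λ v → σ s * σ s' * v < 1ℚ) (sym (pairing-value i j)) (signed-< s s' h h')
    wrap-≢ : ∀ i → s ≢ s' → pairing (i , s) (i , s') < 1ℚ
    wrap-≢ i h = subst (λ v → σ s * σ s' * v < 1ℚ) (sym (pairing-value i i)) (opposite-sign s s' h (self i))
    just-case : ∀ i j → Dec (i ≡ j) → Dec (k ≡ 1) → Dec (s ≡ s') → (just j , s') ≡ (just i , s) ⊎ pairing (just i , s) (just j , s') < 1ℚ
    just-case i j (yes refl) _ (yes refl) = inj₁ refl
    just-case i j (yes refl) _ (no h)     = inj₂ (wrap-≢ (just i) h)
    just-case i j (no i≢j) (yes k1) _     = ⊥-elim (i≢j (unique k1 i j))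
      where
      unique : k ≡ 1 → (i j : Fin k) → i ≡ j
      unique refl zero zero = refl
    just-case i j (no i≢j) (no k≢1) _     = inj₂ (wrap (just i) (just j) (subst (λ v → v < 1ℚ × - v < 1ℚ) (sym v-eq) (-c<1 , subst (_< 1ℚ) (sym (neg-neg c)) (c<1 k≢1))))
      where
      lem : ∀ c → (1ℚ + c) * 0ℚ - c ≡ - c
      lem = solve-∀ ℚring
      v-eq : value (just i) (just j) ≡ - c
      v-eq = trans (cong (λ d → (1ℚ + c) * d - c) (δ-≢ i≢j)) (lem c)
    go : ∀ i j → (k ≡ 1 → ∃ λ a → i ≡ just a) → (k ≡ 1 → ∃ λ a → j ≡ just a) → Dec (k ≡ 1) → Dec (s ≡ s') → (j , s') ≡ (i , s) ⊎ pairing (i , s) (j , s') < 1ℚ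
    go (just i) (just j) _ _ D S = just-case i j (i Fin.≟ j) D S
    go nothing nothing _ _ _ (yes refl) = inj₁ refl
    go nothing nothing _ _ _ (no h)     = inj₂ (wrap-≢ nothing h)
    go (just i) nothing _ a' (yes k1) _ = case a' k1 of λ ()
    go (just i) nothing _ _ (no k≢1) _  = inj₂ (wrap (just i) nothing (c<1 k≢1 , -c<1))
    go nothing (just j) a _ (yes k1) _  = case a k1 of λ ()
    go nothing (just j) _ _ (no k≢1) _  = inj₂ (wrap nothing (just j) (c<1 k≢1 , -c<1))

even≢1 : EvenPos k → k ≢ 1
even≢1 (j , refl) eq = case trans (sym (ℕP.+-suc j j)) (ℕP.suc-injective eq) of λ ()

even-suc : EvenPos k → ∃ λ j → k ≡ suc j
even-suc (j , refl) = j ℕ.+ suc j , refl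

dim-suc : ∀ κ → ∃ λ j → dim κ ≡ suc j
dim-suc single     = 0 , refl
dim-suc (dp k ev)  = even-suc ev
dim-suc (pdp k ev) = even-suc ev

raw-single : ∀ κ (e : Elt κ) → dim κ ≡ 1 → ∃ λ i → proj₁ (raw κ e) ≡ just i
raw-single κ (inj₁ (i , s)) _ = i , refl
raw-single (dp k ev) (inj₂ _) eq  = ⊥-elim (even≢1 ev eq)
raw-single (pdp k ev) (inj₂ _) eq = ⊥-elim (even≢1 ev eq)

record Exposing (κ : Kind) (e : Elt κ) : Set where
  field
    a      : Fin (dim κ) → ℚ
    on     : sumF (λ l → a l * (σ (proj₂ (raw κ e)) * weight (proj₁ (raw κ e)) l)) ≡ 1ℚ
    off    : ∀ e' → e' ≡ e ⊎ sumF (λ l → a l * (σ (proj₂ (raw κ e')) * weight (proj₁ (raw κ e')) l)) < 1ℚ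

opaque
  exposing : ∀ κ e → Exposing κ e
  exposing κ e = record
    { a = a
    ; on = trans (as-pairing (raw κ e)) (pairing-self (raw κ e))
    ; off = λ e' → [ (λ eq → inj₁ (raw-injective κ eq)) , (λ lt → inj₂ (subst (_< 1ℚ) (sym (as-pairing (raw κ e'))) lt)) ]′
        (separated (raw κ e) (raw κ e') (raw-single κ e) (raw-single κ e') c<1) }
    where
    k' : ℕ
    k' = proj₁ (dim-suc κ)
    k>0 : 0ℚ < fromℤ (ℤ.+ dim κ)
    k>0 = subst (λ d → 0ℚ < fromℤ (ℤ.+ d)) (sym (proj₂ (dim-suc κ))) (subst (0ℚ <_) (sym (fromℤ≡mk (ℤ.+ suc k'))) (*<* (ℤ.+<+ (ℕ.s≤s ℕ.z≤n))))
    inv : ∃ λ q → q * fromℤ (ℤ.+ dim κ) ≡ 1ℚ × 0ℚ < q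
    inv = inverse-pos (fromℤ (ℤ.+ dim κ)) k>0
    c : ℚ
    c = proj₁ inv
    kc : fromℤ (ℤ.+ dim κ) * c ≡ 1ℚ
    kc = trans (ℚP.*-comm (fromℤ (ℤ.+ dim κ)) c) (proj₁ (proj₂ inv))
    c<1 : dim κ ≢ 1 → c < 1ℚ
    c<1 h = <-by (fromℤ (ℤ.+ k') * c) (*-pos k'>0 (proj₂ (proj₂ inv))) (trans (cong (_- c) (trans (sym kc) (trans (cong (λ d → fromℤ (ℤ.+ d) * c) (proj₂ (dim-suc κ)))
        (cong (_* c) (fromℤ-+ (ℤ.+ 1) (ℤ.+ k')))))) (lem (fromℤ (ℤ.+ k')) c))
      where
      lem : ∀ k c → (1ℚ + k) * c - c ≡ k * c
      lem = solve-∀ ℚring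
      pos : ∀ j → dim κ ≡ suc j → 0ℚ < fromℤ (ℤ.+ j)
      pos zero eq    = ⊥-elim (h eq)
      pos (suc j) eq = subst (0ℚ <_) (sym (fromℤ≡mk (ℤ.+ suc j))) (*<* (ℤ.+<+ (ℕ.s≤s ℕ.z≤n)))
      k'>0 : 0ℚ < fromℤ (ℤ.+ k')
      k'>0 = pos k' (proj₂ (dim-suc κ))
    open Exposure {dim κ} c (proj₂ (proj₂ inv)) kc
    s : Bool
    s = proj₂ (raw κ e)
    a : Fin (dim κ) → ℚ
    a l = σ s * coeff (proj₁ (raw κ e)) l
    as-pairing : ∀ r → sumF (λ l → a l * (σ (proj₂ r) * weight (proj₁ r) l)) ≡ pairing (raw κ e) r
    as-pairing r = trans (sumF-cong (λ l → lem (σ s) (coeff (proj₁ (raw κ e)) l) (σ (proj₂ r)) (weight (proj₁ r) l)))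
      (sumF-* (σ s * σ (proj₂ r)) (λ l → coeff (proj₁ (raw κ e)) l * weight (proj₁ r) l))
      where
      lem : ∀ s c t w → s * c * (t * w) ≡ s * t * (c * w)
      lem = solve-∀ ℚring

unit-rpt : (i : Fin k) → toℚ (unitVec i) ≡ rpt unitQ (just i , true)
unit-rpt i = trans (toℚ-unitVec i) (sym (rpt-just unitQ i))

neg-rpt : (v : Pt k) (i : Maybe (Fin k)) → toℚ v ≡ rpt unitQ (i , true) → toℚ (negℤ v) ≡ rpt unitQ (i , false)
neg-rpt v i eq = trans (toℚ-neg v) (trans (cong negQ eq) (sym (rpt-neg unitQ i)))

ones-rpt : toℚ (allOnes {k}) ≡ rpt unitQ (nothing , true)
ones-rpt {k} = vext λ j → trans (‼-toℚ allOnes j) (trans (cong fromℤ (VecP.lookup-replicate j (ℤ.+ 1))) (sym (trans (‼-comb (λ j → 1ℚ * 1ℚ) unitQ j)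
  (trans (sumF-cong (λ l → cong (1ℚ *_) (‼-tab (δ l) j))) (sumF-δʳ j (λ _ → 1ℚ))))))

cross-cases : {v : Pt k} → v ∈ crossVerts k → ∃ λ i → ∃ λ s → toℚ v ≡ rpt unitQ (just i , s)
cross-cases {k} p = [ (λ q → let (i , _ , eq) = ∈-map⁻ unitVec q in i , true , trans (cong toℚ eq) (unit-rpt i))
  , (λ q → let (i , _ , eq) = ∈-map⁻ (λ i → negℤ (unitVec i)) q in i , false , trans (cong toℚ eq) (neg-rpt (unitVec i) (just i) (unit-rpt i))) ]′
  (∈-++⁻ (List.map unitVec (List.allFin k)) p)

cross-in : (i : Fin k) (s : Bool) → ∃ λ v → v ∈ crossVerts k × toℚ v ≡ rpt unitQ (just i , s)
cross-in i true  = unitVec i , ∈-++⁺ˡ (∈-map⁺ unitVec (∈-allFin i)) , unit-rpt i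
cross-in {k} i false = negℤ (unitVec i) , ∈-++⁺ʳ (List.map unitVec (List.allFin k)) (∈-map⁺ (λ i → negℤ (unitVec i)) (∈-allFin i)) , neg-rpt (unitVec i) (just i) (unit-rpt i)


factor-cases : ∀ κ {v} → v ∈ proj₂ (polyOf κ) → ∃ λ e → toℚ v ≡ pt κ unitQ e
factor-cases single (here refl)         = inj₁ (zero , true) , sym (trans (rpt-just unitQ zero) refl)
factor-cases single (there (here refl)) = inj₁ (zero , false) , sym (trans (rpt-neg unitQ (just zero)) (trans (cong negQ (rpt-just unitQ zero)) refl))
factor-cases (dp k ev) (here refl)          = inj₂ true , ones-rpt
factor-cases (dp k ev) (there (here refl))  = inj₂ false , neg-rpt allOnes nothing ones-rpt
factor-cases (dp k ev) (there (there p))    = let (i , s , eq) = cross-cases p in inj₁ (i , s) , eq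
factor-cases (pdp k ev) (here refl)         = inj₂ tt , neg-rpt allOnes nothing ones-rpt
factor-cases (pdp k ev) (there p)           = let (i , s , eq) = cross-cases p in inj₁ (i , s) , eq

factor-in : ∀ κ e → ⟦ proj₂ (polyOf κ) ⟧ (pt κ unitQ e)
factor-in single (inj₁ (zero , true))  = subst ⟦ proj₂ segment ⟧ (sym (trans (rpt-just unitQ zero) refl)) (⟦⟧-∈ {V = proj₂ segment} (here refl))
factor-in single (inj₁ (zero , false)) = subst ⟦ proj₂ segment ⟧ (sym (trans (rpt-neg unitQ (just zero)) (trans (cong negQ (rpt-just unitQ zero)) refl))) (⟦⟧-∈ {V = proj₂ segment} (there (here refl)))
factor-in (dp k ev) (inj₂ true)  = subst ⟦ proj₂ (delPezzo k) ⟧ ones-rpt (⟦⟧-∈ {V = proj₂ (delPezzo k)} (here refl))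
factor-in (dp k ev) (inj₂ false) = subst ⟦ proj₂ (delPezzo k) ⟧ (neg-rpt allOnes nothing ones-rpt) (⟦⟧-∈ {V = proj₂ (delPezzo k)} (there (here refl)))
factor-in (dp k ev) (inj₁ (i , s)) = let (v , p , eq) = cross-in i s in subst ⟦ proj₂ (delPezzo k) ⟧ eq (⟦⟧-∈ {V = proj₂ (delPezzo k)} (there (there p)))
factor-in (pdp k ev) (inj₂ tt) = subst ⟦ proj₂ (pseudoDelPezzo k) ⟧ (neg-rpt allOnes nothing ones-rpt) (⟦⟧-∈ {V = proj₂ (pseudoDelPezzo k)} (here refl))
factor-in (pdp k ev) (inj₁ (i , s)) = let (v , p , eq) = cross-in i s in subst ⟦ proj₂ (pseudoDelPezzo k) ⟧ eq (⟦⟧-∈ {V = proj₂ (pseudoDelPezzo k)} (there p))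

-- Describes a nested sum as a direct sum over its factors, independently of the nesting. The case
-- `x ≡ zeroQ` in `extreme` is due to the unit `pt0`, whose generator 0 occurs in every `⨁`.
record Leaves (Q : Poly) (L : Set) (leaf : L → Poly) : Set₁ where
  field
    inj      : ∀ ℓ → QPt (proj₁ (leaf ℓ)) → QPt (proj₁ Q)
    prj      : ∀ ℓ → QPt (proj₁ Q) → QPt (proj₁ (leaf ℓ))
    inj-lin  : ∀ ℓ → Linear (inj ℓ)
    prj-lin  : ∀ ℓ → Linear (prj ℓ)
    inj-lat  : ∀ ℓ {x} → IsLattice x → IsLattice (inj ℓ x)
    prj-lat  : ∀ ℓ {x} → IsLattice x → IsLattice (prj ℓ x)
    prj-inj  : ∀ ℓ x → prj ℓ (inj ℓ x) ≡ x
    prj-≢    : ∀ {ℓ ℓ'} → ℓ ≢ ℓ' → ∀ x → prj ℓ (inj ℓ' x) ≡ zeroQ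
    mem      : ∀ ℓ {x} → ⟦ proj₂ (leaf ℓ) ⟧ x → ⟦ proj₂ Q ⟧ (inj ℓ x)
    hull     : ∀ {R : QSet (proj₁ Q)} → Convex R → R zeroQ → (∀ ℓ {x} → ⟦ proj₂ (leaf ℓ) ⟧ x → R (inj ℓ x)) → ∀ {x} → ⟦ proj₂ Q ⟧ x → R x
    extreme  : ∀ {x} → Extreme ⟦ proj₂ Q ⟧ x → x ≡ zeroQ ⊎ ∃ λ ℓ → ∃ λ y → Extreme ⟦ proj₂ (leaf ℓ) ⟧ y × x ≡ inj ℓ y

leaf-self : ∀ Q → Leaves Q ⊤ (λ _ → Q)
leaf-self Q = record { inj = λ _ x → x ; prj = λ _ x → x ; inj-lin = λ _ c e → refl ; prj-lin = λ _ c e → refl ; inj-lat = λ _ h → h ; prj-lat = λ _ h → h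
  ; prj-inj = λ _ x → refl ; prj-≢ = λ h → ⊥-elim (h refl) ; mem = λ _ h → h ; hull = λ _ _ h → h tt ; extreme = λ e → inj₂ (tt , _ , e , refl) }

leaf-none : Leaves pt0 ⊥ (λ ())
leaf-none = record { inj = λ () ; prj = λ () ; inj-lin = λ () ; prj-lin = λ () ; inj-lat = λ () ; prj-lat = λ () ; prj-inj = λ () ; prj-≢ = λ { {()} } ; mem = λ ()
  ; hull = λ { {R} _ R0 _ {[]} _ → R0 } ; extreme = λ { {[]} _ → inj₁ refl } }

zeros : ∀ n → toℚ (Vec.replicate n (ℤ.+ 0)) ≡ zeroQ
zeros n = vext λ j → trans (‼-toℚ (Vec.replicate n (ℤ.+ 0)) j) (trans (cong fromℤ (VecP.lookup-replicate j (ℤ.+ 0))) (sym (‼-zero j)))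

inˡ : ∀ m n → QPt m → QPt (m ℕ.+ n)
inˡ m n x = x Vec.++ zeroQ

inʳ : ∀ m n → QPt n → QPt (m ℕ.+ n)
inʳ m n x = zeroQ {m} Vec.++ x

vec-split : ∀ m {n} {A : Set} {x y : Vec A (m ℕ.+ n)} → (∀ i → x ‼ (i Fin.↑ˡ n) ≡ y ‼ (i Fin.↑ˡ n)) → (∀ i → x ‼ (m Fin.↑ʳ i) ≡ y ‼ (m Fin.↑ʳ i)) → x ≡ y
vec-split zero    hˡ hʳ = vext hʳ
vec-split (suc m) {x = x ∷ xs} {y ∷ ys} hˡ hʳ = cong₂ _∷_ (hˡ zero) (vec-split m (λ i → hˡ (suc i)) hʳ)

prˡ : ∀ m n → QPt (m ℕ.+ n) → QPt m
prˡ m n x = Vec.tabulate (λ i → x ‼ (i Fin.↑ˡ n))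

prʳ : ∀ m n → QPt (m ℕ.+ n) → QPt n
prʳ m n x = Vec.tabulate (λ i → x ‼ (m Fin.↑ʳ i))

sel-lin : (ι : Fin k → Fin l) → Linear (λ (x : QPt l) → Vec.tabulate (λ i → x ‼ ι i))
sel-lin ι c e = vext λ j → trans (‼-tab (λ i → comb c e ‼ ι i) j) (trans (‼-comb c e (ι j))
  (trans (sumF-cong (λ i → cong (c i *_) (sym (‼-tab (λ j → e i ‼ ι j) j)))) (sym (‼-comb c (λ i → Vec.tabulate (λ j → e i ‼ ι j)) j))))

sel-lat : (ι : Fin k → Fin l) {x : QPt l} → IsLattice x → IsLattice (Vec.tabulate (λ i → x ‼ ι i))
sel-lat ι {x} h = int-lattice λ i → Int-cast (sym (‼-tab (λ i → x ‼ ι i) i)) (lattice-int h (ι i))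

‼-ˡ : ∀ {m n} (x : QPt m) (y : QPt n) i → (x Vec.++ y) ‼ (i Fin.↑ˡ n) ≡ x ‼ i
‼-ˡ x y i = VecP.lookup-++ˡ x y i

‼-ʳ : ∀ {m n} (x : QPt m) (y : QPt n) i → (x Vec.++ y) ‼ (m Fin.↑ʳ i) ≡ y ‼ i
‼-ʳ x y i = VecP.lookup-++ʳ x y i

zero-comb-entry : ∀ {n} (c : Fin k → ℚ) (i : Fin n) → sumF (λ j → c j * zeroQ {n} ‼ i) ≡ 0ℚ
zero-comb-entry c i = sumF-zero (λ j → trans (cong (c j *_) (‼-zero i)) (ℚP.*-zeroʳ (c j)))

inˡ-lin : ∀ m n → Linear (inˡ m n)
inˡ-lin m n c e = vec-split m
  (λ i → trans (‼-ˡ (comb c e) zeroQ i) (trans (‼-comb c e i) (trans (sumF-cong (λ j → cong (c j *_) (sym (‼-ˡ (e j) (zeroQ {n}) i)))) (sym (‼-comb c (λ j → inˡ m n (e j)) _)))))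
  (λ i → trans (‼-ʳ (comb c e) zeroQ i) (trans (‼-zero i) (sym (trans (‼-comb c (λ j → inˡ m n (e j)) _) (trans (sumF-cong (λ j → cong (c j *_) (‼-ʳ (e j) (zeroQ {n}) i))) (zero-comb-entry c i))))))

inʳ-lin : ∀ m n → Linear (inʳ m n)
inʳ-lin m n c e = vec-split m
  (λ i → trans (‼-ˡ (zeroQ {m}) (comb c e) i) (trans (‼-zero i) (sym (trans (‼-comb c (λ j → inʳ m n (e j)) _) (trans (sumF-cong (λ j → cong (c j *_) (‼-ˡ (zeroQ {m}) (e j) i))) (zero-comb-entry c i))))))
  (λ i → trans (‼-ʳ (zeroQ {m}) (comb c e) i) (trans (‼-comb c e i) (trans (sumF-cong (λ j → cong (c j *_) (sym (‼-ʳ (zeroQ {m}) (e j) i)))) (sym (‼-comb c (λ j → inʳ m n (e j)) _)))))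

++-lat : ∀ {m n} {x : QPt m} {y : QPt n} → IsLattice x → IsLattice y → IsLattice (x Vec.++ y)
++-lat (v , refl) (w , refl) = v Vec.++ w , VecP.map-++ fromℤ v w

prˡ-inˡ : ∀ m n x → prˡ m n (inˡ m n x) ≡ x
prˡ-inˡ m n x = vext λ i → trans (‼-tab (λ i → inˡ m n x ‼ (i Fin.↑ˡ n)) i) (‼-ˡ x zeroQ i)

prʳ-inʳ : ∀ m n x → prʳ m n (inʳ m n x) ≡ x
prʳ-inʳ m n x = vext λ i → trans (‼-tab (λ i → inʳ m n x ‼ (m Fin.↑ʳ i)) i) (‼-ʳ (zeroQ {m}) x i)

prʳ-inˡ : ∀ m n x → prʳ m n (inˡ m n x) ≡ zeroQ
prʳ-inˡ m n x = vext λ i → trans (‼-tab (λ i → inˡ m n x ‼ (m Fin.↑ʳ i)) i) (‼-ʳ x zeroQ i)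

prˡ-inʳ : ∀ m n x → prˡ m n (inʳ m n x) ≡ zeroQ
prˡ-inʳ m n x = vext λ i → trans (‼-tab (λ i → inʳ m n x ‼ (i Fin.↑ˡ n)) i) (‼-ˡ (zeroQ {m}) x i)

linear-extreme : {f : QPt m → QPt n} {g : QPt n → QPt m} {P : QSet m} {Q : QSet n} → Linear f → (∀ x → g (f x) ≡ x) → (∀ {x} → P x → Q (f x)) →
  ∀ {x} → P x → Extreme Q (f x) → Extreme P x
linear-extreme {f = f} {g} lin gf mem {x} Px (_ , ext) = Px , λ a b Pa Pb eq →
  trans (sym (gf a)) (trans (cong g (ext (f a) (f b) (mem Pa) (mem Pb) (trans (cong f eq) (linear-mid {f = f} lin a b)))) (gf x))

module _ {A B : Poly} where

  private
    mA = proj₁ A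
    nB = proj₁ B

  ++-toˡ : ∀ v → toℚ (v Vec.++ Vec.replicate nB (ℤ.+ 0)) ≡ inˡ mA nB (toℚ v)
  ++-toˡ v = trans (VecP.map-++ fromℤ v _) (cong (toℚ v Vec.++_) (zeros nB))

  ++-toʳ : ∀ w → toℚ (Vec.replicate mA (ℤ.+ 0) Vec.++ w) ≡ inʳ mA nB (toℚ w)
  ++-toʳ w = trans (VecP.map-++ fromℤ (Vec.replicate mA (ℤ.+ 0)) w) (cong (Vec._++ toℚ w) (zeros mA))

  ⊕-memˡ : ∀ {x} → ⟦ proj₂ A ⟧ x → ⟦ proj₂ (A ⊕ B) ⟧ (inˡ mA nB x)
  ⊕-memˡ = ⟦⟧-sub (proj₂ A) {λ x → ⟦ proj₂ (A ⊕ B) ⟧ (inˡ mA nB x)} (linear-convex {f = inˡ mA nB} (inˡ-lin mA nB) {⟦ proj₂ (A ⊕ B) ⟧} (⟦⟧-convex (proj₂ (A ⊕ B))))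
    λ {v} p → subst ⟦ proj₂ (A ⊕ B) ⟧ (++-toˡ v) (⟦⟧-∈ {V = proj₂ (A ⊕ B)} (⊕-∈ˡ {V = proj₂ A} {proj₂ B} p))

  ⊕-memʳ : ∀ {x} → ⟦ proj₂ B ⟧ x → ⟦ proj₂ (A ⊕ B) ⟧ (inʳ mA nB x)
  ⊕-memʳ = ⟦⟧-sub (proj₂ B) {λ x → ⟦ proj₂ (A ⊕ B) ⟧ (inʳ mA nB x)} (linear-convex {f = inʳ mA nB} (inʳ-lin mA nB) {⟦ proj₂ (A ⊕ B) ⟧} (⟦⟧-convex (proj₂ (A ⊕ B))))
    λ {w} p → subst ⟦ proj₂ (A ⊕ B) ⟧ (++-toʳ w) (⟦⟧-∈ {V = proj₂ (A ⊕ B)} (⊕-∈ʳ {V = proj₂ A} {proj₂ B} p))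

  ⊕-hull : ∀ {R : QSet (mA ℕ.+ nB)} → Convex R → (∀ {x} → ⟦ proj₂ A ⟧ x → R (inˡ mA nB x)) → (∀ {x} → ⟦ proj₂ B ⟧ x → R (inʳ mA nB x)) →
    ∀ {x} → ⟦ proj₂ (A ⊕ B) ⟧ x → R x
  ⊕-hull {R} convex hˡ hʳ = ⟦⟧-sub (proj₂ (A ⊕ B)) {R} convex λ p →
    [ (λ { (v , v∈ , refl) → subst R (sym (++-toˡ v)) (hˡ (⟦⟧-∈ v∈)) }) , (λ { (w , w∈ , refl) → subst R (sym (++-toʳ w)) (hʳ (⟦⟧-∈ w∈)) }) ]′ (⊕-∈ {V = proj₂ A} {proj₂ B} p)

  ⊕-extreme : ∀ {x} → Extreme ⟦ proj₂ (A ⊕ B) ⟧ x → (∃ λ y → Extreme ⟦ proj₂ A ⟧ y × x ≡ inˡ mA nB y) ⊎ (∃ λ y → Extreme ⟦ proj₂ B ⟧ y × x ≡ inʳ mA nB y)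
  ⊕-extreme {x} ex = go (⊕-∈ {V = proj₂ A} {proj₂ B} (proj₁ (proj₂ found))) (proj₂ (proj₂ found))
    where
    found : ∃ λ v → v ∈ proj₂ (A ⊕ B) × x ≡ toℚ v
    found = ⟦⟧-extreme (proj₂ (A ⊕ B)) ex
    go : ∀ {u} → (∃ λ v → v ∈ proj₂ A × u ≡ v Vec.++ Vec.replicate nB (ℤ.+ 0)) ⊎ (∃ λ w → w ∈ proj₂ B × u ≡ Vec.replicate mA (ℤ.+ 0) Vec.++ w) → x ≡ toℚ u → (∃ λ y → Extreme ⟦ proj₂ A ⟧ y × x ≡ inˡ mA nB y) ⊎ (∃ λ y → Extreme ⟦ proj₂ B ⟧ y × x ≡ inʳ mA nB y)
    go (inj₁ (v , v∈ , refl)) eq = inj₁ (toℚ v , linear-extreme {f = inˡ mA nB} {prˡ mA nB} {⟦ proj₂ A ⟧} {⟦ proj₂ (A ⊕ B) ⟧} (inˡ-lin mA nB) (prˡ-inˡ mA nB) ⊕-memˡ (⟦⟧-∈ v∈)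
      (subst (Extreme ⟦ proj₂ (A ⊕ B) ⟧) (trans eq (++-toˡ v)) ex) , trans eq (++-toˡ v))
    go (inj₂ (w , w∈ , refl)) eq = inj₂ (toℚ w , linear-extreme {f = inʳ mA nB} {prʳ mA nB} {⟦ proj₂ B ⟧} {⟦ proj₂ (A ⊕ B) ⟧} (inʳ-lin mA nB) (prʳ-inʳ mA nB) ⊕-memʳ (⟦⟧-∈ w∈)
      (subst (Extreme ⟦ proj₂ (A ⊕ B) ⟧) (trans eq (++-toʳ w)) ex) , trans eq (++-toʳ w))

leaf-⊕ : ∀ {A B L L' leaf leaf'} → Leaves A L leaf → Leaves B L' leaf' → Leaves (A ⊕ B) (L ⊎ L') [ leaf , leaf' ]′
leaf-⊕ {A} {B} {L} {L'} {leaf} {leaf'} X Y = record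
  { inj = inj' ; prj = prj' ; inj-lin = inj-lin' ; prj-lin = prj-lin' ; inj-lat = inj-lat' ; prj-lat = prj-lat'
  ; prj-inj = prj-inj' ; prj-≢ = prj-≢' ; mem = mem'
  ; hull = λ {R} convex R0 h → ⊕-hull {A} {B} {R} convex
      (X.hull {λ x → R (inˡ a b x)} (linear-convex {f = inˡ a b} (inˡ-lin a b) {R} convex) (subst R (sym (linear-zero {f = inˡ a b} (inˡ-lin a b))) R0) (λ ℓ → h (inj₁ ℓ)))
      (Y.hull {λ x → R (inʳ a b x)} (linear-convex {f = inʳ a b} (inʳ-lin a b) {R} convex) (subst R (sym (linear-zero {f = inʳ a b} (inʳ-lin a b))) R0) (λ ℓ → h (inj₂ ℓ)))
  ; extreme = λ ex → [ (λ { (y , ey , eq) → [ (λ y0 → inj₁ (trans eq (trans (cong (inˡ a b) y0) (linear-zero {f = inˡ a b} (inˡ-lin a b)))))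
                                          , (λ { (ℓ , z , ez , eq') → inj₂ (inj₁ ℓ , z , ez , trans eq (cong (inˡ a b) eq')) }) ]′ (X.extreme ey) })
                     , (λ { (y , ey , eq) → [ (λ y0 → inj₁ (trans eq (trans (cong (inʳ a b) y0) (linear-zero {f = inʳ a b} (inʳ-lin a b)))))
                                          , (λ { (ℓ , z , ez , eq') → inj₂ (inj₂ ℓ , z , ez , trans eq (cong (inʳ a b) eq')) }) ]′ (Y.extreme ey) }) ]′ (⊕-extreme {A} {B} ex) }
  where
  module X = Leaves X
  module Y = Leaves Y
  a b : ℕ
  a = proj₁ A
  b = proj₁ B
  D : L ⊎ L' → ℕ
  D ℓ = proj₁ ([ leaf , leaf' ]′ ℓ)
  inj' : ∀ ℓ → QPt (D ℓ) → QPt (a ℕ.+ b)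
  inj' (inj₁ ℓ) x = inˡ a b (X.inj ℓ x)
  inj' (inj₂ ℓ) x = inʳ a b (Y.inj ℓ x)
  prj' : ∀ ℓ → QPt (a ℕ.+ b) → QPt (D ℓ)
  prj' (inj₁ ℓ) x = X.prj ℓ (prˡ a b x)
  prj' (inj₂ ℓ) x = Y.prj ℓ (prʳ a b x)
  inj-lin' : ∀ ℓ → Linear (inj' ℓ)
  inj-lin' (inj₁ ℓ) = ∘-linear {f = inˡ a b} {X.inj ℓ} (inˡ-lin a b) (X.inj-lin ℓ)
  inj-lin' (inj₂ ℓ) = ∘-linear {f = inʳ a b} {Y.inj ℓ} (inʳ-lin a b) (Y.inj-lin ℓ)
  prj-lin' : ∀ ℓ → Linear (prj' ℓ)
  prj-lin' (inj₁ ℓ) = ∘-linear {f = X.prj ℓ} {prˡ a b} (X.prj-lin ℓ) (sel-lin (Fin._↑ˡ b))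
  prj-lin' (inj₂ ℓ) = ∘-linear {f = Y.prj ℓ} {prʳ a b} (Y.prj-lin ℓ) (sel-lin (a Fin.↑ʳ_))
  inj-lat' : ∀ ℓ {x} → IsLattice x → IsLattice (inj' ℓ x)
  inj-lat' (inj₁ ℓ) h = ++-lat (X.inj-lat ℓ h) lattice-zero
  inj-lat' (inj₂ ℓ) h = ++-lat (lattice-zero {a}) (Y.inj-lat ℓ h)
  prj-lat' : ∀ ℓ {x} → IsLattice x → IsLattice (prj' ℓ x)
  prj-lat' (inj₁ ℓ) h = X.prj-lat ℓ (sel-lat (Fin._↑ˡ b) h)
  prj-lat' (inj₂ ℓ) h = Y.prj-lat ℓ (sel-lat (a Fin.↑ʳ_) h)
  prj-inj' : ∀ ℓ x → prj' ℓ (inj' ℓ x) ≡ x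
  prj-inj' (inj₁ ℓ) x = trans (cong (X.prj ℓ) (prˡ-inˡ a b (X.inj ℓ x))) (X.prj-inj ℓ x)
  prj-inj' (inj₂ ℓ) x = trans (cong (Y.prj ℓ) (prʳ-inʳ a b (Y.inj ℓ x))) (Y.prj-inj ℓ x)
  prj-≢' : ∀ {ℓ ℓ'} → ℓ ≢ ℓ' → ∀ x → prj' ℓ (inj' ℓ' x) ≡ zeroQ
  prj-≢' {inj₁ ℓ} {inj₁ ℓ'} h x = trans (cong (X.prj ℓ) (prˡ-inˡ a b (X.inj ℓ' x))) (X.prj-≢ (h ∘ cong inj₁) x)
  prj-≢' {inj₂ ℓ} {inj₂ ℓ'} h x = trans (cong (Y.prj ℓ) (prʳ-inʳ a b (Y.inj ℓ' x))) (Y.prj-≢ (h ∘ cong inj₂) x)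
  prj-≢' {inj₁ ℓ} {inj₂ ℓ'} h x = trans (cong (X.prj ℓ) (prˡ-inʳ a b (Y.inj ℓ' x))) (linear-zero {f = X.prj ℓ} (X.prj-lin ℓ))
  prj-≢' {inj₂ ℓ} {inj₁ ℓ'} h x = trans (cong (Y.prj ℓ) (prʳ-inˡ a b (X.inj ℓ' x))) (linear-zero {f = Y.prj ℓ} (Y.prj-lin ℓ))
  mem' : ∀ ℓ {x} → ⟦ proj₂ ([ leaf , leaf' ]′ ℓ) ⟧ x → ⟦ proj₂ (A ⊕ B) ⟧ (inj' ℓ x)
  mem' (inj₁ ℓ) h = ⊕-memˡ {A} {B} (X.mem ℓ h)
  mem' (inj₂ ℓ) h = ⊕-memʳ {A} {B} (Y.mem ℓ h)

leaf-map : ∀ {Q L L'} {leaf : L → Poly} {leaf' : L' → Poly} (f : L' → L) → (∀ {x y} → f x ≡ f y → x ≡ y) → (∀ ℓ → ∃ λ ℓ' → f ℓ' ≡ ℓ) →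
  (∀ ℓ' → leaf (f ℓ') ≡ leaf' ℓ') → Leaves Q L leaf → Leaves Q L' leaf'
leaf-map {Q} {L} {L'} {leaf} {leaf'} f f-inj f-surj eq X = subst-leaves
  where
  open Leaves X
  base : Leaves Q L' (leaf ∘ f)
  base = record { inj = inj ∘ f ; prj = prj ∘ f ; inj-lin = inj-lin ∘ f ; prj-lin = prj-lin ∘ f ; inj-lat = λ ℓ → inj-lat (f ℓ) ; prj-lat = λ ℓ → prj-lat (f ℓ)
    ; prj-inj = λ ℓ → prj-inj (f ℓ) ; prj-≢ = λ h → prj-≢ (h ∘ f-inj) ; mem = λ ℓ → mem (f ℓ)
    ; hull = λ {R} convex R0 h → hull {R} convex R0 (λ ℓ {x} → all {R} h ℓ (f-surj ℓ) {x})
    ; extreme = λ ex → [ inj₁ , (λ { (ℓ , y , ey , e) → inj₂ (back ℓ y ey e (f-surj ℓ)) }) ]′ (extreme ex) }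
    where
    all : ∀ {R : QSet (proj₁ Q)} → (∀ ℓ' {x} → ⟦ proj₂ (leaf (f ℓ')) ⟧ x → R (inj (f ℓ') x)) → ∀ ℓ → (∃ λ ℓ' → f ℓ' ≡ ℓ) → ∀ {x} → ⟦ proj₂ (leaf ℓ) ⟧ x → R (inj ℓ x)
    all h ℓ (ℓ' , refl) = h ℓ'
    back : ∀ {x} ℓ y → Extreme ⟦ proj₂ (leaf ℓ) ⟧ y → x ≡ inj ℓ y → (∃ λ ℓ' → f ℓ' ≡ ℓ) → ∃ λ ℓ' → ∃ λ y → Extreme ⟦ proj₂ (leaf (f ℓ')) ⟧ y × x ≡ inj (f ℓ') y
    back ℓ y ey e (ℓ' , refl) = ℓ' , y , ey , e
  cast : ∀ {A B : Poly} → A ≡ B → QPt (proj₁ A) → QPt (proj₁ B)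
  cast refl x = x
  subst-leaves : Leaves Q L' leaf'
  subst-leaves = record
    { inj = λ ℓ x → inj (f ℓ) (cast (sym (eq ℓ)) x) ; prj = λ ℓ x → cast (eq ℓ) (prj (f ℓ) x)
    ; inj-lin = λ ℓ → go-lin (eq ℓ) {inj (f ℓ)} (inj-lin (f ℓ)) ; prj-lin = λ ℓ → go-lin' (eq ℓ) {prj (f ℓ)} (prj-lin (f ℓ))
    ; inj-lat = λ ℓ → go-lat (eq ℓ) {inj (f ℓ)} (inj-lat (f ℓ)) ; prj-lat = λ ℓ → go-lat' (eq ℓ) {prj (f ℓ)} (prj-lat (f ℓ))
    ; prj-inj = λ ℓ → go-pi (eq ℓ) {inj (f ℓ)} {prj (f ℓ)} (prj-inj (f ℓ)) ; prj-≢ = λ {ℓ} {ℓ'} h → go-ne (eq ℓ) (eq ℓ') {prj (f ℓ)} {inj (f ℓ')} (prj-≢ (h ∘ f-inj))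
    ; mem = λ ℓ → go-mem (eq ℓ) {inj (f ℓ)} (mem (f ℓ))
    ; hull = λ {R} convex R0 h → Leaves.hull base {R} convex R0 (λ ℓ → go-hull (eq ℓ) {R} {inj (f ℓ)} (h ℓ))
    ; extreme = λ ex → [ inj₁ , (λ { (ℓ , y , ey , e) → inj₂ (ℓ , go-ext (eq ℓ) {inj (f ℓ)} y ey e) }) ]′ (Leaves.extreme base ex) }
    where
    go-lin : ∀ {A B : Poly} (e : A ≡ B) {i : QPt (proj₁ A) → QPt (proj₁ Q)} → Linear i → Linear (λ x → i (cast (sym e) x))
    go-lin refl h = h
    go-lin' : ∀ {A B : Poly} (e : A ≡ B) {p : QPt (proj₁ Q) → QPt (proj₁ A)} → Linear p → Linear (λ x → cast e (p x))
    go-lin' refl h = h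
    go-lat : ∀ {A B : Poly} (e : A ≡ B) {i : QPt (proj₁ A) → QPt (proj₁ Q)} → (∀ {x} → IsLattice x → IsLattice (i x)) → ∀ {x} → IsLattice x → IsLattice (i (cast (sym e) x))
    go-lat refl h = h
    go-lat' : ∀ {A B : Poly} (e : A ≡ B) {p : QPt (proj₁ Q) → QPt (proj₁ A)} → (∀ {x} → IsLattice x → IsLattice (p x)) → ∀ {x} → IsLattice x → IsLattice (cast e (p x))
    go-lat' refl h = h
    go-pi : ∀ {A B : Poly} (e : A ≡ B) {i : QPt (proj₁ A) → QPt (proj₁ Q)} {p : QPt (proj₁ Q) → QPt (proj₁ A)} → (∀ x → p (i x) ≡ x) → ∀ x → cast e (p (i (cast (sym e) x))) ≡ x
    go-pi refl h = h
    go-ne : ∀ {A B A' B' : Poly} (e : A ≡ B) (e' : A' ≡ B') {p : QPt (proj₁ Q) → QPt (proj₁ A)} {i : QPt (proj₁ A') → QPt (proj₁ Q)} → (∀ x → p (i x) ≡ zeroQ) → ∀ x → cast e (p (i (cast (sym e') x))) ≡ zeroQ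
    go-ne refl refl h = h
    go-mem : ∀ {A B : Poly} (e : A ≡ B) {i : QPt (proj₁ A) → QPt (proj₁ Q)} → (∀ {x} → ⟦ proj₂ A ⟧ x → ⟦ proj₂ Q ⟧ (i x)) → ∀ {x} → ⟦ proj₂ B ⟧ x → ⟦ proj₂ Q ⟧ (i (cast (sym e) x))
    go-mem refl h {x} = h {x}
    go-hull : ∀ {A B : Poly} (e : A ≡ B) {R : QSet (proj₁ Q)} {i : QPt (proj₁ A) → QPt (proj₁ Q)} → (∀ {x} → ⟦ proj₂ B ⟧ x → R (i (cast (sym e) x))) → ∀ {x} → ⟦ proj₂ A ⟧ x → R (i x)
    go-hull refl h {x} = h {x}
    go-ext : ∀ {A B : Poly} (e : A ≡ B) {i : QPt (proj₁ A) → QPt (proj₁ Q)} {x : QPt (proj₁ Q)} y → Extreme ⟦ proj₂ A ⟧ y → x ≡ i y → ∃ λ y → Extreme ⟦ proj₂ B ⟧ y × x ≡ i (cast (sym e) y)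
    go-ext refl y ey eq = y , ey , eq

leaf-cons : ∀ {Q A : Poly} {n : ℕ} {leaf : Fin n → Poly} {leaf' : Fin (suc n) → Poly} → Q ≡ leaf' zero → (∀ i → leaf i ≡ leaf' (suc i)) →
  Leaves A (Fin n) leaf → Leaves (Q ⊕ A) (Fin (suc n)) leaf'
leaf-cons {Q} {A} {n} {leaf} {leaf'} eq₀ eq X = leaf-map f f-inj f-surj f-leaf (leaf-⊕ (leaf-self Q) X)
  where
  f : Fin (suc n) → ⊤ ⊎ Fin n
  f zero    = inj₁ tt
  f (suc i) = inj₂ i
  f-inj : ∀ {x y} → f x ≡ f y → x ≡ y
  f-inj {zero}  {zero}  _    = refl
  f-inj {suc i} {suc j} refl = refl
  f-surj : ∀ ℓ → ∃ λ ℓ' → f ℓ' ≡ ℓ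
  f-surj (inj₁ tt) = zero , refl
  f-surj (inj₂ i)  = suc i , refl
  f-leaf : ∀ i → [ (λ _ → Q) , leaf ]′ (f i) ≡ leaf' i
  f-leaf zero    = eq₀
  f-leaf (suc i) = eq i

leaf-replicate : (r : ℕ) (Q : Poly) → Leaves (⨁ (List.replicate r Q)) (Fin r) (λ _ → Q)
leaf-replicate zero    Q = leaf-map (λ ()) (λ { {()} }) (λ ()) (λ ()) leaf-none
leaf-replicate (suc r) Q = leaf-cons refl (λ _ → refl) (leaf-replicate r Q)

leaf-list : (F : ℕ → Poly) (xs : List ℕ) → Leaves (⨁ (List.map F xs)) (Fin (List.length xs)) (λ i → F (List.lookup xs i))
leaf-list F []       = leaf-map (λ ()) (λ { {()} }) (λ ()) (λ ()) leaf-none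
leaf-list F (x ∷ xs) = leaf-cons refl (λ _ → refl) (leaf-list F xs)

-- What the comparison of two splittings uses of a core, in a form that also covers the absent core
-- by an empty family. `irreducible` expresses 1-irreducibility through integral functionals.
record CoreData (Q : Poly) : Set₁ where
  field
    w w*        : Fin (proj₁ Q) → QPt (proj₁ Q)
    dual        : Dualᶠ w* w
    mem         : ∀ j s → ⟦ proj₂ Q ⟧ (rpt w (just j , s))
    hull        : ∀ {R : QSet (proj₁ Q)} → Convex R → R zeroQ → (∀ j s → R (rpt w (just j , s))) → ∀ {y} → ⟦ proj₂ Q ⟧ y → R y
    extreme     : ∀ {y} → Extreme ⟦ proj₂ Q ⟧ y → y ≡ zeroQ ⊎ ∃ λ j → ∃ λ s → y ≡ rpt w (just j , s)
    irreducible : ∀ j u → IsLattice u → dot u (w j) ≡ 1ℚ → (∀ j' → j' ≢ j → dot u (w j') ≡ 0ℚ) → ⊥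

-- In dimension 0 the only point is extreme, and a vector without entries is vacuously divisible by
-- 2, hence not primitive.
¬Fano-0 : {V : List (Pt 0)} → ¬ Fano V
¬Fano-0 {V} (zi , prim) = proj₂ (proj₂ (prim [] ([]-in , λ { [] _ _ _ _ → refl }))) 2 ℕP.≤-refl λ ()
  where
  []-in : ⟦ V ⟧ []
  []-in = let (ε , _ , Pε) = zi [] in Pε

-- The zero vector is divisible by 2, hence not primitive.
fano-nonzero : {V : List (Pt (suc n))} → Fano V → ¬ Extreme ⟦ V ⟧ zeroQ
fano-nonzero (_ , prim) ex = let (v , eq , p) = prim zeroQ ex in p 2 ℕP.≤-refl λ i →
  subst (λ z → 2 Data.Nat.Divisibility.∣ ℤ.∣ z ∣) (sym (fromℤ-injective {v ‼ i} {ℤ.+ 0} (trans (sym (‼-toℚ v i)) (trans (cong (_‼ i) eq) (‼-zero i))))) (2 Data.Nat.Divisibility.∣0)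

span-convex : (w : Fin k → QPt n) → Convex (InSpan w)
span-convex w e h (conv c _ _ refl) = (λ j → sumF (λ i → c i * proj₁ (h i) j)) ,
  trans (sym (comb-comb c (λ i → proj₁ (h i)) w)) (comb-cong (λ _ → refl) (λ i → proj₂ (h i)))

rpt-elim : (w : Fin k → QPt n) (j : Fin k) (R : QPt n → Set) → R (w j) → R (negQ (w j)) → ∀ s → R (rpt w (just j , s))
rpt-elim w j R p q true  = subst R (sym (rpt-just w j)) p
rpt-elim w j R p q false = subst R (sym (trans (rpt-neg w (just j)) (cong negQ (rpt-just w j)))) q

neg-zero : negQ (zeroQ {n}) ≡ zeroQ
neg-zero = vext λ t → trans (‼-neg zeroQ t) (trans (cong -_ (‼-zero t)) (sym (‼-zero t)))

span-rpt : (w : Fin k → QPt n) (r : Raw k) → InSpan w (rpt w r)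
span-rpt w (i , s) = (λ j → σ s * weight i j) , refl

-- A vertex pair ±w_j of a cs-crosspolytope with an integral functional u dual to it splits off a segment; the other factor is the image
-- under the projection along w_j onto the kernel of u.
module CoreFromCross {n : ℕ} (V : List (Pt (suc n))) (reflexive : Reflexive V) (cs : CsCross (suc n , V)) (irr : OneIrreducible (suc n , V)) where

  W : List (QPt (suc n))
  W = proj₁ cs

  len : List.length W ≡ suc n
  len = proj₁ (proj₂ cs)

  w : Fin (suc n) → QPt (suc n)
  w j = List.lookup W (Fin.cast (sym len) j)

  both : List (QPt (suc n))
  both = W List.++ List.map negQ W

  in-w : ∀ {x} → x ∈ W → ∃ λ j → w j ≡ x
  in-w p = let (i , eq) = lookup-in p in Fin.cast len i , trans (cong (List.lookup W) (FinP.cast-involutive (sym len) len i)) eq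

  w-∈ : ∀ j → w j ∈ both
  w-∈ j = ∈-++⁺ˡ {xs = W} (∈-lookup {xs = W} (Fin.cast (sym len) j))

  -w-∈ : ∀ j → negQ (w j) ∈ both
  -w-∈ j = ∈-++⁺ʳ W (∈-map⁺ negQ (∈-lookup {xs = W} (Fin.cast (sym len) j)))

  both-cases : ∀ {x} → x ∈ both → ∃ λ j → ∃ λ s → x ≡ rpt w (just j , s)
  both-cases p = [ (λ q → let (j , eq) = in-w q in j , true , trans (sym eq) (sym (rpt-just w j)))
    , (λ q → let (y , y∈ , eq) = ∈-map⁻ negQ q ; (j , eq') = in-w y∈ in j , false , trans eq (trans (cong negQ (trans (sym eq') (sym (rpt-just w j)))) (sym (rpt-neg w (just j))))) ]′
    (∈-++⁻ W p)

  hull : ∀ {R : QSet (suc n)} → Convex R → (∀ j s → R (rpt w (just j , s))) → ∀ {y} → ⟦ V ⟧ y → R y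
  hull {R} convex h {y} Vy = inconv-sub both {R} convex (λ p → let (j , s , eq) = both-cases p in subst R (sym eq) (h j s)) (proj₁ (proj₂ (proj₂ (proj₂ (proj₂ cs))) y) Vy)

  mem : ∀ j s → ⟦ V ⟧ (rpt w (just j , s))
  mem j true  = subst ⟦ V ⟧ (sym (rpt-just w j)) (proj₂ (proj₂ (proj₂ (proj₂ (proj₂ cs))) (w j)) (inconv-∈ {W = both} (w-∈ j)))
  mem j false = subst ⟦ V ⟧ (sym (trans (rpt-neg w (just j)) (cong negQ (rpt-just w j))))
    (proj₂ (proj₂ (proj₂ (proj₂ (proj₂ cs))) (negQ (w j))) (inconv-∈ {W = both} (-w-∈ j)))

  extreme : ∀ {y} → Extreme ⟦ V ⟧ y → ∃ λ j → ∃ λ s → y ≡ rpt w (just j , s)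
  extreme {y} (Vy , ext) = both-cases (inconv-extreme both (proj₁ (same y) Vy , λ a b Ba Bb → ext a b (proj₂ (same a) Ba) (proj₂ (same b) Bb)))
    where
    same : SameSet ⟦ V ⟧ (InConv both)
    same = proj₂ (proj₂ (proj₂ (proj₂ cs)))

  -- As 0 is interior, the hull of the ±w_j contains a positive multiple of each unit vector.
  spanning : ∀ j → InSpan w (unitQ j)
  spanning j = let (ε , ε>0 , Vε) = proj₁ (proj₁ reflexive) (unitQ j)
                   (q , qε , _) = inverse-pos ε ε>0
                   (c , eq) = hull {InSpan w} (span-convex w) (λ j s → span-rpt w (just j , s)) Vε
    in (λ i → q * c i) , trans (comb-scale q c w) (trans (cong (scaleQ q) eq) (vext λ t → trans (‼-scale q (scaleQ ε (unitQ j)) t)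
         (trans (cong (q *_) (‼-scale ε (unitQ j) t)) (trans (sym (ℚP.*-assoc q ε (unitQ j ‼ t))) (trans (cong (_* unitQ j ‼ t) qε) (ℚP.*-identityˡ (unitQ j ‼ t)))))))

  opaque
    w* : Fin (suc n) → QPt (suc n)
    w* = proj₁ (spanning-dual spanning)

    dual : Dualᶠ w* w
    dual = proj₂ (spanning-dual spanning)

  w*-rpt : ∀ i j s → dot (w* i) (rpt w (just j , s)) ≡ σ s * δ j i
  w*-rpt i j s = coord-rpt dual (just j , s) i


  opaque
    w-extreme : ∀ j → Extreme ⟦ V ⟧ (w j)
    w-extreme j = subst (λ y → Extreme ⟦ V ⟧ y) (rpt-just w j) (exposed-extreme (w* j) 1ℚ (mem j true) at-j
      (λ x → hull {λ x → dot (w* j) x ≤ 1ℚ} (λ e → conv-≤ (w* j) 1ℚ) (λ i s → below i s))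
      (λ x Vx → conv-exposed (w* j) 1ℚ (rpt w (just j , true)) at-j
        (λ i → let (l , s , eq) = both-cases (∈-lookup {xs = both} i) in subst (λ y → dot (w* j) y < 1ℚ ⊎ y ≡ rpt w (just j , true)) (sym eq) (strict l s (j Fin.≟ l)))
        (toConv both (proj₁ (proj₂ (proj₂ (proj₂ (proj₂ cs))) x) Vx))))
      where
      at-j : dot (w* j) (rpt w (just j , true)) ≡ 1ℚ
      at-j = trans (w*-rpt j j true) (trans (ℚP.*-identityˡ (δ j j)) (δ-refl j))
      strict : ∀ l s → Dec (j ≡ l) → dot (w* j) (rpt w (just l , s)) < 1ℚ ⊎ rpt w (just l , s) ≡ rpt w (just j , true)
      strict l true  (yes refl) = inj₂ refl
      strict l false (yes refl) = inj₁ (subst (_< 1ℚ) (sym (trans (w*-rpt j j false) (cong (- 1ℚ *_) (δ-refl j)))) (ℚP.<-trans -1<0 0<1))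
      strict l s (no h) = inj₁ (subst (_< 1ℚ) (sym (trans (w*-rpt j l s) (trans (cong (σ s *_) (δ-≢ (h ∘ sym))) (ℚP.*-zeroʳ (σ s))))) 0<1)
      below : ∀ l s → dot (w* j) (rpt w (just l , s)) ≤ 1ℚ
      below l s = go (strict l s (j Fin.≟ l))
        where
        go : dot (w* j) (rpt w (just l , s)) < 1ℚ ⊎ rpt w (just l , s) ≡ rpt w (just j , true) → dot (w* j) (rpt w (just l , s)) ≤ 1ℚ
        go (inj₁ lt) = ℚP.<⇒≤ lt
        go (inj₂ eq) = ℚP.≤-reflexive (trans (cong (dot (w* j)) eq) at-j)

    w-lattice : ∀ j → IsLattice (w j)
    w-lattice j = let (v , eq , _) = proj₂ (proj₁ reflexive) (w j) (w-extreme j) in v , eq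

  module Split (j : Fin (suc n)) (u : QPt (suc n)) (lu : IsLattice u) (uw : dot u (w j) ≡ 1ℚ) (uw' : ∀ j' → j' ≢ j → dot u (w j') ≡ 0ℚ) where

    open Peel (peel lu (w-lattice j) uw) renaming (dual to AB)

    π : QPt (suc n) → QPt n
    π x = Vec.tabulate (λ i → dot (A i) x)

    π-lin : Linear π
    π-lin = tab-linear A

    ι : QPt n → QPt (suc n)
    ι y = comb (y ‼_) B

    ι-lin : Linear ι
    ι-lin = comb-linear B

    πι : ∀ y → π (ι y) ≡ y
    πι y = vext λ i → trans (‼-tab (λ i → dot (A i) (ι y)) i) (dual-coeff AB (y ‼_) i)

    full-dual : Dualᶠ (u ∷ᶠ A) (w j ∷ᶠ B)
    biorth full-dual zero    zero    = uw
    biorth full-dual zero    (suc i) = uB i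
    biorth full-dual (suc i) zero    = Aε i
    biorth full-dual (suc i) (suc l) = trans (biorth AB i l) (sym (δ-suc i l))

    split : ∀ v → v ≡ addQ (scaleQ (dot u v) (w j)) (ι (π v))
    split v = trans (sym (dual-complete full-dual v)) (trans (comb-cong {c' = dot u v ∷ᶠ (π v ‼_)} (λ { zero → refl ; (suc i) → sym (‼-tab (λ i → dot (A i) v) i) }) (λ _ → refl))
      (comb-∷ (dot u v) (π v ‼_) (w j) B))

    πw : π (w j) ≡ zeroQ
    πw = vext λ i → trans (‼-tab (λ i → dot (A i) (w j)) i) (trans (Aε i) (sym (‼-zero i)))

    ιπ : ∀ {x} → dot u x ≡ 0ℚ → ι (π x) ≡ x
    ιπ {x} ux = sym (trans (split x) (trans (cong (λ t → addQ (scaleQ t (w j)) (ι (π x))) ux) (trans (cong (λ z → addQ z (ι (π x))) (scale-0 (w j))) (add-zeroˡ (ι (π x))))))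

    u-rpt : ∀ {j'} → j' ≢ j → ∀ s → dot u (rpt w (just j' , s)) ≡ 0ℚ
    u-rpt {j'} h true  = trans (cong (dot u) (rpt-just w j')) (uw' j' h)
    u-rpt {j'} h false = trans (cong (dot u) (trans (rpt-neg w (just j')) (cong negQ (rpt-just w j')))) (trans (dot-neg u (w j')) (cong -_ (uw' j' h)))

    ι-zero : ι zeroQ ≡ zeroQ
    ι-zero = linear-zero {f = ι} ι-lin

    π-j : ∀ s → π (rpt w (just j , s)) ≡ zeroQ
    π-j s = rpt-elim w j (λ y → π y ≡ zeroQ) πw (trans (linear-neg {f = π} π-lin (w j)) (trans (cong negQ πw) neg-zero)) s

    V-zero : ⟦ V ⟧ zeroQ
    V-zero = convex-0 (⟦⟧-convex V) (proj₁ (w-extreme j)) (subst ⟦ V ⟧ (trans (rpt-neg w (just j)) (cong negQ (rpt-just w j))) (mem j false))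

    -- The projection along w_j sends ±w_j to 0 and fixes all other generators, so the complementary
    -- factor is a section of the polytope as well as its image.
    V-ιπ : ∀ {x} → ⟦ V ⟧ x → ⟦ V ⟧ (ι (π x))
    V-ιπ = hull {λ x → ⟦ V ⟧ (ι (π x))} (linear-convex {f = ι ∘ π} (∘-linear {f = ι} {π} ι-lin π-lin) {⟦ V ⟧} (⟦⟧-convex V)) λ j' s → on j' s (j' Fin.≟ j)
      where
      on : ∀ j' s → Dec (j' ≡ j) → ⟦ V ⟧ (ι (π (rpt w (just j' , s))))
      on j' s (yes refl) = subst ⟦ V ⟧ (sym (trans (cong ι (π-j s)) ι-zero)) V-zero
      on j' s (no h)     = subst ⟦ V ⟧ (sym (ιπ (u-rpt h s))) (mem j' s)

    ρ : Pt (suc n) → Pt n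
    ρ v = integral (tab-lattice A A-lat {toℚ v} (v , refl))

    toℚ-ρ : ∀ v → toℚ (ρ v) ≡ π (toℚ v)
    toℚ-ρ v = proj₂ (tab-lattice A A-lat {toℚ v} (v , refl))

    W' : List (Pt n)
    W' = List.map ρ V

    W'-in : ∀ {x} → ⟦ V ⟧ x → ⟦ W' ⟧ (π x)
    W'-in = ⟦⟧-sub V {λ x → ⟦ W' ⟧ (π x)} (linear-convex {f = π} π-lin {⟦ W' ⟧} (⟦⟧-convex W')) λ {v} p → subst ⟦ W' ⟧ (toℚ-ρ v) (⟦⟧-∈ (∈-map⁺ ρ p))

    W'-hull : ∀ {R : QSet n} → Convex R → R zeroQ → (∀ j' s → j' ≢ j → R (π (rpt w (just j' , s)))) → ∀ {y} → ⟦ W' ⟧ y → R y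
    W'-hull {R} convex R0 h = ⟦⟧-sub W' {R} convex λ {z} p → let (v , v∈ , eq) = ∈-map⁻ ρ p in
      subst R (trans (sym (toℚ-ρ v)) (cong toℚ (sym eq))) (hull {R ∘ π} (linear-convex {f = π} π-lin {R} convex) (λ j' s → on j' s (j' Fin.≟ j)) (⟦⟧-∈ v∈))
      where
      on : ∀ j' s → Dec (j' ≡ j) → R (π (rpt w (just j' , s)))
      on j' s (yes refl) = subst R (sym (π-j s)) R0
      on j' s (no ne)    = h j' s ne

    Q : Poly
    Q = n , W'

    frame : Vec (QPt (suc n)) (suc n)
    frame = w j ∷ Vec.tabulate B

    frame-tail : ∀ z → ev z (Vec.tabulate B) ≡ ι (toℚ z)
    frame-tail z = trans (ev-comb z (Vec.tabulate B)) (comb-cong (λ _ → refl) (‼-tab B))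

    ev-top : ∀ t (z : Pt n) → ev (t ∷ z) frame ≡ addQ (scaleQ (fromℤ t) (w j)) (ι (toℚ z))
    ev-top t z = cong (addQ (scaleQ (fromℤ t) (w j))) (frame-tail z)

    open SegmentFactor n W' using (verts; top; bottom)

    ev-± : ∀ t → ev (t ∷ Vec.replicate n (ℤ.+ 0)) frame ≡ scaleQ (fromℤ t) (w j)
    ev-± t = trans (cong (addQ (scaleQ (fromℤ t) (w j))) (ev-0 (Vec.tabulate B))) (add-zeroʳ _)

    ev-W' : ∀ z → ev ((ℤ.+ 0) ∷ z) frame ≡ ι (toℚ z)
    ev-W' z = trans (ev-top (ℤ.+ 0) z) (trans (cong (λ y → addQ y (ι (toℚ z))) (scale-0 (w j))) (add-zeroˡ (ι (toℚ z))))

    inside : Inside ⟦ V ⟧ (segment ⊕ Q) frame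
    inside (here refl)         = subst ⟦ V ⟧ (sym (trans (ev-± (ℤ.+ 1)) (scale-1 (w j)))) (proj₁ (w-extreme j))
    inside (there (here refl)) = subst ⟦ V ⟧ (sym (trans (ev-± (ℤ.- (ℤ.+ 1))) (trans (sym (neg-scale (w j))) (trans (cong negQ (sym (rpt-just w j))) (sym (rpt-neg w (just j))))))) (mem j false)
    inside (there (there p)) = tail (∈-map⁻ (λ z → Vec.replicate 1 (ℤ.+ 0) Vec.++ z) p)
      where
      tail : ∀ {x} → (∃ λ z → z ∈ W' × x ≡ (ℤ.+ 0) ∷ z) → ⟦ V ⟧ (ev x frame)
      tail (z , z∈ , refl) = let (v , v∈ , eq) = ∈-map⁻ ρ z∈ in
        subst ⟦ V ⟧ (sym (trans (ev-W' z) (cong ι (trans (cong toℚ eq) (toℚ-ρ v))))) (V-ιπ (⟦⟧-∈ v∈))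

    vx : ∀ {p} → Extreme ⟦ V ⟧ p → Vx (segment ⊕ Q) frame p
    vx {p} ex = let (j' , s , eq) = extreme ex in go j' s eq (j' Fin.≟ j)
      where
      go : ∀ j' s → p ≡ rpt w (just j' , s) → Dec (j' ≡ j) → Vx (segment ⊕ Q) frame p
      go j' true  eq (yes refl) = top , here refl , trans (ev-± (ℤ.+ 1)) (trans (scale-1 (w j)) (sym (trans eq (rpt-just w j))))
      go j' false eq (yes refl) = bottom , there (here refl) , trans (ev-± (ℤ.- (ℤ.+ 1))) (trans (sym (neg-scale (w j))) (sym (trans eq (trans (rpt-neg w (just j)) (cong negQ (rpt-just w j))))))
      go j' s eq (no h) = let (v , v∈ , eqv) = ⟦⟧-extreme V ex in
        (ℤ.+ 0) ∷ ρ v , there (there (∈-map⁺ (λ z → Vec.replicate 1 (ℤ.+ 0) Vec.++ z) (∈-map⁺ ρ v∈))) ,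
        trans (ev-W' (ρ v)) (trans (cong ι (trans (toℚ-ρ v) (cong π (sym eqv)))) (ιπ (trans (cong (dot u) eq) (u-rpt h s))))

    lat : VAll.All IsLattice frame
    lat = w-lattice j VAll.∷ VAllP.tabulate⁺ B-lat

    frame-span : ∀ i → IntSpan frame (unitQ i)
    frame-span i = let (t , teq) = lattice-dot lu (lattice-unit i) ; (z , zeq) = tab-lattice A A-lat (lattice-unit i) in
      intSpan (t ∷ z) (trans (ev-top t z) (trans (cong₂ (λ a b → addQ (scaleQ a (w j)) (ι b)) teq zeq) (sym (split (unitQ i)))))

    rpt-extreme : ∀ j' s → Extreme ⟦ V ⟧ (rpt w (just j' , s))
    rpt-extreme j' true  = subst (λ y → Extreme ⟦ V ⟧ y) (sym (rpt-just w j')) (w-extreme j')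
    rpt-extreme j' false = mem j' false , λ a b Va Vb eq → trans (sym (negQ-negQ a)) (trans (cong negQ (proj₂ (w-extreme j') (negQ a) (negQ b) (neg-in Va) (neg-in Vb)
        (trans (sym (negQ-negQ (w j'))) (trans (cong negQ (trans (sym (trans (rpt-neg w (just j')) (cong negQ (rpt-just w j')))) eq)) (mid-neg a b)))))
      (sym (trans (rpt-neg w (just j')) (cong negQ (rpt-just w j')))))
      where
      neg-lin : Linear (negQ {suc n})
      neg-lin c e = vext λ t → trans (‼-neg (comb c e) t) (trans (cong -_ (‼-comb c e t)) (trans (sym (sumF-neg (λ i → c i * e i ‼ t)))
        (trans (sumF-cong (λ i → trans (lem (c i) (e i ‼ t)) (cong (c i *_) (sym (‼-neg (e i) t))))) (sym (‼-comb c (negQ ∘ e) t)))))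
        where
        lem : ∀ a b → - (a * b) ≡ a * (- b)
        lem = solve-∀ ℚring
      neg-in : ∀ {x} → ⟦ V ⟧ x → ⟦ V ⟧ (negQ x)
      neg-in = hull {λ x → ⟦ V ⟧ (negQ x)} (linear-convex {f = negQ} neg-lin {⟦ V ⟧} (⟦⟧-convex V)) λ l s → flip-sign l s
        where
        flip-sign : ∀ l s → ⟦ V ⟧ (negQ (rpt w (just l , s)))
        flip-sign l true  = subst ⟦ V ⟧ (rpt-neg w (just l)) (mem l false)
        flip-sign l false = subst ⟦ V ⟧ (trans (sym (negQ-negQ _)) (cong negQ (sym (rpt-neg w (just l))))) (mem l true)

    Q-iso : IsoP (suc n , V) (segment ⊕ Q)
    Q-iso = toIsoP {V = V} {proj₂ (segment ⊕ Q)} (basis-iso {V = V} (segment ⊕ Q) frame refl lat frame-span inside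
      (λ {R} convex ext → hull {R} convex (λ j' s → ext (rpt-extreme j' s))) vx)

    Q-fano : n ≢ 0 → Fano W'
    Q-fano n≢0 = (λ y → let (ε , ε>0 , Vε) = proj₁ (proj₁ reflexive) (ι y) in
        ε , ε>0 , subst ⟦ W' ⟧ (trans (linear-scale {f = π} π-lin ε (ι y)) (cong (scaleQ ε) (πι y))) (W'-in Vε)) ,
      λ y ex → let (z , z∈ , eq) = ⟦⟧-extreme W' ex in z , sym eq , prim z (sym eq) ex (located y ex)
      where
      family : List (QPt n)
      family = zeroQ ∷ List.map π both
      -- Vertices of the image are sought among 0 and the projected generators. 0 is ruled out as
      -- the midpoint of the images of w_j' and -w_j' for another index j', which exists because n
      -- is not 0.
      located : ∀ y → Extreme ⟦ W' ⟧ y → ∃ λ j' → ∃ λ s → j' ≢ j × y ≡ π (rpt w (just j' , s))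
      located y ex = which (extreme-gen {w = List.lookup family} (⟦⟧-convex W') (λ i → in-W' (∈-lookup {xs = family} i)) ex
          (toConv family (W'-hull {InConv family} (inconv-convex family) (inconv-∈ {W = family} (here refl)) (λ j' s _ → inconv-∈ {W = family} (there (∈-map⁺ π (both-∈ j' s)))) (proj₁ ex))))
        where
        both-∈ : ∀ j' s → rpt w (just j' , s) ∈ both
        both-∈ j' true  = subst (_∈ both) (sym (rpt-just w j')) (w-∈ j')
        both-∈ j' false = subst (_∈ both) (sym (trans (rpt-neg w (just j')) (cong negQ (rpt-just w j')))) (-w-∈ j')
        W'-zero : ⟦ W' ⟧ zeroQ
        W'-zero = subst ⟦ W' ⟧ πw (W'-in (proj₁ (w-extreme j)))
        in-W' : ∀ {x} → x ∈ family → ⟦ W' ⟧ x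
        in-W' (here refl) = W'-zero
        in-W' (there p)   = let (x , x∈ , eq) = ∈-map⁻ π p ; (j' , s , eq') = both-cases x∈ in subst ⟦ W' ⟧ (sym (trans eq (cong π eq'))) (W'-in (mem j' s))
        other : ∃ λ j' → j' ≢ j
        other = different n n≢0 j
          where
          different : ∀ n → n ≢ 0 → (j : Fin (suc n)) → ∃ λ j' → j' ≢ j
          different zero    h _       = ⊥-elim (h refl)
          different (suc n) h zero    = suc zero , λ ()
          different (suc n) h (suc j) = zero , λ ()
        not-zero : y ≢ zeroQ
        not-zero y0 = let (j' , ne) = other ; z = π (w j') in
          0≢1 (trans (trans (sym (dot-zero (w* j'))) (cong (dot (w* j')) (trans (sym ι-zero) (trans (cong ι (sym (proj₂ (subst (Extreme ⟦ W' ⟧) y0 ex) z (negQ z) (W'-in (proj₁ (w-extreme j')))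
              (subst ⟦ W' ⟧ (linear-neg {f = π} π-lin (w j')) (W'-in (subst ⟦ V ⟧ (trans (rpt-neg w (just j')) (cong negQ (rpt-just w j'))) (mem j' false))))
              (vext λ t → trans (‼-zero t) (trans (lem (z ‼ t)) (sym (trans (‼-scale ½ (addQ z (negQ z)) t) (cong (½ *_) (trans (‼-add z (negQ z) t) (cong (z ‼ t +_) (‼-neg z t)))))))))))
            (ιπ (uw' j' ne)))))) (trans (biorth dual j' j') (δ-refl j')))
          where
          lem : ∀ a → 0ℚ ≡ ½ * (a + - a)
          lem = solve-∀ ℚring
        which : (∃ λ i → List.lookup family i ≡ y) → ∃ λ j' → ∃ λ s → j' ≢ j × y ≡ π (rpt w (just j' , s))
        which (zero , eq)  = ⊥-elim (not-zero (sym eq))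
        which (suc i , eq) = let (x , x∈ , eqx) = ∈-map⁻ π (∈-lookup {xs = List.map π both} i) ; (j' , s , eq') = both-cases x∈ in
          j' , s , (λ e → not-zero (trans (sym eq) (trans eqx (trans (cong π eq') (trans (cong (λ i → π (rpt w (just i , s))) e) (π-j s)))))) , trans (sym eq) (trans eqx (cong π eq'))
      prim : ∀ z {y} → toℚ z ≡ y → Extreme ⟦ W' ⟧ y → (∃ λ j' → ∃ λ s → j' ≢ j × y ≡ π (rpt w (just j' , s))) → Primitive z
      prim z eq ex (j' , s , ne , eqy) = let (v , eqv , pv) = proj₂ (proj₁ reflexive) (rpt w (just j' , s)) (rpt-extreme j' s) in
        primitive-coords B B-lat z v (trans (cong ι (trans eq eqy)) (trans (ιπ (u-rpt ne s)) (sym eqv))) pv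

    contradiction : ⊥
    -- For n = 0 the polytope is the segment itself and the other factor has dimension 0, where it
    -- cannot be Fano; `OneIrreducible` provides for this case separately.
    contradiction = irr (Q , factor (n ℕ.≟ 0) , Q-iso)
      where
      factor : Dec (n ≡ 0) → Fano W' ⊎ n ≡ 0
      factor (yes e) = inj₂ e
      factor (no h)  = inj₁ (Q-fano h)

  coreData : CoreData (suc n , V)
  coreData = record { w = w ; w* = w* ; dual = dual ; mem = mem ; hull = λ {R} convex _ → hull {R} convex
    ; extreme = inj₂ ∘ extreme ; irreducible = λ j u lu uw uw' → Split.contradiction j u lu uw uw' }

coreData : (c : Maybe Poly) → CoreOK c → CoreData (corePoly c)
coreData nothing _ = record { w = λ () ; w* = λ () ; dual = dualᶠ (λ ()) ; mem = λ () ; hull = λ { {R} _ R0 _ {[]} _ → R0 } ; extreme = λ { {[]} _ → inj₁ refl } ; irreducible = λ () }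
coreData (just (zero , V)) (refl' , _)         = ⊥-elim (¬Fano-0 {V} (proj₁ refl'))
coreData (just (suc n , V)) (reflexive , cs , irr) = CoreFromCross.coreData V reflexive cs irr

-- Counting the vertices of a block

size : Kind → ℕ
size single    = 1 ℕ.* 2 ℕ.+ 0
size (dp k _)  = k ℕ.* 2 ℕ.+ 2
size (pdp k _) = k ℕ.* 2 ℕ.+ 1

elt↔ : ∀ κ → Elt κ ↔ Fin (size κ)
elt↔ κ = ↔-trans (pairs ⊎-↔ extra κ) (sum-fin κ)
  where
  pairs : ∀ {k} → (Fin k × Bool) ↔ Fin (k ℕ.* 2)
  pairs {k} = ↔-trans (↔-refl ×-↔ ↔-sym FinP.2↔Bool) (↔-sym FinP.*↔×)
  extraSize : Kind → ℕ
  extraSize single    = 0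
  extraSize (dp _ _)  = 2
  extraSize (pdp _ _) = 1
  extra : ∀ κ → Extra κ ↔ Fin (extraSize κ)
  extra single    = ↔-sym FinP.0↔⊥
  extra (dp _ _)  = ↔-sym FinP.2↔Bool
  extra (pdp _ _) = ↔-sym FinP.1↔⊤
  sum-fin : ∀ κ → (Fin (dim κ ℕ.* 2) ⊎ Fin (extraSize κ)) ↔ Fin (size κ)
  sum-fin single    = ↔-sym FinP.+↔⊎
  sum-fin (dp _ _)  = ↔-sym FinP.+↔⊎
  sum-fin (pdp _ _) = ↔-sym FinP.+↔⊎

size-≤ : ∀ κ κ' (f : Elt κ → Elt κ') → (∀ {x y} → f x ≡ f y → x ≡ y) → size κ ℕ.≤ size κ'
size-≤ κ κ' f inj = FinP.injective⇒≤ {f = Inverse.to (elt↔ κ') ∘ f ∘ Inverse.from (elt↔ κ)} λ {x} {y} eq →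
  trans (sym (Inverse.strictlyInverseˡ (elt↔ κ) x)) (trans (cong (Inverse.to (elt↔ κ)) (inj
    (trans (sym (Inverse.strictlyInverseʳ (elt↔ κ') _)) (trans (cong (Inverse.from (elt↔ κ')) eq) (Inverse.strictlyInverseʳ (elt↔ κ') _)))))
    (Inverse.strictlyInverseˡ (elt↔ κ) y))

SameKind : Kind → Kind → Set
SameKind single    single     = ⊤
SameKind (dp k _)  (dp k' _)  = k ≡ k'
SameKind (pdp k _) (pdp k' _) = k ≡ k'
SameKind _         _          = ⊥

even≢odd : ∀ a b → a ℕ.* 2 ≢ suc (b ℕ.* 2)
even≢odd zero    b       ()
even≢odd (suc a) zero    eq = case ℕP.suc-injective eq of λ ()
even≢odd (suc a) (suc b) eq = even≢odd a b (ℕP.suc-injective (ℕP.suc-injective eq))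

even-pos-absurd : EvenPos k → k ≢ 0
even-pos-absurd (j , refl) ()

-- The sizes are 2, 2k + 2 and 2k + 1: parity singles out the pseudo-del Pezzo kind, and k > 0
-- separates a del Pezzo block from a single pair.
same-size : ∀ κ κ' → size κ ≡ size κ' → SameKind κ κ'
same-size single single _ = tt
same-size single (dp k ev) eq = ⊥-elim (even-pos-absurd ev (ℕP.*-cancelʳ-≡ k 0 2 (ℕP.+-cancelʳ-≡ 2 (k ℕ.* 2) 0 (sym eq))))
same-size (dp k ev) single eq = ⊥-elim (even-pos-absurd ev (ℕP.*-cancelʳ-≡ k 0 2 (ℕP.+-cancelʳ-≡ 2 (k ℕ.* 2) 0 eq)))
same-size single (pdp k ev) eq = ⊥-elim (even≢odd 1 k (trans eq (ℕP.+-comm (k ℕ.* 2) 1)))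
same-size (pdp k ev) single eq = ⊥-elim (even≢odd 1 k (trans (sym eq) (ℕP.+-comm (k ℕ.* 2) 1)))
same-size (dp k _) (dp k' _) eq = ℕP.*-cancelʳ-≡ k k' 2 (ℕP.+-cancelʳ-≡ 2 (k ℕ.* 2) (k' ℕ.* 2) eq)
same-size (pdp k _) (pdp k' _) eq = ℕP.*-cancelʳ-≡ k k' 2 (ℕP.+-cancelʳ-≡ 1 (k ℕ.* 2) (k' ℕ.* 2) eq)
same-size (dp k _) (pdp k' _) eq = ⊥-elim (even≢odd (suc k) k' (trans (ℕP.+-comm 2 (k ℕ.* 2)) (trans eq (ℕP.+-comm (k' ℕ.* 2) 1))))
same-size (pdp k _) (dp k' _) eq = ⊥-elim (even≢odd (suc k') k (trans (ℕP.+-comm 2 (k' ℕ.* 2)) (trans (sym eq) (ℕP.+-comm (k ℕ.* 2) 1))))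

-- Permutations are obtained from bag equality, that is, from bijections between membership proofs.
-- Such a proof is determined by its position, because equations in ℕ have at most one proof, so a
-- bijection of positions suffices.
bijection-↭ : {xs ys : List ℕ} (f : Fin (List.length xs) → Fin (List.length ys)) (g : Fin (List.length ys) → Fin (List.length xs)) →
  (∀ i → g (f i) ≡ i) → (∀ j → f (g j) ≡ j) → (∀ i → List.lookup ys (f i) ≡ List.lookup xs i) → xs ↭ ys
bijection-↭ {xs} {ys} f g gf fg h = ∼bag⇒↭ (mk↔ₛ′ (move f h) (move g h') (λ p → index-inj (trans (index-at _ _) (trans (cong f (index-at _ _)) (fg (Any.index p)))))
    (λ p → index-inj (trans (index-at _ _) (trans (cong g (index-at _ _)) (gf (Any.index p))))))
  where
  h' : ∀ j → List.lookup xs (g j) ≡ List.lookup ys j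
  h' j = trans (sym (h (g j))) (cong (List.lookup ys) (fg j))
  at : ∀ {x} {zs : List ℕ} (i : Fin (List.length zs)) → List.lookup zs i ≡ x → x ∈ zs
  at {zs = z ∷ zs} zero    eq = here (sym eq)
  at {zs = z ∷ zs} (suc i) eq = there (at i eq)
  index-at : ∀ {x} {zs : List ℕ} (i : Fin (List.length zs)) (eq : List.lookup zs i ≡ x) → Any.index (at {zs = zs} i eq) ≡ i
  index-at {zs = z ∷ zs} zero    eq = refl
  index-at {zs = z ∷ zs} (suc i) eq = cong suc (index-at i eq)
  move : ∀ {us vs : List ℕ} (f : Fin (List.length us) → Fin (List.length vs)) → (∀ i → List.lookup vs (f i) ≡ List.lookup us i) → ∀ {x} → x ∈ us → x ∈ vs
  move f h p = at (f (Any.index p)) (trans (h (Any.index p)) (sym (AnyP.lookup-index p)))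
  index-inj : ∀ {x} {zs : List ℕ} {p q : x ∈ zs} → Any.index p ≡ Any.index q → p ≡ q
  index-inj {p = here a}  {here b}  _  = cong here (ℕP.≡-irrelevant a b)
  index-inj {p = there p} {there q} eq = cong there (index-inj (FinP.suc-injective eq))

module _ (D : Decomposition) where

  open Decomposition D

  Tail : Set
  Tail = Fin r ⊎ (Fin (List.length dP) ⊎ Fin (List.length pdP))

  tkind : Tail → Kind
  tkind (inj₁ _)        = single
  tkind (inj₂ (inj₁ i)) = dp (List.lookup dP i) (dPEven i)
  tkind (inj₂ (inj₂ i)) = pdp (List.lookup pdP i) (pdPEven i)

  coreDim : ℕ
  coreDim = proj₁ (corePoly core)

  -- Each vertex pair of the core is a block of its own, since linear maps that fix or kill each
  -- vertex separate these pairs.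
  Blk : Set
  Blk = Fin coreDim ⊎ Tail

  kind : Blk → Kind
  kind (inj₁ _) = single
  kind (inj₂ t) = tkind t

  _≟ᵇ_ : (b b' : Blk) → Dec (b ≡ b')
  _≟ᵇ_ = SumP.≡-dec Fin._≟_ (SumP.≡-dec Fin._≟_ (SumP.≡-dec Fin._≟_ Fin._≟_))

  leafOf : ⊤ ⊎ Tail → Poly
  leafOf (inj₁ _) = corePoly core
  leafOf (inj₂ t) = polyOf (tkind t)

  opaque
    splitLeaves : Leaves (splitPoly D) (⊤ ⊎ Tail) leafOf
    splitLeaves = leaf-map id id (λ ℓ → ℓ , refl) (λ { (inj₁ _) → refl ; (inj₂ (inj₁ _)) → refl ; (inj₂ (inj₂ (inj₁ _))) → refl ; (inj₂ (inj₂ (inj₂ _))) → refl })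
      (leaf-⊕ (leaf-self (corePoly core)) (leaf-⊕ (leaf-replicate r segment) (leaf-⊕ (leaf-list delPezzo dP) (leaf-list pseudoDelPezzo pdP))))

-- A splitting transported into the coordinates of the given polytope, so that two splittings can be
-- compared vertex by vertex. `ψ` embeds the lattice of the core and `ρ` retracts onto it.
record Presentation {d : ℕ} (P : QSet d) (D : Decomposition) : Set₁ where
  open Decomposition D
  field
    C            : CoreData (corePoly core)
    β β*         : ∀ b → Fin (dim (kind D b)) → QPt d
    dual         : ∀ b → Dualᶠ (β* b) (β b)
    cross        : ∀ {b b'} → b ≢ b' → ∀ i j → dot (β* b i) (β b' j) ≡ 0ℚ
    mem          : ∀ b e → P (pt (kind D b) (β b) e)
    hull         : ∀ {R : QSet d} → Convex R → R zeroQ → (∀ b e → R (pt (kind D b) (β b) e)) → ∀ {x} → P x → R x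
    gen          : ∀ {x} → Extreme P x → ∃ λ b → ∃ λ e → x ≡ pt (kind D b) (β b) e
    seg-lattice  : ∀ i → IsLattice (β* (inj₂ (inj₁ i)) zero)
    ψ            : QPt (coreDim D) → QPt d
    ρ            : QPt d → QPt (coreDim D)
    ψ-lin        : Linear ψ
    ρ-lin        : Linear ρ
    ψ-lat        : ∀ {x} → IsLattice x → IsLattice (ψ x)
    ρ-lat        : ∀ {x} → IsLattice x → IsLattice (ρ x)
    ρψ           : ∀ x → ρ (ψ x) ≡ x
    ψ-w          : ∀ j → ψ (CoreData.w C j) ≡ β (inj₁ j) zero

opaque
  -- All data are pulled back along the isomorphism. As 0 is no vertex of the polytope, the
  -- generator 0 that stems from `pt0` drops out of `gen`.
  present : ∀ {d} {V : List (Pt d)} → ¬ Extreme ⟦ V ⟧ zeroQ → (D : Decomposition) → PolyIso ⟦ V ⟧ ⟦ proj₂ (splitPoly D) ⟧ → Presentation ⟦ V ⟧ D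
  present {d} {V} nonzero D I = record
    { C = C ; β = β ; β* = β* ; dual = dual ; cross = cross ; mem = mem ; hull = λ {R} → hull {R} ; gen = gen
    ; seg-lattice = λ i → pullback-lattice {g = λ x → L.prj (inj₂ (inj₁ i)) (I.f x)} (λ lx → L.prj-lat (inj₂ (inj₁ i)) (I.f-lat lx)) (lattice-unit zero)
    ; ψ = λ y → I.g (L.inj (inj₁ tt) y) ; ρ = λ x → L.prj (inj₁ tt) (I.f x)
    ; ψ-lin = ∘-linear {f = I.g} {L.inj (inj₁ tt)} I.g-comb (L.inj-lin (inj₁ tt)) ; ρ-lin = ∘-linear {f = L.prj (inj₁ tt)} {I.f} (L.prj-lin (inj₁ tt)) I.f-comb
    ; ψ-lat = λ lx → I.g-lat (L.inj-lat (inj₁ tt) lx) ; ρ-lat = λ lx → L.prj-lat (inj₁ tt) (I.f-lat lx)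
    ; ρψ = λ x → trans (cong (L.prj (inj₁ tt)) (I.fg _)) (L.prj-inj (inj₁ tt) x) ; ψ-w = λ _ → refl }
    where
    open Decomposition D
    module I = PolyIso I
    module L = Leaves (splitLeaves D)
    C : CoreData (corePoly core)
    C = coreData core coreOK
    module C = CoreData C
    up : ∀ ℓ → QPt (proj₁ (leafOf D ℓ)) → QPt d
    up ℓ y = I.g (L.inj ℓ y)
    down : ∀ ℓ → QPt d → QPt (proj₁ (leafOf D ℓ))
    down ℓ x = L.prj ℓ (I.f x)
    up-lin : ∀ ℓ → Linear (up ℓ)
    up-lin ℓ = ∘-linear {f = I.g} {L.inj ℓ} I.g-comb (L.inj-lin ℓ)
    down-lin : ∀ ℓ → Linear (down ℓ)
    down-lin ℓ = ∘-linear {f = L.prj ℓ} {I.f} (L.prj-lin ℓ) I.f-comb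
    down-up : ∀ ℓ y → down ℓ (up ℓ y) ≡ y
    down-up ℓ y = trans (cong (L.prj ℓ) (I.fg (L.inj ℓ y))) (L.prj-inj ℓ y)
    down-up-≢ : ∀ {ℓ ℓ'} → ℓ ≢ ℓ' → ∀ y → down ℓ (up ℓ' y) ≡ zeroQ
    down-up-≢ {ℓ} {ℓ'} h y = trans (cong (L.prj ℓ) (I.fg (L.inj ℓ' y))) (L.prj-≢ h y)
    β β* : ∀ b → Fin (dim (kind D b)) → QPt d
    β (inj₁ j) _  = up (inj₁ tt) (C.w j)
    β (inj₂ t) i  = up (inj₂ t) (unitQ i)
    β* (inj₁ j) _ = pullback (down (inj₁ tt)) (C.w* j)
    β* (inj₂ t) i = pullback (down (inj₂ t)) (unitQ i)
    down-dot : ∀ ℓ u x → dot (pullback (down ℓ) u) x ≡ dot u (down ℓ x)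
    down-dot ℓ = dot-pullback {g = down ℓ} (down-lin ℓ)
    dual : ∀ b → Dualᶠ (β* b) (β b)
    biorth (dual (inj₁ j)) zero zero = trans (down-dot (inj₁ tt) (C.w* j) (β (inj₁ j) zero)) (trans (cong (dot (C.w* j)) (down-up (inj₁ tt) (C.w j))) (trans (biorth C.dual j j) (δ-refl j)))
    biorth (dual (inj₂ t)) i l = trans (down-dot (inj₂ t) (unitQ i) (β (inj₂ t) l)) (trans (cong (dot (unitQ i)) (down-up (inj₂ t) (unitQ l))) (biorth unit-dual i l))
    cross : ∀ {b b'} → b ≢ b' → ∀ i j → dot (β* b i) (β b' j) ≡ 0ℚ
    cross {inj₁ a} {inj₁ b} h i j = trans (down-dot (inj₁ tt) (C.w* a) (β (inj₁ b) j)) (trans (cong (dot (C.w* a)) (down-up (inj₁ tt) (C.w b))) (trans (biorth C.dual a b) (δ-≢ (h ∘ cong inj₁))))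
    cross {inj₁ a} {inj₂ t} h i j = trans (down-dot (inj₁ tt) (C.w* a) (β (inj₂ t) j)) (trans (cong (dot (C.w* a)) (down-up-≢ {inj₁ tt} {inj₂ t} (λ ()) (unitQ j))) (dot-zero (C.w* a)))
    cross {inj₂ t} {inj₁ a} h i j = trans (down-dot (inj₂ t) (unitQ i) (β (inj₁ a) j)) (trans (cong (dot (unitQ i)) (down-up-≢ {inj₂ t} {inj₁ tt} (λ ()) (C.w a))) (dot-zero (unitQ i)))
    cross {inj₂ t} {inj₂ t'} h i j = trans (down-dot (inj₂ t) (unitQ i) (β (inj₂ t') j)) (trans (cong (dot (unitQ i)) (down-up-≢ {inj₂ t} {inj₂ t'} (λ { refl → h refl }) (unitQ j))) (dot-zero (unitQ i)))
    core-pt : ∀ j s → up (inj₁ tt) (rpt C.w (just j , s)) ≡ rpt (β (inj₁ j)) (just zero , s)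
    core-pt j true  = trans (cong (up (inj₁ tt)) (rpt-just C.w j)) (sym (rpt-just (β (inj₁ j)) zero))
    core-pt j false = trans (cong (up (inj₁ tt)) (trans (rpt-neg C.w (just j)) (cong negQ (rpt-just C.w j)))) (trans (linear-neg {f = up (inj₁ tt)} (up-lin (inj₁ tt)) (C.w j))
      (sym (trans (rpt-neg (β (inj₁ j)) (just zero)) (cong negQ (rpt-just (β (inj₁ j)) zero)))))
    tail-pt : ∀ t e → up (inj₂ t) (pt (tkind D t) unitQ e) ≡ pt (tkind D t) (β (inj₂ t)) e
    tail-pt t e = linear-rpt {f = up (inj₂ t)} (up-lin (inj₂ t)) unitQ (raw (tkind D t) e)
    mem : ∀ b e → ⟦ V ⟧ (pt (kind D b) (β b) e)
    mem (inj₁ j) (inj₁ (zero , s)) = subst ⟦ V ⟧ (core-pt j s) (I.back (L.mem (inj₁ tt) (C.mem j s)))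
    mem (inj₂ t) e = subst ⟦ V ⟧ (tail-pt t e) (I.back (L.mem (inj₂ t) (factor-in (tkind D t) e)))
    hull : ∀ {R : QSet d} → Convex R → R zeroQ → (∀ b e → R (pt (kind D b) (β b) e)) → ∀ {x} → ⟦ V ⟧ x → R x
    hull {R} convex R0 h {x} Vx = subst R (I.gf x) (L.hull {λ y → R (I.g y)} (linear-convex {f = I.g} I.g-comb {R} convex)
        (subst R (sym (linear-zero {f = I.g} I.g-comb)) R0) leaf (I.into Vx))
      where
      leaf : ∀ ℓ {y} → ⟦ proj₂ (leafOf D ℓ) ⟧ y → R (up ℓ y)
      leaf (inj₁ _) = C.hull {λ y → R (up (inj₁ tt) y)} (linear-convex {f = up (inj₁ tt)} (up-lin (inj₁ tt)) {R} convex)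
        (subst R (sym (linear-zero {f = up (inj₁ tt)} (up-lin (inj₁ tt)))) R0) (λ j s → subst R (sym (core-pt j s)) (h (inj₁ j) (inj₁ (zero , s))))
      leaf (inj₂ t) = ⟦⟧-sub (proj₂ (polyOf (tkind D t))) {λ y → R (up (inj₂ t) y)} (linear-convex {f = up (inj₂ t)} (up-lin (inj₂ t)) {R} convex)
        λ p → let (e , eq) = factor-cases (tkind D t) p in subst R (sym (trans (cong (up (inj₂ t)) eq) (tail-pt t e))) (h (inj₂ t) e)
    gen : ∀ {x} → Extreme ⟦ V ⟧ x → ∃ λ b → ∃ λ e → x ≡ pt (kind D b) (β b) e
    gen {x} ex = go (L.extreme (iso-extreme I ex))
      where
      zero-absurd : x ≡ zeroQ → ⊥
      zero-absurd eq = nonzero (subst (Extreme ⟦ V ⟧) eq ex)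
      at : ∀ ℓ y → Extreme ⟦ proj₂ (leafOf D ℓ) ⟧ y → x ≡ up ℓ y → ∃ λ b → ∃ λ e → x ≡ pt (kind D b) (β b) e
      at (inj₁ _) y ey eq = [ (λ y0 → ⊥-elim (zero-absurd (trans eq (trans (cong (up (inj₁ tt)) y0) (linear-zero {f = up (inj₁ tt)} (up-lin (inj₁ tt)))))))
        , (λ { (j , s , eq') → inj₁ j , inj₁ (zero , s) , trans eq (trans (cong (up (inj₁ tt)) eq') (core-pt j s)) }) ]′ (C.extreme ey)
      at (inj₂ t) y ey eq = let (v , v∈ , eqv) = ⟦⟧-extreme (proj₂ (polyOf (tkind D t))) ey ; (e , eq') = factor-cases (tkind D t) v∈ in
        inj₂ t , e , trans eq (trans (cong (up (inj₂ t)) (trans eqv eq')) (tail-pt t e))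
      go : I.f x ≡ zeroQ ⊎ (∃ λ ℓ → ∃ λ y → Extreme ⟦ proj₂ (leafOf D ℓ) ⟧ y × I.f x ≡ L.inj ℓ y) → ∃ λ b → ∃ λ e → x ≡ pt (kind D b) (β b) e
      go (inj₁ f0) = ⊥-elim (zero-absurd (trans (sym (I.gf x)) (trans (cong I.g f0) (linear-zero {f = I.g} I.g-comb))))
      go (inj₂ (ℓ , y , ey , eq)) = at ℓ y ey (trans (sym (I.gf x)) (cong I.g eq))

-- Uniqueness of the splitting

-- The l-th coordinate of the image of -Σ β is -1 if β_l is fixed and 0 if β_l is killed. Both del
-- Pezzo kinds have the vertex -Σ β, which is itself fixed or killed, so all β_l behave alike.
all-or-none : ∀ κ {β β* : Fin (dim κ) → QPt n} → Dualᶠ β* β → {π : QPt n → QPt n} → Linear π →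
  (∀ e → π (pt κ β e) ≡ pt κ β e ⊎ π (pt κ β e) ≡ zeroQ) → (∀ e → π (pt κ β e) ≡ pt κ β e) ⊎ (∀ e → π (pt κ β e) ≡ zeroQ)
all-or-none κ {β} {β*} dl {π} lin h = [ (λ fix → inj₁ (λ e → trans (linear-rpt {f = π} lin β (raw κ e)) (rpt-cong fix (raw κ e))))
    , (λ kill → inj₂ (λ e → trans (linear-rpt {f = π} lin β (raw κ e)) (trans (rpt-cong kill (raw κ e)) (rpt-zero (raw κ e))))) ]′ (uniform κ dl h)
  where
  rpt-zero : ∀ {k} (r : Raw k) → rpt (λ _ → zeroQ) r ≡ zeroQ
  rpt-zero (i , s) = vext λ j → trans (‼-comb (λ l → σ s * weight i l) (λ _ → zeroQ) j)
    (trans (sumF-zero (λ l → trans (cong (σ s * weight i l *_) (‼-zero j)) (ℚP.*-zeroʳ (σ s * weight i l)))) (sym (‼-zero j)))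
  with-sum : ∀ {k} {β β* : Fin k → QPt _} → Dualᶠ β* β → (∀ l → π (β l) ≡ β l ⊎ π (β l) ≡ zeroQ) →
    π (rpt β (nothing , false)) ≡ rpt β (nothing , false) ⊎ π (rpt β (nothing , false)) ≡ zeroQ → (∀ l → π (β l) ≡ β l) ⊎ (∀ l → π (β l) ≡ zeroQ)
  with-sum {k} {β} {β*} dl each total = [ (λ fix → inj₁ (λ l → [ id , (λ z → ⊥-elim (fixed≢0 fix l z)) ]′ (each l)))
      , (λ kill → inj₂ (λ l → [ (λ f → ⊥-elim (killed≢0 kill l f)) , id ]′ (each l))) ]′ total
    where
    S : QPt _
    S = rpt β (nothing , false)
    off : ∀ l j → j ≢ l → dot (β* l) (π (β j)) ≡ 0ℚ
    off l j h = [ (λ f → trans (cong (dot (β* l)) f) (trans (biorth dl l j) (δ-≢ (h ∘ sym)))) , (λ z → trans (cong (dot (β* l)) z) (dot-zero (β* l))) ]′ (each j)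
    coord-πS : ∀ l → dot (β* l) (π S) ≡ - dot (β* l) (π (β l))
    coord-πS l = trans (cong (dot (β* l)) (linear-rpt {f = π} lin β (nothing , false))) (trans (dot-comb (β* l) (λ j → - 1ℚ * 1ℚ) (π ∘ β))
      (trans (sumF-single l (λ j → - 1ℚ * 1ℚ * dot (β* l) (π (β j))) (λ j h → trans (cong (- 1ℚ * 1ℚ *_) (off l j h)) (ℚP.*-zeroʳ (- 1ℚ * 1ℚ)))) (lem (dot (β* l) (π (β l))))))
      where
      lem : ∀ a → - 1ℚ * 1ℚ * a ≡ - a
      lem = solve-∀ ℚring
    fixed≢0 : π S ≡ S → ∀ l → π (β l) ≡ zeroQ → ⊥
    fixed≢0 fix l z = case trans (sym (coord-rpt dl (nothing , false) l)) (trans (cong (dot (β* l)) (sym fix)) (trans (coord-πS l) (cong -_ (trans (cong (dot (β* l)) z) (dot-zero (β* l)))))) of λ ()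
    killed≢0 : π S ≡ zeroQ → ∀ l → π (β l) ≡ β l → ⊥
    killed≢0 kill l f = case trans (sym (dot-zero (β* l))) (trans (cong (dot (β* l)) (sym kill)) (trans (coord-πS l) (cong -_ (trans (cong (dot (β* l)) f) (trans (biorth dl l l) (δ-refl l)))))) of λ ()
  at-just : ∀ {k} {β : Fin k → QPt _} l → π (rpt β (just l , true)) ≡ rpt β (just l , true) ⊎ π (rpt β (just l , true)) ≡ zeroQ → π (β l) ≡ β l ⊎ π (β l) ≡ zeroQ
  at-just {β = β} l = subst (λ y → π y ≡ y ⊎ π y ≡ zeroQ) (rpt-just β l)
  uniform : ∀ κ {β β* : Fin (dim κ) → QPt _} → Dualᶠ β* β → (∀ e → π (pt κ β e) ≡ pt κ β e ⊎ π (pt κ β e) ≡ zeroQ) → (∀ l → π (β l) ≡ β l) ⊎ (∀ l → π (β l) ≡ zeroQ)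
  uniform single dl h = [ (λ f → inj₁ λ { zero → f }) , (λ z → inj₂ λ { zero → z }) ]′ (at-just zero (h (inj₁ (zero , true))))
  uniform (dp k _) dl h  = with-sum dl (λ l → at-just l (h (inj₁ (l , true)))) (h (inj₂ false))
  uniform (pdp k _) dl h = with-sum dl (λ l → at-just l (h (inj₁ (l , true)))) (h (inj₂ tt))

-- Uniqueness of the maximiser alone is not a convex property, but together with the bound it is, by
-- `conv-exposed`; in this form it can be established through `hull`.
exposed-convex : (f : QPt n) (p : QPt n) → dot f p ≡ 1ℚ → Convex (λ x → dot f x ≤ 1ℚ × (dot f x ≡ 1ℚ → x ≡ p))
exposed-convex f p fp w h c = conv-≤ f 1ℚ (proj₁ ∘ h) c , conv-exposed f 1ℚ p fp (λ i → each i (dot f (w i) ℚP.≟ 1ℚ)) c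
  where
  each : ∀ i → Dec (dot f (w i) ≡ 1ℚ) → dot f (w i) < 1ℚ ⊎ w i ≡ p
  each i (yes eq) = inj₂ (proj₂ (h i) eq)
  each i (no ne)  = inj₁ (ℚP.≰⇒> λ ge → ne (ℚP.≤-antisym (proj₁ (h i)) ge))

module Vertices {d : ℕ} {P : QSet d} {D : Decomposition} (X : Presentation P D) where

  open Presentation X public

  vertex : ∀ b → Elt (kind D b) → QPt d
  vertex b e = pt (kind D b) (β b) e

  opaque
    expose : ∀ b → Elt (kind D b) → QPt d
    expose b e = comb (Exposing.a (exposing (kind D b) e)) (β* b)

    expose-own : ∀ b e e' → dot (expose b e) (vertex b e') ≡
      sumF (λ l → Exposing.a (exposing (kind D b) e) l * (σ (proj₂ (raw (kind D b) e')) * weight (proj₁ (raw (kind D b) e')) l))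
    expose-own b e e' = trans (dot-combˡ (Exposing.a (exposing (kind D b) e)) (β* b) (vertex b e'))
      (sumF-cong (λ l → cong (Exposing.a (exposing (kind D b) e) l *_) (coord-rpt (dual b) (raw (kind D b) e') l)))

    expose-other : ∀ {b b'} e e' → b ≢ b' → dot (expose b e) (vertex b' e') ≡ 0ℚ
    expose-other {b} {b'} e e' h = trans (dot-combˡ a (β* b) (vertex b' e')) (sumF-zero (λ l → trans (cong (a l *_) (vanish l)) (ℚP.*-zeroʳ (a l))))
      where
      a : Fin (dim (kind D b)) → ℚ
      a = Exposing.a (exposing (kind D b) e)
      c : Fin (dim (kind D b')) → ℚ
      c j = σ (proj₂ (raw (kind D b') e')) * weight (proj₁ (raw (kind D b') e')) j
      vanish : ∀ l → dot (β* b l) (vertex b' e') ≡ 0ℚ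
      vanish l = trans (dot-comb (β* b l) c (β b')) (sumF-zero (λ j → trans (cong (c j *_) (cross h l j)) (ℚP.*-zeroʳ (c j))))

  expose-on : ∀ b e → dot (expose b e) (vertex b e) ≡ 1ℚ
  expose-on b e = trans (expose-own b e e) (Exposing.on (exposing (kind D b) e))

  expose-off : ∀ b e e' → e' ≡ e ⊎ dot (expose b e) (vertex b e') < 1ℚ
  expose-off b e e' = [ inj₁ , (λ lt → inj₂ (subst (_< 1ℚ) (sym (expose-own b e e')) lt)) ]′ (Exposing.off (exposing (kind D b) e) e')

  vertex≢0 : ∀ b e → vertex b e ≢ zeroQ
  vertex≢0 b e eq = 0≢1 (trans (sym (dot-zero (expose b e))) (trans (cong (dot (expose b e)) (sym eq)) (expose-on b e)))

  same-block : ∀ {b b' e e'} → vertex b e ≡ vertex b' e' → b ≡ b'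
  same-block {b} {b'} {e} {e'} eq = go (_≟ᵇ_ D b b')
    where
    go : Dec (b ≡ b') → b ≡ b'
    go (yes r) = r
    go (no h)  = ⊥-elim (0≢1 (trans (sym (expose-other e e' h)) (trans (cong (dot (expose b e)) (sym eq)) (expose-on b e))))

  same-elt : ∀ {b e e'} → vertex b e ≡ vertex b e' → e ≡ e'
  same-elt {b} {e} {e'} eq = [ sym , (λ lt → ⊥-elim (ℚP.<-irrefl (trans (cong (dot (expose b e)) (sym eq)) (expose-on b e)) lt)) ]′ (expose-off b e e')

  opaque
    -- The exposing functional is built from the dual family of one block, so it vanishes on all
    -- other blocks and only the comparison inside the block remains.
    vertex-extreme : ∀ b e → Extreme P (vertex b e)
    vertex-extreme b e = exposed-extreme (expose b e) 1ℚ (mem b e) (expose-on b e) (λ x Px → proj₁ (bound Px)) (λ x Px → proj₂ (bound Px))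
      where
      f : QPt d
      f = expose b e
      R : QSet d
      R x = dot f x ≤ 1ℚ × (dot f x ≡ 1ℚ → x ≡ vertex b e)
      strict : ∀ {x} → dot f x < 1ℚ → R x
      strict lt = ℚP.<⇒≤ lt , λ eq → ⊥-elim (ℚP.<-irrefl eq lt)
      zero-value : ∀ {x} → dot f x ≡ 0ℚ → R x
      zero-value eq = strict (subst (_< 1ℚ) (sym eq) 0<1)
      on : ∀ b' e' → Dec (b ≡ b') → R (vertex b' e')
      on b' e' (no h)     = zero-value (expose-other e e' h)
      on b' e' (yes refl) = [ (λ eq → subst (λ z → R (vertex b z)) (sym eq) (ℚP.≤-reflexive (expose-on b e) , λ _ → refl)) , strict ]′ (expose-off b e e')
      bound : ∀ {x} → P x → R x
      bound = hull {R} (exposed-convex f (vertex b e) (expose-on b e)) (zero-value (dot-zero f)) (λ b' e' → on b' e' (_≟ᵇ_ D b b'))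

  base : ∀ b → Elt (kind D b)
  base b = inj₁ (subst Fin (sym (proj₂ (dim-suc (kind D b)))) zero , true)

  projector : Blk D → QPt d → QPt d
  projector b x = comb (λ l → dot (β* b l) x) (β b)

  projector-linear : ∀ b → Linear (projector b)
  projector-linear b c e = trans (comb-cong (λ l → dot-comb (β* b l) c e) (λ _ → refl)) (sym (comb-comb c (λ i l → dot (β* b l) (e i)) (β b)))

  projector-fixes : ∀ b e → projector b (vertex b e) ≡ vertex b e
  projector-fixes b e = span-fixed (dual b) (span-rpt (β b) (raw (kind D b) e))

  projector-kills : ∀ {b b'} e → b ≢ b' → projector b (vertex b' e) ≡ zeroQ
  projector-kills {b} {b'} e h = comb-zero λ l → trans (dot-comb (β* b l) (c e) (β b')) (sumF-zero (λ j → trans (cong (c e j *_) (cross h l j)) (ℚP.*-zeroʳ (c e j))))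
    where
    c : Elt (kind D b') → Fin (dim (kind D b')) → ℚ
    c e j = σ (proj₂ (raw (kind D b') e)) * weight (proj₁ (raw (kind D b') e)) j

module _ {d : ℕ} {P : QSet d} {D E : Decomposition} where

  BlockMatch : Presentation P D → Presentation P E → Blk D → Blk E → Set
  BlockMatch X Y b b' = ∀ e → ∃ λ e' → Vertices.vertex X b e ≡ Vertices.vertex Y b' e'

  opaque
    -- The partner is the block of `Y` that contains the base vertex of b. Its projector fixes or
    -- kills every vertex, as each vertex lies in some block of `Y`. It fixes the base vertex, hence
    -- the whole block b by `all-or-none`, and a fixed nonzero vertex cannot lie in another block of
    -- `Y`.
    match : (X : Presentation P D) (Y : Presentation P E) (b : Blk D) → ∃ λ b' → BlockMatch X Y b b'
    match X Y b = b₀ , λ e → locate e (Y.gen (X.vertex-extreme b e))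
      where
      module X = Vertices X
      module Y = Vertices Y
      start : ∃ λ b' → ∃ λ e' → X.vertex b (X.base b) ≡ Y.vertex b' e'
      start = Y.gen (X.vertex-extreme b (X.base b))
      b₀ : Blk E
      b₀ = proj₁ start
      π : QPt d → QPt d
      π = Y.projector b₀
      fix-or-kill : ∀ {x} b' e' → x ≡ Y.vertex b' e' → Dec (b₀ ≡ b') → π x ≡ x ⊎ π x ≡ zeroQ
      fix-or-kill b' e' eq (yes refl) = inj₁ (trans (cong π eq) (trans (Y.projector-fixes b₀ e') (sym eq)))
      fix-or-kill b' e' eq (no h)     = inj₂ (trans (cong π eq) (Y.projector-kills e' h))
      each : ∀ e → π (X.vertex b e) ≡ X.vertex b e ⊎ π (X.vertex b e) ≡ zeroQ
      each e = let (b' , e' , eq) = Y.gen (X.vertex-extreme b e) in fix-or-kill b' e' eq (_≟ᵇ_ E b₀ b')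
      start-fixed : π (X.vertex b (X.base b)) ≡ X.vertex b (X.base b)
      start-fixed = let (e' , eq) = proj₂ start in trans (cong π eq) (trans (Y.projector-fixes b₀ e') (sym eq))
      fixed : ∀ e → π (X.vertex b e) ≡ X.vertex b e
      fixed = [ id , (λ kill → ⊥-elim (X.vertex≢0 b (X.base b) (trans (sym start-fixed) (kill (X.base b))))) ]′
        (all-or-none (kind D b) (X.dual b) {π} (Y.projector-linear b₀) each)
      locate : ∀ e → (∃ λ b' → ∃ λ e' → X.vertex b e ≡ Y.vertex b' e') → ∃ λ e' → X.vertex b e ≡ Y.vertex b₀ e'
      locate e (b' , e' , eq) = go (_≟ᵇ_ E b₀ b') e' eq
        where
        go : Dec (b₀ ≡ b') → (e' : Elt (kind E b')) → X.vertex b e ≡ Y.vertex b' e' → ∃ λ e' → X.vertex b e ≡ Y.vertex b₀ e'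
        go (yes refl) e' eq = e' , eq
        go (no h) e' eq     = ⊥-elim (X.vertex≢0 b e (trans (sym (fixed e)) (trans (cong π eq) (Y.projector-kills e' h))))

  θ : (X : Presentation P D) (Y : Presentation P E) → Blk D → Blk E
  θ X Y b = proj₁ (match X Y b)

  match-size : (X : Presentation P D) (Y : Presentation P E) (b : Blk D) → size (kind D b) ℕ.≤ size (kind E (θ X Y b))
  match-size X Y b = size-≤ (kind D b) (kind E (θ X Y b)) (λ e → proj₁ (proj₂ (match X Y b) e)) λ {e} {e'} eq →
    Vertices.same-elt X (trans (proj₂ (proj₂ (match X Y b) e)) (trans (cong (Vertices.vertex Y (θ X Y b)) eq) (sym (proj₂ (proj₂ (match X Y b) e')))))

module _ {d : ℕ} {P : QSet d} {D E : Decomposition} (X : Presentation P D) (Y : Presentation P E) where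

  private
    module X = Vertices X
    module Y = Vertices Y
    module D = Decomposition D
    module E = Decomposition E

  -- The base vertex of b lies in the block reached on the way back, and a vertex lies in only one
  -- block.
  θθ : ∀ b → θ Y X (θ X Y b) ≡ b
  θθ b = let (e' , eq) = proj₂ (match X Y b) (X.base b) ; (e'' , eq') = proj₂ (match Y X (θ X Y b)) e' in sym (X.same-block {e = X.base b} {e''} (trans eq eq'))

  -- Matching embeds a block into its partner in both directions, so the sizes agree, and the size
  -- determines the kind.
  θ-kind : ∀ b → SameKind (kind D b) (kind E (θ X Y b))
  θ-kind b = same-size (kind D b) (kind E (θ X Y b)) (ℕP.≤-antisym (match-size X Y b)
    (subst (λ b' → size (kind E (θ X Y b)) ℕ.≤ size (kind D b')) (θθ b) (match-size Y X (θ X Y b))))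

module _ {d : ℕ} {P : QSet d} {D E : Decomposition} (X : Presentation P D) (Y : Presentation P E) where

  private
    module X = Vertices X
    module Y = Vertices Y
    module D = Decomposition D
    module E = Decomposition E
    module CY = CoreData Y.C

  vertex-single : ∀ j s (u : QPt d) → dot u (Y.vertex (inj₁ j) (inj₁ (zero , s))) ≡ σ s * dot u (Y.β (inj₁ j) zero)
  vertex-single j s u = trans (dot-comb u (λ l → σ s * weight (just zero) l) (Y.β (inj₁ j))) (trans (ℚP.+-identityʳ _) (cong (_* dot u (Y.β (inj₁ j) zero)) (ℚP.*-identityʳ (σ s))))

  -- The coordinate functional of a segment is integral and takes the value ±1 on just one pair of vertices.
  seg≢core : ∀ i j → θ X Y (inj₂ (inj₁ i)) ≢ inj₁ j
  seg≢core i j eq = go (subst (λ b → BlockMatch X Y (inj₂ (inj₁ i)) b) eq (proj₂ (match X Y (inj₂ (inj₁ i)))) (inj₁ (zero , true)))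
    where
    u : QPt d
    u = X.β* (inj₂ (inj₁ i)) zero
    uβ : dot u (X.vertex (inj₂ (inj₁ i)) (inj₁ (zero , true))) ≡ 1ℚ
    uβ = trans (coord-rpt (X.dual (inj₂ (inj₁ i))) (just zero , true) zero) refl
    others : ∀ j' → j' ≢ j → dot u (Y.β (inj₁ j') zero) ≡ 0ℚ
    others j' ne = let (e , veq) = proj₂ (match Y X (inj₁ j')) (inj₁ (zero , true)) in
      trans (cong (dot u) (trans (sym (rpt-just (Y.β (inj₁ j')) zero)) veq)) (vanish e)
      where
      differ : inj₂ (inj₁ i) ≢ θ Y X (inj₁ j')
      differ same = ne (SumP.inj₁-injective (trans (sym (θθ Y X (inj₁ j'))) (trans (cong (θ X Y) (sym same)) eq)))
      vanish : ∀ e → dot u (X.vertex (θ Y X (inj₁ j')) e) ≡ 0ℚ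
      vanish e = trans (dot-comb u c (X.β (θ Y X (inj₁ j')))) (sumF-zero (λ l → trans (cong (c l *_) (X.cross differ zero l)) (ℚP.*-zeroʳ (c l))))
        where
        c : Fin (dim (kind D (θ Y X (inj₁ j')))) → ℚ
        c l = σ (proj₂ (raw (kind D (θ Y X (inj₁ j'))) e)) * weight (proj₁ (raw (kind D (θ Y X (inj₁ j'))) e)) l
    go : (∃ λ e' → X.vertex (inj₂ (inj₁ i)) (inj₁ (zero , true)) ≡ Y.vertex (inj₁ j) e') → ⊥
    go (inj₁ (zero , s) , veq) = CY.irreducible j (pullback Y.ψ (scaleQ (σ s) u)) (pullback-lattice {g = Y.ψ} Y.ψ-lat (lattice-scale (σ-int s) (X.seg-lattice i)))
        (trans (value j) (trans (sym (vertex-single j s u)) (trans (cong (dot u) (sym veq)) uβ)))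
        (λ j' ne → trans (value j') (trans (cong (σ s *_) (others j' ne)) (ℚP.*-zeroʳ (σ s))))
      where
      σ-int : ∀ s → IsInt (σ s)
      σ-int true  = Int-1
      σ-int false = Int-neg Int-1
      value : ∀ j' → dot (pullback Y.ψ (scaleQ (σ s) u)) (CY.w j') ≡ σ s * dot u (Y.β (inj₁ j') zero)
      value j' = trans (dot-pullback {g = Y.ψ} Y.ψ-lin (scaleQ (σ s) u) (CY.w j')) (trans (cong (dot (scaleQ (σ s) u)) (Y.ψ-w j')) (dot-scaleˡ (σ s) u (Y.β (inj₁ j') zero)))

  θ-seg : ∀ i → ∃ λ i' → θ X Y (inj₂ (inj₁ i)) ≡ inj₂ (inj₁ i')
  θ-seg i = go (θ X Y (inj₂ (inj₁ i))) refl (θ-kind X Y (inj₂ (inj₁ i)))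
    where
    go : ∀ b → θ X Y (inj₂ (inj₁ i)) ≡ b → SameKind single (kind E b) → ∃ λ i' → b ≡ inj₂ (inj₁ i')
    go (inj₁ j) eq _               = ⊥-elim (seg≢core i j eq)
    go (inj₂ (inj₁ i')) _ _        = i' , refl
    go (inj₂ (inj₂ (inj₁ _))) _ ()
    go (inj₂ (inj₂ (inj₂ _))) _ ()

  θ-dp : ∀ i → ∃ λ i' → θ X Y (inj₂ (inj₂ (inj₁ i))) ≡ inj₂ (inj₂ (inj₁ i')) × List.lookup E.dP i' ≡ List.lookup D.dP i
  θ-dp i = go (θ X Y (inj₂ (inj₂ (inj₁ i)))) (θ-kind X Y (inj₂ (inj₂ (inj₁ i))))
    where
    go : ∀ b → SameKind (kind D (inj₂ (inj₂ (inj₁ i)))) (kind E b) → ∃ λ i' → b ≡ inj₂ (inj₂ (inj₁ i')) × List.lookup E.dP i' ≡ List.lookup D.dP i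
    go (inj₁ _) ()
    go (inj₂ (inj₁ _)) ()
    go (inj₂ (inj₂ (inj₁ i'))) eq = i' , refl , sym eq
    go (inj₂ (inj₂ (inj₂ _))) ()

  θ-pdp : ∀ i → ∃ λ i' → θ X Y (inj₂ (inj₂ (inj₂ i))) ≡ inj₂ (inj₂ (inj₂ i')) × List.lookup E.pdP i' ≡ List.lookup D.pdP i
  θ-pdp i = go (θ X Y (inj₂ (inj₂ (inj₂ i)))) (θ-kind X Y (inj₂ (inj₂ (inj₂ i))))
    where
    go : ∀ b → SameKind (kind D (inj₂ (inj₂ (inj₂ i)))) (kind E b) → ∃ λ i' → b ≡ inj₂ (inj₂ (inj₂ i')) × List.lookup E.pdP i' ≡ List.lookup D.pdP i
    go (inj₁ _) ()
    go (inj₂ (inj₁ _)) ()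
    go (inj₂ (inj₂ (inj₁ _))) ()
    go (inj₂ (inj₂ (inj₂ i'))) eq = i' , refl , sym eq

module _ {d : ℕ} {P : QSet d} {D E : Decomposition} (X : Presentation P D) (Y : Presentation P E) where

  private
    module X = Vertices X
    module Y = Vertices Y
    module D = Decomposition D
    module E = Decomposition E

  -- A core pair matched with a segment would, on the way back, be the partner of that segment,
  -- against `θ-seg`.
  θ-core : ∀ j → ∃ λ j' → θ X Y (inj₁ j) ≡ inj₁ j'
  θ-core j = go (θ X Y (inj₁ j)) refl (θ-kind X Y (inj₁ j))
    where
    go : ∀ b → θ X Y (inj₁ j) ≡ b → SameKind single (kind E b) → ∃ λ j' → b ≡ inj₁ j'
    go (inj₁ j') _ _ = j' , refl
    go (inj₂ (inj₁ i)) eq _ = case trans (sym (θθ X Y (inj₁ j))) (trans (cong (θ Y X) eq) (proj₂ (θ-seg Y X i))) of λ ()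
    go (inj₂ (inj₂ (inj₁ _))) _ ()
    go (inj₂ (inj₂ (inj₂ _))) _ ()

  θ-injective : ∀ {b b'} → θ X Y b ≡ θ X Y b' → b ≡ b'
  θ-injective {b} {b'} eq = trans (sym (θθ X Y b)) (trans (cong (θ Y X) eq) (θθ X Y b'))

  r-≤ : D.r ℕ.≤ E.r
  r-≤ = FinP.injective⇒≤ {f = λ i → proj₁ (θ-seg X Y i)} λ {i} {i'} eq → SumP.inj₁-injective (SumP.inj₂-injective
    (θ-injective (trans (proj₂ (θ-seg X Y i)) (trans (cong (λ z → inj₂ (inj₁ z)) eq) (sym (proj₂ (θ-seg X Y i')))))))

  private
    dp-inj : ∀ {D : Decomposition} {i i'} → _≡_ {A = Blk D} (inj₂ (inj₂ (inj₁ i))) (inj₂ (inj₂ (inj₁ i'))) → i ≡ i'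
    dp-inj refl = refl
    pdp-inj : ∀ {D : Decomposition} {i i'} → _≡_ {A = Blk D} (inj₂ (inj₂ (inj₂ i))) (inj₂ (inj₂ (inj₂ i'))) → i ≡ i'
    pdp-inj refl = refl

  dp-round : ∀ i → proj₁ (θ-dp Y X (proj₁ (θ-dp X Y i))) ≡ i
  dp-round i = dp-inj {D} (trans (sym (proj₁ (proj₂ (θ-dp Y X (proj₁ (θ-dp X Y i)))))) (trans (cong (θ Y X) (sym (proj₁ (proj₂ (θ-dp X Y i))))) (θθ X Y _)))

  pdp-round : ∀ i → proj₁ (θ-pdp Y X (proj₁ (θ-pdp X Y i))) ≡ i
  pdp-round i = pdp-inj {D} (trans (sym (proj₁ (proj₂ (θ-pdp Y X (proj₁ (θ-pdp X Y i)))))) (trans (cong (θ Y X) (sym (proj₁ (proj₂ (θ-pdp X Y i))))) (θθ X Y _)))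

  core-vertex : ∀ j → ∃ λ j' → ∃ λ s → X.ψ (CoreData.w X.C j) ≡ Y.ψ (rpt (CoreData.w Y.C) (just j' , s))
  core-vertex j = let (j' , eq) = θ-core j in j' , go j' (subst (BlockMatch X Y (inj₁ j)) eq (proj₂ (match X Y (inj₁ j))) (inj₁ (zero , true)))
    where
    go : ∀ j' → (∃ λ e' → X.vertex (inj₁ j) (inj₁ (zero , true)) ≡ Y.vertex (inj₁ j') e') → ∃ λ s → X.ψ (CoreData.w X.C j) ≡ Y.ψ (rpt (CoreData.w Y.C) (just j' , s))
    go j' (inj₁ (zero , s) , veq) = s , trans (X.ψ-w j) (trans (sym (rpt-just (X.β (inj₁ j)) zero)) (trans veq (sym (trans (linear-rpt {f = Y.ψ} Y.ψ-lin (CoreData.w Y.C) (just j' , s)) (collapse s)))))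
      where
      collapse : ∀ s → rpt (Y.ψ ∘ CoreData.w Y.C) (just j' , s) ≡ rpt (Y.β (inj₁ j')) (just zero , s)
      collapse true  = trans (rpt-just (Y.ψ ∘ CoreData.w Y.C) j') (trans (Y.ψ-w j') (sym (rpt-just (Y.β (inj₁ j')) zero)))
      collapse false = trans (rpt-neg (Y.ψ ∘ CoreData.w Y.C) (just j')) (trans (cong negQ (collapse true)) (sym (rpt-neg (Y.β (inj₁ j')) (just zero))))

record CoreMap {A B : Poly} (C : CoreData A) (C' : CoreData B) : Set where
  field
    f     : QPt (proj₁ A) → QPt (proj₁ B)
    f-lin : Linear f
    f-lat : ∀ {x} → IsLattice x → IsLattice (f x)
    f-w   : ∀ j → ∃ λ j' → ∃ λ s → f (CoreData.w C j) ≡ rpt (CoreData.w C') (just j' , s)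

coreMap : ∀ {d} {P : QSet d} {D E : Decomposition} (X : Presentation P D) (Y : Presentation P E) → CoreMap (Presentation.C X) (Presentation.C Y)
coreMap X Y = record { f = Y.ρ ∘ X.ψ ; f-lin = ∘-linear {f = Y.ρ} {X.ψ} Y.ρ-lin X.ψ-lin ; f-lat = λ l → Y.ρ-lat (X.ψ-lat l)
  ; f-w = λ j → let (j' , s , eq) = core-vertex X Y j in j' , s , trans (cong Y.ρ eq) (Y.ρψ _) }
  where
  module X = Presentation X
  module Y = Presentation Y

-- It suffices to look at the basis of vertices `w`. An embedded vertex of one core lies in the
-- embedded other core, where embedding after retracting is the identity.
coreMap-inverse : ∀ {d} {P : QSet d} {D E : Decomposition} (X : Presentation P D) (Y : Presentation P E) →
  ∀ x → CoreMap.f (coreMap Y X) (CoreMap.f (coreMap X Y) x) ≡ x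
coreMap-inverse X Y x = trans (cong gf (sym (dual-complete CX.dual x))) (trans (gf-lin (λ i → dot (CX.w* i) x) CX.w) (trans (comb-cong (λ _ → refl) on-w) (dual-complete CX.dual x)))
  where
  module X = Presentation X
  module Y = Presentation Y
  module CX = CoreData X.C
  gf : _ → _
  gf x = X.ρ (Y.ψ (Y.ρ (X.ψ x)))
  gf-lin : Linear gf
  gf-lin = ∘-linear {f = X.ρ ∘ Y.ψ} {Y.ρ ∘ X.ψ} (∘-linear {f = X.ρ} {Y.ψ} X.ρ-lin Y.ψ-lin) (∘-linear {f = Y.ρ} {X.ψ} Y.ρ-lin X.ψ-lin)
  on-w : ∀ j → gf (CX.w j) ≡ CX.w j
  on-w j = let (j' , s , eq) = core-vertex X Y j in
    trans (cong (λ z → X.ρ (Y.ψ (Y.ρ z))) eq) (trans (cong (X.ρ ∘ Y.ψ) (Y.ρψ _)) (trans (cong X.ρ (sym eq)) (X.ρψ (CX.w j))))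

core-zero : {A : Poly} (C : CoreData A) → Fin (proj₁ A) → ⟦ proj₂ A ⟧ zeroQ
core-zero {A} C j = convex-0 (⟦⟧-convex (proj₂ A)) (C.mem j true) (subst ⟦ proj₂ A ⟧ (rpt-neg C.w (just j)) (C.mem j false))
  where module C = CoreData C

-- The index `j₀` guarantees that the target contains 0, which `hull` asks for.
coreMap-into : {A B : Poly} {C : CoreData A} {C' : CoreData B} (M : CoreMap C C') → Fin (proj₁ B) → ∀ {x} → ⟦ proj₂ A ⟧ x → ⟦ proj₂ B ⟧ (CoreMap.f M x)
coreMap-into {A} {B} {C} {C'} M j₀ = C.hull {λ x → ⟦ proj₂ B ⟧ (f x)} (linear-convex {f = f} f-lin {⟦ proj₂ B ⟧} (⟦⟧-convex (proj₂ B)))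
    (subst ⟦ proj₂ B ⟧ (sym (linear-zero {f = f} f-lin)) (core-zero C' j₀)) on
  where
  module C = CoreData C
  module C' = CoreData C'
  open CoreMap M
  on : ∀ j s → ⟦ proj₂ B ⟧ (f (rpt C.w (just j , s)))
  on j true = let (j' , s' , eq) = f-w j in subst ⟦ proj₂ B ⟧ (sym (trans (cong f (rpt-just C.w j)) eq)) (C'.mem j' s')
  on j false = let (j' , s' , eq) = f-w j in subst ⟦ proj₂ B ⟧ (sym (trans (cong f (trans (rpt-neg C.w (just j)) (cong negQ (rpt-just C.w j)))) (trans (linear-neg {f = f} f-lin (C.w j)) (cong negQ eq))))
    (opposite-in j' s')
    where
    opposite-in : ∀ j' s' → ⟦ proj₂ B ⟧ (negQ (rpt C'.w (just j' , s')))
    opposite-in j' true  = subst ⟦ proj₂ B ⟧ (rpt-neg C'.w (just j')) (C'.mem j' false)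
    opposite-in j' false = subst ⟦ proj₂ B ⟧ (trans (sym (negQ-negQ _)) (cong negQ (sym (rpt-neg C'.w (just j'))))) (C'.mem j' true)

-- A core cannot be compared with an absent one: the map would send an index of a vertex of the
-- former into `Fin 0`.
same-core : (c c' : Maybe Poly) → CoreOK c → CoreOK c' → (C : CoreData (corePoly c)) (C' : CoreData (corePoly c')) (M : CoreMap C C') (M' : CoreMap C' C) →
  (∀ x → CoreMap.f M' (CoreMap.f M x) ≡ x) → (∀ y → CoreMap.f M (CoreMap.f M' y) ≡ y) → SameCore c c'
same-core nothing nothing _ _ _ _ _ _ _ _ = tt
same-core (just (zero , V)) _ (r , _) _ _ _ _ _ _ _ = ⊥-elim (¬Fano-0 {V} (proj₁ r))
same-core _ (just (zero , V)) _ (r , _) _ _ _ _ _ _ = ⊥-elim (¬Fano-0 {V} (proj₁ r))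
same-core nothing (just (suc n , V)) _ _ C C' M M' _ _ = case proj₁ (CoreMap.f-w M' zero) of λ ()
same-core (just (suc n , V)) nothing _ _ C C' M M' _ _ = case proj₁ (CoreMap.f-w M zero) of λ ()
same-core (just (suc n , V)) (just (suc m , W)) _ _ C C' M M' gf fg = toIsoP {V = V} {W} (record
  { iso = record { f = CoreMap.f M ; g = CoreMap.f M' ; f-comb = CoreMap.f-lin M ; g-comb = CoreMap.f-lin M' ; gf = gf ; fg = fg ; f-lat = CoreMap.f-lat M ; g-lat = CoreMap.f-lat M' }
  ; into = coreMap-into M zero ; back = coreMap-into M' zero })

uniqueness : ∀ {d} {V : List (Pt d)} → ¬ Extreme ⟦ V ⟧ zeroQ → (D E : Decomposition) → IsoP (d , V) (splitPoly D) → IsoP (d , V) (splitPoly E) → SameDecomposition D E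
uniqueness {V = V} nonzero D E I J =
    same-core D.core E.core D.coreOK E.coreOK (Presentation.C X) (Presentation.C Y) (coreMap X Y) (coreMap Y X) (coreMap-inverse X Y) (coreMap-inverse Y X) ,
    ℕP.≤-antisym (r-≤ X Y) (r-≤ Y X) ,
    bijection-↭ (λ i → proj₁ (θ-dp X Y i)) (λ i → proj₁ (θ-dp Y X i)) (dp-round X Y) (dp-round Y X) (λ i → proj₂ (proj₂ (θ-dp X Y i))) ,
    bijection-↭ (λ i → proj₁ (θ-pdp X Y i)) (λ i → proj₁ (θ-pdp Y X i)) (pdp-round X Y) (pdp-round Y X) (λ i → proj₂ (proj₂ (θ-pdp X Y i)))
  where
  module D = Decomposition D
  module E = Decomposition E
  X : Presentation ⟦ V ⟧ D
  X = present {V = V} nonzero D (fromIsoP {V = V} {proj₂ (splitPoly D)} I)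
  Y : Presentation ⟦ V ⟧ E
  Y = present {V = V} nonzero E (fromIsoP {V = V} {proj₂ (splitPoly E)} J)


theorem2p5 : (d : ℕ) (V : List (Pt d)) →
    Reflexive V → Simplicial V → PseudoSymmetric V →
    (∃ λ (D : Decomposition) → IsoP (d , V) (splitPoly D)) ×
    (∀ (D₁ D₂ : Decomposition) → IsoP (d , V) (splitPoly D₁) →
    IsoP (d , V) (splitPoly D₂) → SameDecomposition D₁ D₂)
-- In dimension 0 no polytope is Fano in the sense of the definitions.
theorem2p5 zero V reflexive _ _ = ⊥-elim (¬Fano-0 {V} (proj₁ reflexive))
theorem2p5 (suc d) V reflexive simplicial pseudo =
  Existence.existence V reflexive simplicial (Symmetric.opposite V reflexive simplicial pseudo) ,
  uniqueness {V = V} (fano-nonzero {V = V} (proj₁ reflexive))
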